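{- For any positive integer $d$, there is a bijection between plane maps of girth $d$ and outer degree $d$ and $d$-branching mobiles. Moreover, under this bijection each inner face of degree $i$ of the map corresponds to a black vertex of degree $i$ of the mobile (so for every $i$ the number of inner faces of degree $i$ of the map equals the number of black vertices of degree $i$ of the associated mobile).
   Context: A planar map is a connected graph (loops and multiple edges allowed) embedded in the oriented sphere, up to continuous deformation; the degree of a face is its number of incident corners (angular sections between consecutive half-edges around a vertex). The girth is the minimal length of a cycle. A plane map is a planar map with a distinguished face (root-face, outer face), whose degree is the outer degree; the other faces are inner faces. A mobile is a plane tree (embedded in the plane up to deformation) whose vertices are colored black or white, where black vertices may carry additional dangling half-edges called buds (placed in the cyclic order around the vertex). The degree of a black vertex is its number of incident half-edges, buds included. A $\mathbb{Z}$-mobile is a mobile in which every non-bud half-edge carries an integer weight, positive if the half-edge is incident to a white vertex and non-positive if it is incident to a black vertex. The weight of an edge is the sum of the weights of its two half-edges; the weight $w(v)$ of a vertex is the sum of the weights of its incident non-bud half-edges. A $d$-branching mobile is a $\mathbb{Z}$-mobile in which every half-edge incident to a black vertex has weight $0$, $-1$ or $-2$ and (i) each edge has weight $d-2$, (ii) each white vertex has weight $d$, (iii) each black vertex $v$ satisfies $\deg(v)+w(v)=d$. -}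

module Defs where

open import Data.Bool using (Bool; true; false; if_then_else_; _∧_; _∨_; not)
open import Data.Nat using (ℕ; zero; suc; _+_; _*_; _∸_; _≤_; _≤ᵇ_; _≡ᵇ_)
open import Data.Nat.DivMod using (_%_; m%n<n)
open import Data.Fin using (Fin; toℕ; fromℕ<; _≟_)
open import Data.Integer using (ℤ; +_; _-_) renaming (_+_ to _+ℤ_; _≤_ to _≤ℤ_; _<_ to _<ℤ_)
open import Data.List using (List; map; foldr; upTo; allFin)
open import Data.Bool.ListAction using (any; all)
open import Data.Nat.ListAction using (sum)
open import Data.Product using (Σ; _×_; _,_)
open import Data.Sum using (_⊎_)
open import Data.Empty using (⊥)
open import Function using (_∘_)
open import Function.Bundles using (_↔_; Inverse)
open import Relation.Nullary using (¬_)
open import Relation.Nullary.Decidable using (⌊_⌋)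
open import Relation.Binary.PropositionalEquality using (_≡_; _≢_)
open import Relation.Binary.Construct.Closure.ReflexiveTransitive using (Star)

iter : ∀ {A : Set} → (A → A) → ℕ → A → A
iter f zero x = x
iter f (suc k) x = f (iter f k x)

-- y is in the orbit of x under p (for a permutation p of Fin n,
-- the exponents 0 .. n-1 suffice)
reachB : ∀ {n} → (Fin n → Fin n) → Fin n → Fin n → Bool
reachB {n} p x y = any (λ t → ⌊ iter p t x ≟ y ⌋) (upTo n)

InOrbit : ∀ {n} → (Fin n → Fin n) → Fin n → Fin n → Set
InOrbit p x y = Σ ℕ λ t → iter p t x ≡ y

countB : ∀ {n} → (Fin n → Bool) → ℕ
countB {n} P = sum (map (λ y → if P y then 1 else 0) (allFin n))

orbitSize : ∀ {n} → (Fin n → Fin n) → Fin n → ℕ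
orbitSize p x = countB (reachB p x)

isOrbitMin : ∀ {n} → (Fin n → Fin n) → Fin n → Bool
isOrbitMin {n} p x = all (λ y → not (reachB p x y) ∨ (toℕ x ≤ᵇ toℕ y)) (allFin n)

numOrbits : ∀ {n} → (Fin n → Fin n) → ℕ
numOrbits p = countB (isOrbitMin p)

data Step {n} (σ α : Fin n → Fin n) : Fin n → Fin n → Set where
  byσ : ∀ x → Step σ α x (σ x)
  byα : ∀ x → Step σ α x (α x)

-- Plane maps, as combinatorial maps (rotation systems) on n darts:
-- σ = rotation around vertices, α = edge involution (fixed-point free),
-- φ = σ ∘ α = face permutation (faces = φ-orbits, degree = #corners =
-- orbit length).  Connected, genus 0 (Euler: V - E + F = 2 with
-- E = n/2, i.e. 2(V + F) = n + 4), and a distinguished root face,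
-- given as the face of the dart `root`.

record PlaneMap (n : ℕ) : Set where
  field
    σ σ⁻ : Fin n → Fin n
    σ-inv₁ : ∀ x → σ⁻ (σ x) ≡ x
    σ-inv₂ : ∀ x → σ (σ⁻ x) ≡ x
    α : Fin n → Fin n
    α-invol : ∀ x → α (α x) ≡ x
    α-fpf : ∀ x → α x ≢ x
    connected : ∀ x y → Star (Step σ α) x y
    genus0 : 2 * (numOrbits σ + numOrbits (σ ∘ α)) ≡ n + 4
    root : Fin n

  φ : Fin n → Fin n
  φ = σ ∘ α

  SameVertex : Fin n → Fin n → Set
  SameVertex = InOrbit σ

open PlaneMap public using () renaming (σ to σᴹ; α to αᴹ; φ to φᴹ; root to rootᴹ; SameVertex to SameVertexᴹ)

outerDegree : ∀ {n} → PlaneMap n → ℕ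
outerDegree M = orbitSize (φᴹ M) (rootᴹ M)

innerFacesOfDegree : ∀ {n} → PlaneMap n → ℕ → ℕ
innerFacesOfDegree M i =
  countB (λ x → isOrbitMin (φᴹ M) x ∧ not (reachB (φᴹ M) (rootᴹ M) x)
                ∧ (orbitSize (φᴹ M) x ≡ᵇ i))

nextIdx : ∀ {m} → Fin (suc m) → Fin (suc m)
nextIdx {m} j = fromℕ< (m%n<n (suc (toℕ j)) (suc m))

-- a (simple) cycle of length suc m: darts c 0, ..., c m, where the edge
-- of c j goes from the vertex of c j to the vertex of α (c j), which is
-- the vertex of c (j+1 mod (m+1)); the vertices are pairwise distinct and
-- the edges are pairwise distinct.
record Cycle {n} (M : PlaneMap n) (m : ℕ) : Set where
  field
    c : Fin (suc m) → Fin n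
    link : ∀ j → SameVertexᴹ M (αᴹ M (c j)) (c (nextIdx j))
    distinctVertices : ∀ i j → i ≢ j → ¬ SameVertexᴹ M (c i) (c j)
    distinctEdges : ∀ i j → i ≢ j → (c i ≢ c j) × (c i ≢ αᴹ M (c j))

HasCycleOfLength : ∀ {n} → PlaneMap n → ℕ → Set
HasCycleOfLength M zero = ⊥
HasCycleOfLength M (suc m) = Cycle M m

HasGirth : ∀ {n} → PlaneMap n → ℕ → Set
HasGirth M g = HasCycleOfLength M g × (∀ k → HasCycleOfLength M k → g ≤ k)

record MapIso {n n'} (M : PlaneMap n) (M' : PlaneMap n') : Set where
  field
    f : Fin n ↔ Fin n'
    σ-comm : ∀ x → Inverse.to f (σᴹ M x) ≡ σᴹ M' (Inverse.to f x)
    α-comm : ∀ x → Inverse.to f (αᴹ M x) ≡ αᴹ M' (Inverse.to f x)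
    root-face : InOrbit (φᴹ M') (rootᴹ M') (Inverse.to f (rootᴹ M))

-- Mobiles as plane trees with buds, encoded on n half-edges (darts):
-- σ = rotation around vertices (buds included), α = involution whose
-- fixed points are exactly the buds; vertices = σ-orbits.

data Color : Set where
  black white : Color

isBlack : Color → Bool
isBlack black = true
isBlack white = false

sumℤ : List ℤ → ℤ
sumℤ = foldr _+ℤ_ (+ 0)

numBuds : ∀ {n} → (Fin n → Fin n) → ℕ
numBuds α = countB (λ x → ⌊ α x ≟ x ⌋)

-- a ℤ-mobile; bud half-edges carry the dummy weight 0
record ZMobile (n : ℕ) : Set where
  field
    σ σ⁻ : Fin n → Fin n
    σ-inv₁ : ∀ x → σ⁻ (σ x) ≡ x
    σ-inv₂ : ∀ x → σ (σ⁻ x) ≡ x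
    α : Fin n → Fin n
    α-invol : ∀ x → α (α x) ≡ x
    color : Fin n → Color
    color-vertex : ∀ x → color (σ x) ≡ color x
    bud-black : ∀ x → α x ≡ x → color x ≡ black
    -- plane tree: connected and #vertices = #edges + 1
    connected : ∀ x y → Star (Step σ α) x y
    tree : 2 * numOrbits σ ≡ (n ∸ numBuds α) + 2
    weight : Fin n → ℤ
    bud-weight : ∀ x → α x ≡ x → weight x ≡ + 0
    white-pos : ∀ x → α x ≢ x → color x ≡ white → + 0 <ℤ weight x
    black-nonpos : ∀ x → α x ≢ x → color x ≡ black → weight x ≤ℤ + 0

  vertexWeight : Fin n → ℤ
  vertexWeight x = sumℤ (map (λ y → if reachB σ x y then weight y else + 0) (allFin n))

  vertexDegree : Fin n → ℕ
  vertexDegree x = orbitSize σ x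

open ZMobile public

record DBranching (d : ℕ) {n} (T : ZMobile n) : Set where
  field
    black-weights : ∀ x → α T x ≢ x → color T x ≡ black →
      (weight T x ≡ + 0) ⊎ (weight T x ≡ + 0 - + 1) ⊎ (weight T x ≡ + 0 - + 2)
    edge-weight : ∀ x → α T x ≢ x → weight T x +ℤ weight T (α T x) ≡ + d - + 2
    white-weight : ∀ x → color T x ≡ white → vertexWeight T x ≡ + d
    black-weight : ∀ x → color T x ≡ black →
      + vertexDegree T x +ℤ vertexWeight T x ≡ + d

blackVerticesOfDegree : ∀ {n} → ZMobile n → ℕ → ℕ
blackVerticesOfDegree T i =
  countB (λ x → isOrbitMin (σ T) x ∧ isBlack (color T x) ∧ (orbitSize (σ T) x ≡ᵇ i))

record MobileIso {n n'} (T : ZMobile n) (T' : ZMobile n') : Set where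
  field
    f : Fin n ↔ Fin n'
    σ-comm : ∀ x → Inverse.to f (σ T x) ≡ σ T' (Inverse.to f x)
    α-comm : ∀ x → Inverse.to f (α T x) ≡ α T' (Inverse.to f x)
    color-pres : ∀ x → color T' (Inverse.to f x) ≡ color T x
    weight-pres : ∀ x → weight T' (Inverse.to f x) ≡ weight T x

PlaneMapGirthOuter : ℕ → Set
PlaneMapGirthOuter d = Σ ℕ λ n → Σ (PlaneMap n) λ M → HasGirth M d × (outerDegree M ≡ d)

BranchingMobile : ℕ → Set
BranchingMobile d = Σ ℕ λ n → Σ (ZMobile n) λ T → DBranching d T

_≅ᴹ_ : ∀ {d} → PlaneMapGirthOuter d → PlaneMapGirthOuter d → Set
(_ , M , _) ≅ᴹ (_ , M' , _) = MapIso M M'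

_≅ᵀ_ : ∀ {d} → BranchingMobile d → BranchingMobile d → Set
(_ , T , _) ≅ᵀ (_ , T' , _) = MobileIso T T'

innerFaces : ∀ {d} → PlaneMapGirthOuter d → ℕ → ℕ
innerFaces (_ , M , _) = innerFacesOfDegree M

blackVertices : ∀ {d} → BranchingMobile d → ℕ → ℕ
blackVertices (_ , T , _) = blackVerticesOfDegree T

{-# OPTIONS --safe #-}
module Submission where

-- Reading the weights of a mobile on the darts of its map gives nonnegative functions a (towards
-- the vertex) and b (towards the face) such that a sums to d around every inner vertex, 1 - b sums
-- to d around every inner face, and a + a' - b - b' = d - 2 on every inner edge.  For a map of
-- girth d such a flow exists by a Hoffman-type criterion: an obstruction is an open region, whose
-- Euler characteristic is at most 1 and whose boundary contains a cycle, hence has length ≥ d.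
-- Pushing the flow along potentials until every dart reaches the outer face by tight moves (turn
-- around the vertex if a = 0, around the face if b = 0) makes the associated mobile a tree.
-- Conversely, the contour of a mobile is a bracket word in which arrivals at white vertices open
-- and buds close; matching brackets closes the mobile to a map with d unmatched buds on the outer
-- face.  Its cycles have length ≥ d by Euler's relation for the side of the cycle away from the
-- outer face, summed against the flow.  The map determines the mobile because two flows differ by
-- the gradient of a potential plus a flow on a tree, which vanishes; the potential then vanishes
-- by comparing its values along tight moves towards the outer face.

open import Defs
open import Data.Bool using (Bool; true; false; if_then_else_; T; not; _∧_; _∨_)
open import Data.Empty using (⊥; ⊥-elim)
open import Data.Fin using (Fin; toℕ; fromℕ<; _≟_; _↑ˡ_; _↑ʳ_; splitAt) renaming (zero to fz; suc to fs)
open import Data.Fin.Properties using (any?; pigeonhole)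
open import Data.Integer using (ℤ; +_; -[1+_]; 0ℤ; 1ℤ; nonNeg; pos; ∣_∣; _+_; _*_; -_; _-_; _<_; +≤+; +<+) renaming (_≤_ to _≤ᶻ_)
open import Data.Integer.Tactic.RingSolver using (solve-∀)
open import Data.List.Properties using (map-tabulate)
open import Data.Nat using (ℕ; zero; suc; z≤n; s≤s; _∸_; nonZero; _≤_) renaming (_+_ to _+ℕ_; _*_ to _*ℕ_; _<_ to _<ℕ_)
open import Data.Nat.DivMod using (_%_; m<n⇒m%n≡m; n%n≡0)
open import Data.Product using (Σ; ∃; _×_; _,_; proj₁; proj₂)
open import Data.Sum using (_⊎_; inj₁; inj₂; [_,_]′)
open import Data.Sum.Properties using (inj₁-injective; inj₂-injective)
open import Data.Unit using (⊤; tt)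
open import Function using (_∘_; id; case_of_; Inverse)
open import Function.Bundles using (mk↔ₛ′)
open import Relation.Nullary using (¬_; Dec; yes; no; does)
open import Relation.Nullary.Decidable using (_×-dec_; _⊎-dec_; ¬?; map′; toWitness; fromWitness; ⌊_⌋)
open import Relation.Binary.Construct.Closure.ReflexiveTransitive using (Star; ε; _◅_; _◅◅_)
open import Relation.Binary.Definitions using (tri<; tri≈; tri>)
open import Relation.Binary.PropositionalEquality using (_≡_; _≢_; refl; sym; trans; cong; cong₂; subst; subst₂; module ≡-Reasoning)
import Data.Bool.ListAction as BL
import Data.Fin
import Data.Fin.Properties as FP
import Data.Integer
import Data.Integer.Properties as ZP
import Data.List as List
import Data.Nat
import Data.Nat.ListAction as NL
import Data.Nat.Properties as NP
import Data.Sum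


-- Finite sums of integers

-- No planar topology is available: the sphere enters only through a count of orbits. Every
-- separation statement is drawn from one algebraic fact, `forest-flow`: an antisymmetric function
-- on the edges of a tree with zero sum at each vertex but the root vanishes. Applied to the jump of
-- an indicator across edges, it shows that deleting a spanning tree of the faces keeps the vertices
-- connected, and that a single contour runs along a whole tree; applied to a difference of weights,
-- it gives uniqueness. The two directions are never composed. Map and mobile are tied by a relation
-- `Corr`, which both the opening and the closure produce; it determines each partner from the other
-- up to isomorphism. The delicate point of the opening is connectedness. Euler's relation only
-- gives vertices minus edges equal to 1 in total, which also fits a tree beside components with
-- cycles. Some component is a tree, and the brackets of its contour can be closed; accessibility
-- brings it to the outer face, and from there it is shown to fill the map. Edges are counted by
-- darts, whence the factors 2.

interchange : ∀ a b c d → (a + b) + (c + d) ≡ (a + c) + (b + d)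
interchange = solve-∀

opaque
  ∑ : ∀ {n} → (Fin n → ℤ) → ℤ
  ∑ {zero} f = 0ℤ
  ∑ {suc n} f = f fz + ∑ (f ∘ fs)

  ∑-cong : ∀ {n} {f g : Fin n → ℤ} → (∀ x → f x ≡ g x) → ∑ f ≡ ∑ g
  ∑-cong {zero} e = refl
  ∑-cong {suc n} e = cong₂ _+_ (e fz) (∑-cong (e ∘ fs))

  ∑-zero : ∀ {n} {f : Fin n → ℤ} → (∀ x → f x ≡ 0ℤ) → ∑ f ≡ 0ℤ
  ∑-zero {zero} e = refl
  ∑-zero {suc n} e = cong₂ _+_ (e fz) (∑-zero (e ∘ fs))

  ∑-+ : ∀ {n} (f g : Fin n → ℤ) → ∑ (λ x → f x + g x) ≡ ∑ f + ∑ g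
  ∑-+ {zero} f g = refl
  ∑-+ {suc n} f g = trans (cong (λ z → f fz + g fz + z) (∑-+ (f ∘ fs) (g ∘ fs))) (interchange (f fz) (g fz) _ _)

  ∑-* : ∀ {n} c (f : Fin n → ℤ) → ∑ (λ x → c * f x) ≡ c * ∑ f
  ∑-* {zero} c f = sym (ZP.*-zeroʳ c)
  ∑-* {suc n} c f = trans (cong (λ z → c * f fz + z) (∑-* c (f ∘ fs))) (sym (ZP.*-distribˡ-+ c (f fz) _))

  ∑-neg : ∀ {n} (f : Fin n → ℤ) → ∑ (λ x → - f x) ≡ - ∑ f
  ∑-neg {zero} f = refl
  ∑-neg {suc n} f = trans (cong (λ z → - f fz + z) (∑-neg (f ∘ fs))) (sym (ZP.neg-distrib-+ (f fz) _))

  ∑-sub : ∀ {n} (f g : Fin n → ℤ) → ∑ (λ x → f x - g x) ≡ ∑ f - ∑ g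
  ∑-sub f g = trans (∑-+ f (-_ ∘ g)) (cong (λ z → ∑ f + z) (∑-neg g))

  ∑-swap : ∀ {n m} (f : Fin n → Fin m → ℤ) → ∑ (λ x → ∑ (f x)) ≡ ∑ (λ y → ∑ (λ x → f x y))
  ∑-swap {zero} {m} f = sym (∑-zero {m} {λ y → ∑ (λ x → f x y)} (λ _ → refl))
  ∑-swap {suc n} f = trans (cong (λ z → ∑ (f fz) + z) (∑-swap (f ∘ fs))) (sym (∑-+ (f fz) (λ y → ∑ (λ x → f (fs x) y))))

  ∑-mono : ∀ {n} {f g : Fin n → ℤ} → (∀ x → f x ≤ᶻ g x) → ∑ f ≤ᶻ ∑ g
  ∑-mono {zero} e = ZP.≤-refl
  ∑-mono {suc n} e = ZP.+-mono-≤ (e fz) (∑-mono (e ∘ fs))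

  ∑-single : ∀ {n} (f : Fin n → ℤ) x → (∀ y → y ≢ x → f y ≡ 0ℤ) → ∑ f ≡ f x
  ∑-single f fz e = trans (cong (λ z → f fz + z) (∑-zero (λ y → e (fs y) (λ ())))) (ZP.+-identityʳ _)
  ∑-single f (fs x) e = trans (cong₂ _+_ (e fz (λ ())) (∑-single (f ∘ fs) x (λ y ne → e (fs y) (ne ∘ FP.suc-injective)))) (ZP.+-identityˡ _)

  -- Nothing can compensate for a strictly smaller term. This is how equalities of counts are turned
  -- into pointwise statements throughout.
  ∑-tight : ∀ {n} {f g : Fin n → ℤ} → (∀ x → f x ≤ᶻ g x) → ∑ g ≤ᶻ ∑ f → ∀ x → f x ≡ g x
  ∑-tight {suc n} {f} {g} le s = λ where
      fz → ZP.≤-antisym (le fz) (cancel₁ (ZP.≤-trans s (ZP.+-monoʳ-≤ (f fz) (∑-mono (le ∘ fs)))))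
      (fs x) → ∑-tight (le ∘ fs) (cancel₂ {c = g fz} (ZP.≤-trans s (ZP.+-monoˡ-≤ (∑ (f ∘ fs)) (le fz)))) x
    where
    cancel₁ : ∀ {a b c} → a + c ≤ᶻ b + c → a ≤ᶻ b
    cancel₁ {a} {b} {c} p = subst₂ _≤ᶻ_ (lem a c) (lem b c) (ZP.+-monoˡ-≤ (- c) p)
      where
      lem : ∀ a c → a + c + - c ≡ a
      lem = solve-∀
    cancel₂ : ∀ {a b c} → c + a ≤ᶻ c + b → a ≤ᶻ b
    cancel₂ {a} {b} {c} p = cancel₁ {c = c} (subst₂ _≤ᶻ_ (ZP.+-comm c a) (ZP.+-comm c b) p)

  ∑-suc : ∀ {n} (f : Fin (suc n) → ℤ) → ∑ f ≡ f fz + ∑ (f ∘ fs)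
  ∑-suc f = refl

  ∑-one : ∀ n → ∑ {n} (λ _ → 1ℤ) ≡ + n
  ∑-one zero = refl
  ∑-one (suc n) = cong (λ z → 1ℤ + z) (∑-one n)

∑-nonneg : ∀ {n} {f : Fin n → ℤ} → (∀ x → 0ℤ ≤ᶻ f x) → 0ℤ ≤ᶻ ∑ f
∑-nonneg {n} {f} e = subst (_≤ᶻ ∑ f) (∑-zero {n} {λ _ → 0ℤ} (λ _ → refl)) (∑-mono e)

∑-pos : ∀ {n} (f : Fin n → ℤ) → 0ℤ < ∑ f → ∃ λ x → 0ℤ < f x
∑-pos {n} f p with any? (λ x → 0ℤ ZP.<? f x)
... | yes r = r
... | no r = ⊥-elim (ZP.<⇒≱ p (subst (∑ f ≤ᶻ_) (∑-zero {n} {λ _ → 0ℤ} (λ _ → refl)) (∑-mono (λ x → ZP.≮⇒≥ (λ q → r (x , q))))))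

-- Indicators

𝟙 : ∀ {p} {P : Set p} → Dec P → ℤ
𝟙 d = if does d then 1ℤ else 0ℤ

𝟙-yes : ∀ {P : Set} (d : Dec P) → P → 𝟙 d ≡ 1ℤ
𝟙-yes (yes _) _ = refl
𝟙-yes (no ¬p) p = ⊥-elim (¬p p)

𝟙-no : ∀ {P : Set} (d : Dec P) → ¬ P → 𝟙 d ≡ 0ℤ
𝟙-no (yes p) ¬p = ⊥-elim (¬p p)
𝟙-no (no _) _ = refl

𝟙-cong : ∀ {P Q : Set} (d : Dec P) (e : Dec Q) → (P → Q) → (Q → P) → 𝟙 d ≡ 𝟙 e
𝟙-cong (yes p) e f g = sym (𝟙-yes e (f p))
𝟙-cong (no ¬p) e f g = sym (𝟙-no e (¬p ∘ g))

𝟙-≤ : ∀ {P Q : Set} (d : Dec P) (e : Dec Q) → (P → Q) → 𝟙 d ≤ᶻ 𝟙 e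
𝟙-≤ (yes p) e f = ZP.≤-reflexive (sym (𝟙-yes e (f p)))
𝟙-≤ (no ¬p) (yes _) f = +≤+ z≤n
𝟙-≤ (no ¬p) (no _) f = ZP.≤-refl

𝟙-nonneg : ∀ {P : Set} (d : Dec P) → 0ℤ ≤ᶻ 𝟙 d
𝟙-nonneg (yes p) = +≤+ z≤n
𝟙-nonneg (no ¬p) = ZP.≤-refl

𝟙-× : ∀ {P Q : Set} (d : Dec P) (e : Dec Q) → 𝟙 (d ×-dec e) ≡ 𝟙 d * 𝟙 e
𝟙-× (yes p) (yes q) = refl
𝟙-× (yes p) (no q) = refl
𝟙-× (no p) (yes q) = refl
𝟙-× (no p) (no q) = refl

𝟙-split : ∀ {P Q : Set} (d : Dec P) (e : Dec Q) → 𝟙 d ≡ 𝟙 (d ×-dec e) + 𝟙 (d ×-dec ¬? e)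
𝟙-split (yes p) (yes q) = refl
𝟙-split (yes p) (no q) = refl
𝟙-split (no p) (yes q) = refl
𝟙-split (no p) (no q) = refl

𝟙-⊎ : ∀ {P Q : Set} (d : Dec P) (e : Dec Q) → (P → ¬ Q) → 𝟙 d + 𝟙 e ≡ 𝟙 (d ⊎-dec e)
𝟙-⊎ (yes p) (yes q) x = ⊥-elim (x p q)
𝟙-⊎ (yes p) (no q) x = refl
𝟙-⊎ (no p) (yes q) x = refl
𝟙-⊎ (no p) (no q) x = refl

𝟙-pos : ∀ {P : Set} (d : Dec P) → 0ℤ < 𝟙 d → P
𝟙-pos (yes p) _ = p
𝟙-pos (no ¬p) (+<+ ())

on : ∀ {P : Set} (d : Dec P) {v : ℤ} → P → 𝟙 d * v ≡ v
on d {v} p = trans (cong (_* v) (𝟙-yes d p)) (ZP.*-identityˡ v)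

off : ∀ {P : Set} (d : Dec P) {v : ℤ} → ¬ P → 𝟙 d * v ≡ 0ℤ
off d {v} p = cong (_* v) (𝟙-no d p)

𝟙-*cong : ∀ {P : Set} (d : Dec P) {v w : ℤ} → (P → v ≡ w) → 𝟙 d * v ≡ 𝟙 d * w
𝟙-*cong (yes p) f = cong (λ z → 1ℤ * z) (f p)
𝟙-*cong (no ¬p) f = refl

∑-δ : ∀ {n} (x : Fin n) (f : Fin n → ℤ) → ∑ (λ y → 𝟙 (x ≟ y) * f y) ≡ f x
∑-δ x f = trans (∑-single _ x (λ y ne → off (x ≟ y) (ne ∘ sym))) (on (x ≟ x) refl)

count : ∀ {n} {P : Fin n → Set} → (∀ x → Dec (P x)) → ℤ
count P? = ∑ (λ x → 𝟙 (P? x))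

count-unique : ∀ {n} {P : Fin n → Set} (P? : ∀ x → Dec (P x)) (x : Fin n) → P x → (∀ y → P y → y ≡ x) → count P? ≡ 1ℤ
count-unique P? x p u = trans (∑-single _ x (λ y ne → 𝟙-no (P? y) (ne ∘ u y))) (𝟙-yes (P? x) p)

count-≤1 : ∀ {n} {P : Fin n → Set} (P? : ∀ x → Dec (P x)) → (∀ x y → P x → P y → x ≡ y) → count P? ≤ᶻ 1ℤ
count-≤1 P? u with any? P?
... | yes (x , p) = ZP.≤-reflexive (count-unique P? x p (λ y q → u y x q p))
... | no ¬e = subst (_≤ᶻ 1ℤ) (sym (∑-zero (λ x → 𝟙-no (P? x) (λ p → ¬e (x , p))))) (+≤+ z≤n)

count-mono : ∀ {n} {P Q : Fin n → Set} (P? : ∀ x → Dec (P x)) (Q? : ∀ x → Dec (Q x)) → (∀ x → P x → Q x) → count P? ≤ᶻ count Q?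
count-mono P? Q? f = ∑-mono (λ x → 𝟙-≤ (P? x) (Q? x) (f x))

count-cong : ∀ {n} {P Q : Fin n → Set} (P? : ∀ x → Dec (P x)) (Q? : ∀ x → Dec (Q x)) → (∀ x → P x → Q x) → (∀ x → Q x → P x) → count P? ≡ count Q?
count-cong P? Q? f g = ∑-cong (λ x → 𝟙-cong (P? x) (Q? x) (f x) (g x))

count-tight : ∀ {n} {P Q : Fin n → Set} (P? : ∀ x → Dec (P x)) (Q? : ∀ x → Dec (Q x)) → (∀ x → P x → Q x) → count Q? ≤ᶻ count P? → ∀ x → Q x → P x
count-tight P? Q? f le x q = 𝟙-pos (P? x) (subst (0ℤ <_) (sym (trans (∑-tight (λ y → 𝟙-≤ (P? y) (Q? y) (f y)) le x) (𝟙-yes (Q? x) q))) (+<+ (s≤s z≤n)))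

-- Double counting of the pairs `(i , e i)`: each `y` in `Q` is hit exactly once, every other `y`
-- never.
∑-reindex : ∀ {m n} {Q : Fin n → Set} (Q? : ∀ y → Dec (Q y)) (e : Fin m → Fin n) → (∀ {i j} → e i ≡ e j → i ≡ j) →
  (∀ i → Q (e i)) → (∀ y → Q y → ∃ λ i → e i ≡ y) → (f : Fin n → ℤ) → ∑ (λ i → f (e i)) ≡ ∑ (λ y → 𝟙 (Q? y) * f y)
∑-reindex Q? e inj eQ ix f = begin
  ∑ (λ i → f (e i)) ≡⟨ ∑-cong (λ i → sym (∑-δ (e i) f)) ⟩
  ∑ (λ i → ∑ (λ y → 𝟙 (e i ≟ y) * f y)) ≡⟨ ∑-swap _ ⟩
  ∑ (λ y → ∑ (λ i → 𝟙 (e i ≟ y) * f y)) ≡⟨ ∑-cong (λ y → trans (∑-cong (λ i → ZP.*-comm (𝟙 (e i ≟ y)) (f y))) (trans (∑-* (f y) _) (trans (cong (λ z → f y * z) (cnt y)) (ZP.*-comm (f y) _)))) ⟩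
  ∑ (λ y → 𝟙 (Q? y) * f y) ∎
  where
  open ≡-Reasoning
  cnt : ∀ y → count (λ i → e i ≟ y) ≡ 𝟙 (Q? y)
  cnt y with Q? y
  ... | yes q = count-unique (λ i → e i ≟ y) (proj₁ (ix y q)) (proj₂ (ix y q)) (λ j ej → inj (trans ej (sym (proj₂ (ix y q)))))
  ... | no ¬q = ∑-zero (λ i → 𝟙-no (e i ≟ y) (λ eq → ¬q (subst _ eq (eQ i))))

∑-perm : ∀ {n} (p p⁻ : Fin n → Fin n) → (∀ x → p⁻ (p x) ≡ x) → (∀ x → p (p⁻ x) ≡ x) → (f : Fin n → ℤ) → ∑ (f ∘ p) ≡ ∑ f
∑-perm p p⁻ l r f = trans (∑-reindex {Q = λ _ → ⊤} (λ _ → yes tt) p (λ {i} {j} e → trans (sym (l i)) (trans (cong p⁻ e) (l j))) (λ _ → tt) (λ y _ → p⁻ y , r y) f) (∑-cong (λ y → ZP.*-identityˡ (f y)))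

-- Row and column sums of the incidence matrix of `f`: rows sum to the indicator of `P`, columns to
-- at most the indicator of `Q`. As `f` takes a proof of `P`, the matrix is defined on the decision
-- `P?`, which fixes the proof that is used.
count-inj : ∀ {n m} {P : Fin n → Set} {Q : Fin m → Set} (P? : ∀ x → Dec (P x)) (Q? : ∀ x → Dec (Q x)) (f : ∀ x → P x → Fin m) →
  (∀ x p → Q (f x p)) → (∀ x y p q → f x p ≡ f y q → x ≡ y) → count P? ≤ᶻ count Q?
count-inj {n} {m} {P} {Q} P? Q? f fQ inj = ZP.≤-trans (ZP.≤-reflexive (trans (∑-cong (λ x → row (P? x))) (∑-swap _))) (∑-mono col)
  where
  Hit : ∀ {x} → Dec (P x) → Fin m → Set
  Hit {x} (yes p) y = f x p ≡ y
  Hit (no _) y = ⊥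
  Hit? : ∀ {x} (d : Dec (P x)) y → Dec (Hit d y)
  Hit? {x} (yes p) y = f x p ≟ y
  Hit? (no _) y = no id
  row : ∀ {x} (d : Dec (P x)) → 𝟙 d ≡ ∑ (λ y → 𝟙 (Hit? d y))
  row {x} (yes p) = sym (count-unique (f x p ≟_) (f x p) refl (λ y → sym))
  row (no _) = sym (∑-zero {m} {λ _ → 0ℤ} (λ _ → refl))
  hit-inj : ∀ {x x' y} (d : Dec (P x)) (d' : Dec (P x')) → Hit d y → Hit d' y → x ≡ x'
  hit-inj (yes p) (yes p') e e' = inj _ _ p p' (trans e (sym e'))
  hit-Q : ∀ {x y} (d : Dec (P x)) → Hit d y → Q y
  hit-Q (yes p) e = subst Q e (fQ _ p)
  col : ∀ y → ∑ (λ x → 𝟙 (Hit? (P? x) y)) ≤ᶻ 𝟙 (Q? y)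
  col y with Q? y
  ... | yes q = count-≤1 (λ x → Hit? (P? x) y) (λ x x' → hit-inj (P? x) (P? x'))
  ... | no ¬q = ZP.≤-reflexive (∑-zero (λ x → 𝟙-no (Hit? (P? x) y) (¬q ∘ hit-Q (P? x))))

-- Decidable search

opaque
  least : ∀ {n} {P : Fin n → Set} → (∀ x → Dec (P x)) → ∃ P → Σ (Fin n) λ x → P x × (∀ y → P y → toℕ x ≤ toℕ y)
  least {suc n} {P} P? e with P? fz
  ... | yes p = fz , p , λ _ _ → z≤n
  ... | no ¬p with least (P? ∘ fs) (down e)
    where
    down : ∃ P → ∃ (P ∘ fs)
    down (fz , p) = ⊥-elim (¬p p)
    down (fs x , p) = x , p
  ... | x , p , m = fs x , p , λ { fz q → ⊥-elim (¬p q) ; (fs y) q → s≤s (m y q) }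

-- Iteration and orbits of an injection

iter-+ : ∀ {A : Set} (f : A → A) i j x → iter f (i +ℕ j) x ≡ iter f i (iter f j x)
iter-+ f zero j x = refl
iter-+ f (suc i) j x = cong f (iter-+ f i j x)

iter-suc : ∀ {A : Set} (f : A → A) i x → iter f i (f x) ≡ iter f (suc i) x
iter-suc f zero x = refl
iter-suc f (suc i) x = cong f (iter-suc f i x)

record Perm (n : ℕ) : Set where
  field
    ap ap⁻ : Fin n → Fin n
    left : ∀ x → ap⁻ (ap x) ≡ x
    right : ∀ x → ap (ap⁻ x) ≡ x
  ap-inj : ∀ {x y} → ap x ≡ ap y → x ≡ y
  ap-inj {x} {y} e = trans (sym (left x)) (trans (cong ap⁻ e) (left y))

-- Kept general because class sums are taken over orbits of permutations and also over connected
-- components of a graph.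
record DecEquiv (n : ℕ) : Set₁ where
  infix 4 _~_
  field
    _~_ : Fin n → Fin n → Set
    _~?_ : ∀ x y → Dec (x ~ y)
    ~-refl : ∀ {x} → x ~ x
    ~-sym : ∀ {x y} → x ~ y → y ~ x
    ~-trans : ∀ {x y z} → x ~ y → y ~ z → x ~ z

module Orbits {n} (P : Perm n) where
  open Perm P renaming (ap to p; ap⁻ to p⁻; ap-inj to pinj)

  iter-inj : ∀ k {x y} → iter p k x ≡ iter p k y → x ≡ y
  iter-inj zero e = e
  iter-inj (suc k) e = iter-inj k (pinj e)

  opaque
    -- Pigeonhole on the `n + 1` iterates of exponent 0 to `n`; cancelling the smaller exponent by
    -- injectivity leaves a period. The bound on it is what makes exponents below `n` suffice in
    -- `~-short`.
    return : ∀ x → ∃ λ r → suc r ≤ n × iter p (suc r) x ≡ x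
    return x with pigeonhole (NP.n<1+n n) (λ i → iter p (toℕ i) x)
    ... | i , j , i<j , e = r , bound , iter-inj (toℕ i) (trans (sym (iter-+ p (toℕ i) (suc r) x)) (trans (cong (λ t → iter p t x) eq) (sym e)))
      where
      r : ℕ
      r = toℕ j ∸ suc (toℕ i)
      eq : toℕ i +ℕ suc r ≡ toℕ j
      eq = trans (NP.+-suc (toℕ i) r) (NP.m+[n∸m]≡n i<j)
      bound : suc r ≤ n
      bound = NP.≤-trans (subst (suc r ≤_) eq (NP.m≤n+m (suc r) (toℕ i))) (NP.≤-pred (FP.toℕ<n j))

  infix 4 _~_
  _~_ : Fin n → Fin n → Set
  x ~ y = ∃ λ t → iter p t x ≡ y

  ~-refl : ∀ {x} → x ~ x
  ~-refl = 0 , refl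

  ~-trans : ∀ {x y z} → x ~ y → y ~ z → x ~ z
  ~-trans {x} (s , refl) (t , e) = t +ℕ s , trans (iter-+ p t s x) e

  ~-step : ∀ {x} → x ~ p x
  ~-step = 1 , refl

  ~-back : ∀ {x} → p x ~ x
  ~-back {x} with return x
  ... | r , _ , e = r , trans (iter-suc p r x) e

  ~-sym : ∀ {x y} → x ~ y → y ~ x
  ~-sym (zero , refl) = ~-refl
  ~-sym {x} (suc t , refl) = ~-trans ~-back (~-sym (t , refl))

  ~-short : ∀ {x y} → x ~ y → ∃ λ t → t <ℕ n × iter p t x ≡ y
  ~-short {x} (t , refl) = go t t NP.≤-refl
    where
    go : ∀ k t → t ≤ k → ∃ λ s → s <ℕ n × iter p s x ≡ iter p t x
    go k t le with t NP.<? n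
    ... | yes l = t , l , refl
    go zero zero le | no nl with return x
    ... | r , b , _ = ⊥-elim (nl (NP.≤-trans (s≤s z≤n) b))
    go (suc k) t le | no nl with return x
    ... | r , b , ret with go k (t ∸ suc r) (NP.≤-trans (NP.∸-monoʳ-≤ {1} {suc r} t (s≤s z≤n)) (NP.∸-monoˡ-≤ 1 le))
    ...   | s , s<n , e = s , s<n , trans e (trans (cong (iter p (t ∸ suc r)) (sym ret)) (trans (sym (iter-+ p (t ∸ suc r) (suc r) x)) (cong (λ u → iter p u x) (NP.m∸n+n≡m (NP.≤-trans b (NP.≮⇒≥ nl))))))

  opaque
    _~?_ : ∀ x y → Dec (x ~ y)
    x ~? y = map′ (λ { (t , e) → toℕ t , e }) (λ r → bounded (~-short r)) (any? (λ (t : Fin n) → iter p (toℕ t) x ≟ y))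
      where
      bounded : (∃ λ t → t <ℕ n × iter p t x ≡ y) → ∃ λ (t : Fin n) → iter p (toℕ t) x ≡ y
      bounded (t , l , e) = fromℕ< l , trans (cong (λ u → iter p u x) (FP.toℕ-fromℕ< l)) e

-- Classes of a decidable equivalence and their least representatives

module Classes {n} (D : DecEquiv n) where
  open DecEquiv D public

  opaque
    rep : Fin n → Fin n
    rep x = proj₁ (least (x ~?_) (x , ~-refl))

    rep-~ : ∀ x → x ~ rep x
    rep-~ x = proj₁ (proj₂ (least (x ~?_) (x , ~-refl)))

    rep-least : ∀ x y → x ~ y → toℕ (rep x) ≤ toℕ y
    rep-least x = proj₂ (proj₂ (least (x ~?_) (x , ~-refl)))

  rep-cong : ∀ {x y} → x ~ y → rep x ≡ rep y
  rep-cong {x} {y} r = FP.toℕ-injective (NP.≤-antisym (rep-least x _ (~-trans r (rep-~ y))) (rep-least y _ (~-trans (~-sym r) (rep-~ x))))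

  rep-sound : ∀ {x y} → rep x ≡ rep y → x ~ y
  rep-sound {x} {y} e = ~-trans (subst (x ~_) e (rep-~ x)) (~-sym (rep-~ y))

  rep-idem : ∀ x → rep (rep x) ≡ rep x
  rep-idem x = sym (rep-cong (rep-~ x))

  Rep : Fin n → Set
  Rep x = rep x ≡ x

  Rep? : ∀ x → Dec (Rep x)
  Rep? x = rep x ≟ x

  clsum : Fin n → (Fin n → ℤ) → ℤ
  clsum x g = ∑ (λ y → 𝟙 (x ~? y) * g y)

  clsum-cong : ∀ {x y} g → x ~ y → clsum x g ≡ clsum y g
  clsum-cong {x} {y} g r = ∑-cong (λ z → cong (_* g z) (𝟙-cong (x ~? z) (y ~? z) (~-trans (~-sym r)) (~-trans r)))

  ∑-classes : ∀ g → ∑ g ≡ ∑ (λ r → 𝟙 (Rep? r) * clsum r g)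
  ∑-classes g = begin
    ∑ g ≡⟨ ∑-cong (λ x → sym (trans (∑-cong (λ r → ZP.*-comm (𝟙 (Rep? r ×-dec (r ~? x))) (g x))) (trans (∑-* (g x) _) (trans (cong (λ z → g x * z) (one x)) (ZP.*-identityʳ (g x)))))) ⟩
    ∑ (λ x → ∑ (λ r → 𝟙 (Rep? r ×-dec (r ~? x)) * g x)) ≡⟨ ∑-swap _ ⟩
    ∑ (λ r → ∑ (λ x → 𝟙 (Rep? r ×-dec (r ~? x)) * g x)) ≡⟨ ∑-cong (λ r → trans (∑-cong (λ x → trans (cong (_* g x) (𝟙-× (Rep? r) (r ~? x))) (ZP.*-assoc (𝟙 (Rep? r)) (𝟙 (r ~? x)) (g x)))) (∑-* (𝟙 (Rep? r)) _)) ⟩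
    ∑ (λ r → 𝟙 (Rep? r) * clsum r g) ∎
    where
    open ≡-Reasoning
    one : ∀ x → count (λ r → Rep? r ×-dec (r ~? x)) ≡ 1ℤ
    one x = count-unique (λ r → Rep? r ×-dec (r ~? x)) (rep x) (rep-idem x , ~-sym (rep-~ x)) (λ { r (e , s) → trans (sym e) (rep-cong s) })

  #cls : {Q : Fin n → Set} → (∀ x → Dec (Q x)) → ℤ
  #cls Q? = count (λ x → Rep? x ×-dec Q? x)

  ∑-const : {Q : Fin n → Set} (Q? : ∀ x → Dec (Q x)) → (∀ {x y} → x ~ y → Q x → Q y) → ∀ g c → (∀ x → Q x → clsum x g ≡ c) →
    ∑ (λ x → 𝟙 (Q? x) * g x) ≡ c * #cls Q?
  ∑-const Q? inv g c h = trans (∑-classes _) (trans (∑-cong row) (∑-* c _))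
    where
    row : ∀ r → 𝟙 (Rep? r) * clsum r (λ x → 𝟙 (Q? x) * g x) ≡ c * 𝟙 (Rep? r ×-dec Q? r)
    row r = trans (cong (λ z → 𝟙 (Rep? r) * z) inner) (trans (sym (ZP.*-assoc (𝟙 (Rep? r)) _ c)) (trans (cong (_* c) (sym (𝟙-× (Rep? r) (Q? r)))) (ZP.*-comm _ c)))
      where
      pull : ∀ a b c → a * (b * c) ≡ b * (a * c)
      pull = solve-∀
      inner : clsum r (λ x → 𝟙 (Q? x) * g x) ≡ 𝟙 (Q? r) * c
      inner = trans (∑-cong (λ x → trans (𝟙-*cong (r ~? x) (λ s → cong (_* g x) (𝟙-cong (Q? x) (Q? r) (inv (~-sym s)) (inv s)))) (pull (𝟙 (r ~? x)) (𝟙 (Q? r)) (g x))))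
        (trans (∑-* (𝟙 (Q? r)) _) (𝟙-*cong (Q? r) (h r)))

orbits : ∀ {n} → Perm n → DecEquiv n
orbits P = record { Orbits P }

module Orb {n} (P : Perm n) where
  open Perm P renaming (ap to p; ap⁻ to p⁻)
  open Classes (orbits P) public
  ~-step : ∀ {x} → x ~ p x
  ~-step = Orbits.~-step P
  ~-back : ∀ {x} → p x ~ x
  ~-back = Orbits.~-back P
  ~-prev : ∀ {x} → x ~ p⁻ x
  ~-prev {x} = ~-sym (subst (p⁻ x ~_) (right x) ~-step)
  clsum-shift : ∀ x g → clsum x (g ∘ p) ≡ clsum x g
  clsum-shift x g = trans (∑-cong (λ y → cong (_* g (p y)) (𝟙-cong (x ~? y) (x ~? p y) (λ s → ~-trans s ~-step) (λ s → ~-trans s ~-back))))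
    (∑-perm p p⁻ left right (λ y → 𝟙 (x ~? y) * g y))
  closed-~ : {Q : Fin n → Set} → (∀ x → Q x → Q (p x)) → ∀ {x y} → x ~ y → Q x → Q y
  closed-~ c (zero , refl) q = q
  closed-~ {Q} c {x} (suc t , refl) q = c _ (closed-~ {Q} c (t , refl) q)

-- Reachability with ranks

T∨ˡ : ∀ {a b} → T a → T (a ∨ b)
T∨ˡ {true} _ = tt

T∨ʳ : ∀ {a b} → T b → T (a ∨ b)
T∨ʳ {true} _ = tt
T∨ʳ {false} t = t

T∨ : ∀ {a b} → T (a ∨ b) → T a ⊎ T b
T∨ {true} t = inj₁ t
T∨ {false} t = inj₂ t

missing : ∀ {n} → (Fin n → Bool) → ℕ
missing {zero} S = 0
missing {suc n} S = (if S fz then 0 else 1) +ℕ missing (S ∘ fs)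

missing-mono : ∀ {n} {S S' : Fin n → Bool} → (∀ x → T (S x) → T (S' x)) → missing S' ≤ missing S
missing-mono {zero} h = z≤n
missing-mono {suc n} {S} {S'} h = NP.+-mono-≤ (head (S fz) (S' fz) (h fz)) (missing-mono (h ∘ fs))
  where
  head : ∀ a b → (T a → T b) → (if b then 0 else 1) ≤ (if a then 0 else 1)
  head a true _ = z≤n
  head false false _ = NP.≤-refl
  head true false f = ⊥-elim (f tt)

missing-< : ∀ {n} {S S' : Fin n → Bool} → (∀ x → T (S x) → T (S' x)) → ∀ y → ¬ T (S y) → T (S' y) → missing S' <ℕ missing S
missing-< {S = S} {S'} h fz ny y = NP.+-mono-<-≤ (head (S fz) (S' fz) ny y) (missing-mono (h ∘ fs))
  where
  head : ∀ a b → ¬ T a → T b → (if b then 0 else 1) <ℕ (if a then 0 else 1)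
  head true b na tb = ⊥-elim (na tt)
  head false true na tb = s≤s z≤n
missing-< {S = S} {S'} h (fs y) ny ty = NP.+-mono-≤-< (head (S fz) (S' fz) (h fz)) (missing-< (h ∘ fs) y ny ty)
  where
  head : ∀ a b → (T a → T b) → (if b then 0 else 1) ≤ (if a then 0 else 1)
  head a true _ = z≤n
  head false false _ = NP.≤-refl
  head true false f = ⊥-elim (f tt)

record Start (n : ℕ) : Set₁ where
  field
    E : Fin n → Fin n → Set
    E? : ∀ x y → Dec (E x y)
    I : Fin n → Set
    I? : ∀ x → Dec (I x)

module Reach {n} (R : Start n) where
  open Start R

  data Path : Fin n → Set where
    here : ∀ {x} → I x → Path x
    step : ∀ {x y} → Path x → E x y → Path y

  -- Ranks are times of discovery, not distances: a new element receives the current `bound`, above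
  -- every rank given so far. What matters later is that ranks strictly decrease from an element to
  -- its parent.
  record State : Set where
    field
      S : Fin n → Bool
      rank : Fin n → ℕ
      bound : ℕ
      S-I : ∀ x → I x → T (S x)
      S-path : ∀ x → T (S x) → Path x
      rank-< : ∀ x → T (S x) → rank x <ℕ bound
      par : ∀ x → T (S x) → I x ⊎ Σ (Fin n) λ y → T (S y) × E y x × rank y <ℕ rank x

  open State

  record Result : Set where
    field
      state : State
      closed : ∀ x y → T (S state x) → E x y → T (S state y)

  T? : ∀ b → Dec (T b)
  T? true = yes tt
  T? false = no id

  init : State
  init = record
    { S = λ x → ⌊ I? x ⌋ ; rank = λ _ → 0 ; bound = 1
    ; S-I = λ x i → fromWitness i ; S-path = λ x t → here (toWitness t)
    ; rank-< = λ x t → s≤s z≤n ; par = λ x t → inj₁ (toWitness t) }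

  extend : (s : State) → ∀ x y → T (S s x) → ¬ T (S s y) → E x y → Σ State λ s' → missing (S s') <ℕ missing (S s)
  extend s x y sx ny e = s' , missing-< old y ny (T∨ʳ {S s y} (fromWitness {a? = y ≟ y} refl))
    where
    S' : Fin n → Bool
    S' z = S s z ∨ ⌊ z ≟ y ⌋
    old : ∀ z → T (S s z) → T (S' z)
    old z t = T∨ˡ t
    rank' : Fin n → ℕ
    rank' z with z ≟ y
    ... | yes _ = bound s
    ... | no _ = rank s z
    rank'-y : rank' y ≡ bound s
    rank'-y with y ≟ y
    ... | yes _ = refl
    ... | no ne = ⊥-elim (ne refl)
    rank'-old : ∀ z → T (S s z) → rank' z ≡ rank s z
    rank'-old z t with z ≟ y
    ... | yes refl = ⊥-elim (ny t)
    ... | no _ = refl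
    cases : ∀ {A : Fin n → Set} → (∀ z → T (S s z) → A z) → A y → ∀ z → T (S' z) → A z
    cases f g z t with T∨ {S s z} t
    ... | inj₁ q = f z q
    ... | inj₂ q with z ≟ y
    ...   | yes refl = g
    s' : State
    s' = record
      { S = S' ; rank = rank' ; bound = suc (bound s)
      ; S-I = λ z i → old z (S-I s z i)
      ; S-path = cases (S-path s) (step (S-path s x sx) e)
      ; rank-< = cases (λ z t → subst (_<ℕ suc (bound s)) (sym (rank'-old z t)) (NP.m≤n⇒m≤1+n (rank-< s z t))) (subst (_<ℕ suc (bound s)) (sym rank'-y) NP.≤-refl)
      ; par = cases (λ z t → oldpar z t (par s z t)) (inj₂ (x , old x sx , e , subst₂ _<ℕ_ (sym (rank'-old x sx)) (sym rank'-y) (rank-< s x sx))) }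
      where
      oldpar : ∀ z → T (S s z) → (I z ⊎ Σ (Fin n) λ y → T (S s y) × E y z × rank s y <ℕ rank s z) → I z ⊎ Σ (Fin n) λ y → T (S' y) × E y z × rank' y <ℕ rank' z
      oldpar z t (inj₁ i) = inj₁ i
      oldpar z t (inj₂ (w , tw , e , l)) = inj₂ (w , old w tw , e , subst₂ _<ℕ_ (sym (rank'-old w tw)) (sym (rank'-old z t)) l)

  grow : ∀ fuel (s : State) → missing (S s) <ℕ fuel → Result
  grow (suc fuel) s l with any? (λ x → any? (λ y → T? (S s x) ×-dec (¬? (T? (S s y)) ×-dec E? x y)))
  ... | yes (x , y , sx , ny , e) = let s' , d = extend s x y sx ny e in grow fuel s' (NP.≤-trans d (NP.≤-pred l))
  ... | no none = record { state = s ; closed = cl }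
    where
    cl : ∀ x y → T (S s x) → E x y → T (S s y)
    cl x y sx e with T? (S s y)
    ... | yes t = t
    ... | no nt = ⊥-elim (none (x , y , sx , nt , e))

  opaque
    result : Result
    result = grow _ init NP.≤-refl

  final : State
  final = Result.state result

  In : Fin n → Set
  In x = T (S final x)

  In? : ∀ x → Dec (In x)
  In? x = T? (S final x)

  In-I : ∀ {x} → I x → In x
  In-I = S-I final _

  In-E : ∀ {x y} → In x → E x y → In y
  In-E = Result.closed result _ _

  In-path : ∀ {x} → In x → Path x
  In-path = S-path final _

  rk : Fin n → ℕ
  rk = rank final

  rk-bound : ∀ {x} → In x → rk x <ℕ bound final
  rk-bound = rank-< final _

  parent : ∀ {x} → In x → I x ⊎ Σ (Fin n) λ y → In y × E y x × rk y <ℕ rk x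
  parent = par final _

  In-ind : {Q : Fin n → Set} → (∀ x → I x → Q x) → (∀ x y → Q x → E x y → Q y) → ∀ {x} → In x → Q x
  In-ind {Q} b s t = go (In-path t)
    where
    go : ∀ {x} → Path x → Q x
    go (here i) = b _ i
    go (step p e) = s _ _ (go p) e

-- Spanning forests of the graph with vertices the p-orbits and edges the α-pairs in Ed

record Graph (n : ℕ) : Set₁ where
  field
    vert : Perm n
    inv : Fin n → Fin n
    inv-inv : ∀ x → inv (inv x) ≡ x
    Ed : Fin n → Set
    Ed? : ∀ x → Dec (Ed x)
    Ed-inv : ∀ {x} → Ed x → Ed (inv x)

module Explore {n} (G : Graph n) (root : Fin n) where
  open Graph G renaming (inv to ι; inv-inv to ι-inv; Ed-inv to Ed-ι)
  open Orb vert

  -- The edge is directed from the class `x` already reached to the class `y` that it discovers, and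
  -- `z` is the dart at the end `y`, so that it can serve as the parent dart of `y`.
  Link : Fin n → Fin n → Fin n → Set
  Link x y z = z ~ y × Ed z × rep (ι z) ≡ x × Rep y

  Link? : ∀ x y z → Dec (Link x y z)
  Link? x y z = (z ~? y) ×-dec (Ed? z ×-dec ((rep (ι z) ≟ x) ×-dec Rep? y))

  links : Start n
  links = record { E = λ x y → ∃ (Link x y) ; E? = λ x y → any? (Link? x y) ; I = _≡ rep root ; I? = _≟ rep root }

  module R = Reach links

  Reached : Fin n → Set
  Reached x = R.In (rep x)

  Reached? : ∀ x → Dec (Reached x)
  Reached? x = R.In? (rep x)

  reached-root : Reached root
  reached-root = R.In-I refl

  reached-~ : ∀ {x y} → x ~ y → Reached x → Reached y
  reached-~ s = subst R.In (rep-cong s)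

  reached-inv : ∀ {x} → Ed x → Reached x → Reached (ι x)
  reached-inv {x} e r = R.In-E r (ι x , rep-~ (ι x) , Ed-ι e , cong rep (ι-inv x) , rep-idem (ι x))

  reached-ind : {Q : Fin n → Set} → Q root → (∀ {x y} → x ~ y → Q x → Q y) → (∀ {x} → Ed x → Q x → Q (ι x)) → ∀ {x} → Reached x → Q x
  reached-ind {Q} b cp ca {x} r = cp (~-sym (rep-~ x)) (R.In-ind {Q} (λ { _ refl → cp (rep-~ root) b }) st r)
    where
    st : ∀ x y → Q x → ∃ (Link x y) → Q y
    st x y q (z , s , e , refl , _) = cp s (subst Q (ι-inv z) (ca (Ed-ι e) (cp (~-sym (rep-~ (ι z))) q)))

  rk : Fin n → ℕ
  rk x = R.rk (rep x)

  bd : ℕ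
  bd = R.State.bound R.final

  NonRoot : Fin n → Set
  NonRoot x = rep x ≢ rep root

  find : ∀ r → Rep r → R.In r → r ≢ rep root → Σ (Fin n) λ z → z ~ r × Ed z × Reached (ι z) × rk (ι z) <ℕ rk r
  find r rr i ne with R.parent i
  ... | inj₁ e = ⊥-elim (ne e)
  ... | inj₂ (y , iy , (z , s , e , refl , _) , l) = z , s , e , iy , subst (λ t → R.rk (rep (ι z)) <ℕ R.rk t) (sym rr) l

  parentOf : ∀ r → Dec (R.In r) → Dec (r ≡ rep root) → Dec (Rep r) → Fin n
  parentOf r (yes i) (no ne) (yes rr) = proj₁ (find r rr i ne)
  parentOf r _ _ _ = r

  par : Fin n → Fin n
  par x = parentOf (rep x) (R.In? (rep x)) (rep x ≟ rep root) (Rep? (rep x))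

  par-cong : ∀ {x y} → x ~ y → par x ≡ par y
  par-cong s = cong (λ r → parentOf r (R.In? r) (r ≟ rep root) (Rep? r)) (rep-cong s)

  par-spec : ∀ x → Reached x → NonRoot x → par x ~ x × Ed (par x) × Reached (ι (par x)) × rk (ι (par x)) <ℕ rk x
  par-spec x i ne with R.In? (rep x) | rep x ≟ rep root | Rep? (rep x)
  ... | no ni | _ | _ = ⊥-elim (ni i)
  ... | yes _ | yes e | _ = ⊥-elim (ne e)
  ... | yes _ | no _ | no nr = ⊥-elim (nr (rep-idem x))
  ... | yes i' | no ne' | yes rr with find (rep x) rr i' ne'
  ...   | z , s , e , rz , l = ~-trans s (~-sym (rep-~ x)) , e , rz , subst (λ t → rk (ι z) <ℕ R.rk t) (rep-idem x) l

  -- The child ends of the tree edges. Each reached class other than the root class has exactly one,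
  -- so counting these darts counts vertices; `Up h` or `Up (ι h)` says that the edge of `h` is in
  -- the tree.
  Up : Fin n → Set
  Up h = (Reached h × NonRoot h) × par h ≡ h

  Up? : ∀ h → Dec (Up h)
  Up? h = (Reached? h ×-dec ¬? (rep h ≟ rep root)) ×-dec (par h ≟ h)

  up-par : ∀ x → Reached x → NonRoot x → Up (par x)
  up-par x r ne = let s , e , ra , l = par-spec x r ne in
    (reached-~ (~-sym s) r , λ q → ne (trans (sym (rep-cong s)) q)) , par-cong s

  up-rk : ∀ {h} → Up h → rk (ι h) <ℕ rk h
  up-rk {h} ((r , ne) , e) = subst (λ z → rk (ι z) <ℕ rk h) e (proj₂ (proj₂ (proj₂ (par-spec h r ne))))

  up-Ed : ∀ {h} → Up h → Ed h
  up-Ed {h} ((r , ne) , e) = subst Ed e (proj₁ (proj₂ (par-spec h r ne)))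

  up-anti : ∀ {h} → Up h → ¬ Up (ι h)
  up-anti {h} u v = NP.<-asym (up-rk u) (subst (λ z → rk z <ℕ rk (ι h)) (ι-inv h) (up-rk v))

  cls-≤ : {Q : Fin n → Set} (Q? : ∀ x → Dec (Q x)) → (∀ {x y} → x ~ y → Q x → Q y) → (∀ {x} → Q x → Reached x × NonRoot x) →
    #cls Q? ≤ᶻ count (λ h → Up? h ×-dec Q? h)
  cls-≤ Q? inv good = count-inj (λ x → Rep? x ×-dec Q? x) (λ h → Up? h ×-dec Q? h) (λ x _ → par x)
    (λ { x (rx , q) → let r , ne = good q in up-par x r ne , inv (~-sym (proj₁ (par-spec x r ne))) q })
    (λ { x y (rx , q) (ry , q') e → let r , ne = good q ; r' , ne' = good q' in
      trans (sym rx) (trans (rep-cong (~-trans (~-sym (proj₁ (par-spec x r ne))) (subst (_~ y) (sym e) (proj₁ (par-spec y r' ne'))))) ry) })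

  cls-≤-root : {Q : Fin n → Set} (Q? : ∀ x → Dec (Q x)) → (∀ {x y} → x ~ y → Q x → Q y) → (∀ {x} → Q x → Reached x) →
    #cls Q? ≤ᶻ count Up? + 1ℤ
  cls-≤-root {Q} Q? inv good = ZP.≤-trans (ZP.≤-reflexive (trans (∑-cong (λ x → split (Rep? x) (Q? x) (rep x ≟ rep root))) (∑-+ _ _))) (ZP.+-mono-≤
      (ZP.≤-trans (cls-≤ NQ? (λ s → λ { (a , b) → inv s a , λ q → b (trans (rep-cong s) q) }) (λ { (a , b) → good a , b }))
        (count-mono (λ h → Up? h ×-dec NQ? h) Up? (λ _ → proj₁)))
      (count-≤1 (λ x → Rep? x ×-dec (Q? x ×-dec (rep x ≟ rep root))) (λ { x y (a , _ , b) (c , _ , d) → trans (sym a) (trans b (trans (sym d) c)) })))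
    where
    NQ? : ∀ h → Dec (Q h × NonRoot h)
    NQ? h = Q? h ×-dec ¬? (rep h ≟ rep root)
    split : ∀ {A B C : Set} (d : Dec A) (r : Dec B) (q : Dec C) → 𝟙 (d ×-dec r) ≡ 𝟙 (d ×-dec (r ×-dec ¬? q)) + 𝟙 (d ×-dec (r ×-dec q))
    split (no _) _ _ = refl
    split (yes _) (no _) _ = refl
    split (yes _) (yes _) (yes _) = refl
    split (yes _) (yes _) (no _) = refl

  -- Elimination of leaves, from high rank to low: at the vertex of an `Up` dart `h`, every other
  -- dart of the support is the parent end of an edge to a child of larger rank, where `z` already
  -- vanishes, so the zero sum at the vertex reduces to `z h`. The fuel `k` measures how far the
  -- rank of `h` is from the bound.
  forest-flow : (z : Fin n → ℤ) → (∀ h → z (ι h) ≡ - z h) → (∀ h → z h ≢ 0ℤ → Up h ⊎ Up (ι h)) →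
    (∀ x → Reached x → NonRoot x → clsum x z ≡ 0ℤ) → ∀ h → z h ≡ 0ℤ
  forest-flow z anti supp bal h with z h ZP.≟ 0ℤ
  ... | yes e = e
  ... | no ne = case supp h ne of λ where
      (inj₁ u) → up-zero bd h u (NP.m≤n+m bd (rk h))
      (inj₂ v) → flip h (up-zero bd (ι h) v (NP.m≤n+m bd (rk (ι h))))
    where
    flip : ∀ h → z (ι h) ≡ 0ℤ → z h ≡ 0ℤ
    flip h e = trans (sym (cong z (ι-inv h))) (trans (anti (ι h)) (cong -_ e))
    up-zero : ∀ k h → Up h → bd ≤ rk h +ℕ k → z h ≡ 0ℤ
    up-zero zero h ((r , _) , _) l = ⊥-elim (NP.<-irrefl refl (NP.≤-trans (R.rk-bound r) (subst (bd ≤_) (NP.+-identityʳ (rk h)) l)))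
    up-zero (suc k) h u@((r , nr) , e) l = trans (sym single) (bal h r nr)
      where
      lift : ∀ y → rk h <ℕ rk (ι y) → rk h +ℕ suc k ≤ rk (ι y) +ℕ k
      lift y q = subst (_≤ rk (ι y) +ℕ k) (sym (NP.+-suc (rk h) k)) (NP.+-monoˡ-≤ k q)
      rest : ∀ y → h ~ y → y ≢ h → z y ≡ 0ℤ
      rest y s ny with z y ZP.≟ 0ℤ
      ... | yes q = q
      ... | no nz = case supp y nz of λ where
        (inj₁ (_ , e')) → ⊥-elim (ny (trans (sym e') (trans (par-cong (~-sym s)) e)))
        (inj₂ v) → flip y (up-zero k (ι y) v (NP.≤-trans l (lift y (subst (_<ℕ rk (ι y)) (trans (cong rk (ι-inv y)) (sym (cong R.rk (rep-cong s)))) (up-rk v)))))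
      single : clsum h z ≡ z h
      single = trans (∑-single _ h other) (on (h ~? h) ~-refl)
        where
        other : ∀ y → y ≢ h → 𝟙 (h ~? y) * z y ≡ 0ℤ
        other y ny with h ~? y
        ... | yes s = trans (ZP.*-identityˡ (z y)) (rest y s ny)
        ... | no _ = refl

  -- The `Up` darts and their opposites already number at least twice the classes minus 2, since all
  -- reached classes but one have a parent dart. If the edges have no more darts than that,
  -- `∑-tight` puts each of them in the tree.
  tree-covered : count (λ h → Ed? h ×-dec Reached? h) + + 2 ≤ᶻ + 2 * #cls Reached? → ∀ h → Ed h → Reached h → Up h ⊎ Up (ι h)
  tree-covered few h e r = conclude (∑-tight le total h)
    where
    ER? : ∀ h → Dec (Ed h × Reached h)
    ER? h = Ed? h ×-dec Reached? h
    le : ∀ h → 𝟙 (Up? h) + 𝟙 (Up? (ι h)) ≤ᶻ 𝟙 (ER? h)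
    le h = aux (Up? h) (Up? (ι h))
      where
      aux : (d : Dec (Up h)) (d' : Dec (Up (ι h))) → 𝟙 d + 𝟙 d' ≤ᶻ 𝟙 (ER? h)
      aux (yes u) (yes v) = ⊥-elim (up-anti u v)
      aux (no _) (no _) = 𝟙-nonneg (ER? h)
      aux (yes u) (no _) = ZP.≤-reflexive (sym (𝟙-yes (ER? h) (up-Ed u , proj₁ (proj₁ u))))
      aux (no _) (yes v) = ZP.≤-reflexive (sym (𝟙-yes (ER? h) (subst Ed (ι-inv h) (Ed-ι (up-Ed v)) , subst Reached (ι-inv h) (reached-inv (up-Ed v) (proj₁ (proj₁ v))))))
    rootcls : #cls Reached? ≤ᶻ count Up? + 1ℤ
    rootcls = cls-≤-root Reached? reached-~ id
    arith : ∀ {a b c} → a + + 2 ≤ᶻ + 2 * b → b ≤ᶻ c + 1ℤ → a ≤ᶻ c + c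
    arith {a} {b} {c} x y = subst₂ _≤ᶻ_ (e₁ a) (e₂ c) (ZP.+-monoˡ-≤ (- (+ 2)) (ZP.≤-trans x (ZP.*-monoˡ-≤-nonNeg (+ 2) y)))
      where
      e₁ : ∀ a → a + + 2 + - (+ 2) ≡ a
      e₁ = solve-∀
      e₂ : ∀ c → + 2 * (c + 1ℤ) + - (+ 2) ≡ c + c
      e₂ = solve-∀
    total : count ER? ≤ᶻ ∑ (λ h → 𝟙 (Up? h) + 𝟙 (Up? (ι h)))
    total = ZP.≤-trans (arith {c = count Up?} few rootcls) (ZP.≤-reflexive (sym (trans (∑-+ _ _) (cong (λ t → count Up? + t) (∑-perm ι ι ι-inv ι-inv (λ h → 𝟙 (Up? h)))))))
    conclude : 𝟙 (Up? h) + 𝟙 (Up? (ι h)) ≡ 𝟙 (ER? h) → Up h ⊎ Up (ι h)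
    conclude q = aux (Up? h) (Up? (ι h)) (trans q (𝟙-yes (ER? h) (e , r)))
      where
      aux : (d : Dec (Up h)) (d' : Dec (Up (ι h))) → 𝟙 d + 𝟙 d' ≡ 1ℤ → Up h ⊎ Up (ι h)
      aux (yes u) _ _ = inj₁ u
      aux (no _) (yes v) _ = inj₂ v
      aux (no _) (no _) ()

-- Rotation systems

-- Connectedness and genus are kept apart: the closure of a mobile is handled as a rotation system
-- before either is known.
record RMap (n : ℕ) : Set where
  field
    rot : Perm n
    inv : Fin n → Fin n
    inv-inv : ∀ x → inv (inv x) ≡ x
    root : Fin n

  open Perm rot public using () renaming (ap to rt; ap⁻ to rt⁻; left to rt-left; right to rt-right)

  fc fc⁻ : Fin n → Fin n
  fc h = rt (inv h)
  fc⁻ h = inv (rt⁻ h)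

  face : Perm n
  face = record { ap = fc ; ap⁻ = fc⁻ ; left = λ x → trans (cong inv (rt-left (inv x))) (inv-inv x) ; right = λ x → trans (cong rt (inv-inv (rt⁻ x))) (rt-right x) }

  module V = Orb rot
  module F = Orb face

  Outer : Fin n → Set
  Outer h = root F.~ h

  Outer? : ∀ h → Dec (Outer h)
  Outer? h = root F.~? h

  -- Connectedness as an induction principle over sets of darts, which spares any handling of paths.
  Connected : Set₁
  Connected = (Q : Fin n → Set) → (∀ h → Q h → Q (rt h)) → (∀ h → Q h → Q (inv h)) → ∀ {x} → Q x → ∀ y → Q y

module OpenRegion {n} (M : RMap n) (conn : RMap.Connected M) where
  open RMap M

  -- For an open region (vertex set ⊆ edge set ⊆ face set, read on darts) with connected dual
  -- and missing some vertex, V - E + F ≤ᶻ 1: the parent edges of a spanning tree of the faces and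
  -- those of a spanning tree of the vertices in the remaining edges are all distinct.
  module _ {Vs Es Fs : Fin n → Set} (Vs? : ∀ h → Dec (Vs h)) (Es? : ∀ h → Dec (Es h)) (Fs? : ∀ h → Dec (Fs h))
    (Vs-~ : ∀ {x y} → x V.~ y → Vs x → Vs y) (Es-inv : ∀ {x} → Es x → Es (inv x)) (Fs-~ : ∀ {x y} → x F.~ y → Fs x → Fs y)
    (VE : ∀ {x} → Vs x → Es x) (h₀ z₀ : Fin n) (¬Vz : ¬ Vs z₀)
    (Fconn : (Q : Fin n → Set) → (∀ {x y} → x F.~ y → Q x → Q y) → (∀ {x} → Es x → Q x → Q (inv x)) → Q h₀ → ∀ h → Fs h → Q h) where

    G₁ : Graph n
    G₁ = record { vert = face ; inv = inv ; inv-inv = inv-inv ; Ed = Es ; Ed? = Es? ; Ed-inv = Es-inv }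

    module X₁ = Explore G₁ h₀

    Tr? : ∀ h → Dec (X₁.Up h ⊎ X₁.Up (inv h))
    Tr? h = X₁.Up? h ⊎-dec X₁.Up? (inv h)

    G₂ : Graph n
    G₂ = record { vert = rot ; inv = inv ; inv-inv = inv-inv ; Ed = λ h → ¬ (X₁.Up h ⊎ X₁.Up (inv h)) ; Ed? = λ h → ¬? (Tr? h)
                ; Ed-inv = λ { {x} ne (inj₁ u) → ne (inj₂ u) ; {x} ne (inj₂ u) → ne (inj₁ (subst X₁.Up (inv-inv x) u)) } }

    module X₂ = Explore G₂ z₀

    -- Jump across an edge of the indicator of the vertices reached without using the edges of the
    -- face tree `X₁`. The jumps telescope around each face and are supported on that tree, so
    -- `forest-flow` on the faces makes them vanish: the edges outside the tree still connect all
    -- vertices. This stands in for the Jordan curve theorem.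
    z : Fin n → ℤ
    z h = 𝟙 (X₂.Reached? (inv h)) - 𝟙 (X₂.Reached? h)

    z-anti : ∀ h → z (inv h) ≡ - z h
    z-anti h = trans (cong (λ t → 𝟙 (X₂.Reached? t) - 𝟙 (X₂.Reached? (inv h))) (inv-inv h)) (lem (𝟙 (X₂.Reached? h)) (𝟙 (X₂.Reached? (inv h))))
      where
      lem : ∀ a b → a - b ≡ - (b - a)
      lem = solve-∀

    z-supp : ∀ h → z h ≢ 0ℤ → X₁.Up h ⊎ X₁.Up (inv h)
    z-supp h ne with Tr? h
    ... | yes t = t
    ... | no nt = ⊥-elim (ne (trans (cong (_- 𝟙 (X₂.Reached? h)) (𝟙-cong (X₂.Reached? (inv h)) (X₂.Reached? h)
            (λ r → subst X₂.Reached (inv-inv h) (X₂.reached-inv (Graph.Ed-inv G₂ nt) r)) (X₂.reached-inv nt))) (ZP.+-inverseʳ (𝟙 (X₂.Reached? h)))))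

    z-bal : ∀ x → F.clsum x z ≡ 0ℤ
    z-bal x = trans (∑-cong (λ y → trans (cong (λ t → 𝟙 (x F.~? y) * (t - 𝟙 (X₂.Reached? y))) (𝟙-cong (X₂.Reached? (inv y)) (X₂.Reached? (fc y)) (X₂.reached-~ V.~-step) (X₂.reached-~ V.~-back)))
        (lem (𝟙 (x F.~? y)) (𝟙 (X₂.Reached? (fc y))) (𝟙 (X₂.Reached? y)))))
      (trans (∑-sub (λ y → 𝟙 (x F.~? y) * 𝟙 (X₂.Reached? (fc y))) (λ y → 𝟙 (x F.~? y) * 𝟙 (X₂.Reached? y)))
        (trans (cong (_- F.clsum x (λ y → 𝟙 (X₂.Reached? y))) (F.clsum-shift x (λ y → 𝟙 (X₂.Reached? y)))) (ZP.+-inverseʳ (F.clsum x (λ y → 𝟙 (X₂.Reached? y))))))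
      where
      lem : ∀ a b c → a * (b - c) ≡ a * b - a * c
      lem = solve-∀

    all-reached : ∀ h → X₂.Reached h
    all-reached = conn X₂.Reached (λ _ → X₂.reached-~ V.~-step) cross X₂.reached-root
      where
      cross : ∀ h → X₂.Reached h → X₂.Reached (inv h)
      cross h r = 𝟙-pos (X₂.Reached? (inv h)) (subst (0ℤ <_) (sym (trans (diff _ _ (X₁.forest-flow z z-anti z-supp (λ x _ _ → z-bal x) h)) (𝟙-yes (X₂.Reached? h) r))) (+<+ (s≤s z≤n)))
        where
        diff : ∀ a b → a - b ≡ 0ℤ → a ≡ b
        diff a b e = ZP.i-j≡0⇒i≡j a b e

    UV? : ∀ h → Dec (X₂.Up h × Vs h)
    UV? h = X₂.Up? h ×-dec Vs? h

    euler-≤ : + 2 * (V.#cls Vs? + F.#cls Fs?) ≤ᶻ count Es? + + 2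
    euler-≤ = ZP.≤-trans (ZP.*-monoˡ-≤-nonNeg (+ 2) (ZP.+-mono-≤ (X₂.cls-≤ Vs? Vs-~ (λ {x} v → all-reached x , λ e → ¬Vz (Vs-~ (V.rep-sound e) v)))
        (X₁.cls-≤-root Fs? Fs-~ (λ {x} f → Fconn X₁.Reached X₁.reached-~ X₁.reached-inv X₁.reached-root x f))))
      (subst (_≤ᶻ count Es? + + 2) (sym (lem (count UV?) (count X₁.Up?))) (ZP.+-monoˡ-≤ (+ 2) darts))
      where
      lem : ∀ v u → + 2 * (v + (u + 1ℤ)) ≡ u + u + (v + v) + + 2
      lem = solve-∀
      Any? : ∀ h → Dec ((X₁.Up h ⊎ X₁.Up (inv h)) ⊎ ((X₂.Up h × Vs h) ⊎ (X₂.Up (inv h) × Vs (inv h))))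
      Any? h = Tr? h ⊎-dec (UV? h ⊎-dec UV? (inv h))
      into : ∀ h → (X₁.Up h ⊎ X₁.Up (inv h)) ⊎ ((X₂.Up h × Vs h) ⊎ (X₂.Up (inv h) × Vs (inv h))) → Es h
      back : ∀ h → Es (inv h) → Es h
      back h e = subst Es (inv-inv h) (Es-inv e)
      into h (inj₁ (inj₁ u)) = X₁.up-Ed u
      into h (inj₁ (inj₂ u)) = back h (X₁.up-Ed u)
      into h (inj₂ (inj₁ (_ , v))) = VE v
      into h (inj₂ (inj₂ (_ , v))) = back h (VE v)
      twice : ∀ {P : Fin n → Set} (P? : ∀ h → Dec (P h)) → count P? + count P? ≡ ∑ (λ h → 𝟙 (P? h) + 𝟙 (P? (inv h)))
      twice P? = sym (trans (∑-+ _ _) (cong (λ t → count P? + t) (∑-perm inv inv inv-inv inv-inv (λ h → 𝟙 (P? h)))))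
      darts : count X₁.Up? + count X₁.Up? + (count UV? + count UV?) ≤ᶻ count Es?
      darts = ZP.≤-trans (ZP.≤-reflexive (trans (cong₂ _+_ (twice X₁.Up?) (twice UV?)) (trans (sym (∑-+ _ _)) (∑-cong (λ h →
          trans (cong₂ _+_ (𝟙-⊎ (X₁.Up? h) (X₁.Up? (inv h)) X₁.up-anti) (𝟙-⊎ (UV? h) (UV? (inv h)) (λ a b → X₂.up-anti (proj₁ a) (proj₁ b))))
            (𝟙-⊎ (Tr? h) (UV? h ⊎-dec UV? (inv h)) (λ { t (inj₁ (u , _)) → X₂.up-Ed u t ; t (inj₂ (u , _)) → Graph.Ed-inv G₂ (X₂.up-Ed u) (subst (λ y → X₁.Up y ⊎ X₁.Up (inv y)) (sym (inv-inv h)) t) }))))))) 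
        (count-mono Any? Es? into)

-- Simple cycles from walks and from boundaries of unions of faces

raw : ∀ {n} → PlaneMap n → RMap n
raw M = record { rot = record { ap = P.σ ; ap⁻ = P.σ⁻ ; left = P.σ-inv₁ ; right = P.σ-inv₂ } ; inv = P.α ; inv-inv = P.α-invol ; root = P.root }
  where module P = PlaneMap M

star-closed : ∀ {n} {s a : Fin n → Fin n} (Q : Fin n → Set) → (∀ h → Q h → Q (s h)) → (∀ h → Q h → Q (a h)) → ∀ {x y} → Star (Step s a) x y → Q x → Q y
star-closed Q f g ε q = q
star-closed Q f g (byσ x ◅ r) q = star-closed Q f g r (f x q)
star-closed Q f g (byα x ◅ r) q = star-closed Q f g r (g x q)

raw-conn : ∀ {n} (M : PlaneMap n) → RMap.Connected (raw M)
raw-conn M Q f g {x} q y = star-closed Q f g (PlaneMap.connected M x y) q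

nextIdx-step : ∀ {m} (j : Fin (suc m)) → toℕ j <ℕ m → toℕ (nextIdx j) ≡ suc (toℕ j)
nextIdx-step j l = trans (FP.toℕ-fromℕ< _) (m<n⇒m%n≡m (s≤s l))

nextIdx-last : ∀ {m} (j : Fin (suc m)) → toℕ j ≡ m → toℕ (nextIdx j) ≡ 0
nextIdx-last {m} j e = trans (FP.toℕ-fromℕ< _) (trans (cong (λ t → suc t % suc m) e) (n%n≡0 (suc m)))

-- An endless walk must repeat a vertex; between the earlier visit `i₀` and the first repetition
-- `j₀` it is a simple cycle of length `j₀ - i₀`, stored as `suc m`. Since the walk never contains
-- the opposite of one of its darts, distinct indices carry distinct edges.
module WalkCycle {n} (M : PlaneMap n) (c : ℕ → Fin n)
  (link : ∀ k → RMap.V._~_ (raw M) (PlaneMap.α M (c k)) (c (suc k))) (noback : ∀ i j → c i ≢ PlaneMap.α M (c j)) where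
  open RMap (raw M)

  Again : Fin (suc n) → Set
  Again j = Σ (Fin (suc n)) λ i → toℕ i <ℕ toℕ j × V.rep (c (toℕ i)) ≡ V.rep (c (toℕ j))

  Again? : ∀ j → Dec (Again j)
  Again? j = any? (λ i → (toℕ i NP.<? toℕ j) ×-dec (V.rep (c (toℕ i)) ≟ V.rep (c (toℕ j))))

  opaque
   again : ∃ Again
   again with pigeonhole (NP.n<1+n n) (λ i → V.rep (c (toℕ i)))
   ... | i , j , l , e = j , i , l , e

  first = least Again? again
  j₀ = proj₁ first
  i₀ = proj₁ (proj₁ (proj₂ first))
  i = toℕ i₀
  m = toℕ j₀ ∸ suc i

  i<j : i <ℕ toℕ j₀
  i<j = proj₁ (proj₂ (proj₁ (proj₂ first)))

  end : suc (i +ℕ m) ≡ toℕ j₀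
  end = NP.m+[n∸m]≡n i<j

  fresh : ∀ s t → s <ℕ t → t ≤ m → ¬ (c (i +ℕ s) V.~ c (i +ℕ t))
  fresh s t l t≤m r = NP.<-irrefl refl (NP.≤-trans (subst (_<ℕ toℕ j₀) (sym (FP.toℕ-fromℕ< bt)) bt') (proj₂ (proj₂ first) (fromℕ< bt) (fromℕ< bs , less , same)))
    where
    bt' : i +ℕ t <ℕ toℕ j₀
    bt' = subst (i +ℕ t <ℕ_) end (s≤s (NP.+-monoʳ-≤ i t≤m))
    bt : i +ℕ t <ℕ suc n
    bt = NP.<-trans bt' (FP.toℕ<n j₀)
    bs : i +ℕ s <ℕ suc n
    bs = NP.<-trans (NP.+-monoʳ-< i l) bt
    less : toℕ (fromℕ< bs) <ℕ toℕ (fromℕ< bt)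
    less = subst₂ _<ℕ_ (sym (FP.toℕ-fromℕ< bs)) (sym (FP.toℕ-fromℕ< bt)) (NP.+-monoʳ-< i l)
    same : V.rep (c (toℕ (fromℕ< bs))) ≡ V.rep (c (toℕ (fromℕ< bt)))
    same = subst₂ (λ a b → V.rep (c a) ≡ V.rep (c b)) (sym (FP.toℕ-fromℕ< bs)) (sym (FP.toℕ-fromℕ< bt)) (V.rep-cong r)

  at : Fin (suc m) → Fin n
  at t = c (i +ℕ toℕ t)

  at-fresh : ∀ s t → s ≢ t → ¬ (at s V.~ at t)
  at-fresh s t ne r = case NP.<-cmp (toℕ s) (toℕ t) of λ where
    (tri< l _ _) → fresh (toℕ s) (toℕ t) l (NP.≤-pred (FP.toℕ<n t)) r
    (tri≈ _ e _) → ne (FP.toℕ-injective e)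
    (tri> _ _ l) → fresh (toℕ t) (toℕ s) l (NP.≤-pred (FP.toℕ<n s)) (V.~-sym r)

  at-link : ∀ t → inv (at t) V.~ at (nextIdx t)
  at-link t = case toℕ t NP.<? m of λ where
      (yes l) → subst (λ k → inv (at t) V.~ c k) (trans (sym (NP.+-suc i (toℕ t))) (cong (i +ℕ_) (sym (nextIdx-step t l)))) (link (i +ℕ toℕ t))
      (no nl) → wrap (NP.≤-antisym (NP.≤-pred (FP.toℕ<n t)) (NP.≮⇒≥ nl))
    where
    wrap : toℕ t ≡ m → inv (at t) V.~ at (nextIdx t)
    wrap last = subst (λ k → inv (at t) V.~ c k) (trans (sym (NP.+-identityʳ i)) (cong (i +ℕ_) (sym (nextIdx-last t last))))
      (V.~-trans (subst (λ k → inv (at t) V.~ c k) (trans (cong (λ k → suc (i +ℕ k)) last) end) (link (i +ℕ toℕ t))) (V.~-sym (V.rep-sound (proj₂ (proj₂ (proj₁ (proj₂ first)))))))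

  cycle : Cycle M m
  cycle = record { c = at ; link = at-link ; distinctVertices = at-fresh
    ; distinctEdges = λ s t ne → (λ e → at-fresh s t ne (subst (at s V.~_) e V.~-refl)) , noback _ _ }

module Boundary {n} (M : PlaneMap n) {A : Fin n → Set} (A? : ∀ h → Dec (A h)) (A-~ : ∀ {x y} → RMap.F._~_ (raw M) x y → A x → A y) where
  open RMap (raw M)

  Bd : Fin n → Set
  Bd h = A h × ¬ A (inv h)

  Bd? : ∀ h → Dec (Bd h)
  Bd? h = A? h ×-dec ¬? (A? (inv h))

  leave : ∀ k x → A x → ¬ A (iter rt k x) → Σ (Fin n) λ h → x V.~ h × A h × ¬ A (rt h)
  leave zero x a na = ⊥-elim (na a)
  leave (suc k) x a na with A? (rt x)
  ... | no nr = x , V.~-refl , a , nr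
  ... | yes ar = let h , s , r = leave k (rt x) ar (λ q → na (subst A (iter-suc rt k x) q)) in h , V.~-trans V.~-step s , r

  -- Turning around the end vertex from `fc h`, which is in the face of `h`, one must leave `A` at
  -- the latest at `inv h`, which is outside. The last dart inside is the next boundary dart,
  -- because its opposite lies in the face of the dart that follows it.
  next : ∀ h → Bd h → Σ (Fin n) λ h' → Bd h' × inv h V.~ h'
  next h (a , na) = let h' , s , a' , na' = leave (proj₁ (V.~-back {inv h})) (fc h) (A-~ F.~-step a) (λ q → na (subst A (proj₂ (V.~-back {inv h})) q)) in
    h' , (a' , λ q → na' (subst A (cong rt (inv-inv h')) (A-~ {inv h'} {rt (inv (inv h'))} F.~-step q))) , V.~-trans V.~-step s

  opaque
    boundary-cycle : ∀ {h} → Bd h → Σ ℕ λ m → Σ (Cycle M m) λ C → ∀ t → Bd (Cycle.c C t)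
    boundary-cycle {h} b = W.m , W.cycle , λ t → proj₂ (walk (W.i +ℕ toℕ t))
      where
      walk : ℕ → Σ (Fin n) Bd
      walk zero = h , b
      walk (suc k) = let h' , b' , _ = next (proj₁ (walk k)) (proj₂ (walk k)) in h' , b'
      module W = WalkCycle M (λ k → proj₁ (walk k)) (λ k → proj₂ (proj₂ (next (proj₁ (walk k)) (proj₂ (walk k)))))
        (λ i j e → proj₂ (proj₂ (walk j)) (subst A e (proj₁ (proj₂ (walk i)))))

  module _ {d} (girth : HasGirth M d) {h} (b : Bd h) where
    m = proj₁ (boundary-cycle b)
    C = proj₁ (proj₂ (boundary-cycle b))
    C-Bd = proj₂ (proj₂ (boundary-cycle b))

    Im? : ∀ h → Dec (∃ λ t → Cycle.c C t ≡ h)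
    Im? h = any? (λ t → Cycle.c C t ≟ h)

    d≤m : d ≤ suc m
    d≤m = proj₂ girth (suc m) C

    cyc-inj : ∀ {s t} → Cycle.c C s V.~ Cycle.c C t → s ≡ t
    cyc-inj {s} {t} e with s ≟ t
    ... | yes q = q
    ... | no ne = ⊥-elim (Cycle.distinctVertices C s t ne e)

    im-count : + d ≤ᶻ count Im?
    im-count = ZP.≤-trans (+≤+ d≤m) (ZP.≤-reflexive (trans (sym (∑-one (suc m))) (trans (∑-reindex Im? (Cycle.c C) (λ {s} {t} e → cyc-inj (subst (Cycle.c C s V.~_) e V.~-refl)) (λ t → t , refl) (λ y q → q) (λ _ → 1ℤ)) (∑-cong (λ y → ZP.*-identityʳ _)))))

    bd-count : + d ≤ᶻ count Bd?
    bd-count = ZP.≤-trans im-count (count-mono Im? Bd? (λ { _ (t , refl) → C-Bd t }))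

    -- One boundary cycle has at least `d` darts, so when there are only `d` boundary darts it uses
    -- them all; and a simple cycle leaves each vertex once.
    bd-simple : count Bd? ≤ᶻ + d → ∀ {x y} → Bd x → Bd y → x V.~ y → x ≡ y
    bd-simple le {x} {y} bx by s with im x bx | im y by
      where
      im : ∀ x → Bd x → ∃ λ t → Cycle.c C t ≡ x
      im = count-tight Im? Bd? (λ { _ (t , refl) → C-Bd t }) (ZP.≤-trans le im-count)
    ... | t , refl | t' , refl = cong (Cycle.c C) (cyc-inj s)

module OuterSimple {n d} (M : PlaneMap n) (girth : HasGirth M d) (odeg : count (RMap.Outer? (raw M)) ≡ + d) where
  open RMap (raw M)
  open Boundary M Outer? (λ s r → F.~-trans r s)

  -- Otherwise every dart is outer, by connectedness. A cycle of length `d` has `2 d` darts, more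
  -- than the degree `d` of the outer face.
  some : ∃ Bd
  some with any? Bd?
  ... | yes r = r
  ... | no none = ⊥-elim (absurd girth refl)
    where
    all-outer : ∀ h → Outer h
    all-outer = raw-conn M Outer (λ h o → subst Outer (cong rt (inv-inv h)) (F.~-trans (cross h o) F.~-step)) cross F.~-refl
      where
      cross : ∀ h → Outer h → Outer (inv h)
      cross h o with Outer? (inv h)
      ... | yes q = q
      ... | no nq = ⊥-elim (none (h , o , nq))
    absurd : ∀ {e} → HasGirth M e → e ≡ d → ⊥
    absurd {zero} (() , _) _
    absurd {suc m} (C , _) refl = NP.<-irrefl refl (NP.<-≤-trans (NP.m<m+n (suc m) (s≤s z≤n)) (ZP.drop‿+≤+ twice))
      where
      open Cycle C
      Dc? : ∀ h → Dec (∃ λ t → c t ≡ h)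
      Dc? h = any? (λ t → c t ≟ h)
      c-inj : ∀ {s t} → c s ≡ c t → s ≡ t
      c-inj {s} {t} e with s ≟ t
      ... | yes q = q
      ... | no ne = ⊥-elim (distinctVertices s t ne (subst (c s V.~_) e V.~-refl))
      im : count Dc? ≡ + suc m
      im = trans (sym (trans (∑-reindex Dc? c c-inj (λ t → t , refl) (λ _ q → q) (λ _ → 1ℤ)) (∑-cong (λ y → ZP.*-identityʳ _)))) (∑-one (suc m))
      disj : ∀ {h} → (∃ λ t → c t ≡ h) → ¬ (∃ λ t → c t ≡ inv h)
      disj (s , refl) (t , e) with t ≟ s
      ... | yes refl = PlaneMap.α-fpf M _ (sym e)
      ... | no ne = proj₂ (distinctEdges t s ne) e
      twice : + (suc m +ℕ suc m) ≤ᶻ + suc m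
      twice = ZP.≤-trans (ZP.≤-reflexive (trans (cong₂ _+_ (sym im) (sym im)) (trans (cong (λ z → count Dc? + z) (sym (∑-perm inv inv inv-inv inv-inv (λ h → 𝟙 (Dc? h))))) (trans (sym (∑-+ _ _)) (∑-cong (λ h → 𝟙-⊎ (Dc? h) (Dc? (inv h)) disj))))))
        (ZP.≤-trans (count-mono (λ h → Dc? h ⊎-dec Dc? (inv h)) Outer? (λ h _ → all-outer h)) (ZP.≤-reflexive odeg))

  -- The girth bounds the boundary below by `d`, the outer degree bounds it above.
  bd-all : count Bd? ≡ + d
  bd-all = ZP.≤-antisym (ZP.≤-trans (count-mono Bd? Outer? (λ _ → proj₁)) (ZP.≤-reflexive odeg)) (bd-count girth (proj₂ some))

  outer-inv : ∀ h → Outer h → ¬ Outer (inv h)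
  outer-inv h o = proj₂ (count-tight Bd? Outer? (λ _ → proj₁) (ZP.≤-reflexive (trans odeg (sym bd-all))) h o)

  outer-distinct : ∀ {x y} → Outer x → Outer y → x V.~ y → x ≡ y
  outer-distinct {x} {y} ox oy = bd-simple girth (proj₂ some) (ZP.≤-reflexive bd-all) (ox , outer-inv x ox) (oy , outer-inv y oy)

-- Existence of nonnegative flows with prescribed divergence

record Network (N K : ℕ) : Set where
  field
    tl hd : Fin K → Fin N

module Flows {N K} (W : Network N K) (t : Fin N → ℤ) where
  open Network W

  δ : Fin K → Fin N → ℤ
  δ k x = 𝟙 (tl k ≟ x) - 𝟙 (hd k ≟ x)

  div : (Fin K → ℕ) → Fin N → ℤ
  div g x = ∑ (λ k → δ k x * + g k)

  surplus : (Fin K → ℕ) → Fin N → ℤ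
  surplus g x = t x - div g x

  ∑-div-on : ∀ {S : Fin N → Set} (S? : ∀ x → Dec (S x)) g → ∑ (λ x → 𝟙 (S? x) * div g x) ≡ ∑ (λ k → (𝟙 (S? (tl k)) - 𝟙 (S? (hd k))) * + g k)
  ∑-div-on S? g = trans (∑-cong (λ x → sym (∑-* (𝟙 (S? x)) (λ k → δ k x * + g k)))) (trans (∑-swap _) (∑-cong row))
    where
    dist : ∀ s a b c → s * ((a - b) * c) ≡ a * (s * c) - b * (s * c)
    dist = solve-∀
    fact : ∀ a b c → a * c - b * c ≡ (a - b) * c
    fact = solve-∀
    row : ∀ k → ∑ (λ x → 𝟙 (S? x) * (δ k x * + g k)) ≡ (𝟙 (S? (tl k)) - 𝟙 (S? (hd k))) * + g k
    row k = trans (∑-cong (λ x → dist (𝟙 (S? x)) (𝟙 (tl k ≟ x)) (𝟙 (hd k ≟ x)) (+ g k)))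
      (trans (∑-sub (λ x → 𝟙 (tl k ≟ x) * (𝟙 (S? x) * + g k)) (λ x → 𝟙 (hd k ≟ x) * (𝟙 (S? x) * + g k)))
      (trans (cong₂ _-_ (∑-δ (tl k) (λ x → 𝟙 (S? x) * + g k)) (∑-δ (hd k) (λ x → 𝟙 (S? x) * + g k))) (fact (𝟙 (S? (tl k))) (𝟙 (S? (hd k))) (+ g k))))

  -- The residual graph of a flow without upper capacities.
  Res : (Fin K → ℕ) → Fin N → Fin N → Set
  Res g x y = ∃ λ k → (tl k ≡ x × hd k ≡ y) ⊎ (hd k ≡ x × tl k ≡ y × 1 ≤ g k)

  Res? : ∀ g x y → Dec (Res g x y)
  Res? g x y = any? (λ k → ((tl k ≟ x) ×-dec (hd k ≟ y)) ⊎-dec ((hd k ≟ x) ×-dec ((tl k ≟ y) ×-dec (1 NP.≤? g k))))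

  from : (Fin K → ℕ) → Fin N → Start N
  from g x = record { E = Res g ; E? = Res? g ; I = _≡ x ; I? = _≟ x }

  set : (Fin K → ℕ) → Fin K → ℕ → Fin K → ℕ
  set g k v j with j ≟ k
  ... | yes _ = v
  ... | no _ = g j

  set-other : ∀ g k v j → j ≢ k → set g k v j ≡ g j
  set-other g k v j ne with j ≟ k
  ... | yes e = ⊥-elim (ne e)
  ... | no _ = refl

  div-set : ∀ g k v x → div (set g k v) x ≡ div g x + δ k x * (+ v - + g k)
  div-set g k v x = trans (∑-cong row) (trans (∑-+ (λ j → δ j x * + g j) (λ j → 𝟙 (k ≟ j) * (δ j x * (+ v - + g k)))) (cong (λ z → div g x + z) (∑-δ k (λ j → δ j x * (+ v - + g k)))))
    where
    lem : ∀ a v g → a * v ≡ a * g + 1ℤ * (a * (v - g))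
    lem = solve-∀
    row : ∀ j → δ j x * + set g k v j ≡ δ j x * + g j + 𝟙 (k ≟ j) * (δ j x * (+ v - + g k))
    row j with j ≟ k
    ... | yes refl = trans (lem (δ j x) (+ v) (+ g j)) (cong (λ z → δ j x * + g j + z * (δ j x * (+ v - + g j))) (sym (𝟙-yes (j ≟ j) refl)))
    ... | no ne = sym (trans (cong (λ z → δ j x * + g j + z) (off (k ≟ j) (ne ∘ sym))) (ZP.+-identityʳ _))

  module Augment (g : Fin K → ℕ) (x : Fin N) where
    module R = Reach (from g x)

    Pushed : Fin N → Set
    Pushed y = Σ (Fin K → ℕ) λ g' → (∀ z → div g' z ≡ div g z + (𝟙 (x ≟ z) - 𝟙 (y ≟ z))) ×
      (∀ k → (R.rk y <ℕ R.rk (tl k)) ⊎ (R.rk y <ℕ R.rk (hd k)) → g' k ≡ g k)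

    -- one more unit along the parent path from x to y; ranks show that no arc is used twice
    push : ∀ b y → R.In y → R.rk y <ℕ b → Pushed y
    push (suc b) y iy l with R.parent iy
    ... | inj₁ refl = g , (λ z → sym (trans (cong (λ w → div g z + w) (ZP.+-inverseʳ (𝟙 (x ≟ z)))) (ZP.+-identityʳ _))) , λ _ _ → refl
    ... | inj₂ (y' , iy' , (k , inj₁ (refl , refl)) , lt) with push b y' iy' (NP.≤-trans lt (NP.≤-pred l))
    ...   | g₁ , d₁ , same = set g₁ k (suc (g₁ k)) , dv , λ j o → trans (set-other g₁ k _ j (ne j o)) (same j (later o))
      where
      ne : ∀ j → (R.rk y <ℕ R.rk (tl j)) ⊎ (R.rk y <ℕ R.rk (hd j)) → j ≢ k
      ne j (inj₁ o) refl = NP.<-asym o lt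
      ne j (inj₂ o) refl = NP.<-irrefl refl o
      later : ∀ {j} → (R.rk y <ℕ R.rk (tl j)) ⊎ (R.rk y <ℕ R.rk (hd j)) → (R.rk y' <ℕ R.rk (tl j)) ⊎ (R.rk y' <ℕ R.rk (hd j))
      later (inj₁ o) = inj₁ (NP.<-trans lt o)
      later (inj₂ o) = inj₂ (NP.<-trans lt o)
      alg : ∀ d a b c v → d + (a - b) + (b - c) * ((1ℤ + v) - v) ≡ d + (a - c)
      alg = solve-∀
      dv : ∀ z → div (set g₁ k (suc (g₁ k))) z ≡ div g z + (𝟙 (x ≟ z) - 𝟙 (y ≟ z))
      dv z = trans (div-set g₁ k (suc (g₁ k)) z) (trans (cong (_+ δ k z * (+ suc (g₁ k) - + g₁ k)) (d₁ z)) (alg (div g z) (𝟙 (x ≟ z)) (𝟙 (tl k ≟ z)) (𝟙 (hd k ≟ z)) (+ g₁ k)))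
    push (suc b) y iy l | inj₂ (y' , iy' , (k , inj₂ (refl , refl , pos)) , lt) with push b y' iy' (NP.≤-trans lt (NP.≤-pred l))
    ...   | g₁ , d₁ , same = set g₁ k (g₁ k ∸ 1) , dv , λ j o → trans (set-other g₁ k _ j (ne j o)) (same j (later o))
      where
      ne : ∀ j → (R.rk y <ℕ R.rk (tl j)) ⊎ (R.rk y <ℕ R.rk (hd j)) → j ≢ k
      ne j (inj₁ o) refl = NP.<-irrefl refl o
      ne j (inj₂ o) refl = NP.<-asym o lt
      later : ∀ {j} → (R.rk y <ℕ R.rk (tl j)) ⊎ (R.rk y <ℕ R.rk (hd j)) → (R.rk y' <ℕ R.rk (tl j)) ⊎ (R.rk y' <ℕ R.rk (hd j))
      later (inj₁ o) = inj₁ (NP.<-trans lt o)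
      later (inj₂ o) = inj₂ (NP.<-trans lt o)
      alg : ∀ d a b c v → d + (a - b) + (c - b) * (v - (1ℤ + v)) ≡ d + (a - c)
      alg = solve-∀
      pos₁ : g₁ k ≡ suc (g₁ k ∸ 1)
      pos₁ = sym (NP.m+[n∸m]≡n (subst (1 ≤_) (sym (same k (inj₁ lt))) pos))
      dv : ∀ z → div (set g₁ k (g₁ k ∸ 1)) z ≡ div g z + (𝟙 (x ≟ z) - 𝟙 (y ≟ z))
      dv z = trans (div-set g₁ k (g₁ k ∸ 1) z) (trans (cong₂ (λ a b → a + δ k z * (+ (g₁ k ∸ 1) - + b)) (d₁ z) pos₁) (alg (div g z) (𝟙 (x ≟ z)) (𝟙 (hd k ≟ z)) (𝟙 (tl k ≟ z)) (+ (g₁ k ∸ 1))))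

  -- A set that no arc leaves has nonpositive total divergence under any nonnegative flow, so this
  -- condition is necessary. It is asked only for sets connected by the arcs inside them,
  -- connectedness being given as an induction principle from `x`; the Euler bound for regions of a
  -- map relies on it.
  Demand : Set₁
  Demand = (x : Fin N) {S : Fin N → Set} (S? : ∀ y → Dec (S y)) → S x → (∀ k → S (tl k) → S (hd k)) →
    ((Q : Fin N → Set) → Q x → (∀ k → S (tl k) → S (hd k) → (Q (tl k) → Q (hd k)) × (Q (hd k) → Q (tl k))) → ∀ y → S y → Q y) →
    ∑ (λ y → 𝟙 (S? y) * t y) ≤ᶻ 0ℤ

  abs↓ : ∀ s → 0ℤ < s → ∣ s - 1ℤ ∣ <ℕ ∣ s ∣
  abs↓ (+ suc k) _ = NP.≤-refl
  abs↓ (+ zero) (+<+ ())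

  abs↑ : ∀ s → s < 0ℤ → ∣ s + 1ℤ ∣ <ℕ ∣ s ∣
  abs↑ (-[1+ zero ]) _ = NP.≤-refl
  abs↑ (-[1+ suc k ]) _ = NP.≤-refl
  abs↑ (+ k) (+<+ ())

  size : (Fin K → ℕ) → ℤ
  size g = ∑ (λ x → + ∣ surplus g x ∣)

  -- Augmentation, decreasing the sum of absolute surpluses. If no vertex of negative surplus is
  -- reachable from a positive `x`, no arc leaves the reached set and the arcs entering it carry 0;
  -- its divergence is then 0 and its demand equals its surplus, which is positive and contradicts
  -- `Demand`.
  solve : Demand → ∑ t ≡ 0ℤ → ∀ fuel g → size g ≤ᶻ + fuel → Σ (Fin K → ℕ) λ g' → ∀ x → div g' x ≡ t x
  solve H bal fuel g le with any? (λ x → 0ℤ ZP.<? surplus g x)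
  ... | no none = g , λ x → sym (ZP.i-j≡0⇒i≡j (t x) (div g x) (∑-tight {g = λ _ → 0ℤ} (λ y → ZP.≮⇒≥ (λ q → none (y , q))) (ZP.≤-reflexive total) x))
    where
    total : ∑ (λ _ → 0ℤ) ≡ ∑ (surplus g)
    total = sym (trans (∑-sub t (div g)) (trans (cong₂ _-_ bal zero-div) (sym (∑-zero {N} {λ _ → 0ℤ} (λ _ → refl)))))
      where
      zero-div : ∑ (div g) ≡ 0ℤ
      zero-div = trans (∑-cong (λ x → sym (ZP.*-identityˡ (div g x)))) (trans (∑-div-on {S = λ _ → ⊤} (λ _ → yes tt) g) (∑-zero (λ k → refl)))
  ... | yes (x , sx) with any? (λ y → Augment.R.In? g x y ×-dec (surplus g y ZP.<? 0ℤ))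
  ...   | yes (y , iy , sy) = again fuel le
    where
    open Augment g x
    pushed = push _ y iy NP.≤-refl
    g' = proj₁ pushed
    x≢y : x ≢ y
    x≢y refl = ZP.<-asym sx sy
    sur : ∀ z → surplus g' z ≡ surplus g z - (𝟙 (x ≟ z) - 𝟙 (y ≟ z))
    sur z = trans (cong (λ w → t z - w) (proj₁ (proj₂ pushed) z)) (alg (t z) (div g z) (𝟙 (x ≟ z)) (𝟙 (y ≟ z)))
      where
      alg : ∀ t d a b → t - (d + (a - b)) ≡ t - d - (a - b)
      alg = solve-∀
    at-x : ∣ surplus g' x ∣ <ℕ ∣ surplus g x ∣
    at-x = subst (λ w → ∣ w ∣ <ℕ ∣ surplus g x ∣) (sym (trans (sur x) (cong₂ (λ a b → surplus g x - (a - b)) (𝟙-yes (x ≟ x) refl) (𝟙-no (y ≟ x) (x≢y ∘ sym))))) (abs↓ (surplus g x) sx)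
    point : ∀ z → ∣ surplus g' z ∣ ≤ ∣ surplus g z ∣
    point z = aux (x ≟ z) (y ≟ z)
      where
      aux : Dec (x ≡ z) → Dec (y ≡ z) → ∣ surplus g' z ∣ ≤ ∣ surplus g z ∣
      aux (yes refl) _ = NP.<⇒≤ at-x
      aux (no _) (yes refl) = NP.<⇒≤ (subst (λ w → ∣ w ∣ <ℕ ∣ surplus g y ∣) (sym (trans (sur y) (trans (cong₂ (λ a b → surplus g y - (a - b)) (𝟙-no (x ≟ y) x≢y) (𝟙-yes (y ≟ y) refl)) refl))) (abs↑ (surplus g y) sy))
      aux (no a) (no b) = NP.≤-reflexive (cong ∣_∣ (trans (sur z) (trans (cong₂ (λ a b → surplus g z - (a - b)) (𝟙-no (x ≟ z) a) (𝟙-no (y ≟ z) b)) (ZP.+-identityʳ (surplus g z)))))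
    smaller : size g' < size g
    smaller = ZP.≰⇒> (λ q → NP.<⇒≢ at-x (ZP.+-injective (∑-tight (λ z → +≤+ (point z)) q x)))
    again : ∀ fuel → size g ≤ᶻ + fuel → Σ (Fin K → ℕ) λ g' → ∀ x → div g' x ≡ t x
    again zero l = ⊥-elim (ZP.<⇒≱ (ZP.<-≤-trans smaller l) (∑-nonneg (λ _ → +≤+ z≤n)))
    again (suc fuel) l = solve H bal fuel g' (ZP.≤-trans (ZP.i<j⇒i≤pred[j] smaller) (ZP.pred-mono l))
  ...   | no none = ⊥-elim (ZP.<⇒≱ positive (H x R.In? (R.In-I refl) closed conn))
    where
    open Augment g x
    closed : ∀ k → R.In (tl k) → R.In (hd k)
    closed k i = R.In-E i (k , inj₁ (refl , refl))
    conn : (Q : Fin N → Set) → Q x → (∀ k → R.In (tl k) → R.In (hd k) → (Q (tl k) → Q (hd k)) × (Q (hd k) → Q (tl k))) → ∀ y → R.In y → Q y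
    conn Q q st y i = proj₂ (R.In-ind {λ y → R.In y × Q y} (λ { _ refl → R.In-I refl , q }) go i)
      where
      go : ∀ a b → R.In a × Q a → Res g a b → R.In b × Q b
      go a b (ia , qa) r@(k , inj₁ (refl , refl)) = R.In-E ia r , proj₁ (st k ia (R.In-E ia r)) qa
      go a b (ia , qa) r@(k , inj₂ (refl , refl , _)) = R.In-E ia r , proj₂ (st k (R.In-E ia r) ia) qa
    no-div : ∑ (λ y → 𝟙 (R.In? y) * div g y) ≡ 0ℤ
    no-div = trans (∑-div-on R.In? g) (∑-zero (λ k → aux k (R.In? (tl k)) (R.In? (hd k))))
      where
      aux : ∀ k (a : Dec (R.In (tl k))) (b : Dec (R.In (hd k))) → (𝟙 a - 𝟙 b) * + g k ≡ 0ℤ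
      aux k (yes a) (yes b) = refl
      aux k (yes a) (no b) = ⊥-elim (b (closed k a))
      aux k (no a) (no b) = refl
      aux k (no a) (yes b) with g k in eq
      ... | zero = refl
      ... | suc v = ⊥-elim (a (R.In-E b (k , inj₂ (refl , refl , subst (1 ≤_) (sym eq) (s≤s z≤n)))))
    nonneg : ∀ y → 0ℤ ≤ᶻ 𝟙 (R.In? y) * surplus g y
    nonneg y = aux (R.In? y)
      where
      aux : (a : Dec (R.In y)) → 0ℤ ≤ᶻ 𝟙 a * surplus g y
      aux (yes a) = subst (0ℤ ≤ᶻ_) (sym (ZP.*-identityˡ _)) (ZP.≮⇒≥ (λ q → none (y , a , q)))
      aux (no _) = ZP.≤-refl
    alg : ∀ s t d → s * t ≡ s * (t - d) + s * d
    alg = solve-∀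
    sum-t : ∑ (λ y → 𝟙 (R.In? y) * t y) ≡ ∑ (λ y → 𝟙 (R.In? y) * surplus g y)
    sum-t = trans (∑-cong (λ y → alg (𝟙 (R.In? y)) (t y) (div g y))) (trans (∑-+ _ (λ y → 𝟙 (R.In? y) * div g y)) (trans (cong (λ w → ∑ (λ y → 𝟙 (R.In? y) * surplus g y) + w) no-div) (ZP.+-identityʳ _)))
    positive : 0ℤ < ∑ (λ y → 𝟙 (R.In? y) * t y)
    positive = subst (0ℤ <_) (sym sum-t) (ZP.≰⇒> (λ q → ZP.<⇒≢ sx (trans (∑-tight {f = λ _ → 0ℤ} nonneg (ZP.≤-trans q (ZP.≤-reflexive (sym (∑-zero {N} {λ _ → 0ℤ} (λ _ → refl))))) x) (on (R.In? x) (R.In-I refl)))))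

  hoffman : Demand → ∑ t ≡ 0ℤ → Σ (Fin K → ℕ) λ g → ∀ x → div g x ≡ t x
  hoffman H bal = solve H bal ∣ size (λ _ → 0) ∣ (λ _ → 0) (ZP.≤-reflexive (sym (ZP.0≤i⇒+∣i∣≡i (∑-nonneg (λ _ → +≤+ z≤n)))))

-- Boolean counting against decidable counting

opaque
  sum-∑ : ∀ {n} (f : Fin n → ℕ) → + NL.sum (List.map f (List.allFin n)) ≡ ∑ (λ x → + f x)
  sum-∑ {n} f = trans (cong (λ l → + NL.sum l) (map-tabulate id f)) (go f)
    where
    go : ∀ {n} (f : Fin n → ℕ) → + NL.sum (List.tabulate f) ≡ ∑ (λ x → + f x)
    go {zero} f = sym (∑-zero {0} {λ x → + f x} (λ ()))
    go {suc n} f = trans (cong (λ z → + f fz + z) (go (f ∘ fs))) (sym (∑-suc (λ x → + f x)))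

  sumℤ-∑ : ∀ {n} (f : Fin n → ℤ) → sumℤ (List.map f (List.allFin n)) ≡ ∑ f
  sumℤ-∑ {n} f = trans (cong sumℤ (map-tabulate id f)) (go f)
    where
    go : ∀ {n} (f : Fin n → ℤ) → sumℤ (List.tabulate f) ≡ ∑ f
    go {zero} f = sym (∑-zero {0} {f} (λ ()))
    go {suc n} f = trans (cong (λ z → f fz + z) (go (f ∘ fs))) (sym (∑-suc f))

  if-𝟙 : ∀ {Q : Set} b (d : Dec Q) → (T b → Q) → (Q → T b) → + (if b then 1 else 0) ≡ 𝟙 d
  if-𝟙 true d f g = sym (𝟙-yes d (f tt))
  if-𝟙 false d f g = sym (𝟙-no d g)

  countB-count : ∀ {n} (P : Fin n → Bool) {Q : Fin n → Set} (Q? : ∀ x → Dec (Q x)) → (∀ x → T (P x) → Q x) → (∀ x → Q x → T (P x)) → + countB P ≡ count Q?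
  countB-count P Q? f g = trans (sum-∑ _) (∑-cong (λ x → if-𝟙 (P x) (Q? x) (f x) (g x)))

  any-tab : ∀ {n m} (g : Fin m → Fin n) (P : Fin n → Bool) → T (BL.any P (List.tabulate g)) → ∃ λ x → T (P (g x))
  any-tab {m = suc m} g P t with T∨ {P (g fz)} t
  ... | inj₁ q = fz , q
  ... | inj₂ q = let x , r = any-tab (g ∘ fs) P q in fs x , r

  any-upTo : ∀ n (P : ℕ → Bool) → T (BL.any P (List.upTo n)) → ∃ λ t → T (P t)
  any-upTo n = go n id
    where
    go : ∀ n (f : ℕ → ℕ) (P : ℕ → Bool) → T (BL.any P (List.applyUpTo f n)) → ∃ λ t → T (P t)
    go (suc n) f P t with T∨ {P (f 0)} t
    ... | inj₁ q = f 0 , q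
    ... | inj₂ q = go n (f ∘ suc) P q

  upTo-any : ∀ n (P : ℕ → Bool) t → t <ℕ n → T (P t) → T (BL.any P (List.upTo n))
  upTo-any n = go n id
    where
    go : ∀ n (f : ℕ → ℕ) (P : ℕ → Bool) t → t <ℕ n → T (P (f t)) → T (BL.any P (List.applyUpTo f n))
    go (suc n) f P zero l p = T∨ˡ p
    go (suc n) f P (suc t) (s≤s l) p = T∨ʳ {P (f 0)} (go n (f ∘ suc) P t l p)

T∧ : ∀ {a b} → T (a ∧ b) → T a × T b
T∧ {true} t = tt , t

∧T : ∀ {a b} → T a → T b → T (a ∧ b)
∧T {true} _ t = t

T-not : ∀ {a} → T (not a) → ¬ T a
T-not {false} _ ()

not-T : ∀ {a} → ¬ T a → T (not a)
not-T {false} _ = tt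
not-T {true} n = n tt

opaque
  all-tab : ∀ {n} (P : Fin n → Bool) → T (BL.all P (List.allFin n)) → ∀ x → T (P x)
  all-tab P = go id P
    where
    go : ∀ {n m} (g : Fin m → Fin n) (P : Fin n → Bool) → T (BL.all P (List.tabulate g)) → ∀ x → T (P (g x))
    go g P t fz = proj₁ (T∧ t)
    go g P t (fs x) = go (g ∘ fs) P (proj₂ (T∧ {P (g fz)} t)) x

  tab-all : ∀ {n} (P : Fin n → Bool) → (∀ x → T (P x)) → T (BL.all P (List.allFin n))
  tab-all P = go id P
    where
    go : ∀ {n m} (g : Fin m → Fin n) (P : Fin n → Bool) → (∀ x → T (P (g x))) → T (BL.all P (List.tabulate g))
    go {m = zero} g P t = tt
    go {m = suc m} g P t = ∧T (t fz) (go (g ∘ fs) P (t ∘ fs))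

module OrbitBridge {n} (P : Perm n) where
  open Perm P renaming (ap to p)
  open Orb P

  reach-sound : ∀ x y → T (reachB p x y) → x ~ y
  reach-sound x y t = let s , q = any-upTo n _ t in s , toWitness q

  reach-complete : ∀ x y → x ~ y → T (reachB p x y)
  reach-complete x y r = let t , l , e = Orbits.~-short P r in upTo-any n _ t l (fromWitness {a? = iter p t x ≟ y} e)

  min-sound : ∀ x → T (isOrbitMin p x) → Rep x
  min-sound x t = FP.toℕ-injective (NP.≤-antisym (rep-least x x ~-refl) (below (T∨ (all-tab _ t (rep x)))))
    where
    below : T (not (reachB p x (rep x))) ⊎ T (toℕ x Data.Nat.≤ᵇ toℕ (rep x)) → toℕ x ≤ toℕ (rep x)
    below (inj₁ q) = ⊥-elim (T-not q (reach-complete x (rep x) (rep-~ x)))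
    below (inj₂ q) = NP.≤ᵇ⇒≤ _ _ q

  min-complete : ∀ x → Rep x → T (isOrbitMin p x)
  min-complete x e = tab-all _ λ y → aux y (x ~? y)
    where
    aux : ∀ y → Dec (x ~ y) → T (not (reachB p x y) ∨ (toℕ x Data.Nat.≤ᵇ toℕ y))
    aux y (yes s) = T∨ʳ {not (reachB p x y)} (NP.≤⇒≤ᵇ (subst (λ z → toℕ z ≤ toℕ y) e (rep-least x y s)))
    aux y (no ns) = T∨ˡ (not-T (ns ∘ reach-sound x y))

  numOrbits-cls : + numOrbits p ≡ count Rep?
  numOrbits-cls = countB-count _ Rep? min-sound min-complete

  orbitSize-clsum : ∀ x → + orbitSize p x ≡ count (x ~?_)
  orbitSize-clsum x = countB-count _ (x ~?_) (reach-sound x) (reach-complete x)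

-- The outer contour is a simple cycle with `d` edges. Maps of girth and outer degree `d` provide
-- this, and so does the closure of a mobile, so that the counting below serves both directions.
record OuterData {n} (d : ℕ) (M : RMap n) : Set₁ where
  open RMap M
  field
    fpf : ∀ x → inv x ≢ x
    conn : Connected
    outer-inv : ∀ h → Outer h → ¬ Outer (inv h)
    outer-distinct : ∀ {x y} → Outer x → Outer y → x V.~ y → x ≡ y
    odeg : count Outer? ≡ + d

-- Inner vertices, edges and faces, their number and the flows on them

module Inner {n} (M : RMap n) where
  open RMap M

  OutV : Fin n → Set
  OutV h = ∃ λ o → Outer o × h V.~ o

  opaque
    OutV? : ∀ h → Dec (OutV h)
    OutV? h = any? (λ o → Outer? o ×-dec (h V.~? o))

  InV : Fin n → Set
  InV h = ¬ OutV h

  InV? : ∀ h → Dec (InV h)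
  InV? h = ¬? (OutV? h)

  InE : Fin n → Set
  InE h = ¬ Outer h × ¬ Outer (inv h)

  InE? : ∀ h → Dec (InE h)
  InE? h = ¬? (Outer? h) ×-dec ¬? (Outer? (inv h))

  InF : Fin n → Set
  InF h = ¬ Outer h

  InF? : ∀ h → Dec (InF h)
  InF? h = ¬? (Outer? h)

  OutV-~ : ∀ {x y} → x V.~ y → OutV x → OutV y
  OutV-~ s (o , out , r) = o , out , V.~-trans (V.~-sym s) r

  InV-~ : ∀ {x y} → x V.~ y → InV x → InV y
  InV-~ s i o = i (OutV-~ (V.~-sym s) o)

  InF-~ : ∀ {x y} → x F.~ y → InF x → InF y
  InF-~ s i o = i (F.~-trans o (F.~-sym s))

  InE-inv : ∀ {x} → InE x → InE (inv x)
  InE-inv {x} (a , b) = b , λ o → a (subst Outer (inv-inv x) o)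

  outer-next : ∀ h → Outer (inv h) → Outer (rt h)
  outer-next h o = subst Outer (cong rt (inv-inv h)) (F.~-trans o F.~-step)

  InV-InE : ∀ {h} → InV h → InE h
  InV-InE {h} i = (λ o → i (h , o , V.~-refl)) , λ o → i (rt h , outer-next h o , V.~-step)

-- Weights of a plane map: a on the half-edge leaving the vertex of a dart, b towards its face.
record Flow {n} (d : ℕ) (M : RMap n) : Set where
  open RMap M
  open Inner M
  field
    a b : Fin n → ℤ
    a≥0 : ∀ h → 0ℤ ≤ᶻ a h
    b≥0 : ∀ h → 0ℤ ≤ᶻ b h
    a-out : ∀ h → OutV h → a h ≡ 0ℤ
    b-out : ∀ h → ¬ InE h → b h ≡ 0ℤ
    at-vertex : ∀ h → InV h → V.clsum h a ≡ + d
    at-face : ∀ h → InF h → F.clsum h (λ y → 1ℤ - b y) ≡ + d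
    at-edge : ∀ h → InE h → a h + a (inv h) - (b h + b (inv h)) ≡ + d - + 2

module Counts {n d} (M : RMap n) (OD : OuterData d M) where
  open RMap M
  open Inner M
  open OuterData OD

  #outV : V.#cls OutV? ≡ + d
  #outV = ZP.≤-antisym
    (ZP.≤-trans (count-inj (λ x → V.Rep? x ×-dec OutV? x) Outer? (λ { x (_ , o , _) → o }) (λ { x (_ , _ , q , _) → q })
      (λ { x y (rx , _ , _ , s) (ry , _ , _ , s') refl → trans (sym rx) (trans (V.rep-cong (V.~-trans s (V.~-sym s'))) ry) })) (ZP.≤-reflexive odeg))
    (ZP.≤-trans (ZP.≤-reflexive (sym odeg)) (count-inj Outer? (λ x → V.Rep? x ×-dec OutV? x) (λ o _ → V.rep o) (λ o q → V.rep-idem o , o , q , V.~-sym (V.rep-~ o))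
      (λ o o' q q' e → outer-distinct q q' (V.rep-sound e))))

  #V : count V.Rep? ≡ V.#cls InV? + + d
  #V = trans (trans (∑-cong (λ x → trans (𝟙-split (V.Rep? x) (OutV? x)) (ZP.+-comm (𝟙 (V.Rep? x ×-dec OutV? x)) _))) (∑-+ _ (λ x → 𝟙 (V.Rep? x ×-dec OutV? x)))) (cong (λ z → V.#cls InV? + z) #outV)

  #F : count F.Rep? ≡ F.#cls InF? + 1ℤ
  #F = trans (trans (∑-cong (λ x → trans (𝟙-split (F.Rep? x) (Outer? x)) (ZP.+-comm (𝟙 (F.Rep? x ×-dec Outer? x)) _))) (∑-+ _ (λ x → 𝟙 (F.Rep? x ×-dec Outer? x))))
    (cong (λ z → F.#cls InF? + z) (count-unique (λ x → F.Rep? x ×-dec Outer? x) (F.rep root) (F.rep-idem root , F.rep-~ root) (λ { y (e , o) → trans (sym e) (sym (F.rep-cong o)) })))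

  #inF : count InF? + + d ≡ + n
  #inF = trans (cong (λ z → count InF? + z) (sym odeg)) (trans (sym (∑-+ _ (λ x → 𝟙 (Outer? x)))) (trans (∑-cong (λ x → aux (Outer? x))) (∑-one n)))
    where
    aux : ∀ {P : Set} (q : Dec P) → 𝟙 (¬? q) + 𝟙 q ≡ 1ℤ
    aux (yes _) = refl
    aux (no _) = refl

  #inE : count InE? + + 2 * + d ≡ + n
  #inE = trans (cong (λ z → count InE? + z) (trans (two (+ d)) (cong₂ _+_ (sym odeg) (trans (sym odeg) (sym (∑-perm inv inv inv-inv inv-inv (λ h → 𝟙 (Outer? h)))))))) 
    (trans (cong (λ z → count InE? + z) (sym (∑-+ _ _))) (trans (sym (∑-+ _ _)) (trans (∑-cong (λ h → aux (Outer? h) (Outer? (inv h)) (outer-inv h))) (∑-one n))))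
    where
    two : ∀ x → + 2 * x ≡ x + x
    two = solve-∀
    aux : ∀ {P Q : Set} (p : Dec P) (q : Dec Q) → (P → ¬ Q) → 𝟙 (¬? p ×-dec ¬? q) + (𝟙 p + 𝟙 q) ≡ 1ℤ
    aux (yes p) (yes q) x = ⊥-elim (x p q)
    aux (yes _) (no _) x = refl
    aux (no _) (yes _) x = refl
    aux (no _) (no _) x = refl

  private
    e₁ : ∀ v f D → + 2 * (v + D + (f + 1ℤ)) ≡ + 2 * (v + f) + (+ 2 * D + + 2)
    e₁ = solve-∀
    e₂ : ∀ c D → c + + 2 * D + + 4 ≡ c + + 2 + (+ 2 * D + + 2)
    e₂ = solve-∀
    cancel : ∀ {x y} z → x + z ≡ y + z → x ≡ y
    cancel {x} {y} z e = trans (sym (lem x z)) (trans (cong (_- z) e) (lem y z))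
      where
      lem : ∀ x z → x + z - z ≡ x
      lem = solve-∀

  -- Removing the outer cycle takes away `d` vertices, `d` edges and one face, so the Euler
  -- characteristic passes from 2 to 1.
  euler→ : + 2 * (count V.Rep? + count F.Rep?) ≡ + n + + 4 → + 2 * (V.#cls InV? + F.#cls InF?) ≡ count InE? + + 2
  euler→ e = cancel (+ 2 * + d + + 2) (trans (sym (e₁ (V.#cls InV?) (F.#cls InF?) (+ d))) (trans (cong₂ (λ x y → + 2 * (x + y)) (sym #V) (sym #F)) (trans e (trans (cong (_+ + 4) (sym #inE)) (e₂ (count InE?) (+ d))))))

  euler← : + 2 * (V.#cls InV? + F.#cls InF?) ≡ count InE? + + 2 → + 2 * (count V.Rep? + count F.Rep?) ≡ + n + + 4
  euler← e = trans (cong₂ (λ x y → + 2 * (x + y)) #V #F) (trans (e₁ (V.#cls InV?) (F.#cls InF?) (+ d)) (trans (cong (_+ (+ 2 * + d + + 2)) e) (trans (sym (e₂ (count InE?) (+ d))) (cong (_+ + 4) #inE))))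

-- Existence of a flow on a map of girth d

∑-++ : ∀ n {m} (f : Fin (n +ℕ m) → ℤ) → ∑ f ≡ ∑ (λ x → f (x ↑ˡ m)) + ∑ (λ x → f (n ↑ʳ x))
∑-++ zero f = sym (trans (cong (_+ ∑ f) (∑-zero {0} {λ x → f (x ↑ˡ _)} (λ ()))) (ZP.+-identityˡ _))
∑-++ (suc n) {m} f = trans (∑-suc f) (trans (cong (λ z → f fz + z) (∑-++ n (f ∘ fs))) (trans (sym (ZP.+-assoc (f fz) _ _)) (cong (_+ ∑ (λ x → f (suc n ↑ʳ x))) (sym (∑-suc (λ x → f (x ↑ˡ m)))))))

module Edges {n} (M : RMap n) (fpf : ∀ x → RMap.inv M x ≢ x) where
  open RMap M
  edge : Perm n
  edge = record { ap = inv ; ap⁻ = inv ; left = inv-inv ; right = inv-inv }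
  module E = Orb edge

  E-cases : ∀ {x y} → x E.~ y → x ≡ y ⊎ inv x ≡ y
  E-cases (zero , e) = inj₁ e
  E-cases {x} (suc t , refl) with E-cases (t , refl)
  ... | inj₁ e = inj₂ (cong inv e)
  ... | inj₂ e = inj₁ (trans (sym (inv-inv x)) (cong inv e))

  E-clsum : ∀ h f → E.clsum h f ≡ f h + f (inv h)
  E-clsum h f = trans (∑-cong (λ y → trans (cong (_* f y) (trans (𝟙-cong (h E.~? y) ((h ≟ y) ⊎-dec (inv h ≟ y)) E-cases (λ { (inj₁ refl) → E.~-refl ; (inj₂ refl) → E.~-step }))
      (sym (𝟙-⊎ (h ≟ y) (inv h ≟ y) (λ e e' → fpf h (trans e' (sym e))))))) (ZP.*-distribʳ-+ (f y) (𝟙 (h ≟ y)) (𝟙 (inv h ≟ y)))))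
    (trans (∑-+ (λ y → 𝟙 (h ≟ y) * f y) (λ y → 𝟙 (inv h ≟ y) * f y)) (cong₂ _+_ (∑-δ h f) (∑-δ (inv h) f)))

module FlowExists {n d} (P : PlaneMap n) (girth : HasGirth P d) (OD : OuterData d (raw P)) where
  M = raw P
  open RMap M
  open Inner M
  open OuterData OD
  open Edges M fpf

  N = n +ℕ (n +ℕ n)

  nV nE nF : Fin n → Fin N
  nV x = x ↑ˡ (n +ℕ n)
  nE x = n ↑ʳ (x ↑ˡ n)
  nF x = n ↑ʳ (n ↑ʳ x)

  kind : Fin N → Fin n ⊎ (Fin n ⊎ Fin n)
  kind k = Data.Sum.map₂ (splitAt n) (splitAt n k)

  kV : ∀ x → kind (nV x) ≡ inj₁ x
  kV x = cong (Data.Sum.map₂ (splitAt n)) (FP.splitAt-↑ˡ n x (n +ℕ n))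
  kE : ∀ x → kind (nE x) ≡ inj₂ (inj₁ x)
  kE x = trans (cong (Data.Sum.map₂ (splitAt n)) (FP.splitAt-↑ʳ n (n +ℕ n) (x ↑ˡ n))) (cong inj₂ (FP.splitAt-↑ˡ n x n))
  kF : ∀ x → kind (nF x) ≡ inj₂ (inj₂ x)
  kF x = trans (cong (Data.Sum.map₂ (splitAt n)) (FP.splitAt-↑ʳ n (n +ℕ n) (n ↑ʳ x))) (cong inj₂ (FP.splitAt-↑ʳ n n x))

  kdiff : ∀ {x y u v} → kind x ≡ u → kind y ≡ v → u ≢ v → x ≢ y
  kdiff p q ne refl = ne (trans (sym p) q)

  inV : ∀ {x y} → nV x ≡ nV y → x ≡ y
  inV = FP.↑ˡ-injective (n +ℕ n) _ _
  inE : ∀ {x y} → nE x ≡ nE y → x ≡ y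
  inE e = FP.↑ˡ-injective n _ _ (FP.↑ʳ-injective n _ _ e)
  inF : ∀ {x y} → nF x ≡ nF y → x ≡ y
  inF e = FP.↑ʳ-injective n _ _ (FP.↑ʳ-injective n _ _ e)

  -- Divergences read off from the rules of `Flow`: an inner vertex emits `d`, an inner edge retains
  -- `d - 2`, an inner face absorbs its degree minus `d`. Each class acts through its
  -- representative; every other node has demand 0.
  tV tE tF : Fin n → ℤ
  tV x = + d * 𝟙 (V.Rep? x ×-dec InV? x)
  tE x = - ((+ d - + 2) * 𝟙 (E.Rep? x ×-dec InE? x))
  tF x = - (𝟙 (F.Rep? x ×-dec InF? x) * (F.clsum x (λ _ → 1ℤ) - + d))

  tk : Fin n ⊎ (Fin n ⊎ Fin n) → ℤ
  tk (inj₁ x) = tV x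
  tk (inj₂ (inj₁ x)) = tE x
  tk (inj₂ (inj₂ x)) = tF x

  t : Fin N → ℤ
  t x = tk (kind x)

  -- The arc of `a h`, from vertex to edge; `arcB` carries `b h` from edge to face. A dart without
  -- such a weight gets a loop, which contributes nothing to any divergence.
  arcA : ∀ h → Dec (InV h) → Fin N × Fin N
  arcA h (yes _) = nV (V.rep h) , nE (E.rep h)
  arcA h (no _) = nV h , nV h

  arcB : ∀ h → Dec (InE h) → Fin N × Fin N
  arcB h (yes _) = nE (E.rep h) , nF (F.rep h)
  arcB h (no _) = nV h , nV h

  arc : Fin n ⊎ Fin n → Fin N × Fin N
  arc (inj₁ h) = arcA h (InV? h)
  arc (inj₂ h) = arcB h (InE? h)

  net : Network N (n +ℕ n)
  net = record { tl = λ k → proj₁ (arc (splitAt n k)) ; hd = λ k → proj₂ (arc (splitAt n k)) }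

  open Flows net t hiding (δ)

  δₐ : Fin N × Fin N → Fin N → ℤ
  δₐ p x = 𝟙 (proj₁ p ≟ x) - 𝟙 (proj₂ p ≟ x)

  div-split : ∀ g x → div g x ≡ ∑ (λ h → δₐ (arcA h (InV? h)) x * + g (h ↑ˡ n)) + ∑ (λ h → δₐ (arcB h (InE? h)) x * + g (n ↑ʳ h))
  div-split g x = trans (∑-++ n _) (cong₂ _+_ (∑-cong (λ h → cong (λ s → δₐ (arc s) x * + g (h ↑ˡ n)) (FP.splitAt-↑ˡ n h n))) (∑-cong (λ h → cong (λ s → δₐ (arc s) x * + g (n ↑ʳ h)) (FP.splitAt-↑ʳ n n h))))

  module _ (g : Fin (n +ℕ n) → ℕ) where
    a b : Fin n → ℤ
    a h = 𝟙 (InV? h) * + g (h ↑ˡ n)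
    b h = 𝟙 (InE? h) * + g (n ↑ʳ h)

    private
      sA : ∀ u w → (u - 0ℤ) * w ≡ u * (1ℤ * w)
      sA u w = cong₂ _*_ (ZP.+-identityʳ u) (sym (ZP.*-identityˡ w))
      sZ : ∀ u w → (u - u) * w ≡ 0ℤ
      sZ u w = cong (_* w) (ZP.+-inverseʳ u)
      sB : ∀ u w → (0ℤ - u) * w ≡ - (u * (1ℤ * w))
      sB = solve-∀

    div-V : ∀ x → V.Rep x → div g (nV x) ≡ V.clsum x a
    div-V x r = trans (div-split g (nV x)) (trans (cong₂ _+_ (∑-cong (λ h → rowA h (InV? h))) (∑-zero (λ h → rowB h (InE? h)))) (ZP.+-identityʳ _))
      where
      same : ∀ h → 𝟙 (nV (V.rep h) ≟ nV x) ≡ 𝟙 (x V.~? h)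
      same h = 𝟙-cong (nV (V.rep h) ≟ nV x) (x V.~? h) (λ e → V.~-sym (V.rep-sound (trans (inV e) (sym r)))) (λ s → cong nV (trans (sym (V.rep-cong s)) r))
      rowA : ∀ h (q : Dec (InV h)) → δₐ (arcA h q) (nV x) * + g (h ↑ˡ n) ≡ 𝟙 (x V.~? h) * (𝟙 q * + g (h ↑ˡ n))
      rowA h (yes q) = trans (cong₂ (λ u v → (u - v) * + g (h ↑ˡ n)) (same h) (𝟙-no (nE (E.rep h) ≟ nV x) (kdiff (kE _) (kV x) (λ ())))) (sA (𝟙 (x V.~? h)) (+ g (h ↑ˡ n)))
      rowA h (no q) = trans (sZ (𝟙 (nV h ≟ nV x)) _) (sym (ZP.*-zeroʳ (𝟙 (x V.~? h))))
      rowB : ∀ h (q : Dec (InE h)) → δₐ (arcB h q) (nV x) * + g (n ↑ʳ h) ≡ 0ℤ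
      rowB h (yes q) = cong₂ (λ u v → (u - v) * + g (n ↑ʳ h)) (𝟙-no (nE (E.rep h) ≟ nV x) (kdiff (kE _) (kV x) (λ ()))) (𝟙-no (nF (F.rep h) ≟ nV x) (kdiff (kF _) (kV x) (λ ())))
      rowB h (no q) = sZ (𝟙 (nV h ≟ nV x)) _

    div-E : ∀ x → E.Rep x → div g (nE x) ≡ - E.clsum x a + E.clsum x b
    div-E x r = trans (div-split g (nE x)) (cong₂ _+_ (trans (∑-cong (λ h → rowA h (InV? h))) (∑-neg _)) (∑-cong (λ h → rowB h (InE? h))))
      where
      same : ∀ h → 𝟙 (nE (E.rep h) ≟ nE x) ≡ 𝟙 (x E.~? h)
      same h = 𝟙-cong (nE (E.rep h) ≟ nE x) (x E.~? h) (λ e → E.~-sym (E.rep-sound (trans (inE e) (sym r)))) (λ s → cong nE (trans (sym (E.rep-cong s)) r))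
      rowA : ∀ h (q : Dec (InV h)) → δₐ (arcA h q) (nE x) * + g (h ↑ˡ n) ≡ - (𝟙 (x E.~? h) * (𝟙 q * + g (h ↑ˡ n)))
      rowA h (yes q) = trans (cong₂ (λ u v → (u - v) * + g (h ↑ˡ n)) (𝟙-no (nV (V.rep h) ≟ nE x) (kdiff (kV _) (kE x) (λ ()))) (same h)) (sB (𝟙 (x E.~? h)) (+ g (h ↑ˡ n)))
      rowA h (no q) = trans (sZ (𝟙 (nV h ≟ nE x)) _) (sym (cong -_ (ZP.*-zeroʳ (𝟙 (x E.~? h)))))
      rowB : ∀ h (q : Dec (InE h)) → δₐ (arcB h q) (nE x) * + g (n ↑ʳ h) ≡ 𝟙 (x E.~? h) * (𝟙 q * + g (n ↑ʳ h))
      rowB h (yes q) = trans (cong₂ (λ u v → (u - v) * + g (n ↑ʳ h)) (same h) (𝟙-no (nF (F.rep h) ≟ nE x) (kdiff (kF _) (kE x) (λ ())))) (sA (𝟙 (x E.~? h)) (+ g (n ↑ʳ h)))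
      rowB h (no q) = trans (sZ (𝟙 (nV h ≟ nE x)) _) (sym (ZP.*-zeroʳ (𝟙 (x E.~? h))))

    div-F : ∀ x → F.Rep x → div g (nF x) ≡ - F.clsum x b
    div-F x r = trans (div-split g (nF x)) (trans (cong₂ _+_ (∑-zero (λ h → rowA h (InV? h))) (trans (∑-cong (λ h → rowB h (InE? h))) (∑-neg _))) (ZP.+-identityˡ _))
      where
      same : ∀ h → 𝟙 (nF (F.rep h) ≟ nF x) ≡ 𝟙 (x F.~? h)
      same h = 𝟙-cong (nF (F.rep h) ≟ nF x) (x F.~? h) (λ e → F.~-sym (F.rep-sound (trans (inF e) (sym r)))) (λ s → cong nF (trans (sym (F.rep-cong s)) r))
      rowA : ∀ h (q : Dec (InV h)) → δₐ (arcA h q) (nF x) * + g (h ↑ˡ n) ≡ 0ℤ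
      rowA h (yes q) = cong₂ (λ u v → (u - v) * + g (h ↑ˡ n)) (𝟙-no (nV (V.rep h) ≟ nF x) (kdiff (kV _) (kF x) (λ ()))) (𝟙-no (nE (E.rep h) ≟ nF x) (kdiff (kE _) (kF x) (λ ())))
      rowA h (no q) = sZ (𝟙 (nV h ≟ nF x)) _
      rowB : ∀ h (q : Dec (InE h)) → δₐ (arcB h q) (nF x) * + g (n ↑ʳ h) ≡ - (𝟙 (x F.~? h) * (𝟙 q * + g (n ↑ʳ h)))
      rowB h (yes q) = trans (cong₂ (λ u v → (u - v) * + g (n ↑ʳ h)) (𝟙-no (nE (E.rep h) ≟ nF x) (kdiff (kE _) (kF x) (λ ()))) (same h)) (sB (𝟙 (x F.~? h)) (+ g (n ↑ʳ h)))
      rowB h (no q) = trans (sZ (𝟙 (nV h ≟ nF x)) _) (sym (cong -_ (ZP.*-zeroʳ (𝟙 (x F.~? h)))))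

    toFlow : (∀ x → div g x ≡ t x) → Flow d M
    toFlow eq = record
      { a = a ; b = b
      ; a≥0 = λ h → nn (InV? h) _ ; b≥0 = λ h → nn (InE? h) _
      ; a-out = λ h o → off (InV? h) (λ i → i o)
      ; b-out = λ h o → off (InE? h) o
      ; at-vertex = λ h i → trans (V.clsum-cong a (V.rep-~ h)) (trans (sym (div-V (V.rep h) (V.rep-idem h))) (trans (eq _) (trans (cong tk (kV (V.rep h)))
          (trans (cong (λ z → + d * z) (𝟙-yes (V.Rep? (V.rep h) ×-dec InV? (V.rep h)) (V.rep-idem h , InV-~ (V.rep-~ h) i))) (ZP.*-identityʳ (+ d))))))
      ; at-face = λ h i → fin h (trans (cong -_ (F.clsum-cong b (F.rep-~ h))) (trans (sym (div-F (F.rep h) (F.rep-idem h))) (trans (eq _) (trans (cong tk (kF (F.rep h)))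
          (cong -_ (trans (on (F.Rep? (F.rep h) ×-dec InF? (F.rep h)) (F.rep-idem h , InF-~ (F.rep-~ h) i)) (cong (_- + d) (sym (F.clsum-cong (λ _ → 1ℤ) (F.rep-~ h))))))))))
      ; at-edge = λ h i → edg (a h + a (inv h)) (b h + b (inv h)) (trans (cong₂ (λ u v → - u + v) (trans (sym (E-clsum h a)) (E.clsum-cong a (E.rep-~ h))) (trans (sym (E-clsum h b)) (E.clsum-cong b (E.rep-~ h))))
          (trans (sym (div-E (E.rep h) (E.rep-idem h))) (trans (eq _) (trans (cong tk (kE (E.rep h))) (cong (λ z → - ((+ d - + 2) * z)) (𝟙-yes (E.Rep? (E.rep h) ×-dec InE? (E.rep h)) (E.rep-idem h , IEr h i)))))))
      }
      where
      nn : ∀ {Q : Set} (q : Dec Q) k → 0ℤ ≤ᶻ 𝟙 q * + k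
      nn (yes _) k = subst (0ℤ ≤ᶻ_) (sym (ZP.*-identityˡ (+ k))) (+≤+ z≤n)
      nn (no _) k = ZP.≤-refl
      IEr : ∀ h → InE h → InE (E.rep h)
      IEr h i = case E-cases (E.rep-~ h) of λ { (inj₁ e) → subst InE e i ; (inj₂ e) → subst InE e (InE-inv i) }
      fin : ∀ h → - F.clsum h b ≡ - (F.clsum h (λ _ → 1ℤ) - + d) → F.clsum h (λ y → 1ℤ - b y) ≡ + d
      fin h e = trans (trans (∑-cong (λ y → lem (𝟙 (h F.~? y)) (b y))) (∑-sub (λ y → 𝟙 (h F.~? y) * 1ℤ) (λ y → 𝟙 (h F.~? y) * b y))) (trans (cong (λ z → F.clsum h (λ _ → 1ℤ) - z) (ZP.neg-injective e)) (lem₂ (F.clsum h (λ _ → 1ℤ)) (+ d)))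
        where
        lem : ∀ u v → u * (1ℤ - v) ≡ u * 1ℤ - u * v
        lem = solve-∀
        lem₂ : ∀ u v → u - (u - v) ≡ v
        lem₂ = solve-∀
      edg : ∀ u v → - u + v ≡ - ((+ d - + 2) * 1ℤ) → u - v ≡ + d - + 2
      edg u v e = trans (lem u v) (trans (cong -_ e) (lem₂ (+ d - + 2)))
        where
        lem : ∀ u v → u - v ≡ - (- u + v)
        lem = solve-∀
        lem₂ : ∀ u → - (- (u * 1ℤ)) ≡ u
        lem₂ = solve-∀

  module Cut {S : Fin N → Set} (S? : ∀ x → Dec (S x)) where
    Vs Es Fs : Fin n → Set
    Vs h = InV h × S (nV (V.rep h))
    Es h = InE h × S (nE (E.rep h))
    Fs h = InF h × S (nF (F.rep h))

    Vs? : ∀ h → Dec (Vs h)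
    Vs? h = InV? h ×-dec S? (nV (V.rep h))
    Es? : ∀ h → Dec (Es h)
    Es? h = InE? h ×-dec S? (nE (E.rep h))
    Fs? : ∀ h → Dec (Fs h)
    Fs? h = InF? h ×-dec S? (nF (F.rep h))

    Vs-~ : ∀ {x y} → x V.~ y → Vs x → Vs y
    Vs-~ s (i , q) = InV-~ s i , subst (S ∘ nV) (V.rep-cong s) q
    Fs-~ : ∀ {x y} → x F.~ y → Fs x → Fs y
    Fs-~ s (i , q) = InF-~ s i , subst (S ∘ nF) (F.rep-cong s) q
    Es-inv : ∀ {x} → Es x → Es (inv x)
    Es-inv (i , q) = InE-inv i , subst (S ∘ nE) (E.rep-cong E.~-step) q
    Es-~ : ∀ {x y} → x E.~ y → Es x → Es y
    Es-~ s e = case E-cases s of λ { (inj₁ q) → subst Es q e ; (inj₂ q) → subst Es q (Es-inv e) }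

    private
      move : ∀ {A B C D : Set} (p : Dec A) (r : Dec B) (i : Dec C) (q : Dec D) → (B → (A → D) × (D → A)) → 𝟙 p * 𝟙 (r ×-dec i) ≡ 𝟙 (r ×-dec (i ×-dec q))
      move p r i q f = trans (cong (λ z → 𝟙 p * z) (𝟙-× r i)) (trans (com (𝟙 p) (𝟙 r) (𝟙 i)) (trans (𝟙-*cong r (λ b → cong (λ z → 𝟙 i * z) (𝟙-cong p q (proj₁ (f b)) (proj₂ (f b))))) (sym (trans (𝟙-× r (i ×-dec q)) (cong (λ z → 𝟙 r * z) (𝟙-× i q))))))
        where
        com : ∀ p r i → p * (r * i) ≡ r * (i * p)
        com = solve-∀
      pull : ∀ p c r → p * (c * r) ≡ c * (p * r)
      pull = solve-∀
      pulln : ∀ p c r → p * - (c * r) ≡ - c * (p * r)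
      pulln = solve-∀
      pullf : ∀ p r c → p * - (r * c) ≡ - ((p * r) * c)
      pullf = solve-∀

    sumV : ∑ (λ x → 𝟙 (S? (nV x)) * t (nV x)) ≡ + d * V.#cls Vs?
    sumV = trans (∑-cong (λ x → trans (cong (λ z → 𝟙 (S? (nV x)) * tk z) (kV x)) (trans (pull (𝟙 (S? (nV x))) (+ d) (𝟙 (V.Rep? x ×-dec InV? x))) (cong (λ z → + d * z) (move (S? (nV x)) (V.Rep? x) (InV? x) (S? (nV (V.rep x))) (λ r → subst (S ∘ nV) (sym r) , subst (S ∘ nV) r)))))) (∑-* (+ d) _)

    sumE : + 2 * ∑ (λ x → 𝟙 (S? (nE x)) * t (nE x)) ≡ - (+ d - + 2) * count Es?
    sumE = trans (cong (λ z → + 2 * z) (trans (∑-cong (λ x → trans (cong (λ z → 𝟙 (S? (nE x)) * tk z) (kE x)) (trans (pulln (𝟙 (S? (nE x))) (+ d - + 2) (𝟙 (E.Rep? x ×-dec InE? x))) (cong (λ z → - (+ d - + 2) * z) (move (S? (nE x)) (E.Rep? x) (InE? x) (S? (nE (E.rep x))) (λ r → subst (S ∘ nE) (sym r) , subst (S ∘ nE) r)))))) (∑-* (- (+ d - + 2)) _)))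
      (trans (pull (+ 2) (- (+ d - + 2)) (E.#cls Es?)) (cong (λ z → - (+ d - + 2) * z) (sym pairs)))
      where
      pairs : count Es? ≡ + 2 * E.#cls Es?
      pairs = trans (∑-cong (λ x → sym (ZP.*-identityʳ (𝟙 (Es? x))))) (E.∑-const Es? Es-~ (λ _ → 1ℤ) (+ 2) (λ x _ → E-clsum x (λ _ → 1ℤ)))

    sumF : ∑ (λ x → 𝟙 (S? (nF x)) * t (nF x)) ≡ - (count Fs? - + d * F.#cls Fs?)
    sumF = trans (∑-cong (λ x → trans (cong (λ z → 𝟙 (S? (nF x)) * tk z) (kF x)) (trans (pullf (𝟙 (S? (nF x))) (𝟙 (F.Rep? x ×-dec InF? x)) (F.clsum x (λ _ → 1ℤ) - + d)) (cong (λ z → - (z * (F.clsum x (λ _ → 1ℤ) - + d))) (move (S? (nF x)) (F.Rep? x) (InF? x) (S? (nF (F.rep x))) (λ r → subst (S ∘ nF) (sym r) , subst (S ∘ nF) r))))))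
      (trans (∑-neg _) (cong -_ (trans (∑-cong (λ x → dist (𝟙 (F.Rep? x ×-dec Fs? x)) (F.clsum x (λ _ → 1ℤ)) (+ d))) (trans (∑-sub _ (λ x → + d * 𝟙 (F.Rep? x ×-dec Fs? x))) (cong₂ _-_ (sym degs) (∑-* (+ d) _))))))
      where
      dist : ∀ u v w → u * (v - w) ≡ u * v - w * u
      dist = solve-∀
      degs : count Fs? ≡ ∑ (λ x → 𝟙 (F.Rep? x ×-dec Fs? x) * F.clsum x (λ _ → 1ℤ))
      degs = trans (F.∑-classes (λ x → 𝟙 (Fs? x))) (∑-cong (λ r → trans (cong (λ z → 𝟙 (F.Rep? r) * z) (trans (∑-cong (λ x → trans (𝟙-*cong (r F.~? x) (λ s → 𝟙-cong (Fs? x) (Fs? r) (Fs-~ (F.~-sym s)) (Fs-~ s))) (pull₁ (𝟙 (r F.~? x)) (𝟙 (Fs? r))))) (∑-* (𝟙 (Fs? r)) _)))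
          (trans (sym (ZP.*-assoc (𝟙 (F.Rep? r)) (𝟙 (Fs? r)) _)) (cong (_* F.clsum r (λ _ → 1ℤ)) (sym (𝟙-× (F.Rep? r) (Fs? r)))))))
        where
        pull₁ : ∀ p q → p * q ≡ q * (p * 1ℤ)
        pull₁ = solve-∀

    total : + 2 * ∑ (λ x → 𝟙 (S? x) * t x) ≡ + d * (+ 2 * (V.#cls Vs? + F.#cls Fs?)) - (+ d - + 2) * count Es? - + 2 * count Fs?
    total = trans (cong (λ z → + 2 * z) (trans (∑-++ n _) (cong (λ z → ∑ (λ x → 𝟙 (S? (nV x)) * t (nV x)) + z) (∑-++ n _))))
      (trans (e₁ (∑ (λ x → 𝟙 (S? (nV x)) * t (nV x))) (∑ (λ x → 𝟙 (S? (nE x)) * t (nE x))) (∑ (λ x → 𝟙 (S? (nF x)) * t (nF x)))) (trans (cong₂ _+_ (cong₂ (λ u v → + 2 * u + v) sumV sumE) (cong (λ z → + 2 * z) sumF)) (e₂ (+ d) (V.#cls Vs?) (F.#cls Fs?) (count Es?) (count Fs?))))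
      where
      e₁ : ∀ u v w → + 2 * (u + (v + w)) ≡ + 2 * u + + 2 * v + + 2 * w
      e₁ = solve-∀
      e₂ : ∀ D v f e c → + 2 * (D * v) + - (D - + 2) * e + + 2 * - (c - D * f) ≡ D * (+ 2 * (v + f)) - (D - + 2) * e - + 2 * c
      e₂ = solve-∀

  half-≤ : ∀ {x} → + 2 * x ≤ᶻ 0ℤ → x ≤ᶻ 0ℤ
  half-≤ {x} = ZP.*-cancelˡ-≤-pos x 0ℤ (+ 2)

  nonfull : ∀ {A : Fin n → Set} (A? : ∀ h → Dec (A h)) → (∀ {x y} → x F.~ y → A x → A y) → ∀ {h} → A h → ¬ A root → ∃ λ x → A x × ¬ A (inv x)
  nonfull {A} A? A-~ ah nr with any? (λ x → A? x ×-dec ¬? (A? (inv x)))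
  ... | yes r = r
  ... | no none = ⊥-elim (nr (conn A (λ x q → subst A (cong rt (inv-inv x)) (A-~ F.~-step (cross x q))) cross ah root))
    where
    cross : ∀ x → A x → A (inv x)
    cross x q with A? (inv x)
    ... | yes r = r
    ... | no r = ⊥-elim (none (x , q , r))

  arcA-yes : ∀ h (q : Dec (InV h)) → InV h → arcA h q ≡ (nV (V.rep h) , nE (E.rep h))
  arcA-yes h (yes _) i = refl
  arcA-yes h (no q) i = ⊥-elim (q i)

  arcB-yes : ∀ h (q : Dec (InE h)) → InE h → arcB h q ≡ (nE (E.rep h) , nF (F.rep h))
  arcB-yes h (yes _) i = refl
  arcB-yes h (no q) i = ⊥-elim (q i)

  arcL : ∀ h → InV h → arc (splitAt n (h ↑ˡ n)) ≡ (nV (V.rep h) , nE (E.rep h))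
  arcL h i = trans (cong arc (FP.splitAt-↑ˡ n h n)) (arcA-yes h (InV? h) i)

  arcR : ∀ h → InE h → arc (splitAt n (n ↑ʳ h)) ≡ (nE (E.rep h) , nF (F.rep h))
  arcR h i = trans (cong arc (FP.splitAt-↑ʳ n n h)) (arcB-yes h (InE? h) i)

  -- Arcs run from vertices to edges to faces, so a closed set is an open region. With `e` darts on
  -- its edges and `c` in its faces, `euler-≤` bounds twice its total demand by `d (e + 2) - (d - 2)
  -- e - 2 c = 2 (d + e - c)`. The `c - e` darts of its faces off its edges include the boundary
  -- darts, at least `d` in number by the girth.
  demand : Demand
  demand x₀ {S} S? sx closed reach = half-≤ (subst (_≤ᶻ 0ℤ) (sym total) bound)
    where
    open Cut S?
    VE : ∀ {h} → Vs h → Es h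
    VE {h} (i , s) = InV-InE i , subst S (cong proj₂ (arcL h i)) (closed (h ↑ˡ n) (subst S (sym (cong proj₁ (arcL h i))) s))
    EF : ∀ {h} → Es h → Fs h
    EF {h} (i , s) = proj₁ i , subst S (cong proj₂ (arcR h i)) (closed (n ↑ʳ h) (subst S (sym (cong proj₁ (arcR h i))) s))
    emptyc : ∀ {Q : Fin n → Set} (Q? : ∀ x → Dec (Q x)) → (∀ x → ¬ Q x) → count Q? ≡ 0ℤ
    emptyc Q? f = ∑-zero (λ x → 𝟙-no (Q? x) (f x))

    module _ (h₀ : Fin n) (f₀ : Fs h₀) where
      lift : (Fin n → Set) → Fin n ⊎ (Fin n ⊎ Fin n) → Set
      lift Q (inj₁ x) = Q x
      lift Q (inj₂ (inj₁ x)) = Q x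
      lift Q (inj₂ (inj₂ x)) = Q x

      -- Paths of the network may pass through vertices, but all edges around a vertex of the region
      -- belong to it, so turning around the vertex amounts to crossing these edges from face to
      -- face.
      Fconn : (Q : Fin n → Set) → (∀ {x y} → x F.~ y → Q x → Q y) → (∀ {x} → Es x → Q x → Q (inv x)) → Q h₀ → ∀ h → Fs h → Q h
      Fconn Q cf ce q₀ h f = cf (F.~-sym (F.rep-~ h)) (subst (lift Q) (kF _) (proj₁ (equi (nF (F.rep h)) (proj₂ f)) (proj₂ (equi (nF (F.rep h₀)) (proj₂ f₀)) (subst (lift Q) (sym (kF _)) (cf (F.rep-~ h₀) q₀)))))
        where
        L : Fin N → Set
        L x = lift Q (kind x)
        -- The given connectedness starts at `x₀`, which need not be the node of the face of `h₀`;
        -- equivalence with the value at `x₀` links any two nodes.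
        Equi : Fin N → Set
        Equi y = (L x₀ → L y) × (L y → L x₀)
        vert : ∀ {x y} → x V.~ y → Vs x → Q x → Q y
        vert s v q = proj₂ (V.closed-~ {λ z → Vs z × Q z} (λ { z (v , q) → Vs-~ V.~-step v , subst Q (cong rt (inv-inv z)) (cf (F.~-step {inv z}) (ce (VE v) q)) }) s (v , q))
        edg : ∀ {x y} → x E.~ y → Es x → Q x → Q y
        edg s e q = case E-cases s of λ { (inj₁ r) → subst Q r q ; (inj₂ r) → subst Q r (ce e q) }
        stepA : ∀ h (q : Dec (InV h)) → S (proj₁ (arcA h q)) → (L (proj₁ (arcA h q)) → L (proj₂ (arcA h q))) × (L (proj₂ (arcA h q)) → L (proj₁ (arcA h q)))
        stepA h (no _) s = id , id
        stepA h (yes i) s =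
            (λ l → subst (lift Q) (sym (kE _)) (edg (E.rep-~ h) (VE (i , s)) (vert (V.~-sym (V.rep-~ h)) (Vs-~ (V.rep-~ h) (i , s)) (subst (lift Q) (kV _) l))))
          , (λ l → subst (lift Q) (sym (kV _)) (vert (V.rep-~ h) (i , s) (edg (E.~-sym (E.rep-~ h)) (Es-~ (E.rep-~ h) (VE (i , s))) (subst (lift Q) (kE _) l))))
        stepB : ∀ h (q : Dec (InE h)) → S (proj₁ (arcB h q)) → (L (proj₁ (arcB h q)) → L (proj₂ (arcB h q))) × (L (proj₂ (arcB h q)) → L (proj₁ (arcB h q)))
        stepB h (no _) s = id , id
        stepB h (yes i) s =
            (λ l → subst (lift Q) (sym (kF _)) (cf (F.rep-~ h) (edg (E.~-sym (E.rep-~ h)) (Es-~ (E.rep-~ h) (i , s)) (subst (lift Q) (kE _) l))))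
          , (λ l → subst (lift Q) (sym (kE _)) (edg (E.rep-~ h) (i , s) (cf (F.~-sym (F.rep-~ h)) (subst (lift Q) (kF _) l))))
        stepArc : ∀ k → S (proj₁ (arc k)) → (L (proj₁ (arc k)) → L (proj₂ (arc k))) × (L (proj₂ (arc k)) → L (proj₁ (arc k)))
        stepArc (inj₁ h) = stepA h (InV? h)
        stepArc (inj₂ h) = stepB h (InE? h)
        equi : ∀ y → S y → Equi y
        equi = reach Equi (id , id) (λ k st sh → let f , g = stepArc (splitAt n k) st in
          (λ { (u , v) → f ∘ u , v ∘ g }) , (λ { (u , v) → g ∘ u , v ∘ f }))

      euler : + 2 * (V.#cls Vs? + F.#cls Fs?) ≤ᶻ count Es? + + 2
      euler = OpenRegion.euler-≤ M conn Vs? Es? Fs? Vs-~ Es-inv Fs-~ VE h₀ root (λ v → proj₁ v (root , F.~-refl , V.~-refl)) Fconn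

      border : count Es? + + d ≤ᶻ count Fs?
      border = ZP.≤-trans (ZP.+-monoʳ-≤ (count Es?) (Boundary.bd-count P Fs? Fs-~ girth (proj₂ (nonfull Fs? Fs-~ f₀ (λ f → proj₁ f F.~-refl)))))
        (ZP.≤-trans (ZP.≤-reflexive (trans (sym (∑-+ _ _)) (∑-cong (λ h → 𝟙-⊎ (Es? h) (Boundary.Bd? P Fs? Fs-~ h) (λ e b → proj₂ b (EF (Es-inv e)))))))
          (count-mono (λ h → Es? h ⊎-dec Boundary.Bd? P Fs? Fs-~ h) Fs? (λ { h (inj₁ e) → EF e ; h (inj₂ b) → proj₁ b })))

      ineq : ∀ D {x e c} → 0ℤ ≤ᶻ D → x ≤ᶻ e + + 2 → e + D ≤ᶻ c → D * x - (D - + 2) * e - + 2 * c ≤ᶻ 0ℤ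
      ineq D@(+ k) {x} {e} {c} (+≤+ z≤n) p q = ZP.≤-trans (ZP.+-mono-≤ (ZP.+-monoˡ-≤ (- ((D - + 2) * e)) (ZP.*-monoˡ-≤-nonNeg D p)) (ZP.neg-mono-≤ (ZP.*-monoˡ-≤-nonNeg (+ 2) q)))
        (ZP.≤-reflexive (alg D e))
        where
        alg : ∀ D e → D * (e + + 2) - (D - + 2) * e + - (+ 2 * (e + D)) ≡ 0ℤ
        alg = solve-∀

    bound : + d * (+ 2 * (V.#cls Vs? + F.#cls Fs?)) - (+ d - + 2) * count Es? - + 2 * count Fs? ≤ᶻ 0ℤ
    bound with any? Fs?
    ... | yes (h₀ , f₀) = ineq h₀ f₀ (+ d) (+≤+ z≤n) (euler h₀ f₀) (border h₀ f₀)
    ... | no none = ZP.≤-reflexive (trans (cong₂ (λ u v → + d * (+ 2 * (u + v)) - (+ d - + 2) * count Es? - + 2 * count Fs?)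
            (emptyc (λ x → V.Rep? x ×-dec Vs? x) (λ x v → none (x , EF (VE (proj₂ v))))) (emptyc (λ x → F.Rep? x ×-dec Fs? x) (λ x f → none (x , proj₂ f))))
          (trans (cong₂ (λ u v → + d * 0ℤ - (+ d - + 2) * u - + 2 * v) (emptyc Es? (λ x e → none (x , EF e))) (emptyc Fs? (λ x f → none (x , f)))) (alg (+ d))))
      where
      alg : ∀ D → D * 0ℤ - (D - + 2) * 0ℤ - + 2 * 0ℤ ≡ 0ℤ
      alg = solve-∀

  -- The estimate of `demand` becomes an equality for the whole inner part, by the exact Euler
  -- relation and because inner faces have `d` more darts than inner edges.
  balanced : + 2 * (V.#cls InV? + F.#cls InF?) ≡ count InE? + + 2 → ∑ t ≡ 0ℤ
  balanced eu = twice (trans (cong (λ z → + 2 * z) (∑-cong (λ x → sym (ZP.*-identityˡ (t x))))) (trans total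
      (trans (cong₂ (λ u v → + d * (+ 2 * u) - (+ d - + 2) * count Es? - + 2 * v) (cong₂ _+_ (count-cong (λ x → V.Rep? x ×-dec Vs? x) (λ x → V.Rep? x ×-dec InV? x) (λ { _ (r , i , _) → r , i }) (λ { _ (r , i) → r , i , tt })) (count-cong (λ x → F.Rep? x ×-dec Fs? x) (λ x → F.Rep? x ×-dec InF? x) (λ { _ (r , i , _) → r , i }) (λ { _ (r , i) → r , i , tt }))) (count-cong Fs? InF? (λ _ → proj₁) (λ _ i → i , tt)))
      (trans (cong₂ (λ u v → + d * u - (+ d - + 2) * v - + 2 * count InF?) eu (count-cong Es? InE? (λ _ → proj₁) (λ _ i → i , tt)))
        (alg (+ d) (count InE?) (count InF?) (trans (inFE (count InF?) (+ d)) (cong (_- + d) (trans (Counts.#inF M OD) (sym (Counts.#inE M OD))))))))))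
    where
    open Cut {λ _ → ⊤} (λ _ → yes tt)
    inFE : ∀ f D → f ≡ f + D - D
    inFE = solve-∀
    alg : ∀ D e f → f ≡ e + + 2 * D - D → D * (e + + 2) - (D - + 2) * e - + 2 * f ≡ 0ℤ
    alg D e f refl = lem D e
      where
      lem : ∀ D e → D * (e + + 2) - (D - + 2) * e - + 2 * (e + + 2 * D - D) ≡ 0ℤ
      lem = solve-∀
    twice : ∀ {x} → + 2 * x ≡ 0ℤ → x ≡ 0ℤ
    twice {x} e = ZP.*-cancelˡ-≡ (+ 2) x 0ℤ e

  flow : + 2 * (V.#cls InV? + F.#cls InF?) ≡ count InE? + + 2 → Flow d M
  flow eu = let g , e = hoffman demand (balanced eu) in toFlow g e

-- Pushing a flow to the one whose darts all reach the outer face by tight moves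

record AccFlow {n} (d : ℕ) (M : RMap n) : Set₁ where
  open RMap M
  field
    flow : Flow d M
  open Flow flow public
  field
    -- Accessibility as an induction principle: a nonempty set stable under tight moves cannot avoid
    -- the outer face.
    acc : (Q : Fin n → Set) → (∀ h → ¬ Outer h → a h ≡ 0ℤ → Q h → Q (rt h)) → (∀ h → ¬ Outer h → b h ≡ 0ℤ → Q h → Q (fc h)) →
      ∀ h → Q h → ∃ λ o → Outer o × Q o
    complementary : ∀ h → ¬ Outer h → a h ≡ 0ℤ ⊎ b h ≡ 0ℤ

module Push {n d} (M : RMap n) (OD : OuterData d M) where
  open RMap M
  open Inner M
  open OuterData OD

  pos-of : ∀ {x} → 0ℤ ≤ᶻ x → x ≢ 0ℤ → 1ℤ ≤ᶻ x
  pos-of {+ zero} _ ne = ⊥-elim (ne refl)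
  pos-of {+ suc k} _ ne = +≤+ (s≤s z≤n)

  module Tight (f : Flow d M) where
    open Flow f

    -- Reversed, from the target of a tight move to its source, since the search starts on the outer
    -- face.
    Move : Fin n → Fin n → Set
    Move x y = ¬ Outer y × ((a y ≡ 0ℤ × rt y ≡ x) ⊎ (b y ≡ 0ℤ × fc y ≡ x))

    tight : Start n
    tight = record { E = Move ; E? = λ x y → ¬? (Outer? y) ×-dec (((a y ZP.≟ 0ℤ) ×-dec (rt y ≟ x)) ⊎-dec ((b y ZP.≟ 0ℤ) ×-dec (fc y ≟ x))) ; I = Outer ; I? = Outer? }

    module R = Reach tight

    via-rt : ∀ {h} → a h ≡ 0ℤ → R.In (rt h) → R.In h
    via-rt {h} e i with Outer? h
    ... | yes o = R.In-I o
    ... | no no' = R.In-E i (no' , inj₁ (e , refl))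

    via-fc : ∀ {h} → b h ≡ 0ℤ → R.In (fc h) → R.In h
    via-fc {h} e i with Outer? h
    ... | yes o = R.In-I o
    ... | no no' = R.In-E i (no' , inj₂ (e , refl))

    outV-in : ∀ {h} → OutV h → R.In h
    outV-in {h} (o , out , t , e) = go t h (o , out , t , e) e
      where
      go : ∀ t h → OutV h → iter rt t h ≡ o → R.In h
      go zero h v refl = R.In-I out
      go (suc t) h v e = via-rt (a-out h v) (go t (rt h) (OutV-~ V.~-step v) (trans (iter-suc rt t h) e))

    p : Fin n → ℤ
    p h = 𝟙 (¬? (R.In? h))

    p-in : ∀ {h} → R.In h → p h ≡ 0ℤ
    p-in {h} i = 𝟙-no (¬? (R.In? h)) (λ q → q i)

    private
      cong-flip : ∀ h → p (fc (inv h)) ≡ p (rt h)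
      cong-flip h = cong (p ∘ rt) (inv-inv h)

    step≥0 : ∀ {A B : Set} (x : ℤ) (q : Dec A) (r : Dec B) → 0ℤ ≤ᶻ x → (x ≡ 0ℤ → B → A) → 0ℤ ≤ᶻ x + (𝟙 (¬? r) - 𝟙 (¬? q))
    step≥0 x (yes _) (yes _) nn f = subst (0ℤ ≤ᶻ_) (sym (ZP.+-identityʳ x)) nn
    step≥0 x (yes _) (no _) nn f = ZP.≤-trans nn (ZP.≤-trans (ZP.≤-reflexive (sym (ZP.+-identityʳ x))) (ZP.+-monoʳ-≤ x (+≤+ z≤n)))
    step≥0 x (no _) (no _) nn f = subst (0ℤ ≤ᶻ_) (sym (ZP.+-identityʳ x)) nn
    step≥0 x (no na) (yes b) nn f = ZP.≤-trans (ZP.≤-reflexive refl) (ZP.+-monoˡ-≤ (- 1ℤ) (pos-of nn (λ e → na (f e b))))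

    private
      zero-diff : ∀ {x u v} → u ≡ 0ℤ → v ≡ 0ℤ → x ≡ 0ℤ → x + (u - v) ≡ 0ℤ
      zero-diff refl refl refl = refl
      tele : ∀ u v w x → u * (v + (w - x)) ≡ u * v + (u * w - u * x)
      tele = solve-∀
      tele' : ∀ u v w x → u * (1ℤ - (v + (w - x))) ≡ u * (1ℤ - v) - (u * w - u * x)
      tele' = solve-∀
      edge-alg : ∀ a a' b b' x y z w → (a + (x - z)) + (a' + (y - w)) - ((b + (y - z)) + (b' + (x - w))) ≡ a + a' - (b + b')
      edge-alg = solve-∀

    -- Adds the gradient of the indicator `p` of the darts that cannot reach the outer face. It
    -- telescopes around vertices and faces and cancels on each edge, as `rt h` is `fc (inv h)`. A
    -- weight decreases only on a move from outside the reached set into it; such a move is not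
    -- tight, so the weight is at least 1.
    pushed : Flow d M
    pushed = record
      { a = λ h → a h + (p (rt h) - p h) ; b = λ h → b h + (p (fc h) - p h)
      ; a≥0 = λ h → step≥0 (a h) (R.In? h) (R.In? (rt h)) (a≥0 h) via-rt
      ; b≥0 = λ h → step≥0 (b h) (R.In? h) (R.In? (fc h)) (b≥0 h) via-fc
      ; a-out = λ h v → zero-diff (p-in (outV-in (OutV-~ V.~-step v))) (p-in (outV-in v)) (a-out h v)
      ; b-out = λ h ne → bo h ne (Outer? h) (Outer? (inv h))
      ; at-vertex = λ h i → trans (∑-cong (λ y → tele (𝟙 (h V.~? y)) (a y) (p (rt y)) (p y))) (trans (∑-+ _ _) (trans (cong₂ _+_ (at-vertex h i) (trans (∑-sub (λ y → 𝟙 (h V.~? y) * p (rt y)) (λ y → 𝟙 (h V.~? y) * p y)) (trans (cong (_- V.clsum h p) (V.clsum-shift h p)) (ZP.+-inverseʳ (V.clsum h p))))) (ZP.+-identityʳ (+ d))))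
      ; at-face = λ h i → trans (∑-cong (λ y → tele' (𝟙 (h F.~? y)) (b y) (p (fc y)) (p y))) (trans (∑-sub _ _) (trans (cong₂ _-_ (at-face h i) (trans (∑-sub (λ y → 𝟙 (h F.~? y) * p (fc y)) (λ y → 𝟙 (h F.~? y) * p y)) (trans (cong (_- F.clsum h p) (F.clsum-shift h p)) (ZP.+-inverseʳ (F.clsum h p))))) (ZP.+-identityʳ (+ d))))
      ; at-edge = λ h i → trans (cong (λ z → (a h + (p (rt h) - p h)) + (a (inv h) + (p (fc h) - p (inv h))) - ((b h + (p (fc h) - p h)) + (b (inv h) + (z - p (inv h))))) (cong-flip h))
          (trans (edge-alg (a h) (a (inv h)) (b h) (b (inv h)) (p (rt h)) (p (fc h)) (p h) (p (inv h))) (at-edge h i))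
      }
      where
      bo : ∀ h → ¬ InE h → Dec (Outer h) → Dec (Outer (inv h)) → b h + (p (fc h) - p h) ≡ 0ℤ
      bo h ne (yes o) _ = zero-diff (p-in (R.In-I (F.~-trans o F.~-step))) (p-in (R.In-I o)) (b-out h ne)
      bo h ne (no no') (yes o) = zero-diff (p-in (outV-in (inv h , o , V.~-back))) (p-in (outV-in (rt h , outer-next h o , V.~-step))) (b-out h ne)
      bo h ne (no x) (no y) = ⊥-elim (ne (x , y))

    done : (∀ h → R.In h) → AccFlow d M
    done all = record { flow = f ; acc = λ Q qa qb h q → walk Q qa qb _ h q NP.≤-refl ; complementary = comp }
      where
      walk : (Q : Fin n → Set) → (∀ h → ¬ Outer h → a h ≡ 0ℤ → Q h → Q (rt h)) → (∀ h → ¬ Outer h → b h ≡ 0ℤ → Q h → Q (fc h)) → ∀ k h → Q h → R.rk h <ℕ k → ∃ λ o → Outer o × Q o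
      walk Q qa qb (suc k) h q l with R.parent (all h)
      ... | inj₁ o = h , o , q
      ... | inj₂ (x , _ , (no' , inj₁ (e , refl)) , lt) = walk Q qa qb k x (qa h no' e q) (NP.≤-trans lt (NP.≤-pred l))
      ... | inj₂ (x , _ , (no' , inj₂ (e , refl)) , lt) = walk Q qa qb k x (qb h no' e q) (NP.≤-trans lt (NP.≤-pred l))
      comp : ∀ h → ¬ Outer h → a h ≡ 0ℤ ⊎ b h ≡ 0ℤ
      comp h no' with R.parent (all h)
      ... | inj₁ o = ⊥-elim (no' o)
      ... | inj₂ (x , _ , (_ , inj₁ (e , _)) , _) = inj₁ e
      ... | inj₂ (x , _ , (_ , inj₂ (e , _)) , _) = inj₂ e

  moves : Start n
  moves = record { E = λ x y → (rt y ≡ x) ⊎ (fc y ≡ x) ; E? = λ x y → (rt y ≟ x) ⊎-dec (fc y ≟ x) ; I = Outer ; I? = Outer? }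
  module B = Reach moves

  all-moves : ∀ h → B.In h
  all-moves = conn B.In fwd cross (B.In-I F.~-refl)
    where
    peel : ∀ t y → B.In (iter rt t y) → B.In y
    peel zero y i = i
    peel (suc t) y i = peel t y (B.In-E i (inj₁ refl))
    fwd : ∀ h → B.In h → B.In (rt h)
    fwd h i = let t , e = V.~-back {h} in peel t (rt h) (subst B.In (sym e) i)
    cross : ∀ h → B.In h → B.In (inv h)
    cross h i = B.In-E (fwd h i) (inj₂ (cong rt (inv-inv h)))

  -- the accumulated potential p is bounded because a and b stay nonnegative
  module Loop (f₀ : Flow d M) where
    module f₀ = Flow f₀
    big : ℤ
    big = ∑ f₀.a + ∑ f₀.b

    member : ∀ (g : Fin n → ℤ) → (∀ x → 0ℤ ≤ᶻ g x) → ∀ x → g x ≤ᶻ ∑ g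
    member g nn x = subst (_≤ᶻ ∑ g) (∑-δ x g) (∑-mono (λ y → ZP.≤-trans (ZP.≤-reflexive (ZP.*-comm (𝟙 (x ≟ y)) (g y))) (aux y (x ≟ y))))
      where
      aux : ∀ y (q : Dec (x ≡ y)) → g y * 𝟙 q ≤ᶻ g y
      aux y (yes _) = ZP.≤-reflexive (ZP.*-identityʳ (g y))
      aux y (no _) = subst (_≤ᶻ g y) (sym (ZP.*-zeroʳ (g y))) (nn y)

    big≥a : ∀ h → f₀.a h ≤ᶻ big
    big≥a h = ZP.≤-trans (member f₀.a f₀.a≥0 h) (ZP.≤-trans (ZP.≤-reflexive (sym (ZP.+-identityʳ _))) (ZP.+-monoʳ-≤ (∑ f₀.a) (∑-nonneg f₀.b≥0)))
    big≥b : ∀ h → f₀.b h ≤ᶻ big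
    big≥b h = ZP.≤-trans (member f₀.b f₀.b≥0 h) (ZP.≤-trans (ZP.≤-reflexive (sym (ZP.+-identityˡ _))) (ZP.+-monoˡ-≤ (∑ f₀.b) (∑-nonneg f₀.a≥0)))
    big≥0 : 0ℤ ≤ᶻ big
    big≥0 = ZP.≤-trans (f₀.a≥0 root) (big≥a root)

    record St : Set where
      field
        f : Flow d M
        pot : Fin n → ℤ
        out : ∀ h → Outer h → pot h ≡ 0ℤ
        is-a : ∀ h → Flow.a f h ≡ f₀.a h + (pot (rt h) - pot h)
        is-b : ∀ h → Flow.b f h ≡ f₀.b h + (pot (fc h) - pot h)

    bd : ℕ
    bd = B.State.bound B.final

    cap : ℤ
    cap = + bd * big

    module _ (s : St) where
      open St s
      drop : ∀ {u v w x} → 0ℤ ≤ᶻ x → x ≡ u + (v - w) → w ≤ᶻ u + v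
      drop {u} {v} {w} {x} nn e = ZP.≤-trans (ZP.≤-reflexive (sym (ZP.+-identityˡ w))) (ZP.≤-trans (ZP.+-monoˡ-≤ w nn) (ZP.≤-reflexive (trans (cong (_+ w) e) (alg u v w))))
        where
        alg : ∀ u v w → u + (v - w) + w ≡ u + v
        alg = solve-∀
      pot-rank : ∀ k h → B.rk h <ℕ k → pot h ≤ᶻ + k * big
      pot-rank (suc k) h l with B.parent (all-moves h)
      ... | inj₁ o = subst (_≤ᶻ + suc k * big) (sym (out h o)) (ZP.≤-trans (ZP.≤-reflexive (sym (ZP.*-zeroʳ (+ suc k)))) (ZP.*-monoˡ-≤-nonNeg (+ suc k) big≥0))
      ... | inj₂ (x , _ , m , lt) = ZP.≤-trans (one m) (ZP.≤-trans (ZP.+-monoʳ-≤ big (pot-rank k x (NP.≤-trans lt (NP.≤-pred l)))) (ZP.≤-reflexive (alg (+ k) big)))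
        where
        alg : ∀ k b → b + k * b ≡ (1ℤ + k) * b
        alg = solve-∀
        one : (rt h ≡ x) ⊎ (fc h ≡ x) → pot h ≤ᶻ big + pot x
        one (inj₁ refl) = ZP.≤-trans (drop {f₀.a h} {pot (rt h)} {pot h} (Flow.a≥0 f h) (is-a h)) (ZP.+-monoˡ-≤ (pot (rt h)) (big≥a h))
        one (inj₂ refl) = ZP.≤-trans (drop {f₀.b h} {pot (fc h)} {pot h} (Flow.b≥0 f h) (is-b h)) (ZP.+-monoˡ-≤ (pot (fc h)) (big≥b h))
      pot-cap : ∀ h → pot h ≤ᶻ cap
      pot-cap h = pot-rank bd h (B.rk-bound (all-moves h))
      room : ℤ
      room = ∑ (λ h → cap - pot h)
      room≥0 : 0ℤ ≤ᶻ room
      room≥0 = ∑-nonneg (λ h → ZP.i≤j⇒0≤j-i (pot-cap h))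

    advance : (s : St) → let open Tight (St.f s) in ∀ h → ¬ R.In h → Σ St λ s' → room s' < room s
    advance s h₀ nh = s' , ZP.≰⇒> (λ q → strict (∑-tight less q h₀))
      where
      open St s
      open Tight f
      alg : ∀ u v w x y → u + (v - w) + (x - y) ≡ u + ((v + x) - (w + y))
      alg = solve-∀
      s' : St
      s' = record { f = pushed ; pot = λ h → pot h + p h ; out = λ h o → cong₂ _+_ (out h o) (p-in (R.In-I o))
        ; is-a = λ h → trans (cong (_+ (p (rt h) - p h)) (is-a h)) (alg (f₀.a h) (pot (rt h)) (pot h) (p (rt h)) (p h))
        ; is-b = λ h → trans (cong (_+ (p (fc h) - p h)) (is-b h)) (alg (f₀.b h) (pot (fc h)) (pot h) (p (fc h)) (p h)) }
      dec : ∀ c u v → c - (u + v) ≡ c - u - v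
      dec = solve-∀
      less : ∀ h → cap - (pot h + p h) ≤ᶻ cap - pot h
      less h = ZP.≤-trans (ZP.≤-reflexive (dec cap (pot h) (p h))) (ZP.≤-trans (ZP.+-monoʳ-≤ (cap - pot h) (ZP.neg-mono-≤ (𝟙-nonneg (¬? (R.In? h))))) (ZP.≤-reflexive (ZP.+-identityʳ (cap - pot h))))
      strict : cap - (pot h₀ + p h₀) ≢ cap - pot h₀
      strict e = one≢zero (trans (sym (𝟙-yes (¬? (R.In? h₀)) nh)) (trans (sym (alg₂ cap (pot h₀) (p h₀))) (trans (cong (λ z → cap - pot h₀ - z) e) (ZP.+-inverseʳ (cap - pot h₀)))))
        where
        alg₂ : ∀ c u v → c - u - (c - (u + v)) ≡ v
        alg₂ = solve-∀
        one≢zero : 1ℤ ≢ 0ℤ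
        one≢zero ()

    run : ∀ fuel (s : St) → room s ≤ᶻ + fuel → AccFlow d M
    run fuel s l with any? (λ h → ¬? (Tight.R.In? (St.f s) h))
    ... | no none = Tight.done (St.f s) λ h → stable h (Tight.R.In? (St.f s) h)
      where
      stable : ∀ h → Dec (Tight.R.In (St.f s) h) → Tight.R.In (St.f s) h
      stable h (yes i) = i
      stable h (no ni) = ⊥-elim (none (h , ni))
    run zero s l | yes (h , nh) = ⊥-elim (ZP.<⇒≱ (ZP.<-≤-trans (proj₂ (advance s h nh)) l) (room≥0 (proj₁ (advance s h nh))))
    run (suc fuel) s l | yes (h , nh) = run fuel (proj₁ (advance s h nh)) (ZP.≤-trans (ZP.i<j⇒i≤pred[j] (proj₂ (advance s h nh))) (ZP.pred-mono l))

    accessible : AccFlow d M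
    accessible = run ∣ room s₀ ∣ s₀ (ZP.≤-reflexive (sym (ZP.0≤i⇒+∣i∣≡i (room≥0 s₀))))
      where
      s₀ : St
      s₀ = record { f = f₀ ; pot = λ _ → 0ℤ ; out = λ _ _ → refl ; is-a = λ h → sym (ZP.+-identityʳ _) ; is-b = λ h → sym (ZP.+-identityʳ _) }

-- Mobiles and the bracketing of their contour

_≟ᶜ_ : (x y : Color) → Dec (x ≡ y)
black ≟ᶜ black = yes refl
black ≟ᶜ white = no λ ()
white ≟ᶜ black = no λ ()
white ≟ᶜ white = yes refl

-- A mobile apart from connectedness and the tree equation: the opening of a map is first built in
-- this form and only then shown to be a tree.
record RMob (m : ℕ) : Set where
  field
    rotT : Perm m
    invT : Fin m → Fin m
    invT-inv : ∀ x → invT (invT x) ≡ x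
    col : Fin m → Color
    col-rot : ∀ x → col (Perm.ap rotT x) ≡ col x
    bud-bl : ∀ x → invT x ≡ x → col x ≡ black
    wt : Fin m → ℤ
    bud-wt : ∀ x → invT x ≡ x → wt x ≡ 0ℤ
    wh-pos : ∀ x → invT x ≢ x → col x ≡ white → 0ℤ < wt x
    bl-nonpos : ∀ x → invT x ≢ x → col x ≡ black → wt x ≤ᶻ 0ℤ

  open Perm rotT public using () renaming (ap to rT; ap⁻ to rT⁻; left to rT-left; right to rT-right)
  module W = Orb rotT

  ρ ρ⁻ : Fin m → Fin m
  ρ x = rT (invT x)
  ρ⁻ x = invT (rT⁻ x)

  contour : Perm m
  contour = record { ap = ρ ; ap⁻ = ρ⁻ ; left = λ x → trans (cong invT (rT-left (invT x))) (invT-inv x) ; right = λ x → trans (cong rT (invT-inv (rT⁻ x))) (rT-right x) }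

  module C = Orb contour

  Bud : Fin m → Set
  Bud x = invT x ≡ x

  Bud? : ∀ x → Dec (Bud x)
  Bud? x = invT x ≟ x

  -- the contour arrives at a white vertex
  Opens : Fin m → Set
  Opens x = ¬ Bud x × col (invT x) ≡ white

  Opens? : ∀ x → Dec (Opens x)
  Opens? x = ¬? (Bud? x) ×-dec (col (invT x) ≟ᶜ white)

  -- Run y x : reading the contour from y, with arrivals at white vertices as opening
  -- and buds as closing brackets, x is the first closing bracket that is not matched.
  data Run : Fin m → Fin m → Set where
    stop : ∀ {x} → Bud x → Run x x
    skip : ∀ {x y} → ¬ Bud y → col (invT y) ≡ black → Run (ρ y) x → Run y x
    jump : ∀ {x y γ} → Opens y → Run (ρ y) γ → Run (ρ γ) x → Run y x

  black≢white : ∀ {c} → c ≡ black → c ≢ white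
  black≢white refl ()

  not-white : ∀ {c} → c ≢ white → c ≡ black
  not-white {black} _ = refl
  not-white {white} n = ⊥-elim (n refl)

  run-bud : ∀ {y x} → Run y x → Bud x
  run-bud (stop b) = b
  run-bud (skip _ _ r) = run-bud r
  run-bud (jump _ _ r) = run-bud r

  run-fun : ∀ {y x x'} → Run y x → Run y x' → x ≡ x'
  run-fun (stop b) (stop _) = refl
  run-fun (stop b) (skip n _ _) = ⊥-elim (n b)
  run-fun (stop b) (jump (n , _) _ _) = ⊥-elim (n b)
  run-fun (skip n _ _) (stop b) = ⊥-elim (n b)
  run-fun (skip _ _ r) (skip _ _ r') = run-fun r r'
  run-fun (skip _ c _) (jump (_ , c') _ _) = ⊥-elim (black≢white c c')
  run-fun (jump (n , _) _ _) (stop b) = ⊥-elim (n b)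
  run-fun (jump (_ , c') _ _) (skip _ c _) = ⊥-elim (black≢white c c')
  run-fun (jump _ r s) (jump _ r' s') with run-fun r r'
  ... | refl = run-fun s s'

  run-~ : ∀ {y x} → Run y x → y C.~ x
  run-~ (stop _) = C.~-refl
  run-~ (skip _ _ r) = C.~-trans C.~-step (run-~ r)
  run-~ (jump _ r s) = C.~-trans C.~-step (C.~-trans (run-~ r) (C.~-trans C.~-step (run-~ s)))

  -- Contour steps until the first arrival at `β`. Cut open at an unmatched bud, the cyclic contour
  -- becomes a word, and this is the position in it, counted from the end.
  data Dist (β : Fin m) : ℕ → Fin m → Set where
    zero : Dist β 0 β
    suc : ∀ {k y} → y ≢ β → Dist β k (ρ y) → Dist β (suc k) y

  dist-fun : ∀ {β k k' y} → Dist β k y → Dist β k' y → k ≡ k'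
  dist-fun zero zero = refl
  dist-fun zero (suc n _) = ⊥-elim (n refl)
  dist-fun (suc n _) zero = ⊥-elim (n refl)
  dist-fun (suc _ a) (suc _ b) = cong suc (dist-fun a b)

  dist : ∀ {β} y → y C.~ β → ∃ λ k → Dist β k y
  dist y (t , e) = go t y e
    where
    go : ∀ {β} t y → iter ρ t y ≡ β → ∃ λ k → Dist β k y
    go zero y refl = 0 , zero
    go {β} (suc t) y e with y ≟ β
    ... | yes refl = 0 , zero
    ... | no ne = let k , r = go t (ρ y) (trans (iter-suc ρ t y) e) in suc k , suc ne r

  Matched Unmatched : Fin m → Set
  Matched β = ∃ λ y → Opens y × Run (ρ y) β
  Unmatched β = ∀ y → Opens y → ¬ Run (ρ y) β

  dist-next : ∀ {β k y} → y ≢ β → Dist β k y → ∃ λ k' → k ≡ suc k' × Dist β k' (ρ y)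
  dist-next n zero = ⊥-elim (n refl)
  dist-next n (suc _ r) = _ , refl , r

  -- A reading cannot pass an unmatched bud: it could only do so in a jump ending at `β`, and that
  -- would match `β`.
  run-dist : ∀ {β y x k} → Bud β → Unmatched β → Run y x → Dist β k y → ∃ λ k' → k' ≤ k × Dist β k' x
  run-dist bβ u (stop _) D = _ , NP.≤-refl , D
  run-dist {β} {y} bβ u (skip n c r) D with dist-next (λ { refl → n bβ }) D
  ... | k₁ , refl , D₁ = let k' , l , D' = run-dist bβ u r D₁ in k' , NP.m≤n⇒m≤1+n l , D'
  run-dist {β} {y} bβ u (jump {γ = γ} o r s) D with dist-next (λ { refl → proj₁ o bβ }) D
  ... | k₁ , refl , D₁ with run-dist bβ u r D₁
  ...   | k₂ , l₂ , D₂ with dist-next (λ { refl → u y o r }) D₂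
  ...     | k₃ , refl , D₃ = let k' , l , D' = run-dist bβ u s D₃ in k' , NP.≤-trans l (NP.≤-trans (NP.n≤1+n k₃) (NP.m≤n⇒m≤1+n l₂)) , D'

  -- The bracketing computed as far as `β`. Without such a limit a reading may turn around the
  -- contour forever; before `β` the distance decreases, and either the reading stops at or before
  -- `β`, or some jump consumes `β` and exhibits its mate.
  tryRun : ∀ {β} → Bud β → ∀ fuel {k y} → k <ℕ fuel → Dist β k y → (∃ λ x → Run y x × ∃ λ k' → k' ≤ k × Dist β k' x) ⊎ Matched β
  tryRun {β} bβ (suc fuel) {k} {y} l D with Bud? y
  ... | yes b = inj₁ (y , stop b , k , NP.≤-refl , D)
  ... | no nb with dist-next (λ { refl → nb bβ }) D
  ...   | k₁ , refl , D₁ with tryRun bβ fuel (NP.≤-pred l) D₁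
  ...     | inj₂ mt = inj₂ mt
  ...     | inj₁ (γ , r , k₂ , l₂ , D₂) with col (invT y) ≟ᶜ white
  ...       | no nw = inj₁ (γ , skip nb (not-white nw) r , k₂ , NP.m≤n⇒m≤1+n l₂ , D₂)
  ...       | yes cw with γ ≟ β
  ...         | yes refl = inj₂ (y , (nb , cw) , r)
  ...         | no ne with dist-next ne D₂
  ...           | k₃ , refl , D₃ with tryRun bβ fuel (NP.≤-trans (NP.m≤n⇒m≤1+n l₂) (NP.≤-pred l)) D₃
  ...             | inj₂ mt = inj₂ mt
  ...             | inj₁ (x , s , k₄ , l₄ , D₄) = inj₁ (x , jump (nb , cw) r s , k₄ , NP.≤-trans l₄ (NP.≤-trans (NP.n≤1+n k₃) (NP.m≤n⇒m≤1+n l₂)) , D₄)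

  run-total : ∀ {β} → Bud β → Unmatched β → ∀ y → y C.~ β → ∃ (Run y)
  run-total bβ u y s with tryRun bβ _ NP.≤-refl (proj₂ (dist y s))
  ... | inj₁ (x , r , _) = x , r
  ... | inj₂ (z , o , r) = ⊥-elim (u z o r)

  either : ∀ {k} {A : Fin k → Set} {B : Set} → (∀ x → A x ⊎ B) → (∀ x → A x) ⊎ B
  either {zero} f = inj₁ λ ()
  either {suc k} f with f fz | either (f ∘ fs)
  ... | inj₂ b | _ = inj₂ b
  ... | inj₁ a | inj₂ b = inj₂ b
  ... | inj₁ a | inj₁ g = inj₁ λ { fz → a ; (fs x) → g x }

  decideMatched : ∀ {β} → Bud β → Unmatched β ⊎ Matched β
  decideMatched {β} bβ = either test
    where
    test : ∀ y → (Opens y → ¬ Run (ρ y) β) ⊎ Matched β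
    test y with Opens? y | ρ y C.~? β
    ... | no no' | _ = inj₁ λ o → ⊥-elim (no' o)
    ... | yes o | no ns = inj₁ λ _ r → ns (run-~ r)
    ... | yes o | yes s with tryRun bβ _ NP.≤-refl (proj₂ (dist (ρ y) s))
    ...   | inj₂ mt = inj₂ mt
    ...   | inj₁ (x , r , _) with x ≟ β
    ...     | yes refl = inj₂ (y , o , r)
    ...     | no ne = inj₁ λ _ r' → ne (run-fun r r')

  -- If all buds of this contour were matched, sending each to its opening would be injective, as a
  -- reading determines its end.
  base : ∀ y₀ → count (λ x → Opens? x ×-dec (y₀ C.~? x)) < count (λ x → Bud? x ×-dec (y₀ C.~? x)) → ∃ λ β → Bud β × y₀ C.~ β × Unmatched β
  base y₀ more with either (λ β → dec β)
    where
    dec : ∀ β → (Bud β × y₀ C.~ β → Matched β) ⊎ (∃ λ β → Bud β × y₀ C.~ β × Unmatched β)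
    dec β with Bud? β | y₀ C.~? β
    ... | no nb | _ = inj₁ λ q → ⊥-elim (nb (proj₁ q))
    ... | yes _ | no ns = inj₁ λ q → ⊥-elim (ns (proj₂ q))
    ... | yes b | yes s with decideMatched b
    ...   | inj₁ u = inj₂ (β , b , s , u)
    ...   | inj₂ mt = inj₁ λ _ → mt
  ... | inj₂ r = r
  ... | inj₁ f = ⊥-elim (ZP.<⇒≱ more (count-inj (λ x → Bud? x ×-dec (y₀ C.~? x)) (λ x → Opens? x ×-dec (y₀ C.~? x))
      (λ β q → proj₁ (f β q))
      (λ β q → proj₁ (proj₂ (f β q)) , C.~-trans (proj₂ q) (C.~-sym (C.~-trans C.~-step (run-~ (proj₂ (proj₂ (f β q)))))))
      (λ β β' q q' e → run-fun (proj₂ (proj₂ (f β q))) (subst (λ z → Run (ρ z) β') (sym e) (proj₂ (proj₂ (f β' q')))))))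

  skeleton : Graph m
  skeleton = record { vert = rotT ; inv = invT ; inv-inv = invT-inv ; Ed = λ x → ¬ Bud x ; Ed? = λ x → ¬? (Bud? x)
    ; Ed-inv = λ {x} n b → n (trans (sym b) (invT-inv x)) }

  module TreeContour (r : Fin m) where
    module X = Explore skeleton r

    ~-reached : ∀ {x y} → x C.~ y → X.Reached x → X.Reached y
    ~-reached = C.closed-~ {X.Reached} (λ x q → X.reached-~ W.~-step (cross x q))
      where
      cross : ∀ x → X.Reached x → X.Reached (invT x)
      cross x q with Bud? x
      ... | yes b = subst X.Reached (sym b) q
      ... | no nb = X.reached-inv nb q

    module _ (few : count (λ h → ¬? (Bud? h) ×-dec X.Reached? h) + + 2 ≤ᶻ + 2 * W.#cls X.Reached?) where

      -- The device used for open regions: the jump across edges of the indicator of the contour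
      -- through `r`. It telescopes around each vertex, because the contour passes from `invT y` to
      -- `rT y`; on a tree it must vanish, so the contour runs along both sides of every edge.
      z : Fin m → ℤ
      z t = 𝟙 (r C.~? invT t) - 𝟙 (r C.~? t)

      to-rot : ∀ {t} → r C.~ invT t → r C.~ rT t
      to-rot {t} s = subst (r C.~_) (cong rT (invT-inv t)) (C.~-trans s C.~-step)
      from-rot : ∀ {t} → r C.~ rT t → r C.~ invT t
      from-rot {t} s = C.~-trans s (subst (C._~ invT t) (cong rT (invT-inv t)) (C.~-back {invT t}))

      z-anti : ∀ t → z (invT t) ≡ - z t
      z-anti t = trans (cong (λ w → 𝟙 (r C.~? w) - 𝟙 (r C.~? invT t)) (invT-inv t)) (lem (𝟙 (r C.~? t)) (𝟙 (r C.~? invT t)))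
        where
        lem : ∀ a b → a - b ≡ - (b - a)
        lem = solve-∀

      z-supp : ∀ t → z t ≢ 0ℤ → X.Up t ⊎ X.Up (invT t)
      z-supp t ne with Bud? t
      ... | yes b = ⊥-elim (ne (trans (cong (λ w → 𝟙 (r C.~? w) - 𝟙 (r C.~? t)) b) (ZP.+-inverseʳ (𝟙 (r C.~? t)))))
      ... | no nb = X.tree-covered few t nb (inside (r C.~? t) (r C.~? invT t) refl refl)
        where
        inside : ∀ (p : Dec (r C.~ t)) (q : Dec (r C.~ invT t)) → 𝟙 p ≡ 𝟙 (r C.~? t) → 𝟙 q ≡ 𝟙 (r C.~? invT t) → X.Reached t
        inside (yes s) _ _ _ = ~-reached s X.reached-root
        inside (no _) (yes s) _ _ = subst X.Reached (invT-inv t) (X.reached-inv (Graph.Ed-inv skeleton nb) (~-reached s X.reached-root))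
        inside (no _) (no _) e e' = ⊥-elim (ne (cong₂ _-_ (sym e') (sym e)))

      z-bal : ∀ x → W.clsum x z ≡ 0ℤ
      z-bal x = trans (∑-cong (λ y → trans (cong (λ t → 𝟙 (x W.~? y) * (t - 𝟙 (r C.~? y))) (𝟙-cong (r C.~? invT y) (r C.~? rT y) to-rot from-rot))
          (lem (𝟙 (x W.~? y)) (𝟙 (r C.~? rT y)) (𝟙 (r C.~? y)))))
        (trans (∑-sub (λ y → 𝟙 (x W.~? y) * 𝟙 (r C.~? rT y)) (λ y → 𝟙 (x W.~? y) * 𝟙 (r C.~? y)))
          (trans (cong (_- W.clsum x (λ y → 𝟙 (r C.~? y))) (W.clsum-shift x (λ y → 𝟙 (r C.~? y)))) (ZP.+-inverseʳ (W.clsum x (λ y → 𝟙 (r C.~? y))))))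
        where
        lem : ∀ a b c → a * (b - c) ≡ a * b - a * c
        lem = solve-∀

      contour-single : ∀ {t} → X.Reached t → r C.~ t
      contour-single = X.reached-ind {r C.~_} C.~-refl (λ s q → W.closed-~ {r C.~_} (λ t u → to-rot (cross t u)) s q) (λ {t} _ → cross t)
        where
        cross : ∀ t → r C.~ t → r C.~ invT t
        cross t q = 𝟙-pos (r C.~? invT t) (subst (0ℤ <_) (sym (trans (ZP.i-j≡0⇒i≡j (𝟙 (r C.~? invT t)) (𝟙 (r C.~? t)) (X.forest-flow z z-anti z-supp (λ x _ _ → z-bal x) t)) (𝟙-yes (r C.~? t) q))) (+<+ (s≤s z≤n)))

-- The correspondence between a plane map and its mobile

module Rotation {n} (p : Fin n → Fin n) (S : Fin n → Set) where
  -- `Rotate h x`: `x` is the first element of `S` met from `h` on, `h` included.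
  data Rotate : Fin n → Fin n → Set where
    here : ∀ {h} → S h → Rotate h h
    turn : ∀ {h x} → ¬ S h → Rotate (p h) x → Rotate h x

  rotate-S : ∀ {h x} → Rotate h x → S x
  rotate-S (here s) = s
  rotate-S (turn _ r) = rotate-S r

  rotate-fun : ∀ {h x y} → Rotate h x → Rotate h y → x ≡ y
  rotate-fun (here _) (here _) = refl
  rotate-fun (here s) (turn ns _) = ⊥-elim (ns s)
  rotate-fun (turn ns _) (here s) = ⊥-elim (ns s)
  rotate-fun (turn _ r) (turn _ r') = rotate-fun r r'

  rotate-first : ∀ {h x} i {u} → Rotate h x → iter p i h ≡ u → S u → ∃ λ j → j ≤ i × iter p j x ≡ u
  rotate-first i (here s) e su = i , NP.≤-refl , e
  rotate-first zero (turn ns r) refl su = ⊥-elim (ns su)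
  rotate-first (suc i) {u} (turn {h} ns r) e su = let j , l , q = rotate-first i r (trans (iter-suc p i h) e) su in j , NP.m≤n⇒m≤1+n l , q

  rotate-exists : (∀ h → Dec (S h)) → ∀ i {h u} → iter p i h ≡ u → S u → ∃ (Rotate h)
  rotate-exists S? i {h} e su with S? h
  ... | yes s = h , here s
  rotate-exists S? zero refl su | no ns = ⊥-elim (ns su)
  rotate-exists S? (suc i) {h} e su | no ns = let x , r = rotate-exists S? i (trans (iter-suc p i h) e) su in x , turn ns r

  rotate-closed : {Q : Fin n → Set} → (∀ h → ¬ S h → Q h → Q (p h)) → ∀ {h x} → Rotate h x → Q h → Q x
  rotate-closed c (here _) q = q
  rotate-closed {Q} c (turn ns r) q = rotate-closed {Q} c r (c _ ns q)

  rotate-reach : ∀ {h x} → Rotate h x → ∃ λ t → iter p t h ≡ x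
  rotate-reach (here _) = 0 , refl
  rotate-reach (turn {h} _ r) = let t , e = rotate-reach r in suc t , trans (sym (iter-suc p t h)) e

record Branch {m} (d : ℕ) (T : RMob m) : Set where
  open RMob T
  field
    edge-w : ∀ x → ¬ Bud x → wt x + wt (invT x) ≡ + d - + 2
    white-w : ∀ x → col x ≡ white → W.clsum x wt ≡ + d
    black-w : ∀ x → col x ≡ black → count (x W.~?_) + W.clsum x wt ≡ + d

-- Black half-edges of T lie over the inner darts of M and white ones over the darts of positive weight.
record Corr {n m} (M : RMap n) (T : RMob m) : Set where
  open RMap M
  open Inner M
  open RMob T
  field
    κ : Fin m → Fin n
  Over : Color → Fin n → Set
  Over c h = Σ (Fin m) λ x → col x ≡ c × κ x ≡ h
  -- Over such a dart a black half-edge has to be a bud: either a white half-edge over the same dart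
  -- takes its place in the mobile edge, or the other side of the edge is the outer face.
  Stop : Fin n → Set
  Stop h = Over white h ⊎ Outer (inv h)
  open Rotation rt Stop public
  field
    κ-inj : ∀ {x y} → col x ≡ col y → κ x ≡ κ y → x ≡ y
    black-in : ∀ {x} → col x ≡ black → ¬ Outer (κ x)
    black-over : ∀ h → ¬ Outer h → Over black h
    white-in : ∀ {x} → col x ≡ white → InV (κ x)
    white-over : ∀ h → InV h → Σ (Fin m) λ x → col x ≡ white × κ x V.~ h
    rot-black : ∀ {x} → col x ≡ black → κ (rT x) ≡ fc (κ x)
    -- Against the rotation of the map: if `rt` turns counterclockwise around vertices, then `fc`
    -- turns clockwise around faces, and a mobile drawn on the same sphere turns clockwise at all
    -- its vertices.
    rot-white : ∀ {x} → col x ≡ white → Rotate (rt (κ (rT x))) (κ x)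
    bud-stop : ∀ {x} → Bud x → Stop (κ x)
    stop-bud : ∀ {x} → col x ≡ black → Stop (κ x) → Bud x
    over-edge : ∀ {x} → ¬ Bud x → κ (invT x) ≡ inv (κ x)

module CorrFacts {n m} {M : RMap n} {T : RMob m} (K : Corr M T) where
  open RMap M
  open Inner M
  open RMob T
  open Corr K

  Over? : ∀ c h → Dec (Over c h)
  Over? c h = any? (λ x → (col x ≟ᶜ c) ×-dec (κ x ≟ h))

  nonbud-white : ∀ {x} → col x ≡ white → ¬ Bud x
  nonbud-white c b = black≢white (bud-bl _ b) c

  κ-ρ : ∀ {y} → ¬ Bud y → col (invT y) ≡ black → κ (ρ y) ≡ rt (κ y)
  κ-ρ {y} nb c = trans (rot-black c) (trans (cong fc (over-edge nb)) (cong rt (inv-inv (κ y))))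

  κρ-bud : ∀ {γ} → Bud γ → κ (ρ γ) ≡ fc (κ γ)
  κρ-bud {γ} b = trans (cong (κ ∘ rT) b) (rot-black (bud-bl γ b))

  rotate-~ : ∀ {h x} → Rotate h x → h V.~ x
  rotate-~ r = rotate-reach r

  -- the bracketing of the contour is forced by the rotation of the map
  mutual
    run-rotate : ∀ {y x} → Run y x → (col y ≡ black → Rotate (κ y) (κ x)) × (col y ≡ white → Rotate (rt (κ y)) (κ x))
    run-rotate (stop b) = (λ c → here (bud-stop b)) , λ c → ⊥-elim (black≢white (bud-bl _ b) c)
    run-rotate {y} {x} (skip nb c r) = (λ cy → turn (λ s → nb (stop-bud cy s)) next) , λ _ → next
      where
      next : Rotate (rt (κ y)) (κ x)
      next = subst (λ h → Rotate h (κ x)) (κ-ρ nb c) (proj₁ (run-rotate r) (trans (col-rot _) c))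
    run-rotate {y} {x} (jump {γ = γ} o@(nb , c) r s) = (λ cy → turn (λ st → nb (stop-bud cy st)) next) , λ _ → next
      where
      next : Rotate (rt (κ y)) (κ x)
      next = subst (λ h → Rotate h (κ x)) (trans (κρ-bud (run-bud r)) (trans (cong fc (match o r)) (trans (cong fc (over-edge nb)) (cong rt (inv-inv (κ y))))))
          (proj₁ (run-rotate s) (trans (col-rot _) (trans (cong col (run-bud r)) (bud-bl γ (run-bud r)))))

    match : ∀ {y γ} → Opens y → Run (ρ y) γ → κ γ ≡ κ (invT y)
    match {y} (nb , c) r = rotate-fun (proj₂ (run-rotate r) (trans (col-rot (invT y)) c)) (rot-white c)

  -- A matched bud shares its dart with a white half-edge, hence sits at an inner vertex.
  outer-unmatched : ∀ {x} → Outer (inv (κ x)) → Unmatched x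
  outer-unmatched {x} o y op@(nb , c) r = proj₂ (InV-InE (subst InV (sym (match op r)) (white-in c))) o

  black-~ : ∀ {x y} → col x ≡ black → x W.~ y → κ x F.~ κ y
  black-~ {x} c s = proj₂ (W.closed-~ {λ z → col z ≡ black × κ x F.~ κ z} (λ { z (cz , r) → trans (col-rot z) cz , F.~-trans r (subst (κ z F.~_) (sym (rot-black cz)) F.~-step) }) s (c , F.~-refl))

  ~-black : ∀ {x y} → col x ≡ black → col y ≡ black → κ x F.~ κ y → x W.~ y
  ~-black {x} {y} c c' (t , e) = go t x c e
    where
    go : ∀ t x → col x ≡ black → iter fc t (κ x) ≡ κ y → x W.~ y
    go zero x c e = subst (x W.~_) (κ-inj (trans c (sym c')) e) W.~-refl
    go (suc t) x c e = W.~-trans W.~-step (go t (rT x) (trans (col-rot x) c) (trans (cong (iter fc t) (rot-black c)) (trans (iter-suc fc t (κ x)) e)))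

  white-~ : ∀ {x y} → col x ≡ white → x W.~ y → κ x V.~ κ y
  white-~ {x} c s = proj₂ (W.closed-~ {λ z → col z ≡ white × κ x V.~ κ z} (λ { z (cz , r) → trans (col-rot z) cz , V.~-trans r (V.~-sym (V.~-trans V.~-step (rotate-~ (rot-white cz)))) }) s (c , V.~-refl))

  ~-white : ∀ {x y} → col x ≡ white → col y ≡ white → κ x V.~ κ y → x W.~ y
  ~-white {x} {y} c c' (t , e) = go t t x NP.≤-refl c e
    where
    go : ∀ b t x → t ≤ b → col x ≡ white → iter rt t (κ x) ≡ κ y → x W.~ y
    go b zero x l c e = subst (x W.~_) (κ-inj (trans c (sym c')) e) W.~-refl
    go (suc b) (suc t) x l c e with rotate-first t (subst (λ z → Rotate (rt (κ z)) (κ (rT⁻ x))) (rT-right x) (rot-white (trans (sym (col-rot (rT⁻ x))) (trans (cong col (rT-right x)) c)))) (trans (iter-suc rt t (κ x)) e) (inj₁ (y , c' , refl))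
    ... | j , lj , q = W.~-trans W.~-prev (go b j (rT⁻ x) (NP.≤-trans lj (NP.≤-pred l)) (trans (sym (col-rot (rT⁻ x))) (trans (cong col (rT-right x)) c)) q)

  Col? : ∀ c x → Dec (col x ≡ c)
  Col? c x = col x ≟ᶜ c

  col-~ : ∀ {c x y} → x W.~ y → col x ≡ c → col y ≡ c
  col-~ {c} = W.closed-~ {λ z → col z ≡ c} (λ z e → trans (col-rot z) e)

  #black : W.#cls (Col? black) ≡ F.#cls InF?
  #black = ZP.≤-antisym
    (count-inj (λ x → W.Rep? x ×-dec Col? black x) (λ x → F.Rep? x ×-dec InF? x) (λ x _ → F.rep (κ x)) (λ { x (_ , c) → F.rep-idem (κ x) , InF-~ (F.rep-~ (κ x)) (black-in c) })
      (λ { x y (r , c) (r' , c') e → trans (sym r) (trans (W.rep-cong (~-black c c' (F.rep-sound e))) r') }))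
    (count-inj (λ x → F.Rep? x ×-dec InF? x) (λ x → W.Rep? x ×-dec Col? black x) (λ { h (_ , i) → W.rep (proj₁ (black-over h i)) })
      (λ { h (_ , i) → let x , c , _ = black-over h i in W.rep-idem x , col-~ (W.rep-~ x) c })
      (λ { h h' (r , i) (r' , i') e → let x , c , q = black-over h i ; x' , c' , q' = black-over h' i' in
        trans (sym r) (trans (F.rep-cong (subst₂ F._~_ q q' (black-~ c (W.rep-sound e)))) r') }))

  #white : W.#cls (Col? white) ≡ V.#cls InV?
  #white = ZP.≤-antisym
    (count-inj (λ x → W.Rep? x ×-dec Col? white x) (λ x → V.Rep? x ×-dec InV? x) (λ x _ → V.rep (κ x)) (λ { x (_ , c) → V.rep-idem (κ x) , InV-~ (V.rep-~ (κ x)) (white-in c) })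
      (λ { x y (r , c) (r' , c') e → trans (sym r) (trans (W.rep-cong (~-white c c' (V.rep-sound e))) r') }))
    (count-inj (λ x → V.Rep? x ×-dec InV? x) (λ x → W.Rep? x ×-dec Col? white x) (λ { h (_ , i) → W.rep (proj₁ (white-over h i)) })
      (λ { h (_ , i) → let x , c , _ = white-over h i in W.rep-idem x , col-~ (W.rep-~ x) c })
      (λ { h h' (r , i) (r' , i') e → let x , c , q = white-over h i ; x' , c' , q' = white-over h' i' in
        trans (sym r) (trans (V.rep-cong (V.~-trans (V.~-sym q) (V.~-trans (white-~ c (W.rep-sound e)) q'))) r') }))

  -- With `#edges`, the tree equation of the mobile is Euler's relation for the inner part of the
  -- map.
  #vertices : count W.Rep? ≡ V.#cls InV? + F.#cls InF?
  #vertices = trans (∑-cong (λ x → trans (𝟙-split (W.Rep? x) (Col? white x)) (cong (λ z → 𝟙 (W.Rep? x ×-dec Col? white x) + z)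
      (𝟙-cong (W.Rep? x ×-dec ¬? (Col? white x)) (W.Rep? x ×-dec Col? black x) (λ { (r , c) → r , not-white c }) (λ { (r , c) → r , black≢white c })))))
    (trans (∑-+ _ _) (cong₂ _+_ #white #black))

  NB? : ∀ x → Dec (¬ Bud x)
  NB? x = ¬? (Bud? x)

  nonbud-InE : ∀ {x} → ¬ Bud x → InE (κ x)
  nonbud-InE {x} nb with col x in c
  ... | white = InV-InE (white-in c)
  ... | black = black-in c , λ o → nb (stop-bud c (inj₂ o))

  nonbud-inj : ∀ {x y} → ¬ Bud x → ¬ Bud y → κ x ≡ κ y → x ≡ y
  nonbud-inj {x} {y} nx ny e with col x in c | col y in c'
  ... | black | black = κ-inj (trans c (sym c')) e
  ... | white | white = κ-inj (trans c (sym c')) e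
  ... | black | white = ⊥-elim (nx (stop-bud c (inj₁ (y , c' , sym e))))
  ... | white | black = ⊥-elim (ny (stop-bud c' (inj₁ (x , c , e))))

  -- The white half-edge if there is one, the black one otherwise.
  active : ∀ h → InE h → Σ (Fin m) λ x → ¬ Bud x × κ x ≡ h
  active h i with Over? white h
  ... | yes (x , c , e) = x , nonbud-white c , e
  ... | no no' with black-over h (proj₁ i)
  ...   | x , c , refl = x , (λ b → case bud-stop b of λ { (inj₁ o) → no' o ; (inj₂ o) → proj₂ i o }) , refl

  #edges : count NB? ≡ count InE?
  #edges = ZP.≤-antisym (count-inj NB? InE? (λ x _ → κ x) (λ x → nonbud-InE) (λ x y → nonbud-inj))
    (count-inj InE? NB? (λ h i → proj₁ (active h i)) (λ h i → proj₁ (proj₂ (active h i))) (λ h h' i i' e → trans (sym (proj₂ (proj₂ (active h i)))) (trans (cong κ e) (proj₂ (proj₂ (active h' i'))))))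

  over : Color → (Fin m → ℤ) → Fin n → ℤ
  over c f h = ∑ (λ x → 𝟙 (Col? c x ×-dec (κ x ≟ h)) * f x)

  over-at : ∀ {c} f x → col x ≡ c → over c f (κ x) ≡ f x
  over-at {c} f x cx = trans (∑-single _ x (λ y ne → off (Col? c y ×-dec (κ y ≟ κ x)) (λ { (cy , e) → ne (κ-inj (trans cy (sym cx)) e) }))) (on (Col? c x ×-dec (κ x ≟ κ x)) (cx , refl))

  over-none : ∀ {c} f h → ¬ Over c h → over c f h ≡ 0ℤ
  over-none {c} f h no' = ∑-zero (λ x → off (Col? c x ×-dec (κ x ≟ h)) (λ { (cx , e) → no' (x , cx , e) }))

  over-sum : ∀ c (f : Fin m → ℤ) (g : Fin n → ℤ) → ∑ (λ y → g y * over c f y) ≡ ∑ (λ x → 𝟙 (Col? c x) * (g (κ x) * f x))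
  over-sum c f g = trans (∑-cong (λ y → sym (∑-* (g y) _))) (trans (∑-swap _) (∑-cong row))
    where
    alg : ∀ g c k f → g * ((c * k) * f) ≡ k * (c * (g * f))
    alg = solve-∀
    row : ∀ x → ∑ (λ y → g y * (𝟙 (Col? c x ×-dec (κ x ≟ y)) * f x)) ≡ 𝟙 (Col? c x) * (g (κ x) * f x)
    row x = trans (∑-cong (λ y → trans (cong (λ z → g y * (z * f x)) (𝟙-× (Col? c x) (κ x ≟ y))) (alg (g y) (𝟙 (Col? c x)) (𝟙 (κ x ≟ y)) (f x)))) (∑-δ (κ x) (λ y → 𝟙 (Col? c x) * (g y * f x)))

  white-clsum : ∀ f {x₀} → col x₀ ≡ white → V.clsum (κ x₀) (over white f) ≡ W.clsum x₀ f
  white-clsum f {x₀} c₀ = trans (over-sum white f (λ y → 𝟙 (κ x₀ V.~? y))) (∑-cong (λ x → trans (sym (ZP.*-assoc (𝟙 (Col? white x)) (𝟙 (κ x₀ V.~? κ x)) (f x))) (cong (_* f x) (trans (sym (𝟙-× (Col? white x) (κ x₀ V.~? κ x)))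
    (𝟙-cong (Col? white x ×-dec (κ x₀ V.~? κ x)) (x₀ W.~? x) (λ { (c , s) → ~-white c₀ c s }) (λ s → col-~ s c₀ , white-~ c₀ s))))))

  black-clsum : ∀ f {x₀} → col x₀ ≡ black → F.clsum (κ x₀) (over black f) ≡ W.clsum x₀ f
  black-clsum f {x₀} c₀ = trans (over-sum black f (λ y → 𝟙 (κ x₀ F.~? y))) (∑-cong (λ x → trans (sym (ZP.*-assoc (𝟙 (Col? black x)) (𝟙 (κ x₀ F.~? κ x)) (f x))) (cong (_* f x) (trans (sym (𝟙-× (Col? black x) (κ x₀ F.~? κ x)))
    (𝟙-cong (Col? black x ×-dec (κ x₀ F.~? κ x)) (x₀ W.~? x) (λ { (c , s) → ~-black c₀ c s }) (λ s → col-~ s c₀ , black-~ c₀ s))))))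

  degree : ∀ {x₀} → col x₀ ≡ black → count (κ x₀ F.~?_) ≡ count (x₀ W.~?_)
  degree {x₀} c₀ = trans (∑-cong row) (trans (black-clsum (λ _ → 1ℤ) c₀) (∑-cong (λ x → ZP.*-identityʳ _)))
    where
    row : ∀ y → 𝟙 (κ x₀ F.~? y) ≡ 𝟙 (κ x₀ F.~? y) * over black (λ _ → 1ℤ) y
    row y = trans (sym (ZP.*-identityʳ _)) (𝟙-*cong (κ x₀ F.~? y) (λ s → sym (let x , c , e = black-over y (InF-~ s (black-in c₀)) in trans (cong (over black (λ _ → 1ℤ)) (sym e)) (over-at (λ _ → 1ℤ) x c))))

  wt-white : ∀ {x} → col x ≡ white → 0ℤ < wt x
  wt-white {x} c = wh-pos x (nonbud-white c) c

  wt-black : ∀ {x} → col x ≡ black → wt x ≤ᶻ 0ℤ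
  wt-black {x} c with Bud? x
  ... | yes b = ZP.≤-reflexive (bud-wt x b)
  ... | no nb = bl-nonpos x nb c

  fa fb : Fin n → ℤ
  fa = over white wt
  fb h = - over black wt h

  -- If a white half-edge lies over the dart, the black one is a bud of weight 0; so only the
  -- non-bud half-edge contributes.
  net : ∀ {x} → ¬ Bud x → fa (κ x) - fb (κ x) ≡ wt x
  net {x} nb with col x in c
  ... | white = trans (cong₂ (λ u v → u - - v) (over-at wt x c) black0) (alg (wt x))
    where
    alg : ∀ w → w - - 0ℤ ≡ w
    alg = solve-∀
    black0 : over black wt (κ x) ≡ 0ℤ
    black0 with black-over (κ x) (proj₁ (InV-InE (white-in c)))
    ... | z , cz , e = trans (cong (over black wt) (sym e)) (trans (over-at wt z cz) (bud-wt z (stop-bud cz (inj₁ (x , c , sym e)))))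
  ... | black = trans (cong₂ (λ u v → u - - v) (over-none wt (κ x) (λ o → nb (stop-bud c (inj₁ o)))) (over-at wt x c)) (alg (wt x))
    where
    alg : ∀ w → 0ℤ - - w ≡ w
    alg = solve-∀

  toFlow : ∀ {d} → Branch d T → Flow d M
  toFlow {d} B = record
    { a = fa ; b = fb
    ; a≥0 = λ h → a≥0 h (Over? white h)
    ; b≥0 = λ h → b≥0 h (Over? black h)
    ; a-out = λ h o → over-none wt h (λ { (x , c , refl) → white-in c o })
    ; b-out = λ h ne → b-out h ne (Over? black h)
    ; at-vertex = λ h i → let x , c , s = white-over h i in trans (V.clsum-cong fa (V.~-sym s)) (trans (white-clsum wt c) (white-w x c))
    ; at-face = at-face
    ; at-edge = λ h i → let x , nb , e = active h i in subst (λ h → fa h + fa (inv h) - (fb h + fb (inv h)) ≡ + d - + 2) e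
        (trans (alg (fa (κ x)) (fa (inv (κ x))) (fb (κ x)) (fb (inv (κ x)))) (trans (cong₂ _+_ (net nb) (trans (cong (λ h → fa h - fb h) (sym (over-edge nb))) (net (Graph.Ed-inv skeleton nb)))) (edge-w x nb))) }
    where
    open Branch B
    alg : ∀ a a' b b' → a + a' - (b + b') ≡ (a - b) + (a' - b')
    alg = solve-∀
    a≥0 : ∀ h → Dec (Over white h) → 0ℤ ≤ᶻ fa h
    a≥0 h (yes (x , c , refl)) = subst (0ℤ ≤ᶻ_) (sym (over-at wt x c)) (ZP.<⇒≤ (wt-white c))
    a≥0 h (no no') = ZP.≤-reflexive (sym (over-none wt h no'))
    b≥0 : ∀ h → Dec (Over black h) → 0ℤ ≤ᶻ fb h
    b≥0 h (yes (x , c , refl)) = subst (λ z → 0ℤ ≤ᶻ - z) (sym (over-at wt x c)) (ZP.neg-mono-≤ (wt-black c))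
    b≥0 h (no no') = ZP.≤-reflexive (sym (cong -_ (over-none wt h no')))
    b-out : ∀ h → ¬ InE h → Dec (Over black h) → fb h ≡ 0ℤ
    b-out h ne (no no') = cong -_ (over-none wt h no')
    b-out h ne (yes (x , c , refl)) = cong -_ (trans (over-at wt x c) (bud-wt x (isBud x c ne)))
      where
      isBud : ∀ x → col x ≡ black → ¬ InE (κ x) → Bud x
      isBud x c ne with Bud? x
      ... | yes b = b
      ... | no nb = ⊥-elim (ne (nonbud-InE nb))
    at-face : ∀ h → InF h → F.clsum h (λ y → 1ℤ - fb y) ≡ + d
    at-face h i with black-over h i
    ... | x , c , refl = trans (∑-cong (λ y → lem (𝟙 (κ x F.~? y)) (over black wt y))) (trans (∑-+ (λ y → 𝟙 (κ x F.~? y)) (λ y → 𝟙 (κ x F.~? y) * over black wt y)) (trans (cong₂ _+_ (degree c) (black-clsum wt c)) (black-w x c)))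
      where
      lem : ∀ u v → u * (1ℤ - - v) ≡ u + u * v
      lem = solve-∀

-- Opening a map along an accessible flow

record Enum {N} (Q : Fin N → Set) : Set where
  field
    size : ℕ
    el : Fin size → Fin N
    el-inj : ∀ {i j} → el i ≡ el j → i ≡ j
    el-Q : ∀ i → Q (el i)
    ix : ∀ y → Q y → Fin size
    el-ix : ∀ y q → el (ix y q) ≡ y

enum : ∀ {N} {Q : Fin N → Set} → (∀ x → Dec (Q x)) → Enum Q
enum {zero} Q? = record { size = 0 ; el = λ () ; el-inj = λ { {()} } ; el-Q = λ () ; ix = λ () ; el-ix = λ () }
enum {suc N} {Q} Q? with Q? fz | enum (Q? ∘ fs)
... | no n | E = record { size = size ; el = fs ∘ el ; el-inj = el-inj ∘ FP.suc-injective ; el-Q = el-Q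
    ; ix = λ { fz q → ⊥-elim (n q) ; (fs y) q → ix y q } ; el-ix = λ { fz q → ⊥-elim (n q) ; (fs y) q → cong fs (el-ix y q) } }
  where open Enum E
... | yes p | E = record { size = suc size ; el = λ { fz → fz ; (fs i) → fs (el i) }
    ; el-inj = λ { {fz} {fz} e → refl ; {fs i} {fs j} e → cong fs (el-inj (FP.suc-injective e)) ; {fz} {fs j} () ; {fs i} {fz} () }
    ; el-Q = λ { fz → p ; (fs i) → el-Q i } ; ix = λ { fz q → fz ; (fs y) q → fs (ix y q) } ; el-ix = λ { fz q → refl ; (fs y) q → cong fs (el-ix y q) } }
  where open Enum E

-- Half-edges of the opened map, and later darts of the closure, are of two kinds. Operations are
-- written by cases on the sum and carried by `lift` to indices in a single `Fin size`.
module Enum₂ {n n'} {L : Fin n → Set} {R : Fin n' → Set} (EL : Enum L) (ER : Enum R) where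
  private
    module L = Enum EL
    module R = Enum ER

  Holds : Fin n ⊎ Fin n' → Set
  Holds (inj₁ h) = L h
  Holds (inj₂ h) = R h

  size : ℕ
  size = L.size +ℕ R.size

  opaque
    el : Fin size → Fin n ⊎ Fin n'
    el i = Data.Sum.map L.el R.el (splitAt L.size i)

    el-inj : ∀ {i j} → el i ≡ el j → i ≡ j
    el-inj {i} {j} e = trans (sym (FP.join-splitAt L.size R.size i)) (trans (cong (Data.Fin.join L.size R.size) (inner (splitAt L.size i) (splitAt L.size j) e)) (FP.join-splitAt L.size R.size j))
      where
      inner : ∀ a b → Data.Sum.map L.el R.el a ≡ Data.Sum.map L.el R.el b → a ≡ b
      inner (inj₁ a) (inj₁ b) e = cong inj₁ (L.el-inj (inj₁-injective e))
      inner (inj₂ a) (inj₂ b) e = cong inj₂ (R.el-inj (inj₂-injective e))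

    el-ok : ∀ i → Holds (el i)
    el-ok i with splitAt L.size i
    ... | inj₁ a = L.el-Q a
    ... | inj₂ b = R.el-Q b

    mk : ∀ s → Holds s → Fin size
    mk (inj₁ h) q = L.ix h q ↑ˡ R.size
    mk (inj₂ h) q = L.size ↑ʳ R.ix h q

    el-mk : ∀ s q → el (mk s q) ≡ s
    el-mk (inj₁ h) q = trans (cong (Data.Sum.map L.el R.el) (FP.splitAt-↑ˡ L.size (L.ix h q) R.size)) (cong inj₁ (L.el-ix h q))
    el-mk (inj₂ h) q = trans (cong (Data.Sum.map L.el R.el) (FP.splitAt-↑ʳ L.size R.size (R.ix h q))) (cong inj₂ (R.el-ix h q))

  lift : (f : Fin n ⊎ Fin n' → Fin n ⊎ Fin n') → (∀ s → Holds s → Holds (f s)) → Fin size → Fin size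
  lift f ok i = mk (f (el i)) (ok (el i) (el-ok i))

  el-lift : ∀ f ok i → el (lift f ok i) ≡ f (el i)
  el-lift f ok i = el-mk _ _

  lift-lift : ∀ f g okf okg → (∀ s → Holds s → g (f s) ≡ s) → ∀ i → lift g okg (lift f okf i) ≡ i
  lift-lift f g okf okg e i = el-inj (trans (el-lift g okg _) (trans (cong g (el-lift f okf i)) (e (el i) (el-ok i))))

inverse : ∀ {n} → Perm n → Perm n
inverse P = record { ap = Perm.ap⁻ P ; ap⁻ = Perm.ap P ; left = Perm.right P ; right = Perm.left P }

module FirstReturn {n} (P : Perm n) {S : Fin n → Set} (S? : ∀ h → Dec (S h)) where
  open Perm P renaming (ap to p; ap⁻ to p⁻)
  module Fw = Rotation p S
  module Bw = Rotation p⁻ S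

  find : ∀ h → S h → ∃ (Fw.Rotate (p h))
  find h s = let r , _ , e = Orbits.return P h in Fw.rotate-exists S? r (trans (iter-suc p r h) e) s

  ret : Fin n → Fin n
  ret h with S? h
  ... | yes s = proj₁ (find h s)
  ... | no _ = h

  ret-rotate : ∀ h → S h → Fw.Rotate (p h) (ret h)
  ret-rotate h s with S? h
  ... | yes s' = proj₂ (find h s')
  ... | no ns = ⊥-elim (ns s)

  -- Reads a forward search backwards, with the part already reversed as accumulator: the elements
  -- passed are outside `S`, so the backward search from just before `x` ends where the one from `u`
  -- ends.
  rev : ∀ {u h x} → Bw.Rotate u h → Fw.Rotate (p u) x → Bw.Rotate (p⁻ x) h
  rev {u} {h} b (Rotation.here _) = subst (λ z → Bw.Rotate z h) (sym (left u)) b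
  rev {u} {h} b (Rotation.turn ns r) = rev (Bw.turn ns (subst (λ z → Bw.Rotate z h) (sym (left u)) b)) r

module Opening {n d} (M : RMap n) (OD : OuterData d M) (1≤d : 1 ≤ d) (f : AccFlow d M) where
  open RMap M
  open Inner M
  open OuterData OD
  open AccFlow f

  Pos : Fin n → Set
  Pos h = 0ℤ < a h

  Pos? : ∀ h → Dec (Pos h)
  Pos? h = 0ℤ ZP.<? a h

  pos-InV : ∀ {h} → Pos h → InV h
  pos-InV {h} p o = ZP.<⇒≢ p (sym (a-out h o))

  nonpos : ∀ {h} → ¬ Pos h → a h ≡ 0ℤ
  nonpos {h} np = ZP.≤-antisym (ZP.≮⇒≥ np) (a≥0 h)

  -- Here complementarity enters: the black half-edge over a dart with positive `a` becomes a bud,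
  -- which must have weight 0.
  pos-b : ∀ {h} → Pos h → b h ≡ 0ℤ
  pos-b {h} p with complementary h (proj₁ (InV-InE (pos-InV p)))
  ... | inj₁ e = ⊥-elim (ZP.<⇒≢ p (sym e))
  ... | inj₂ e = e

  open Enum₂ (enum InF?) (enum Pos?)

  module Nx = FirstReturn rot Pos?
  module Pv = FirstReturn (inverse rot) Pos?

  pv-nx : ∀ h → Pos h → Pv.ret (Nx.ret h) ≡ h
  pv-nx h p = Nx.Bw.rotate-fun (Pv.ret-rotate _ (Nx.Fw.rotate-S (Nx.ret-rotate h p))) (Nx.rev (Nx.Bw.here p) (Nx.ret-rotate h p))

  nx-pv : ∀ h → Pos h → Nx.ret (Pv.ret h) ≡ h
  nx-pv h p = Nx.Fw.rotate-fun (Nx.ret-rotate _ (Pv.Fw.rotate-S (Pv.ret-rotate h p))) (Pv.rev (Pv.Bw.here p) (Pv.ret-rotate h p))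

  rotS rotS⁻ : Fin n ⊎ Fin n → Fin n ⊎ Fin n
  rotS (inj₁ h) = inj₁ (fc h)
  -- The previous positive dart, since white vertices turn against the map.
  rotS (inj₂ h) = inj₂ (Pv.ret h)
  rotS⁻ (inj₁ h) = inj₁ (fc⁻ h)
  rotS⁻ (inj₂ h) = inj₂ (Nx.ret h)

  rotS-ok : ∀ s → Holds s → Holds (rotS s)
  rotS-ok (inj₁ h) i = InF-~ F.~-step i
  rotS-ok (inj₂ h) p = Pv.Fw.rotate-S (Pv.ret-rotate h p)

  rotS⁻-ok : ∀ s → Holds s → Holds (rotS⁻ s)
  rotS⁻-ok (inj₁ h) i = InF-~ F.~-prev i
  rotS⁻-ok (inj₂ h) p = Nx.Fw.rotate-S (Nx.ret-rotate h p)

  actD : ∀ h → Dec (Pos h) → Fin n ⊎ Fin n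
  actD h (yes _) = inj₂ h
  actD h (no _) = inj₁ h

  act : Fin n → Fin n ⊎ Fin n
  act h = actD h (Pos? h)

  act-pos : ∀ {h} → Pos h → act h ≡ inj₂ h
  act-pos {h} p = aux (Pos? h)
    where
    aux : ∀ q → actD h q ≡ inj₂ h
    aux (yes _) = refl
    aux (no np) = ⊥-elim (np p)

  act-non : ∀ {h} → ¬ Pos h → act h ≡ inj₁ h
  act-non {h} np = aux (Pos? h)
    where
    aux : ∀ q → actD h q ≡ inj₁ h
    aux (yes p) = ⊥-elim (np p)
    aux (no _) = refl

  act-ok : ∀ h → ¬ Outer h → Holds (act h)
  act-ok h i = aux (Pos? h)
    where
    aux : ∀ q → Holds (actD h q)
    aux (yes p) = p
    aux (no _) = i

  under : Fin n ⊎ Fin n → Fin n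
  under = [ id , id ]′

  under-act : ∀ h → under (act h) ≡ h
  under-act h = aux (Pos? h)
    where
    aux : ∀ q → under (actD h q) ≡ h
    aux (yes _) = refl
    aux (no _) = refl

  BudS : Fin n ⊎ Fin n → Set
  BudS (inj₁ h) = Pos h ⊎ Outer (inv h)
  BudS (inj₂ h) = ⊥

  BudS? : ∀ s → Dec (BudS s)
  BudS? (inj₁ h) = Pos? h ⊎-dec Outer? (inv h)
  BudS? (inj₂ h) = no id

  live-InE : ∀ s → Holds s → ¬ BudS s → InE (under s)
  live-InE (inj₁ h) i nb = i , nb ∘ inj₂
  live-InE (inj₂ h) p nb = InV-InE (pos-InV p)

  live-act : ∀ s → Holds s → ¬ BudS s → act (under s) ≡ s
  live-act (inj₁ h) i nb = act-non (nb ∘ inj₁)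
  live-act (inj₂ h) p nb = act-pos p

  act-live : ∀ h → InE h → ¬ BudS (act h)
  act-live h i = aux (Pos? h)
    where
    aux : ∀ q → ¬ BudS (actD h q)
    aux (yes p) ()
    aux (no np) (inj₁ p) = np p
    aux (no np) (inj₂ o) = proj₂ i o

  invD : ∀ s → Dec (BudS s) → Fin n ⊎ Fin n
  invD s (yes _) = s
  invD s (no _) = act (inv (under s))

  invS : Fin n ⊎ Fin n → Fin n ⊎ Fin n
  invS s = invD s (BudS? s)

  invS-bud : ∀ s → BudS s → invS s ≡ s
  invS-bud s bs = aux (BudS? s)
    where
    aux : ∀ q → invD s q ≡ s
    aux (yes _) = refl
    aux (no nb) = ⊥-elim (nb bs)

  invS-live : ∀ s → ¬ BudS s → invS s ≡ act (inv (under s))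
  invS-live s nb = aux (BudS? s)
    where
    aux : ∀ q → invD s q ≡ act (inv (under s))
    aux (yes bs) = ⊥-elim (nb bs)
    aux (no _) = refl

  invS-ok : ∀ s → Holds s → Holds (invS s)
  invS-ok s q = aux (BudS? s)
    where
    aux : ∀ c → Holds (invD s c)
    aux (yes _) = q
    aux (no nb) = act-ok _ (proj₂ (live-InE s q nb))

  invS-invS : ∀ s → Holds s → invS (invS s) ≡ s
  invS-invS s q = aux (BudS? s)
    where
    aux : Dec (BudS s) → invS (invS s) ≡ s
    aux (yes bs) = trans (cong invS (invS-bud s bs)) (invS-bud s bs)
    aux (no nb) = trans (cong invS (invS-live s nb)) (trans (invS-live (act (inv (under s))) (act-live _ (InE-inv (live-InE s q nb))))
      (trans (cong (λ h → act (inv h)) (under-act (inv (under s)))) (trans (cong act (inv-inv (under s))) (live-act s q nb))))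

  BudS-fix : ∀ s → Holds s → invS s ≡ s → BudS s
  BudS-fix s q e = aux (BudS? s)
    where
    aux : Dec (BudS s) → BudS s
    aux (yes bs) = bs
    aux (no nb) = ⊥-elim (fpf (under s) (trans (sym (under-act (inv (under s)))) (cong under (trans (sym (invS-live s nb)) e))))

  colS : Fin n ⊎ Fin n → Color
  colS (inj₁ _) = black
  colS (inj₂ _) = white

  wtS : Fin n ⊎ Fin n → ℤ
  wtS (inj₁ h) = - b h
  wtS (inj₂ h) = a h

  colS-rot : ∀ s → colS (rotS s) ≡ colS s
  colS-rot (inj₁ _) = refl
  colS-rot (inj₂ _) = refl

  invX : Fin size → Fin size
  invX = lift invS invS-ok

  isBud : ∀ i → invX i ≡ i → BudS (el i)
  isBud i e = BudS-fix (el i) (el-ok i) (trans (sym (el-lift invS invS-ok i)) (cong el e))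

  isLive : ∀ i → invX i ≢ i → ¬ BudS (el i)
  isLive i ne bs = ne (el-inj (trans (el-lift invS invS-ok i) (invS-bud (el i) bs)))

  T₀ : RMob size
  T₀ = record
    { rotT = record { ap = lift rotS rotS-ok ; ap⁻ = lift rotS⁻ rotS⁻-ok
        ; left = lift-lift rotS rotS⁻ rotS-ok rotS⁻-ok (λ { (inj₁ h) _ → cong inj₁ (Perm.left face h) ; (inj₂ h) p → cong inj₂ (nx-pv h p) })
        ; right = lift-lift rotS⁻ rotS rotS⁻-ok rotS-ok (λ { (inj₁ h) _ → cong inj₁ (Perm.right face h) ; (inj₂ h) p → cong inj₂ (pv-nx h p) }) }
    ; invT = invX
    ; invT-inv = lift-lift invS invS invS-ok invS-ok invS-invS
    ; col = colS ∘ el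
    ; col-rot = λ i → trans (cong colS (el-lift rotS rotS-ok i)) (colS-rot (el i))
    ; bud-bl = λ i e → bb (el i) (isBud i e)
    ; wt = wtS ∘ el
    ; bud-wt = λ i e → bw (el i) (el-ok i) (isBud i e)
    ; wh-pos = λ i _ c → wp (el i) (el-ok i) c
    ; bl-nonpos = λ i _ c → bn (el i) c }
    where
    bb : ∀ s → BudS s → colS s ≡ black
    bb (inj₁ _) _ = refl
    bw : ∀ s → Holds s → BudS s → wtS s ≡ 0ℤ
    bw (inj₁ h) i (inj₁ p) = cong -_ (pos-b p)
    bw (inj₁ h) i (inj₂ o) = cong -_ (b-out h (λ e → proj₂ e o))
    wp : ∀ s → Holds s → colS s ≡ white → 0ℤ < wtS s
    wp (inj₂ h) p _ = p
    bn : ∀ s → colS s ≡ black → wtS s ≤ᶻ 0ℤ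
    bn (inj₁ h) _ = ZP.neg-mono-≤ (b≥0 h)

  open RMob T₀

  κ₀ : Fin size → Fin n
  κ₀ i = under (el i)

  OverW : Fin n → Set
  OverW h = Σ (Fin size) λ x → col x ≡ white × κ₀ x ≡ h

  over→pos : ∀ {h} → OverW h → Pos h
  over→pos (x , c , refl) = aux (el x) (el-ok x) c
    where
    aux : ∀ s → Holds s → colS s ≡ white → Pos (under s)
    aux (inj₂ h) p _ = p

  pos→over : ∀ {h} → Pos h → OverW h
  pos→over {h} p = mk (inj₂ h) p , cong colS (el-mk (inj₂ h) p) , cong under (el-mk (inj₂ h) p)

  module RS = Rotation rt (λ h → OverW h ⊎ Outer (inv h))

  rotate-stop : ∀ {h x} → InV h → Nx.Fw.Rotate h x → RS.Rotate h x
  rotate-stop i (Rotation.here p) = RS.here (inj₁ (pos→over p))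
  rotate-stop i (Rotation.turn np r) = RS.turn (λ { (inj₁ o) → np (over→pos o) ; (inj₂ o) → proj₂ (InV-InE i) o }) (rotate-stop (InV-~ V.~-step i) r)

  corr : Corr M T₀
  corr = record
    { κ = κ₀
    ; κ-inj = λ {x} {y} c e → el-inj (ki (el x) (el y) c e)
    ; black-in = λ {x} c → bi (el x) (el-ok x) c
    ; black-over = λ h i → mk (inj₁ h) i , cong colS (el-mk (inj₁ h) i) , cong under (el-mk (inj₁ h) i)
    ; white-in = λ {x} c → pos-InV (over→pos (x , c , refl))
    ; white-over = wo
    ; rot-black = λ {x} c → trans (cong under (el-lift rotS rotS-ok x)) (rb (el x) c)
    ; rot-white = λ {x} c → rw (el x) (el-ok x) c (cong under (el-lift rotS rotS-ok x))
    ; bud-stop = λ {x} e → bs (el x) (isBud x e)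
    ; stop-bud = λ {x} c s → el-inj (trans (el-lift invS invS-ok x) (invS-bud (el x) (sb (el x) c s)))
    ; over-edge = λ {x} ne → trans (cong under (trans (el-lift invS invS-ok x) (invS-live (el x) (isLive x ne)))) (under-act _) }
    where
    ki : ∀ s t → colS s ≡ colS t → under s ≡ under t → s ≡ t
    ki (inj₁ _) (inj₁ _) _ e = cong inj₁ e
    ki (inj₂ _) (inj₂ _) _ e = cong inj₂ e
    bi : ∀ s → Holds s → colS s ≡ black → ¬ Outer (under s)
    bi (inj₁ h) i _ = i
    rb : ∀ s → colS s ≡ black → under (rotS s) ≡ fc (under s)
    rb (inj₁ h) _ = refl
    rw : ∀ s → Holds s → colS s ≡ white → ∀ {g} → g ≡ under (rotS s) → RS.Rotate (rt g) (under s)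
    rw (inj₂ h) p _ refl = rotate-stop (InV-~ V.~-step (pos-InV (Pv.Fw.rotate-S (Pv.ret-rotate h p)))) (Pv.rev (Pv.Bw.here p) (Pv.ret-rotate h p))
    bs : ∀ s → BudS s → OverW (under s) ⊎ Outer (inv (under s))
    bs (inj₁ h) (inj₁ p) = inj₁ (pos→over p)
    bs (inj₁ h) (inj₂ o) = inj₂ o
    sb : ∀ s → colS s ≡ black → OverW (under s) ⊎ Outer (inv (under s)) → BudS s
    sb (inj₁ h) _ (inj₁ o) = inj₁ (over→pos o)
    sb (inj₁ h) _ (inj₂ o) = inj₂ o
    pos-factor : ∀ {P : Set} (q : Dec P) {v} → 0ℤ < 𝟙 q * v → P × 0ℤ < v
    pos-factor (yes p) {v} l = p , subst (0ℤ <_) (ZP.*-identityˡ v) l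
    pos-factor (no _) (+<+ ())
    wo : ∀ h → InV h → Σ (Fin size) λ x → col x ≡ white × κ₀ x V.~ h
    -- The weights `a` sum to `d ≥ 1` around an inner vertex, so one of them is positive and the
    -- vertex appears in the mobile.
    wo h i with ∑-pos _ (subst (0ℤ <_) (sym (at-vertex h i)) (+<+ 1≤d))
    ... | y , l = let s , p = pos-factor (h V.~? y) l ; x , c , e = pos→over p in x , c , subst (V._~ h) (sym e) (V.~-sym s)

  open CorrFacts corr

  over-a : ∀ h → over white wt h ≡ a h
  over-a h = aux (Pos? h)
    where
    aux : Dec (Pos h) → over white wt h ≡ a h
    aux (yes p) = let x = mk (inj₂ h) p ; e = el-mk (inj₂ h) p in trans (cong (over white wt) (sym (cong under e))) (trans (over-at wt x (cong colS e)) (cong wtS e))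
    aux (no np) = trans (over-none wt h (np ∘ over→pos)) (sym (nonpos np))

  over-b : ∀ h → ¬ Outer h → over black wt h ≡ - b h
  over-b h i = let x = mk (inj₁ h) i ; e = el-mk (inj₁ h) i in trans (cong (over black wt) (sym (cong under e))) (trans (over-at wt x (cong colS e)) (cong wtS e))

  branch : Branch d T₀
  branch = record
    { edge-w = λ x nb → ew (el x) (el-ok x) (isLive x nb) (el-lift invS invS-ok x)
    ; white-w = λ x c → trans (sym (white-clsum wt c)) (trans (∑-cong (λ y → cong (λ z → 𝟙 (κ₀ x V.~? y) * z) (over-a y))) (at-vertex (κ₀ x) (Corr.white-in corr c)))
    ; black-w = λ x c → trans (cong₂ _+_ (sym (degree c)) (sym (black-clsum wt c))) (trans (sym (∑-+ _ _)) (trans (∑-cong (λ y → bwl x c y)) (at-face (κ₀ x) (Corr.black-in corr c)))) }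
    where
    wt-act : ∀ h → wtS (act h) ≡ a h - b h
    wt-act h = aux (Pos? h)
      where
      aux : ∀ q → wtS (actD h q) ≡ a h - b h
      aux (yes p) = sym (trans (cong (λ z → a h - z) (pos-b p)) (ZP.+-identityʳ (a h)))
      aux (no np) = sym (trans (cong (_- b h) (nonpos np)) (ZP.+-identityˡ (- b h)))
    alg : ∀ a b a' b' → (a - b) + (a' - b') ≡ a + a' - (b + b')
    alg = solve-∀
    ew : ∀ s → Holds s → ¬ BudS s → ∀ {t} → t ≡ invS s → wtS s + wtS t ≡ + d - + 2
    ew s q nb refl = trans (cong₂ _+_ (trans (cong wtS (sym (live-act s q nb))) (wt-act (under s))) (trans (cong wtS (invS-live s nb)) (wt-act (inv (under s))))) (trans (alg (a (under s)) _ _ _) (at-edge (under s) (live-InE s q nb)))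
    lem : ∀ u v → u + u * - v ≡ u * (1ℤ - v)
    lem = solve-∀
    bwl : ∀ x → col x ≡ black → ∀ y → 𝟙 (κ₀ x F.~? y) + 𝟙 (κ₀ x F.~? y) * over black wt y ≡ 𝟙 (κ₀ x F.~? y) * (1ℤ - b y)
    bwl x c y = trans (cong (λ z → 𝟙 (κ₀ x F.~? y) + z) (𝟙-*cong (κ₀ x F.~? y) (λ s → over-b y (InF-~ s (Corr.black-in corr c))))) (lem (𝟙 (κ₀ x F.~? y)) (b y))

-- Connectedness of the mobile of an accessible flow

module Components {m} (G : Graph m) where
  open Graph G
  module X (r : Fin m) = Explore G r

  _≈_ : Fin m → Fin m → Set
  x ≈ y = X.Reached x y

  ≈-refl : ∀ {x} → x ≈ x
  ≈-refl {x} = X.reached-root x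

  ≈-trans : ∀ {x y z} → x ≈ y → y ≈ z → x ≈ z
  ≈-trans {x} {y} a b = X.reached-ind y {x ≈_} a (X.reached-~ x) (X.reached-inv x) b

  ≈-sym : ∀ {x y} → x ≈ y → y ≈ x
  ≈-sym {x} = X.reached-ind x {λ y → y ≈ x} ≈-refl
    (λ {y} {z} s q → ≈-trans (X.reached-~ z (Orb.~-sym vert s) ≈-refl) q)
    (λ {y} e q → ≈-trans (subst (inv y ≈_) (inv-inv y) (X.reached-inv (inv y) (Ed-inv e) ≈-refl)) q)

  comps : DecEquiv m
  comps = record { _~_ = _≈_ ; _~?_ = λ x y → X.Reached? x y ; ~-refl = λ {x} → ≈-refl {x} ; ~-sym = ≈-sym ; ~-trans = ≈-trans }

two-colours : ∀ {A B C D : Set} (k : Dec A) (w : Dec B) (b : Dec C) (q : Dec D) → (A → ¬ B) → (¬ A → ¬ ¬ B) →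
  𝟙 (k ×-dec q) + 𝟙 (w ×-dec q) ≡ 𝟙 (b ×-dec q) + 𝟙 (¬? b ×-dec q)
two-colours {A} {B} {_} {D} k w b q f g = trans (𝟙-⊎ (k ×-dec q) (w ×-dec q) (λ a c → f (proj₁ a) (proj₁ c))) (trans (𝟙-cong ((k ×-dec q) ⊎-dec (w ×-dec q)) q (λ { (inj₁ a) → proj₂ a ; (inj₂ a) → proj₂ a }) (pick k w))
    (trans (𝟙-cong q ((b ×-dec q) ⊎-dec (¬? b ×-dec q)) (part b) (λ { (inj₁ a) → proj₂ a ; (inj₂ a) → proj₂ a })) (sym (𝟙-⊎ (b ×-dec q) (¬? b ×-dec q) (λ a c → proj₁ c (proj₁ a))))))
  where
  pick : Dec A → Dec B → D → (A × D) ⊎ (B × D)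
  pick (yes a) _ d = inj₁ (a , d)
  pick (no na) (yes b) d = inj₂ (b , d)
  pick (no na) (no nb) d = ⊥-elim (g na nb)
  part : ∀ {C D : Set} → Dec C → D → (C × D) ⊎ (¬ C × D)
  part (yes c) d = inj₁ (c , d)
  part (no nc) d = inj₂ (nc , d)

nb-white : ∀ {c} → c ≢ black → c ≡ white
nb-white {black} n = ⊥-elim (n refl)
nb-white {white} _ = refl

module TreeComponent {m d} (T : RMob m) (B : Branch d T) (1≤d : 1 ≤ d)
  (tree : + 2 * count (RMob.W.Rep? T) ≡ count (λ x → ¬? (RMob.Bud? T x)) + + 2) where
  open RMob T
  open Branch B
  open Components skeleton
  module K = Classes comps

  NB? : ∀ x → Dec (¬ Bud x)
  NB? x = ¬? (Bud? x)

  Half? : ∀ x → Dec (¬ Bud x × toℕ x <ℕ toℕ (invT x))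
  Half? x = NB? x ×-dec (toℕ x NP.<? toℕ (invT x))

  halves : ∀ {Q : Fin m → Set} (Q? : ∀ x → Dec (Q x)) → (∀ {x} → Q x → Q (invT x)) →
    count (λ x → NB? x ×-dec Q? x) ≡ + 2 * count (λ x → Half? x ×-dec Q? x)
  halves {Q} Q? cl = trans (∑-cong split) (trans (∑-+ _ (λ x → 𝟙 (Half? (invT x) ×-dec Q? (invT x)))) (trans (cong (λ z → count HQ? + z) (∑-perm invT invT invT-inv invT-inv (λ x → 𝟙 (HQ? x)))) (two (count HQ?))))
    where
    HQ? : ∀ x → Dec ((¬ Bud x × toℕ x <ℕ toℕ (invT x)) × Q x)
    HQ? x = Half? x ×-dec Q? x
    two : ∀ x → x + x ≡ + 2 * x
    two = solve-∀
    back : ∀ {x} → Q (invT x) → Q x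
    back {x} q = subst Q (invT-inv x) (cl q)
    cmp : ∀ x → ¬ Bud x → toℕ x <ℕ toℕ (invT x) ⊎ toℕ (invT x) <ℕ toℕ (invT (invT x))
    cmp x nb with toℕ x NP.<? toℕ (invT x)
    ... | yes l = inj₁ l
    ... | no nl = inj₂ (subst (λ z → toℕ (invT x) <ℕ toℕ z) (sym (invT-inv x)) (NP.≤∧≢⇒< (NP.≮⇒≥ nl) (λ e → nb (FP.toℕ-injective e))))
    split : ∀ x → 𝟙 (NB? x ×-dec Q? x) ≡ 𝟙 (HQ? x) + 𝟙 (HQ? (invT x))
    split x = trans (𝟙-cong (NB? x ×-dec Q? x) (HQ? x ⊎-dec HQ? (invT x))
        (λ { (nb , q) → Data.Sum.map (λ l → (nb , l) , q) (λ l → (Graph.Ed-inv skeleton nb , l) , cl q) (cmp x nb) })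
        (λ { (inj₁ ((nb , _) , q)) → nb , q ; (inj₂ ((nb , _) , q)) → (λ b → nb (cong invT b)) , back q }))
      (sym (𝟙-⊎ (HQ? x) (HQ? (invT x)) (λ { ((_ , l) , _) ((_ , l') , _) → NP.<-asym l (subst (λ z → toℕ (invT x) <ℕ toℕ z) (invT-inv x) l') })))

  pos-factor : ∀ {P : Set} (q : Dec P) {v} → 0ℤ < 𝟙 q * v → 0ℤ < v
  pos-factor (yes p) {v} l = subst (0ℤ <_) (ZP.*-identityˡ v) l
  pos-factor (no _) (+<+ ())

  inv-reached : ∀ r {x} → X.Reached r x → X.Reached r (invT x)
  inv-reached r {x} q = case Bud? x of λ where
    (yes b) → subst (X.Reached r) (sym b) q
    (no nb) → X.reached-inv r nb q

  opaque
    -- Vertices minus edges, summed over the components, is 1, so some component has value at least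
    -- 1; by `tree-covered` all its edges are tree edges.
    component : ∃ λ r → count (λ h → NB? h ×-dec X.Reached? r h) + + 2 ≤ᶻ + 2 * W.#cls (X.Reached? r)
    component = let r , l = ∑-pos _ (subst (0ℤ <_) (trans (sym total) (K.∑-classes g)) (+<+ (s≤s z≤n))) in r , bound r (pos-factor (K.Rep? r) l)
      where
      g : Fin m → ℤ
      g x = 𝟙 (W.Rep? x) - 𝟙 (Half? x)
      total : ∑ g ≡ 1ℤ
      total = trans (∑-sub _ (λ x → 𝟙 (Half? x))) (half (count W.Rep?) (count Half?) (trans tree (cong (_+ + 2) all)))
        where
        all : count NB? ≡ + 2 * count Half?
        all = trans (count-cong NB? (λ x → NB? x ×-dec yes tt) (λ _ n → n , tt) (λ _ → proj₁)) (trans (halves {λ _ → ⊤} (λ _ → yes tt) (λ _ → tt)) (cong (λ z → + 2 * z) (count-cong (λ x → Half? x ×-dec yes tt) Half? (λ _ → proj₁) (λ _ n → n , tt))))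
        half : ∀ v e → + 2 * v ≡ + 2 * e + + 2 → v - e ≡ 1ℤ
        half v e p = ZP.*-cancelˡ-≡ (+ 2) (v - e) 1ℤ (trans (alg v e) (trans (cong (_- + 2 * e) p) (alg₂ e)))
          where
          alg : ∀ v e → + 2 * (v - e) ≡ + 2 * v - + 2 * e
          alg = solve-∀
          alg₂ : ∀ e → + 2 * e + + 2 - + 2 * e ≡ + 2 * 1ℤ
          alg₂ = solve-∀
      module _ (r : Fin m) (l : 0ℤ < K.clsum r g) where
        V E : ℤ
        V = W.#cls (X.Reached? r)
        E = count (λ x → Half? x ×-dec X.Reached? r x)
        diff : K.clsum r g ≡ V - E
        diff = trans (∑-cong (λ x → trans (alg (𝟙 (X.Reached? r x)) (𝟙 (W.Rep? x)) (𝟙 (Half? x))) (cong₂ _-_ (sym (𝟙-× (W.Rep? x) (X.Reached? r x))) (sym (𝟙-× (Half? x) (X.Reached? r x)))))) (∑-sub (λ x → 𝟙 (W.Rep? x ×-dec X.Reached? r x)) (λ x → 𝟙 (Half? x ×-dec X.Reached? r x)))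
          where
          alg : ∀ k v e → k * (v - e) ≡ v * k - e * k
          alg = solve-∀
        one : 1ℤ ≤ᶻ V - E
        one = ZP.i<j⇒suc[i]≤j (subst (0ℤ <_) diff l)
        bound : count (λ h → NB? h ×-dec X.Reached? r h) + + 2 ≤ᶻ + 2 * V
        bound = ZP.≤-trans (ZP.≤-reflexive (trans (cong (_+ + 2) (halves (X.Reached? r) (inv-reached r))) (alg E))) (ZP.*-monoˡ-≤-nonNeg (+ 2) (ZP.≤-trans (ZP.+-monoʳ-≤ E one) (ZP.≤-reflexive (alg₂ E V))))
          where
          alg : ∀ e → + 2 * e + + 2 ≡ + 2 * (e + 1ℤ)
          alg = solve-∀
          alg₂ : ∀ e v → e + (v - e) ≡ v
          alg₂ = solve-∀

  module Excess (r : Fin m) (few : count (λ h → NB? h ×-dec X.Reached? r h) + + 2 ≤ᶻ + 2 * W.#cls (X.Reached? r)) where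
    module Xr = X r
    module TC = TreeContour r
    single : ∀ {t} → Xr.Reached t → r C.~ t
    single = TC.contour-single few

    R? : ∀ x → Dec (Xr.Reached x)
    R? = Xr.Reached?
    Bl? : ∀ x → Dec (col x ≡ black)
    Bl? x = col x ≟ᶜ black
    Wh? : ∀ x → Dec (col x ≡ white)
    Wh? x = col x ≟ᶜ white

    inv-R : ∀ {x} → Xr.Reached x → Xr.Reached (invT x)
    inv-R = inv-reached r

    cN cB cW cK : ℤ
    cN = count (λ h → NB? h ×-dec R? h)
    cB = count (λ h → Bud? h ×-dec R? h)
    cW = count (λ h → Wh? h ×-dec R? h)
    cK = count (λ h → Bl? h ×-dec R? h)

    by-vertices : ∑ (λ x → 𝟙 (R? x) * (wt x + 𝟙 (Bl? x))) ≡ + d * W.#cls R?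
    by-vertices = W.∑-const R? Xr.reached-~ (λ x → wt x + 𝟙 (Bl? x)) (+ d) (λ x _ → at x)
      where
      dist' : ∀ u v w → u * (v + w) ≡ u * v + u * w
      dist' = solve-∀
      col-~ : ∀ {c x y} → x W.~ y → col x ≡ c → col y ≡ c
      col-~ {c} = W.closed-~ {λ z → col z ≡ c} (λ z e → trans (col-rot z) e)
      at : ∀ x → W.clsum x (λ x → wt x + 𝟙 (Bl? x)) ≡ + d
      at x = trans (∑-cong (λ y → dist' (𝟙 (x W.~? y)) (wt y) (𝟙 (Bl? y)))) (trans (∑-+ (λ y → 𝟙 (x W.~? y) * wt y) (λ y → 𝟙 (x W.~? y) * 𝟙 (Bl? y))) (aux (Bl? x)))
        where
        aux : Dec (col x ≡ black) → W.clsum x wt + W.clsum x (λ y → 𝟙 (Bl? y)) ≡ + d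
        aux (yes c) = trans (ZP.+-comm (W.clsum x wt) _) (trans (cong (_+ W.clsum x wt) (∑-cong (λ y → trans (𝟙-*cong (x W.~? y) (λ s → 𝟙-yes (Bl? y) (col-~ s c))) (ZP.*-identityʳ _)))) (black-w x c))
        aux (no nc) = trans (cong₂ _+_ (white-w x (nb-white nc)) (∑-zero (λ y → trans (𝟙-*cong (x W.~? y) (λ s → 𝟙-no (Bl? y) (λ c → nc (col-~ (W.~-sym s) c)))) (ZP.*-zeroʳ (𝟙 (x W.~? y)))))) (ZP.+-identityʳ (+ d))

    by-edges : + 2 * ∑ (λ x → 𝟙 (R? x) * wt x) ≡ (+ d - + 2) * cN
    by-edges = trans (two (∑ (λ x → 𝟙 (R? x) * wt x))) (trans (cong (λ z → ∑ (λ x → 𝟙 (R? x) * wt x) + z) (sym (∑-perm invT invT invT-inv invT-inv (λ x → 𝟙 (R? x) * wt x)))) (trans (sym (∑-+ _ _)) (trans (∑-cong row) (∑-* (+ d - + 2) _))))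
      where
      two : ∀ x → + 2 * x ≡ x + x
      two = solve-∀
      alg : ∀ r u v → r * u + r * v ≡ r * (u + v)
      alg = solve-∀
      row : ∀ x → 𝟙 (R? x) * wt x + 𝟙 (R? (invT x)) * wt (invT x) ≡ (+ d - + 2) * 𝟙 (NB? x ×-dec R? x)
      row x = trans (cong (λ z → 𝟙 (R? x) * wt x + z * wt (invT x)) (𝟙-cong (R? (invT x)) (R? x) (λ q → subst Xr.Reached (invT-inv x) (inv-R q)) inv-R)) (trans (alg (𝟙 (R? x)) (wt x) (wt (invT x))) (trans (aux (Bud? x)) (trans (com (𝟙 (NB? x)) (𝟙 (R? x)) (+ d - + 2)) (cong (λ z → (+ d - + 2) * z) (sym (𝟙-× (NB? x) (R? x)))))))
        where
        com : ∀ n r c → r * (n * c) ≡ c * (n * r)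
        com = solve-∀
        aux : Dec (Bud x) → 𝟙 (R? x) * (wt x + wt (invT x)) ≡ 𝟙 (R? x) * (𝟙 (NB? x) * (+ d - + 2))
        aux (yes b) = cong (λ z → 𝟙 (R? x) * z) (trans (cong₂ _+_ (bud-wt x b) (trans (cong wt b) (bud-wt x b))) (sym (off (NB? x) (λ n → n b))))
        aux (no nb) = cong (λ z → 𝟙 (R? x) * z) (trans (edge-w x nb) (sym (on (NB? x) nb)))

    colours : cK + cW ≡ cB + cN
    colours = trans (sym (∑-+ _ _)) (trans (∑-cong (λ x → two-colours (Bl? x) (Wh? x) (Bud? x) (R? x) black≢white (λ k w → w (nb-white k)))) (∑-+ _ (λ x → 𝟙 (NB? x ×-dec R? x))))

    -- The total weight of the component in two ways: a vertex contributes `d` once each of its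
    -- black half-edges counts 1 more, an edge contributes `d - 2`. Here `cB`, `cW`, `cK`, `cN`
    -- count buds, white, black and non-bud half-edges, so `cK + cW = cB + cN`. For a tree the right
    -- side is `2 d`: there are `d` more buds than openings.
    balance : + 2 * (cB - cW) ≡ + d * (+ 2 * W.#cls R? - cN)
    balance = fin (+ d) (W.#cls R?) cN cB cW cK (∑ (λ x → 𝟙 (R? x) * wt x)) (trans (sym sumK) by-vertices) by-edges colours
      where
      sumK : ∑ (λ x → 𝟙 (R? x) * (wt x + 𝟙 (Bl? x))) ≡ ∑ (λ x → 𝟙 (R? x) * wt x) + cK
      sumK = trans (∑-cong (λ x → trans (alg (𝟙 (R? x)) (wt x) (𝟙 (Bl? x))) (cong (λ z → 𝟙 (R? x) * wt x + z) (sym (𝟙-× (Bl? x) (R? x)))))) (∑-+ _ _)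
        where
        alg : ∀ r w k → r * (w + k) ≡ r * w + k * r
        alg = solve-∀
      fin : ∀ D V N B W K S → S + K ≡ D * V → + 2 * S ≡ (D - + 2) * N → K + W ≡ B + N → + 2 * (B - W) ≡ D * (+ 2 * V - N)
      fin D V N B W K S e₁ e₂ e₃ = trans (lem₁ B W K) (trans (cong (λ z → + 2 * (B - (z - K))) e₃) (trans (lem₂ B N K) (trans (lem₃ K N S) (trans (cong₂ (λ u v → + 2 * u - v - + 2 * N) e₁ e₂) (lem₄ D V N)))))
        where
        lem₁ : ∀ B W K → + 2 * (B - W) ≡ + 2 * (B - (K + W - K))
        lem₁ = solve-∀
        lem₂ : ∀ B N K → + 2 * (B - (B + N - K)) ≡ + 2 * (K - N)
        lem₂ = solve-∀
        lem₃ : ∀ K N S → + 2 * (K - N) ≡ + 2 * (S + K) - + 2 * S - + 2 * N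
        lem₃ = solve-∀
        lem₄ : ∀ D V N → + 2 * (D * V) - (D - + 2) * N - + 2 * N ≡ D * (+ 2 * V - N)
        lem₄ = solve-∀

    opens-white : count (λ x → Opens? x ×-dec R? x) ≡ cW
    opens-white = trans (count-cong (λ x → Opens? x ×-dec R? x) (λ x → Wh? (invT x) ×-dec R? (invT x)) (λ { x ((_ , c) , q) → c , inv-R q })
        (λ { x (c , q) → ((λ b → black≢white (trans (cong col b) (bud-bl x b)) c) , c) , subst Xr.Reached (invT-inv x) (inv-R q) }))
      (∑-perm invT invT invT-inv invT-inv (λ x → 𝟙 (Wh? x ×-dec R? x)))

    more : cW < cB
    more = ZP.≰⇒> λ le → ZP.<⇒≱ gap (ZP.≤-trans (ZP.≤-reflexive (sym balance)) (ZP.≤-trans (ZP.*-monoˡ-≤-nonNeg (+ 2) (ZP.i≤j⇒i-j≤0 le)) ZP.≤-refl))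
      where
      gap : 0ℤ < + d * (+ 2 * W.#cls R? - cN)
      gap = ZP.<-≤-trans (pos* 1≤d) (ZP.*-monoˡ-≤-nonNeg (+ d) (ZP.≤-trans (ZP.≤-reflexive (alg cN)) (ZP.+-monoˡ-≤ (- cN) few)))
        where
        alg : ∀ n → + 2 ≡ n + + 2 - n
        alg = solve-∀
        pos* : ∀ {k} → 1 ≤ k → 0ℤ < + k * + 2
        pos* {suc k} _ = +<+ (s≤s z≤n)

    opaque
      bud-base : ∃ λ β → Bud β × r C.~ β × Unmatched β
      bud-base = base r (subst₂ _<_ (trans (sym opens-white) (class Opens?)) (class Bud?) more)
        where
        class : ∀ {Q : Fin m → Set} (Q? : ∀ x → Dec (Q x)) → count (λ x → Q? x ×-dec R? x) ≡ count (λ x → Q? x ×-dec (r C.~? x))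
        class Q? = count-cong (λ x → Q? x ×-dec R? x) (λ x → Q? x ×-dec (r C.~? x)) (λ { _ (q , s) → q , single s }) (λ { _ (q , s) → q , TC.~-reached s Xr.reached-root })

module DistBound {m} (T : RMob m) where
  open RMob T

  dist-~ : ∀ {β k y} → Dist β k y → y C.~ β
  dist-~ zero = C.~-refl
  dist-~ (suc _ D) = C.~-trans C.~-step (dist-~ D)

  dist-≤ : ∀ {β} t y → iter ρ t y ≡ β → ∀ {k} → Dist β k y → k ≤ t
  dist-≤ t y e zero = z≤n
  dist-≤ zero y e (suc ne D) = ⊥-elim (ne e)
  dist-≤ (suc t) y e (suc ne D) = s≤s (dist-≤ t (ρ y) (trans (iter-suc ρ t y) e) D)

  dist-bound : ∀ {β k y} → Dist β k y → k <ℕ m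
  dist-bound {y = y} D = let t , l , e = Orbits.~-short contour (dist-~ D) in NP.≤-<-trans (dist-≤ t y e D) l

-- a set of half-edges closed under the mobile's moves, on which every contour reading terminates
record Closed {m} (T : RMob m) : Set₁ where
  open RMob T
  field
    R : Fin m → Set
    R-C : ∀ {x y} → x C.~ y → R x → R y
    R-C' : ∀ {x y} → R x → R y → x C.~ y
    R-rT : ∀ {x} → R x → R (rT x)
    R-rT⁻ : ∀ {x} → R (rT x) → R x
    inv-R : ∀ {x} → R x → R (invT x)
    total : ∀ {y} → R y → ∃ (Run y)
    β : Fin m
    bβ : Bud β
    Rβ : R β

  R-inv⁻ : ∀ {x} → R (invT x) → R x
  R-inv⁻ {x} q = subst R (invT-inv x) (inv-R q)

  R-ρ⁻ : ∀ {x} → R (ρ x) → R x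
  R-ρ⁻ q = R-inv⁻ (R-rT⁻ q)

module Fill {n m d} {M : RMap n} (OD : OuterData d M) {T : RMob m} (K : Corr M T) (Z : Closed T)
  (access : (Q : Fin n → Set) → (∀ h → ¬ RMap.Outer M h → ¬ Corr.Over K white h → Q h → Q (RMap.rt M h)) →
     (∀ h → ¬ RMap.Outer M h → Q h → Q (RMap.fc M h)) → ∀ h → Q h → ∃ λ o → RMap.Outer M o × Q o) where
  open RMap M
  open Inner M
  open OuterData OD
  open RMob T
  open Corr K
  open CorrFacts K
  open DistBound T
  open Closed Z

  run-R : ∀ {y x} → Run y x → R y → R x
  run-R s = R-C (run-~ s)

  InR : Fin n → Set
  InR h = Σ (Fin m) λ x → col x ≡ black × κ x ≡ h × R x

  ρ-R : ∀ {x} → R x → R (ρ x)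
  ρ-R = R-C C.~-step

  InR-fc : ∀ h → InR h → InR (fc h)
  InR-fc h (x , c , refl , q) = rT x , trans (col-rot x) c , rot-black c , R-rT q

  -- If the opposite half-edge is white, the bud matched with this opening lies over the same dart
  -- and on the same contour.
  InR-across : ∀ {x} → ¬ Bud x → R x → InR (inv (κ x))
  InR-across {x} nb q with col (invT x) in c
  ... | black = invT x , c , over-edge nb , inv-R q
  ... | white = let γ , s = total (ρ-R q) in γ , bud-bl γ (run-bud s) , trans (match (nb , c) s) (over-edge nb) , run-R s (ρ-R q)

  Goal : Set
  Goal = Σ (Fin m) λ x → col x ≡ black × R x × Outer (inv (κ x))

  opaque
    -- A tight move stays over `R` until a bud facing the outer face is met: a turn around a vertex
    -- crosses the edge by `InR-across` and then follows the face beyond. An accessible walk ends on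
    -- an outer dart, over which there is no black half-edge, so such a bud must occur.
    goal : Goal
    goal with access (λ h → InR h ⊎ Goal) step (λ { h _ (inj₁ q) → inj₁ (InR-fc h q) ; h _ (inj₂ g) → inj₂ g }) (κ β) (inj₁ (β , bud-bl β bβ , refl , Rβ))
      where
      step : ∀ h → ¬ Outer h → ¬ Over white h → InR h ⊎ Goal → InR (rt h) ⊎ Goal
      step h _ nw (inj₂ g) = inj₂ g
      step h _ nw (inj₁ (x , c , refl , q)) with Bud? x
      ... | no nb = inj₁ (subst InR (cong rt (inv-inv (κ x))) (InR-fc (inv (κ x)) (InR-across nb q)))
      ... | yes b with bud-stop b
      ...   | inj₁ o = ⊥-elim (nw o)
      ...   | inj₂ o = inj₂ (x , c , q , o)
    ... | o , out , inj₂ g = g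
    ... | o , out , inj₁ (x , c , refl , _) = ⊥-elim (black-in c out)

  x₀ : Fin m
  x₀ = proj₁ goal
  c₀ : col x₀ ≡ black
  c₀ = proj₁ (proj₂ goal)
  R₀ : R x₀
  R₀ = proj₁ (proj₂ (proj₂ goal))
  o₀ : Outer (inv (κ x₀))
  o₀ = proj₂ (proj₂ (proj₂ goal))
  b₀ : Bud x₀
  b₀ = stop-bud c₀ (inj₂ o₀)
  u₀ : Unmatched x₀
  u₀ = outer-unmatched o₀

  At : ℕ → Fin n → Set
  At k h = Σ (Fin m) λ x → col x ≡ black × κ x ≡ h × R x × ∃ λ j → k ≤ j × Dist x₀ j x

  over-white≢x₀ : ∀ {z w} → col w ≡ white → κ w ≡ κ z → z ≢ x₀
  over-white≢x₀ c e refl = proj₂ (InV-InE (subst InV e (white-in c))) o₀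

  -- Induction on buds from the farthest to the nearest: distances to `x₀` are below `m`, and the
  -- fuel bounds how many larger ones remain. Turning back around the white vertex of `w` from the
  -- dart of `z`, white half-edges are met only across edges, and the buds over their darts are
  -- farther from `x₀` than `k`.
  Claim : ℕ → Set
  Claim fuel = ∀ {k z w} → m ≤ k +ℕ fuel → R z → Dist x₀ k z → col z ≡ black → col w ≡ white → κ w ≡ κ z → R w

  -- On the contour, `u` follows either `g` itself or, if `g` opens, the bud matched with it. That
  -- bud is farther than `u`, so the claim already applies to it and brings the white half-edge
  -- opposite `g`, hence `g`, into `R`.
  live-back : ∀ fuel → Claim fuel → ∀ k → m ≤ suc k +ℕ fuel → ∀ {g} → ¬ Bud g → At k (rt (κ g)) → R g × (∃ λ j → k ≤ j × Dist x₀ j g)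
  live-back fuel ih k l {g} nb (u , cu , eu , q , j , lj , D) with col (invT g) in ci
  ... | black = R-ρ⁻ (subst R (sym same) q) , suc j , NP.m≤n⇒m≤1+n lj , suc (λ { refl → nb b₀ }) (subst (Dist x₀ j) (sym same) D)
    where
    same : ρ g ≡ u
    same = κ-inj (trans (trans (col-rot (invT g)) ci) (sym cu)) (trans (κ-ρ nb ci) (sym eu))
  ... | white with black-over (inv (κ g)) (proj₂ (nonbud-InE nb))
  ...   | z , cz , ez = Rg , farther
    where
    κz : κ (invT g) ≡ κ z
    κz = trans (over-edge nb) (sym ez)
    bz : Bud z
    bz = stop-bud cz (inj₁ (invT g , ci , κz))
    same : ρ z ≡ u
    same = κ-inj (trans (trans (col-rot (invT z)) (trans (cong col bz) cz)) (sym cu)) (trans (κρ-bud bz) (trans (cong fc ez) (trans (cong rt (inv-inv (κ g))) (sym eu))))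
    Rz : R z
    Rz = R-ρ⁻ (subst R (sym same) q)
    Dz : Dist x₀ (suc j) z
    Dz = suc (over-white≢x₀ ci κz) (subst (Dist x₀ j) (sym same) D)
    Rg : R g
    Rg = R-inv⁻ (ih {suc j} {z} {invT g} (NP.≤-trans l (s≤s (NP.+-monoˡ-≤ fuel lj))) Rz Dz cz ci κz)
    farther : ∃ λ j' → k ≤ j' × Dist x₀ j' g
    farther with dist g (R-C' Rg R₀) | total (ρ-R Rg)
    ... | kg , Dg | γ , s with dist-next (λ { refl → nb b₀ }) Dg
    ...   | k₁ , refl , D₁ with run-dist b₀ u₀ s D₁
    ...     | k₂ , l₂ , D₂ = suc k₁ , NP.≤-trans lj (NP.≤-trans (NP.n≤1+n j) (NP.≤-trans (NP.≤-reflexive (dist-fun Dz (subst (Dist x₀ k₂) γz D₂))) (NP.m≤n⇒m≤1+n l₂))) , Dg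
      where
      γz : γ ≡ z
      γz = κ-inj (trans (bud-bl γ (run-bud s)) (sym cz)) (trans (match (nb , ci) s) κz)

  rotate-back : ∀ fuel → Claim fuel → ∀ k → m ≤ suc k +ℕ fuel → ∀ {c h} → InV c → Rotate c h → At k h → At k c
  rotate-back fuel ih k l i (here _) q = q
  rotate-back fuel ih k l i (turn {c} ns rr) q with rotate-back fuel ih k l (InV-~ V.~-step i) rr q | black-over c (proj₁ (InV-InE i))
  ... | at | x , cx , refl = let Rx , j' = live-back fuel ih k l {x} (λ b → ns (bud-stop b)) at in x , cx , refl , Rx , j'

  bud-white : ∀ fuel → Claim fuel
  bud-white zero {k} l q D cz cw e = ⊥-elim (NP.<-irrefl refl (NP.<-≤-trans (dist-bound D) (subst (m ≤_) (NP.+-identityʳ k) l)))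
  bud-white (suc fuel) {k} {z} {w} l q D cz cw e = R-rT⁻ (proj₁ (live-back fuel (bud-white fuel) k l' (nonbud-white cg)
      (rotate-back fuel (bud-white fuel) k l' (InV-~ V.~-step (white-in cg)) (rot-white cw) (z , cz , sym e , q , k , NP.≤-refl , D))))
    where
    l' : m ≤ suc k +ℕ fuel
    l' = subst (m ≤_) (NP.+-suc k fuel) l
    cg : col (rT w) ≡ white
    cg = trans (col-rot w) cw

  white-of-bud : ∀ {z w} → R z → col z ≡ black → col w ≡ white → κ w ≡ κ z → R w
  white-of-bud {z} {w} q = bud-white m {z = z} {w} (NP.m≤n+m m _) q (proj₂ (dist z (R-C' q R₀)))

  InR-inv : ∀ h → InR h → ¬ Outer (inv h) → InR (inv h)
  InR-inv h (x , c , refl , q) no' with Bud? x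
  ... | no nb = InR-across nb q
  ... | yes b with bud-stop b
  ...   | inj₂ o = ⊥-elim (no' o)
  ...   | inj₁ (w , cw , e) = subst (InR ∘ inv) e (InR-across (nonbud-white cw) (white-of-bud q c cw e))

  -- The next unmatched bud on the contour is the first stop around the same outer vertex; the only
  -- outer dart there is `o`, so this bud faces the predecessor of `o` on the outer face.
  outer-step : ∀ o → Outer o → InR (inv o) → InR (inv (fc⁻ o))
  outer-step o oo (x , c , e , q) with total (ρ-R q)
  ... | x' , s = x' , bud-bl x' (run-bud s) , trans (sym (inv-inv (κ x'))) (cong inv prev) , run-R s (ρ-R q)
    where
    b : Bud x
    b = stop-bud c (inj₂ (subst Outer (sym (trans (cong inv e) (inv-inv o))) oo))
    rott : Rotate (rt o) (κ x')
    rott = subst (λ h → Rotate h (κ x')) (trans (κρ-bud b) (trans (cong fc e) (cong rt (inv-inv o)))) (proj₁ (run-rotate s) (trans (col-rot (invT x)) (trans (cong col b) c)))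
    at : o V.~ κ x'
    at = V.~-trans V.~-step (rotate-~ rott)
    out' : Outer (rt (κ x'))
    out' with bud-stop (run-bud s)
    ... | inj₁ (w , cw , ew) = ⊥-elim (white-in cw (o , oo , V.~-sym (subst (o V.~_) (sym ew) at)))
    ... | inj₂ q' = outer-next (κ x') q'
    prev : inv (κ x') ≡ fc⁻ o
    prev = trans (cong inv (sym (rt-left (κ x')))) (cong (λ h → inv (rt⁻ h)) (sym (outer-distinct oo out' (V.~-trans at V.~-step))))

  outer-all : ∀ o → Outer o → InR (inv o)
  outer-all o oo = let t , e = F.~-trans (F.~-sym oo) o₀ in peel t o oo e
    where
    peel : ∀ t o → Outer o → iter fc t o ≡ inv (κ x₀) → InR (inv o)
    peel zero o oo e = x₀ , c₀ , trans (sym (inv-inv (κ x₀))) (cong inv (sym e)) , R₀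
    peel (suc t) o oo e = subst (InR ∘ inv) (Perm.left face o) (outer-step (fc o) (F.~-trans oo F.~-step) (peel t (fc o) (F.~-trans oo F.~-step) (trans (iter-suc fc t o) e)))

  all-InR : ∀ h → ¬ Outer h → InR h
  all-InR h no' = case conn (λ h → Outer h ⊎ InR h) step cross {root} (inj₁ F.~-refl) h of λ { (inj₁ o) → ⊥-elim (no' o) ; (inj₂ q) → q }
    where
    cross : ∀ h → Outer h ⊎ InR h → Outer (inv h) ⊎ InR (inv h)
    cross h (inj₁ o) = inj₂ (outer-all h o)
    cross h (inj₂ q) with Outer? (inv h)
    ... | yes o = inj₁ o
    ... | no no' = inj₂ (InR-inv h q no')
    around : ∀ h → Outer h ⊎ InR h → Outer (fc h) ⊎ InR (fc h)
    around h (inj₁ o) = inj₁ (F.~-trans o F.~-step)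
    around h (inj₂ q) = inj₂ (InR-fc h q)
    step : ∀ h → Outer h ⊎ InR h → Outer (rt h) ⊎ InR (rt h)
    step h q = subst (λ y → Outer y ⊎ InR y) (cong rt (inv-inv h)) (around (inv h) (cross h q))

  all-R : ∀ x → R x
  all-R x with col x in c
  ... | black = let y , cy , e , q = all-InR (κ x) (black-in c) in subst R (κ-inj (trans cy (sym c)) e) q
  ... | white = let y , cy , e , q = all-InR (κ x) (proj₁ (InV-InE (white-in c))) in white-of-bud q cy c (sym e)

module Connect {n m d} {M : RMap n} (OD : OuterData d M) {T : RMob m} (K : Corr M T) (B : Branch d T) (1≤d : 1 ≤ d)
  (tree : + 2 * count (RMob.W.Rep? T) ≡ count (λ x → ¬? (RMob.Bud? T x)) + + 2)
  (access : (Q : Fin n → Set) → (∀ h → ¬ RMap.Outer M h → ¬ Corr.Over K white h → Q h → Q (RMap.rt M h)) →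
     (∀ h → ¬ RMap.Outer M h → Q h → Q (RMap.fc M h)) → ∀ h → Q h → ∃ λ o → RMap.Outer M o × Q o) where
  open RMob T
  open TreeComponent T B 1≤d tree

  r : Fin m
  r = proj₁ component

  open Excess r (proj₂ component)

  closed : Closed T
  closed = record
    { R = Xr.Reached ; R-C = TC.~-reached ; R-C' = λ p q → C.~-trans (C.~-sym (single p)) (single q)
    ; R-rT = Xr.reached-~ W.~-step ; R-rT⁻ = Xr.reached-~ W.~-back ; inv-R = inv-R
    ; total = λ {y} q → run-total (proj₁ (proj₂ bud-base)) (proj₂ (proj₂ (proj₂ bud-base))) y (C.~-trans (C.~-sym (single q)) (proj₁ (proj₂ (proj₂ bud-base))))
    ; β = proj₁ bud-base ; bβ = proj₁ (proj₂ bud-base) ; Rβ = TC.~-reached (proj₁ (proj₂ (proj₂ bud-base))) Xr.reached-root }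

  mobile-connected : (Q : Fin m → Set) → (∀ x → Q x → Q (rT x)) → (∀ x → Q x → Q (invT x)) → ∀ {x} → Q x → ∀ y → Q y
  mobile-connected Q f g {x} q y = Explore.reached-ind skeleton x {Q} q (W.closed-~ {Q} f) (λ {z} _ → g z) (Components.≈-trans skeleton {x} {r} {y} (Components.≈-sym skeleton {r} {x} (Fill.all-R OD K closed access x)) (Fill.all-R OD K closed access y))

-- The closure of a mobile

injPerm : ∀ {n} (f : Fin n → Fin n) → (∀ {x y} → f x ≡ f y → x ≡ y) → Perm n
injPerm {n} f inj = record { ap = f ; ap⁻ = λ y → proj₁ (onto y) ; left = λ x → inj (proj₂ (onto (f x))) ; right = λ y → proj₂ (onto y) }
  where
  Im? : ∀ y → Dec (∃ λ x → f x ≡ y)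
  Im? y = any? (λ x → f x ≟ y)
  onto : ∀ y → ∃ λ x → f x ≡ y
  onto y = count-tight Im? (λ _ → yes tt) (λ _ _ → tt) (ZP.≤-reflexive (trans (∑-reindex Im? f inj (λ x → x , refl) (λ _ q → q) (λ _ → 1ℤ)) (∑-cong (λ y → ZP.*-identityʳ _)))) y tt

-- The unmatched bud `β` serves as the end of the word: the distances `k` to it order all half-edges
-- linearly, and readings terminate from every point.
module Bracket {m} (T : RMob m) (β : Fin m) (bβ : RMob.Bud T β) (uβ : RMob.Unmatched T β) (single : ∀ y → RMob.C._~_ T y β) where
  open RMob T
  open DistBound T

  opaque
    F : Fin m → Fin m
    F y = proj₁ (run-total bβ uβ y (single y))

    F-run : ∀ y → Run y (F y)
    F-run y = proj₂ (run-total bβ uβ y (single y))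

  F-fun : ∀ {y x} → Run y x → F y ≡ x
  F-fun r = run-fun (F-run _) r

  opaque
    k : Fin m → ℕ
    k y = proj₁ (dist y (single y))

    D : ∀ y → Dist β (k y) y
    D y = proj₂ (dist y (single y))

  k-step : ∀ {y} → y ≢ β → k y ≡ suc (k (ρ y))
  k-step {y} ne with dist-next ne (D y)
  ... | j , e , Dj = trans e (cong suc (dist-fun Dj (D (ρ y))))

  k-run : ∀ {y x} → Run y x → k x ≤ k y
  k-run {y} {x} r with run-dist bβ uβ r (D y)
  ... | j , l , Dj = subst (_≤ k y) (dist-fun Dj (D x)) l

  dist-inj : ∀ {j x y} → Dist β j x → Dist β j y → x ≡ y
  dist-inj zero zero = refl
  dist-inj (suc _ a) (suc _ b) = Perm.ap-inj contour (dist-inj a b)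

  k-inj : ∀ {x y} → k x ≡ k y → x ≡ y
  k-inj {x} {y} e = dist-inj (D x) (subst (λ j → Dist β j y) (sym e) (D y))

  k-max : ∀ y → k y ≤ k (ρ β)
  k-max y = let t , e = C.~-trans (single (ρ β)) (C.~-sym (single y)) in subst (λ z → k z ≤ k (ρ β)) e (go t)
    where
    go : ∀ t → k (iter ρ t (ρ β)) ≤ k (ρ β)
    go zero = NP.≤-refl
    go (suc t) with iter ρ t (ρ β) ≟ β
    ... | yes e = NP.≤-reflexive (cong (k ∘ ρ) e)
    ... | no ne = NP.≤-trans (NP.n≤1+n _) (subst (_≤ k (ρ β)) (k-step ne) (go t))

  opens≢β : ∀ {y} → Opens y → y ≢ β
  opens≢β (nb , _) refl = nb bβ

  matched≢β : ∀ {y γ} → Opens y → Run (ρ y) γ → γ ≢ β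
  matched≢β o r refl = uβ _ o r

  -- Brackets do not cross. The opening is one of those jumped from, or it lies inside a jump or in
  -- what follows it, and the recursion goes along the reading.
  inside-opens : ∀ {y x} → Run y x → ∀ {y' x'} → Opens y' → k y' ≤ k y → k x <ℕ k y' → Run (ρ y') x' → k x <ℕ k x'
  inside-opens (stop _) o l l' r' = ⊥-elim (NP.<⇒≱ l' l)
  inside-opens {y} {x} (skip nb c r) {y'} o l l' r' = inside-opens r o (below (NP.≤∧≢⇒< l (λ e → skipped (k-inj e)))) l' r'
    where
    skipped : y' ≢ y
    skipped refl = black≢white c (proj₂ o)
    below : k y' <ℕ k y → k y' ≤ k (ρ y)
    below q = NP.≤-pred (subst (k y' <ℕ_) (k-step (λ { refl → nb bβ })) q)
  inside-opens {y} {x} (jump {γ = γ} oy r s) {y'} {x'} o l l' r' with y' ≟ y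
  ... | yes refl = subst (λ z → k x <ℕ k z) (run-fun r r') (NP.<-≤-trans (s≤s (k-run s)) (NP.≤-reflexive (sym (k-step (matched≢β oy r)))))
  ... | no ne with k γ NP.<? k y'
  ...   | yes lt = NP.<-trans (NP.<-≤-trans (s≤s (k-run s)) (NP.≤-reflexive (sym (k-step (matched≢β oy r))))) (inside-opens r o (NP.≤-pred (subst (k y' <ℕ_) (k-step (opens≢β oy)) (NP.≤∧≢⇒< l (λ e → ne (k-inj e))))) lt r')
  ...   | no nlt = inside-opens s o (NP.≤-pred (subst (k y' <ℕ_) (k-step (matched≢β oy r)) (NP.≤∧≢⇒< (NP.≮⇒≥ nlt) (λ e → nγ (k-inj e))))) l' r'
    where
    nγ : y' ≢ γ
    nγ refl = proj₁ o (run-bud r)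

  inside-buds : ∀ {y x} → Run y x → ∀ {u} → Bud u → k u ≤ k y → k x <ℕ k u → Matched u
  inside-buds (stop _) o l l' = ⊥-elim (NP.<⇒≱ l' l)
  inside-buds {y} (skip nb c r) {u} b l l' = inside-buds r b (NP.≤-pred (subst (k u <ℕ_) (k-step (λ { refl → nb bβ })) (NP.≤∧≢⇒< l (λ e → ne (k-inj e))))) l'
    where
    ne : u ≢ y
    ne refl = nb b
  inside-buds {y} (jump {γ = γ} oy r s) {u} b l l' with u ≟ γ
  ... | yes refl = y , oy , r
  ... | no ne with k γ NP.<? k u
  ...   | yes lt = inside-buds r b (NP.≤-pred (subst (k u <ℕ_) (k-step (opens≢β oy)) (NP.≤∧≢⇒< l (λ e → ny (k-inj e))))) lt
    where
    ny : u ≢ y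
    ny refl = proj₁ oy b
  ...   | no nlt = inside-buds s b (NP.≤-pred (subst (k u <ℕ_) (k-step (matched≢β oy r)) (NP.≤∧≢⇒< (NP.≮⇒≥ nlt) (λ e → ne (k-inj e))))) l'

  U : Fin m → Set
  U x = Bud x × Unmatched x

  opaque
    U? : ∀ x → Dec (U x)
    U? x with Bud? x
    ... | no nb = no (nb ∘ proj₁)
    ... | yes b with decideMatched b
    ...   | inj₁ u = yes (b , u)
    ...   | inj₂ (y , o , r) = no λ u → proj₂ u y o r

  Src : Fin m → Set
  Src y = Opens y ⊎ U y

  -- Otherwise `y` lies within the reading from `ρ y'`. If it opens, its mate comes strictly before
  -- `x`; if it is an unmatched bud, it would be matched there. The case `y = β` is excluded because
  -- `ρ β` is the farthest from `β`.
  src-later : ∀ {y y' x} → Src y → Run (ρ y) x → Run (ρ y') x → ¬ (k (ρ y) <ℕ k (ρ y'))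
  src-later {y} {y'} {x} p r r' l = case p of λ where
      (inj₁ o) → NP.<-irrefl refl (inside-opens r' o ky kx r)
      (inj₂ u) → let z , o , s = inside-buds r' (proj₁ u) ky kx in proj₂ u z o s
    where
    ne : y ≢ β
    ne refl = NP.<⇒≱ l (k-max (ρ y'))
    ky : k y ≤ k (ρ y')
    ky = subst (_≤ k (ρ y')) (sym (k-step ne)) l
    kx : k x <ℕ k y
    kx = subst (k x <ℕ_) (sym (k-step ne)) (s≤s (k-run r))

  src-inj : ∀ {y y' x} → Src y → Src y' → Run (ρ y) x → Run (ρ y') x → y ≡ y'
  src-inj {y} {y'} p p' r r' with NP.<-cmp (k (ρ y)) (k (ρ y'))
  ... | tri≈ _ e _ = Perm.ap-inj contour (k-inj e)
  ... | tri< l _ _ = ⊥-elim (src-later p r r' l)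
  ... | tri> _ _ l = ⊥-elim (src-later p' r' r l)

  -- From an unmatched bud, the next unmatched bud along the contour.
  ν : Fin m → Fin m
  ν x = F (ρ x)

  ν-U : ∀ {x} → U x → U (ν x)
  ν-U {x} u = run-bud (F-run (ρ x)) , λ y o r → proj₁ o (subst Bud (src-inj (inj₂ u) (inj₁ o) (F-run (ρ x)) r) (proj₁ u))

  ν-k : ∀ {x} → x ≢ β → k (ν x) <ℕ k x
  ν-k {x} ne = subst (k (ν x) <ℕ_) (sym (k-step ne)) (s≤s (k-run (F-run (ρ x))))

  -- Extended by the identity off `U`, `ν` is injective on all of `Fin m`, hence invertible there.
  νt : Fin m → Fin m
  νt x with U? x
  ... | yes _ = ν x
  ... | no _ = x

  νt-U : ∀ {x} → U x → νt x ≡ ν x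
  νt-U {x} u with U? x
  ... | yes _ = refl
  ... | no nu = ⊥-elim (nu u)

  νt-out : ∀ {x} → ¬ U x → νt x ≡ x
  νt-out {x} nu with U? x
  ... | yes u = ⊥-elim (nu u)
  ... | no _ = refl

  νt-inj : ∀ {x y} → νt x ≡ νt y → x ≡ y
  νt-inj {x} {y} e with U? x | U? y
  ... | yes u | yes v = src-inj (inj₂ u) (inj₂ v) (F-run (ρ x)) (subst (Run (ρ y)) (sym e) (F-run (ρ y)))
  ... | yes u | no nv = ⊥-elim (nv (subst U e (ν-U u)))
  ... | no nu | yes v = ⊥-elim (nu (subst U (sym e) (ν-U v)))
  ... | no _ | no _ = e

  opaque
    ν⁻ : Fin m → Fin m
    ν⁻ = Perm.ap⁻ (injPerm νt νt-inj)

    νt-ν⁻ : ∀ x → νt (ν⁻ x) ≡ x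
    νt-ν⁻ = Perm.right (injPerm νt νt-inj)

    ν⁻-νt : ∀ x → ν⁻ (νt x) ≡ x
    ν⁻-νt = Perm.left (injPerm νt νt-inj)

  ν⁻-U : ∀ {x} → U x → U (ν⁻ x)
  ν⁻-U {x} u = case U? (ν⁻ x) of λ where
    (yes v) → v
    (no nv) → ⊥-elim (nv (subst U (trans (sym (νt-ν⁻ x)) (νt-out nv)) u))

  νν⁻ : ∀ {x} → U x → ν (ν⁻ x) ≡ x
  νν⁻ {x} u = trans (sym (νt-U (ν⁻-U u))) (νt-ν⁻ x)

  ν⁻ν : ∀ {x} → U x → ν⁻ (ν x) ≡ x
  ν⁻ν {x} u = trans (cong ν⁻ (sym (νt-U u))) (ν⁻-νt x)

inj₁≢inj₂ : ∀ {A B : Set} {x : A} {y : B} → inj₁ x ≢ inj₂ y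
inj₁≢inj₂ ()

-- The darts: one for each black half-edge, and one on the outer face for each unmatched bud. The
-- face permutation and the edge involution are constructed, and the rotation is recovered as their
-- composite.
module Closure {m d : ℕ} (T : RMob m) (β : Fin m) (bβ : RMob.Bud T β) (uβ : RMob.Unmatched T β) (single : ∀ y → RMob.C._~_ T y β)
  (connT : (Q : Fin m → Set) → (∀ x → Q x → Q (RMob.rT T x)) → (∀ x → Q x → Q (RMob.invT T x)) → ∀ {x} → Q x → ∀ y → Q y) where
  open RMob T
  open Bracket T β bβ uβ single

  Bl? : ∀ x → Dec (col x ≡ black)
  Bl? x = col x ≟ᶜ black

  open Enum₂ (enum Bl?) (enum U?)

  darts : ℕ
  darts = size

  white-live : ∀ {w} → col w ≡ white → ¬ Bud w
  white-live c b = black≢white (bud-bl _ b) c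

  live-inv : ∀ {x} → ¬ Bud x → ¬ Bud (invT x)
  live-inv = Graph.Ed-inv skeleton

  white-opens : ∀ {w} → col w ≡ white → Opens (invT w)
  white-opens {w} c = live-inv (white-live c) , trans (cong col (invT-inv w)) c

  -- the black half-edge lying in the same dart of the closure
  topC : Fin m → Color → Fin m
  topC y black = y
  topC y white = F (rT y)

  top : Fin m → Fin m
  top y = topC y (col y)

  top-bl : ∀ {y} → col y ≡ black → top y ≡ y
  top-bl {y} c = cong (topC y) c

  top-wh : ∀ {y} → col y ≡ white → top y ≡ F (rT y)
  top-wh {y} c = cong (topC y) c

  ρ-inv : ∀ y → ρ (invT y) ≡ rT y
  ρ-inv y = cong rT (invT-inv y)

  F-bud : ∀ y → Bud (F y)
  F-bud y = run-bud (F-run y)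

  top-run : ∀ {w} → col w ≡ white → Run (ρ (invT w)) (top w)
  top-run {w} c = subst₂ Run (sym (ρ-inv w)) (sym (top-wh c)) (F-run (rT w))

  top-black : ∀ y → col (top y) ≡ black
  top-black y with col y in c
  ... | black = c
  ... | white = bud-bl _ (F-bud (rT y))

  top-inj-w : ∀ {w w'} → col w ≡ white → col w' ≡ white → top w ≡ top w' → w ≡ w'
  top-inj-w {w} {w'} c c' e = trans (sym (invT-inv w)) (trans (cong invT (src-inj (inj₁ (white-opens c)) (inj₁ (white-opens c')) (top-run c) (subst (Run (ρ (invT w'))) (sym e) (top-run c')))) (invT-inv w'))

  top-inj : ∀ {z z'} → ¬ Bud z → ¬ Bud z' → top z ≡ top z' → z ≡ z'
  top-inj {z} {z'} nb nb' e = go (col z) (col z') refl refl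
    where
    bw : ∀ {z w} → ¬ Bud z → col z ≡ black → col w ≡ white → top z ≡ top w → ⊥
    bw nb c c' e = nb (subst Bud (trans (sym (top-wh c')) (trans (sym e) (top-bl c))) (F-bud _))
    go : ∀ c c' → col z ≡ c → col z' ≡ c' → z ≡ z'
    go black black p q = trans (sym (top-bl p)) (trans e (top-bl q))
    go white white p q = top-inj-w p q e
    go black white p q = ⊥-elim (bw nb p q e)
    go white black p q = ⊥-elim (bw nb' q p (sym e))

  -- How the dart of a black half-edge gets its opposite. A non-bud is its own `top`, a matched bud
  -- is that of the white half-edge at its opening, and in both cases the mobile edge is crossed;
  -- the dart of an unmatched bud is paired with an outer dart.
  data Kind (x : Fin m) : Set where
    paired : ∀ z → ¬ Bud z → top z ≡ x → Kind x
    free : U x → Kind x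

  kind : ∀ x → col x ≡ black → Kind x
  kind x c with Bud? x
  ... | no nb = paired x nb (top-bl c)
  ... | yes b with decideMatched b
  ...   | inj₁ u = free (b , u)
  ...   | inj₂ (y , (nb , cw) , r) = paired (invT y) (live-inv nb) (trans (top-wh cw) (F-fun r))

  kind-free : ∀ {z x} → ¬ Bud z → top z ≡ x → ¬ U x
  kind-free {z} nb e u with col z in c
  ... | black = nb (subst Bud (sym (trans (sym (top-bl c)) (trans (cong (topC z) c) e))) (proj₁ u))
  ... | white = proj₂ u (invT z) (white-opens c) (subst₂ Run (sym (ρ-inv z)) e (F-run (rT z)))

  invK : ∀ {x} → Kind x → Fin m ⊎ Fin m
  invK (paired z _ _) = inj₁ (top (invT z))
  invK {x} (free _) = inj₂ x

  invC : ∀ x → Dec (col x ≡ black) → Fin m ⊎ Fin m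
  invC x (yes c) = invK (kind x c)
  invC x (no _) = inj₁ x

  invS : Fin m ⊎ Fin m → Fin m ⊎ Fin m
  invS (inj₁ x) = invC x (Bl? x)
  invS (inj₂ x) = inj₁ x

  invS-top : ∀ {z} → ¬ Bud z → invS (inj₁ (top z)) ≡ inj₁ (top (invT z))
  invS-top {z} nb = go (Bl? (top z))
    where
    goK : (q : Kind (top z)) → invK q ≡ inj₁ (top (invT z))
    goK (paired z' nb' e) = cong (inj₁ ∘ top ∘ invT) (top-inj nb' nb e)
    goK (free u) = ⊥-elim (kind-free nb refl u)
    go : ∀ q → invC (top z) q ≡ inj₁ (top (invT z))
    go (yes c) = goK (kind (top z) c)
    go (no nc) = ⊥-elim (nc (top-black z))

  invS-U : ∀ {x} → U x → invS (inj₁ x) ≡ inj₂ x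
  invS-U {x} u = go (Bl? x)
    where
    goK : (q : Kind x) → invK q ≡ inj₂ x
    goK (paired z nb e) = ⊥-elim (kind-free nb e u)
    goK (free _) = refl
    go : ∀ q → invC x q ≡ inj₂ x
    go (yes c) = goK (kind x c)
    go (no nc) = ⊥-elim (nc (bud-bl x (proj₁ u)))

  by-kind : ∀ {A : Fin m → Set} → (∀ z → ¬ Bud z → A (top z)) → (∀ x → U x → A x) → ∀ x → col x ≡ black → A x
  by-kind {A} f g x c with kind x c
  ... | paired z nb e = subst A e (f z nb)
  ... | free u = g x u

  invS-ok : ∀ s → Holds s → Holds (invS s)
  invS-ok (inj₁ x) c = by-kind {λ x → Holds (invS (inj₁ x))} (λ z nb → subst Holds (sym (invS-top nb)) (top-black (invT z))) (λ x u → subst Holds (sym (invS-U u)) u) x c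
  invS-ok (inj₂ x) u = bud-bl x (proj₁ u)

  invS-invS : ∀ s → Holds s → invS (invS s) ≡ s
  invS-invS (inj₁ x) c = by-kind {λ x → invS (invS (inj₁ x)) ≡ inj₁ x} (λ z nb → trans (cong invS (invS-top nb)) (trans (invS-top (live-inv nb)) (cong (inj₁ ∘ top) (invT-inv z)))) (λ x u → cong invS (invS-U u)) x c
  invS-invS (inj₂ x) u = invS-U u

  invS-fpf : ∀ s → Holds s → invS s ≢ s
  invS-fpf (inj₂ x) u ()
  invS-fpf (inj₁ x) c = by-kind {λ x → invS (inj₁ x) ≢ inj₁ x} (λ z nb e → nb (top-inj (live-inv nb) nb (inj₁-injective (trans (sym (invS-top nb)) e)))) (λ x u e → inj₁≢inj₂ (sym (trans (sym (invS-U u)) e))) x c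

  fcS fcS⁻ : Fin m ⊎ Fin m → Fin m ⊎ Fin m
  fcS (inj₁ x) = inj₁ (rT x)
  -- Inverse to `ν`: the next unmatched bud must face the preceding dart of the outer face.
  fcS (inj₂ x) = inj₂ (ν⁻ x)
  fcS⁻ (inj₁ x) = inj₁ (rT⁻ x)
  fcS⁻ (inj₂ x) = inj₂ (ν x)

  fcS-ok : ∀ s → Holds s → Holds (fcS s)
  fcS-ok (inj₁ x) c = trans (col-rot x) c
  fcS-ok (inj₂ x) u = ν⁻-U u

  fcS⁻-ok : ∀ s → Holds s → Holds (fcS⁻ s)
  fcS⁻-ok (inj₁ x) c = trans (sym (col-rot (rT⁻ x))) (trans (cong col (rT-right x)) c)
  fcS⁻-ok (inj₂ x) u = ν-U u

  fcS-left : ∀ s → Holds s → fcS⁻ (fcS s) ≡ s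
  fcS-left (inj₁ x) _ = cong inj₁ (rT-left x)
  fcS-left (inj₂ x) u = cong inj₂ (νν⁻ u)

  fcS-right : ∀ s → Holds s → fcS (fcS⁻ s) ≡ s
  fcS-right (inj₁ x) _ = cong inj₁ (rT-right x)
  fcS-right (inj₂ x) u = cong inj₂ (ν⁻ν u)

  iv fcX fcX⁻ : Fin size → Fin size
  iv = lift invS invS-ok
  fcX = lift fcS fcS-ok
  fcX⁻ = lift fcS⁻ fcS⁻-ok

  iv-iv : ∀ i → iv (iv i) ≡ i
  iv-iv = lift-lift invS invS invS-ok invS-ok invS-invS

  M₀ : RMap size
  M₀ = record
    { rot = record { ap = fcX ∘ iv ; ap⁻ = iv ∘ fcX⁻
        ; left = λ i → trans (cong iv (lift-lift fcS fcS⁻ fcS-ok fcS⁻-ok fcS-left (iv i))) (iv-iv i)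
        ; right = λ i → trans (cong fcX (iv-iv (fcX⁻ i))) (lift-lift fcS⁻ fcS fcS⁻-ok fcS-ok fcS-right i) }
    ; inv = iv ; inv-inv = iv-iv ; root = mk (inj₂ β) (bβ , uβ) }

  open RMap M₀
  open Inner M₀

  el-iv : ∀ i → el (iv i) ≡ invS (el i)
  el-iv = el-lift invS invS-ok

  el-fc : ∀ i → el (fc i) ≡ fcS (el i)
  el-fc i = trans (el-lift fcS fcS-ok (iv (iv i))) (cong (fcS ∘ el) (iv-iv i))

  dart : ∀ x → col x ≡ black → Fin size
  dart x c = mk (inj₁ x) c

  outd : ∀ x → U x → Fin size
  outd x u = mk (inj₂ x) u

  data Side (i : Fin size) : Set where
    inner : ∀ x → col x ≡ black → el i ≡ inj₁ x → Side i
    outer : ∀ x → U x → el i ≡ inj₂ x → Side i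

  side : ∀ i → Side i
  side i with el i in e | el-ok i
  ... | inj₁ x | c = inner x c e
  ... | inj₂ x | u = outer x u e

  OutEl : Fin size → Set
  OutEl i = ∃ λ x → el i ≡ inj₂ x

  fc-outd : ∀ {i x} → el i ≡ inj₂ (ν x) → U x → ∀ {j} → el j ≡ inj₂ x → fc i ≡ j
  fc-outd e u e' = el-inj (trans (el-fc _) (trans (cong fcS e) (trans (cong inj₂ (ν⁻ν u)) (sym e'))))

  outer→el : ∀ {i} → Outer i → OutEl i
  outer→el o = F.closed-~ {OutEl} (λ { i (x , e) → ν⁻ x , trans (el-fc i) (cong fcS e) }) o (β , el-mk (inj₂ β) (bβ , uβ))

  el→outer : ∀ {i x} → el i ≡ inj₂ x → U x → Outer i
  el→outer {i} {x} e u = go (k x) x i e u NP.≤-refl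
    where
    go : ∀ b x i → el i ≡ inj₂ x → U x → k x ≤ b → Outer i
    go b x i e u l with x ≟ β
    ... | yes refl = subst Outer (sym (el-inj (trans e (sym (el-mk (inj₂ β) (bβ , uβ)))))) F.~-refl
    go zero x i e u l | no ne = ⊥-elim (NP.<⇒≱ (ν-k ne) (NP.≤-trans l z≤n))
    go (suc b) x i e u l | no ne = F.~-trans (go b (ν x) (outd (ν x) (ν-U u)) (el-mk (inj₂ (ν x)) (ν-U u)) (ν-U u) (NP.≤-pred (NP.≤-trans (ν-k ne) l))) (subst (outd (ν x) (ν-U u) F.~_) (fc-outd (el-mk (inj₂ (ν x)) (ν-U u)) u e) F.~-step)

  inner-not : ∀ {i x} → el i ≡ inj₁ x → ¬ Outer i
  inner-not e o = inj₁≢inj₂ (trans (sym e) (proj₂ (outer→el o)))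

  κ₀ : Fin m → Fin size
  κ₀ y = dart (top y) (top-black y)

  el-κ : ∀ y → el (κ₀ y) ≡ inj₁ (top y)
  el-κ y = el-mk (inj₁ (top y)) (top-black y)

  el-κ-bl : ∀ {y} → col y ≡ black → el (κ₀ y) ≡ inj₁ y
  el-κ-bl {y} c = trans (el-κ y) (cong inj₁ (top-bl c))

  κ-fc : ∀ {x} → col x ≡ black → κ₀ (rT x) ≡ fc (κ₀ x)
  κ-fc {x} c = el-inj (trans (el-κ-bl (trans (col-rot x) c)) (sym (trans (el-fc (κ₀ x)) (cong fcS (el-κ-bl c)))))

  κ-edge : ∀ {x} → ¬ Bud x → κ₀ (invT x) ≡ iv (κ₀ x)
  κ-edge {x} nb = el-inj (trans (el-κ (invT x)) (sym (trans (el-iv (κ₀ x)) (trans (cong invS (el-κ x)) (invS-top nb)))))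

  κ-top : ∀ y → κ₀ (top y) ≡ κ₀ y
  κ-top y = el-inj (trans (el-κ-bl (top-black y)) (sym (el-κ y)))

  κ-inj₀ : ∀ {x y} → col x ≡ col y → κ₀ x ≡ κ₀ y → x ≡ y
  κ-inj₀ {x} {y} c e = go (col x) refl
    where
    tops : top x ≡ top y
    tops = inj₁-injective (trans (sym (el-κ x)) (trans (cong el e) (el-κ y)))
    go : ∀ q → col x ≡ q → x ≡ y
    go black p = trans (sym (top-bl p)) (trans tops (top-bl (trans (sym c) p)))
    go white p = top-inj-w p (trans (sym c) p) tops

  OverW : Fin size → Set
  OverW h = Σ (Fin m) λ x → col x ≡ white × κ₀ x ≡ h

  Stop : Fin size → Set
  Stop h = OverW h ⊎ Outer (iv h)

  iv-U : ∀ {x} → U x → el (iv (κ₀ x)) ≡ inj₂ x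
  iv-U {x} u = trans (el-iv (κ₀ x)) (trans (cong invS (el-κ-bl (bud-bl x (proj₁ u)))) (invS-U u))

  stop-of-bud : ∀ {x} → Bud x → Stop (κ₀ x)
  stop-of-bud {x} b = case decideMatched b of λ where
    (inj₁ u) → inj₂ (el→outer (iv-U (b , u)) (b , u))
    (inj₂ (y , (nb , c) , r)) → inj₁ (invT y , c , trans (sym (κ-top (invT y))) (cong κ₀ (trans (top-wh c) (F-fun r))))

  bud-of-stop : ∀ {x} → col x ≡ black → Stop (κ₀ x) → Bud x
  bud-of-stop {x} c (inj₁ (w , cw , e)) = subst Bud (trans (sym (top-wh cw)) (κ-inj₀ (trans (top-black w) (sym c)) (trans (κ-top w) e))) (F-bud (rT w))
  bud-of-stop {x} c (inj₂ o) = case Bud? x of λ where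
    (yes b) → b
    (no nb) → ⊥-elim (inner-not (trans (cong el (sym (κ-edge nb))) (el-κ (invT x))) o)

  open Rotation rt Stop

  rt-κ : ∀ {y} → ¬ Bud y → rt (κ₀ y) ≡ fc (κ₀ (invT y))
  rt-κ {y} nb = trans (cong rt (sym (iv-iv (κ₀ y)))) (cong fc (sym (κ-edge nb)))

  -- Each contour step, and each jump over a matched pair, is one turn around a vertex of the
  -- closure; so a reading ends at the first stop of the rotation.
  run-rotate : ∀ {y x} → Run y x → (col y ≡ black → Rotate (κ₀ y) (κ₀ x)) × (¬ Bud y → Rotate (rt (κ₀ y)) (κ₀ x))
  run-rotate (stop b) = (λ _ → here (stop-of-bud b)) , λ nb → ⊥-elim (nb b)
  run-rotate {y} {x} (skip nb c r) = (λ cy → turn (nb ∘ bud-of-stop cy) next) , λ _ → next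
    where
    next : Rotate (rt (κ₀ y)) (κ₀ x)
    next = subst (λ h → Rotate h (κ₀ x)) (trans (κ-fc c) (sym (rt-κ nb))) (proj₁ (run-rotate r) (trans (col-rot (invT y)) c))
  run-rotate {y} {x} (jump {γ = γ} (nb , c) r s) = (λ cy → turn (nb ∘ bud-of-stop cy) next) , λ _ → next
    where
    cγ : col γ ≡ black
    cγ = bud-bl γ (run-bud r)
    same : κ₀ γ ≡ κ₀ (invT y)
    same = trans (cong κ₀ (sym (trans (top-wh c) (F-fun r)))) (κ-top (invT y))
    next : Rotate (rt (κ₀ y)) (κ₀ x)
    next = subst (λ h → Rotate h (κ₀ x)) (trans (cong (κ₀ ∘ rT) (run-bud r)) (trans (κ-fc cγ) (trans (cong fc same) (sym (rt-κ nb)))))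
      (proj₁ (run-rotate s) (trans (col-rot (invT γ)) (trans (cong col (run-bud r)) cγ)))

  rot-wh : ∀ {x} → col x ≡ white → Rotate (rt (κ₀ (rT x))) (κ₀ x)
  rot-wh {x} c = subst (Rotate (rt (κ₀ (rT x)))) (trans (cong κ₀ (sym (top-wh c))) (κ-top x)) (proj₂ (run-rotate (F-run (rT x))) (white-live (trans (col-rot x) c)))

  rot-out : ∀ {i x} → el i ≡ inj₂ x → U x → Rotate (rt i) (κ₀ (ν x))
  rot-out {i} {x} e u = subst (λ h → Rotate h (κ₀ (ν x))) start (proj₁ (run-rotate (F-run (ρ x))) (trans (col-rot (invT x)) (trans (cong col (proj₁ u)) cx)))
    where
    cx : col x ≡ black
    cx = bud-bl x (proj₁ u)
    start : κ₀ (ρ x) ≡ rt i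
    start = trans (cong (κ₀ ∘ rT) (proj₁ u)) (trans (κ-fc cx) (trans (cong fc (el-inj (trans (el-κ-bl cx) (sym (trans (el-iv i) (cong invS e)))))) (cong rt (iv-iv i))))

  ¬Stop-out : ∀ {i x} → el i ≡ inj₂ x → ¬ Stop i
  ¬Stop-out e (inj₁ (w , c , refl)) = inj₁≢inj₂ (trans (sym (el-κ w)) e)
  ¬Stop-out {i} e (inj₂ o) = inner-not (trans (el-iv i) (cong invS e)) o

  stop-out : ∀ {i x w} → el i ≡ inj₂ x → U x → col w ≡ white → ¬ Rotate i (κ₀ w)
  stop-out {i} {x} {w} e u c r = proj₂ (ν-U u) (invT w) (white-opens c) (subst (Run (ρ (invT w))) topw (top-run c))
    where
    topw : top w ≡ ν x
    topw = κ-inj₀ (trans (top-black w) (sym (bud-bl _ (proj₁ (ν-U u))))) (trans (κ-top w) (rotate-fun r (turn (¬Stop-out e) (rot-out e u))))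

  -- That the first stop from a dart is white passes to the next dart, hence to the whole vertex;
  -- from an outer dart the first stop is an unmatched bud.
  white-inV : ∀ {x} → col x ≡ white → InV (κ₀ x)
  white-inV {x} c (o , oo , s) = let w , cw , r = V.closed-~ {λ h → Σ (Fin m) λ w → col w ≡ white × Rotate h (κ₀ w)} step s (x , c , here (inj₁ (x , c , refl)))
                                     y , e = outer→el oo in stop-out e (subst Holds e (el-ok o)) cw r
    where
    step : ∀ h → (Σ (Fin m) λ w → col w ≡ white × Rotate h (κ₀ w)) → Σ (Fin m) λ w → col w ≡ white × Rotate (rt h) (κ₀ w)
    step h (w , cw , turn _ r) = w , cw , r
    step _ (w , cw , here _) = rT⁻ w , cw' , subst (λ z → Rotate (rt (κ₀ z)) (κ₀ (rT⁻ w))) (rT-right w) (rot-wh cw')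
      where
      cw' : col (rT⁻ w) ≡ white
      cw' = trans (sym (col-rot (rT⁻ w))) (trans (cong col (rT-right w)) cw)

  white-ov : ∀ h → InV h → Σ (Fin m) λ x → col x ≡ white × κ₀ x V.~ h
  white-ov h i = case side h of λ where
      (outer x u e) → ⊥-elim (i (h , el→outer e u , V.~-refl))
      (inner x c e) → let rr = subst (λ z → Rotate z (κ₀ (F x))) (el-inj (trans (el-κ-bl c) (sym e))) (proj₁ (run-rotate (F-run x)) c) in go rr (rotate-S rr)
    where
    go : ∀ {x} → Rotate h x → Stop x → Σ (Fin m) λ w → col w ≡ white × κ₀ w V.~ h
    go rr (inj₁ (w , cw , e)) = w , cw , V.~-sym (subst (h V.~_) (sym e) (rotate-reach rr))
    go {x} rr (inj₂ o) = ⊥-elim (i (rt x , outer-next x o , V.~-trans (rotate-reach rr) V.~-step))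

  corr : Corr M₀ T
  corr = record
    { κ = κ₀ ; κ-inj = κ-inj₀
    ; black-in = λ {x} c → inner-not (el-κ x)
    ; black-over = λ h i → case side h of λ { (inner x c e) → x , c , el-inj (trans (el-κ-bl c) (sym e)) ; (outer x u e) → ⊥-elim (i (el→outer e u)) }
    ; white-in = white-inV ; white-over = white-ov ; rot-black = κ-fc ; rot-white = rot-wh
    ; bud-stop = stop-of-bud ; stop-bud = bud-of-stop ; over-edge = κ-edge }

  conn₀ : Connected
  conn₀ Q f g {i} q j = at-i j
    where
    fcQ : ∀ h → Q h → Q (fc h)
    fcQ h q = f (iv h) (g h q)
    ~Q : ∀ {x y} → x V.~ y → Q x → Q y
    ~Q = V.closed-~ {Q} f
    seed : ∃ λ y → Q (κ₀ y)
    seed = case side i of λ where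
      (inner x c e) → x , subst Q (el-inj (trans e (sym (el-κ-bl c)))) q
      (outer x u e) → x , subst Q (el-inj (trans (el-iv i) (trans (cong invS e) (sym (el-κ-bl (bud-bl x (proj₁ u))))))) (g i q)
    turnT : ∀ x → Q (κ₀ x) → Q (κ₀ (rT x))
    turnT x q = go (col x) refl
      where
      go : ∀ c → col x ≡ c → Q (κ₀ (rT x))
      go black c = subst Q (sym (κ-fc c)) (fcQ (κ₀ x) q)
      go white c = ~Q (V.~-sym (V.~-trans V.~-step (rotate-reach (rot-wh c)))) q
    crossT : ∀ x → Q (κ₀ x) → Q (κ₀ (invT x))
    crossT x q = case Bud? x of λ where
      (yes b) → subst (Q ∘ κ₀) (sym b) q
      (no nb) → subst Q (sym (κ-edge nb)) (g (κ₀ x) q)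
    all : ∀ x → Q (κ₀ x)
    all = connT (Q ∘ κ₀) turnT crossT (proj₂ seed)
    at-i : ∀ j → Q j
    at-i j = case side j of λ where
      (inner x c e) → subst Q (el-inj (trans (el-κ-bl c) (sym e))) (all x)
      (outer x u e) → subst Q (el-inj (trans (iv-U u) (sym e))) (g (κ₀ x) (all x))

  outerData : count U? ≡ + d → OuterData d M₀
  outerData cU = record
    { fpf = λ i e → invS-fpf (el i) (el-ok i) (trans (sym (el-iv i)) (cong el e))
    ; conn = conn₀
    ; outer-inv = λ h o → let x , e = outer→el o in inner-not (trans (el-iv h) (cong invS e))
    ; outer-distinct = distinct
    ; odeg = trans (ZP.≤-antisym
        (count-inj Outer? U? (λ h o → proj₁ (outer→el o)) (λ h o → let x , e = outer→el o in subst Holds e (el-ok h)) (λ h h' o o' q → el-inj (trans (proj₂ (outer→el o)) (trans (cong inj₂ q) (sym (proj₂ (outer→el o')))))))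
        (count-inj U? Outer? (λ x u → outd x u) (λ x u → el→outer (el-mk (inj₂ x) u) u) (λ x y u v q → inj₂-injective (trans (sym (el-mk (inj₂ x) u)) (trans (cong el q) (el-mk (inj₂ y) v)))))) cU }
    where
    -- After the outer dart `o` the first stop is the bud `ν x`, and one turn after that bud comes
    -- `o` again; so another outer dart at this vertex would lead to the same `ν x`, and `ν` is
    -- injective.
    distinct : ∀ {o o'} → Outer o → Outer o' → o V.~ o' → o ≡ o'
    distinct {o} {o'} p p' s with outer→el p | outer→el p'
    ... | x , e | x' , e' = final (V.closed-~ {λ h → h ≡ o ⊎ Rotate h (κ₀ (ν x))} step s (inj₁ refl))
      where
      u : U x
      u = subst Holds e (el-ok o)
      u' : U x'
      u' = subst Holds e' (el-ok o')
      step : ∀ h → h ≡ o ⊎ Rotate h (κ₀ (ν x)) → rt h ≡ o ⊎ Rotate (rt h) (κ₀ (ν x))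
      step h (inj₁ refl) = inj₂ (rot-out e u)
      step h (inj₂ (turn _ r)) = inj₂ r
      step _ (inj₂ (here _)) = inj₁ (trans (cong rt (sym (iv-iv (κ₀ (ν x))))) (fc-outd (iv-U (ν-U u)) u e))
      final : o' ≡ o ⊎ Rotate o' (κ₀ (ν x)) → o ≡ o'
      final (inj₁ q) = sym q
      final (inj₂ r) = el-inj (trans e (trans (cong inj₂ same) (sym e')))
        where
        νs : ν x ≡ ν x'
        νs = κ-inj₀ (trans (bud-bl _ (proj₁ (ν-U u))) (sym (bud-bl _ (proj₁ (ν-U u'))))) (rotate-fun r (turn (¬Stop-out e') (rot-out e' u')))
        same : x ≡ x'
        same = trans (sym (ν⁻ν u)) (trans (cong ν⁻ νs) (ν⁻ν u'))

-- Cycles of a map carrying a flow are long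

nextIdx-all : ∀ {m} (Q : Fin (suc m) → Set) → (∀ t → Q t → Q (nextIdx t)) → ∀ {t} → Q t → ∀ s → Q s
nextIdx-all {m} Q cl {t} q s = up (toℕ s) s refl
  where
  same : ∀ {i j : Fin (suc m)} → toℕ i ≡ toℕ j → Q i → Q j
  same e = subst Q (FP.toℕ-injective e)
  toZero : ∀ b t → m ≤ toℕ t +ℕ b → Q t → Q fz
  toZero b t l q with toℕ t NP.<? m
  ... | no nl = same (nextIdx-last t (NP.≤-antisym (NP.≤-pred (FP.toℕ<n t)) (NP.≮⇒≥ nl))) (cl t q)
  toZero zero t l q | yes lt = ⊥-elim (NP.<⇒≱ lt (subst (m ≤_) (NP.+-identityʳ (toℕ t)) l))
  toZero (suc b) t l q | yes lt = toZero b (nextIdx t) (subst (λ z → m ≤ z +ℕ b) (sym (nextIdx-step t lt)) (subst (m ≤_) (NP.+-suc (toℕ t) b) l)) (cl t q)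
  up : ∀ k s → toℕ s ≡ k → Q s
  up zero s e = same (sym e) (toZero m t (NP.m≤n+m m (toℕ t)) q)
  up (suc k) s e = same (trans (nextIdx-step s' lt) (trans (cong suc e') (sym e))) (cl s' (up k s' e'))
    where
    bd : k <ℕ suc m
    bd = NP.<-trans (NP.n<1+n k) (subst (_<ℕ suc m) e (FP.toℕ<n s))
    s' : Fin (suc m)
    s' = fromℕ< bd
    e' : toℕ s' ≡ k
    e' = FP.toℕ-fromℕ< bd
    lt : toℕ s' <ℕ m
    lt = subst (_<ℕ m) (sym e') (NP.≤-pred (subst (_<ℕ suc m) e (FP.toℕ<n s)))

nextIdx-inj : ∀ {m} {s t : Fin (suc m)} → nextIdx s ≡ nextIdx t → s ≡ t
nextIdx-inj {m} {s} {t} e with toℕ s NP.<? m | toℕ t NP.<? m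
... | yes l | yes l' = FP.toℕ-injective (NP.suc-injective (trans (sym (nextIdx-step s l)) (trans (cong toℕ e) (nextIdx-step t l'))))
... | no nl | no nl' = FP.toℕ-injective (trans (last s nl) (sym (last t nl')))
  where
  last : ∀ (s : Fin (suc m)) → ¬ (toℕ s <ℕ m) → toℕ s ≡ m
  last s nl = NP.≤-antisym (NP.≤-pred (FP.toℕ<n s)) (NP.≮⇒≥ nl)
... | yes l | no nl = ⊥-elim (NP.1+n≢0 (trans (sym (nextIdx-step s l)) (trans (cong toℕ e) (nextIdx-last t (NP.≤-antisym (NP.≤-pred (FP.toℕ<n t)) (NP.≮⇒≥ nl))))))
... | no nl | yes l = ⊥-elim (NP.1+n≢0 (trans (sym (nextIdx-step t l)) (trans (cong toℕ (sym e)) (nextIdx-last s (NP.≤-antisym (NP.≤-pred (FP.toℕ<n s)) (NP.≮⇒≥ nl))))))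

part₃ : ∀ {P Q R : Set} (p : Dec P) (q : Dec Q) (r : Dec R) → 𝟙 r ≡ 𝟙 (r ×-dec (p ×-dec ¬? q)) + 𝟙 (r ×-dec (¬? p ×-dec ¬? q)) + 𝟙 (r ×-dec q)
part₃ (yes _) (yes _) (yes _) = refl
part₃ (yes _) (yes _) (no _) = refl
part₃ (yes _) (no _) (yes _) = refl
part₃ (yes _) (no _) (no _) = refl
part₃ (no _) (yes _) (yes _) = refl
part₃ (no _) (yes _) (no _) = refl
part₃ (no _) (no _) (yes _) = refl
part₃ (no _) (no _) (no _) = refl

part₂ : ∀ {P Q : Set} (p : Dec P) (q : Dec Q) → 1ℤ ≡ 𝟙 (p ×-dec ¬? q) + 𝟙 (¬? p ×-dec ¬? q) + 𝟙 q
part₂ (yes _) (yes _) = refl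
part₂ (yes _) (no _) = refl
part₂ (no _) (yes _) = refl
part₂ (no _) (no _) = refl

module LongCycles {n d} (P : PlaneMap n) (OD : OuterData d (raw P)) (f : Flow d (raw P))
  (genus : + 2 * (count (RMap.V.Rep? (raw P)) + count (RMap.F.Rep? (raw P))) ≡ + n + + 4) where
  M : RMap n
  M = raw P
  open RMap M
  open Inner M
  open OuterData OD
  open Flow f

  module _ {k' : ℕ} (Cy : Cycle P k') where
    open Cycle Cy

    CD : Fin n → Set
    CD h = (∃ λ t → c t ≡ h) ⊎ (∃ λ t → c t ≡ inv h)

    CD? : ∀ h → Dec (CD h)
    CD? h = any? (λ t → c t ≟ h) ⊎-dec any? (λ t → c t ≟ inv h)

    CV : Fin n → Set
    CV h = ∃ λ t → c t V.~ h

    CV? : ∀ h → Dec (CV h)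
    CV? h = any? (λ t → c t V.~? h)

    CD-inv : ∀ {h} → CD h → CD (inv h)
    CD-inv {h} (inj₁ (t , e)) = inj₂ (t , trans e (sym (inv-inv h)))
    CD-inv (inj₂ (t , e)) = inj₁ (t , e)

    ¬CD-inv : ∀ {h} → ¬ CD h → ¬ CD (inv h)
    ¬CD-inv {h} n q = n (subst CD (inv-inv h) (CD-inv q))

    CD-CV : ∀ {h} → CD h → CV h
    CD-CV (inj₁ (t , refl)) = t , V.~-refl
    CD-CV {h} (inj₂ (t , e)) = nextIdx t , V.~-sym (subst (V._~ c (nextIdx t)) (trans (cong inv e) (inv-inv h)) (link t))

    c-inj : ∀ {s t} → c s V.~ c t → s ≡ t
    c-inj {s} {t} r with s ≟ t
    ... | yes q = q
    ... | no ne = ⊥-elim (distinctVertices s t ne r)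

    -- Faces joined across the edges off the cycle; what the root reaches is the outer side `A`.
    G : Graph n
    G = record { vert = face ; inv = inv ; inv-inv = inv-inv ; Ed = λ h → ¬ CD h ; Ed? = λ h → ¬? (CD? h) ; Ed-inv = ¬CD-inv }

    module X = Explore G root

    A : Fin n → Set
    A = X.Reached

    A? : ∀ h → Dec (A h)
    A? = X.Reached?

    A-rt : ∀ {h} → ¬ CD h → A h → A (rt h)
    A-rt {h} n q = subst A (cong rt (inv-inv h)) (X.reached-~ F.~-step (X.reached-inv n q))

    A-rt⁻ : ∀ {h} → ¬ CD h → A (rt h) → A h
    A-rt⁻ {h} n q = subst A (inv-inv h) (X.reached-inv (¬CD-inv n) (X.reached-~ (F.~-sym (subst (inv h F.~_) (cong rt (inv-inv h)) F.~-step)) q))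

    open Rotation rt CD

    A-rotate : ∀ {h x} → Rotate h x → (A h → A x) × (A x → A h)
    A-rotate (here _) = id , id
    A-rotate (turn n r) = let f , g = A-rotate r in (f ∘ A-rt n) , (A-rt⁻ n ∘ g)

    at-vertex-CD : ∀ t {h} → CD h → c (nextIdx t) V.~ h → h ≡ inv (c t) ⊎ h ≡ c (nextIdx t)
    at-vertex-CD t (inj₁ (s , refl)) r = inj₂ (cong c (sym (c-inj r)))
    at-vertex-CD t {h} (inj₂ (s , e)) r = inj₁ (trans (sym (inv-inv h)) (cong inv (trans (sym e) (cong c (sym (nextIdx-inj (c-inj (V.~-trans r (subst (V._~ c (nextIdx s)) (trans (cong inv e) (inv-inv h)) (link s))))))))))

    apart : ∀ t → inv (c t) ≢ c (nextIdx t)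
    apart t e with t ≟ nextIdx t
    ... | yes q = fpf (c t) (trans e (cong c (sym q)))
    ... | no ne = proj₂ (distinctEdges (nextIdx t) t (ne ∘ sym)) (sym e)

    -- u, v : the two cycle darts at a vertex; rotating from one the first cycle dart met is the other
    first-other : ∀ {u v} → u ≢ v → CD v → u V.~ v → (∀ {h} → CD h → v V.~ h → h ≡ u ⊎ h ≡ v) → Rotate (rt u) v
    first-other {u} {v} ne cv s only with rotate-exists CD? (proj₁ s') (proj₂ s') cv
      where
      s' : rt u V.~ v
      s' = V.~-trans V.~-back s
    ... | y , r with only (rotate-S r) (V.~-trans (V.~-sym s) (V.~-trans V.~-step (rotate-reach r)))
    ...   | inj₂ refl = r
    ...   | inj₁ refl = ⊥-elim (let i , e = V.~-trans (V.~-back {u}) s in descend i i NP.≤-refl e)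
      where
      descend : ∀ b i → i ≤ b → iter rt i (rt u) ≡ v → ⊥
      descend b i l e with rotate-first i r e cv
      ... | zero , _ , q = ne q
      descend zero .zero z≤n e | suc j , () , q
      descend (suc b) i l e | suc j , lj , q = descend b j (NP.≤-pred (NP.≤-trans lj l)) (trans (iter-suc rt j u) q)

    -- `fc (c t)` is in the face of `c t`, and turning from it meets no dart of the cycle before
    -- `c (nextIdx t)`. Each side of the cycle is thus constant along it.
    A-next : ∀ t → A (c t) → A (c (nextIdx t))
    A-next t q = proj₁ (A-rotate (first-other (apart t) (inj₁ (nextIdx t , refl)) (link t) (at-vertex-CD t))) (X.reached-~ F.~-step q)

    A-inv-next : ∀ t → A (inv (c t)) → A (inv (c (nextIdx t)))
    A-inv-next t q = X.reached-~ (F.~-sym (subst (inv (c (nextIdx t)) F.~_) (cong rt (inv-inv (c (nextIdx t)))) F.~-step))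
      (proj₂ (A-rotate (first-other (apart t ∘ sym) (inj₂ (t , sym (inv-inv (c t)))) (V.~-sym (link t)) (λ cd r → Data.Sum.swap (at-vertex-CD t cd (V.~-trans (V.~-sym (link t)) r))))) q)

    -- If `A` touched the cycle from neither side, no edge would stop its growth and it would be
    -- everything, cycle included.
    one-side : (∀ t → A (c t)) ⊎ (∀ t → A (inv (c t)))
    one-side with any? (λ t → A? (c t)) | any? (λ t → A? (inv (c t)))
    ... | yes (t , q) | _ = inj₁ (nextIdx-all (A ∘ c) A-next q)
    ... | no _ | yes (t , q) = inj₂ (nextIdx-all (A ∘ inv ∘ c) A-inv-next q)
    ... | no x | no y = ⊥-elim (x (fz , conn A (λ h q → A-rt (free h q) q) (λ h q → X.reached-inv (free h q) q) X.reached-root (c fz)))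
      where
      free : ∀ h → A h → ¬ CD h
      free h q (inj₁ (t , refl)) = x (t , q)
      free h q (inj₂ (t , e)) = y (t , subst A (trans (sym (inv-inv h)) (cong inv (sym e))) q)

    V₁? V₂? : ∀ h → Dec _
    V₁? h = A? h ×-dec ¬? (CV? h)
    V₂? h = ¬? (A? h) ×-dec ¬? (CV? h)
    E₁? E₂? : ∀ h → Dec _
    E₁? h = A? h ×-dec ¬? (CD? h)
    E₂? h = ¬? (A? h) ×-dec ¬? (CD? h)
    F₂? : ∀ h → Dec _
    F₂? h = ¬? (A? h)

    A-V : ∀ {x y} → x V.~ y → ¬ CV x → A x → A y
    A-V {x} s n q = proj₂ (V.closed-~ {λ h → ¬ CV h × A h} (λ { h (n , q) → (λ { (t , r) → n (t , V.~-trans r V.~-back) }) , A-rt (n ∘ CD-CV) q }) s (n , q))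

    CV-~ : ∀ {x y} → x V.~ y → CV x → CV y
    CV-~ s (t , r) = t , V.~-trans r s

    euler₁ : + 2 * (V.#cls V₁? + F.#cls A?) ≤ᶻ count E₁? + + 2
    euler₁ = OpenRegion.euler-≤ M conn V₁? E₁? A?
      (λ { s (q , n) → A-V s n q , λ v → n (CV-~ (V.~-sym s) v) }) (λ { (q , n) → X.reached-inv n q , ¬CD-inv n }) X.reached-~
      (λ { (q , n) → q , n ∘ CD-CV }) root (c fz) (λ { (_ , n) → n (fz , V.~-refl) })
      (λ Q cf ce q₀ h a → proj₂ (X.reached-ind {λ y → A y × Q y} (X.reached-root , q₀) (λ { s (q , r) → X.reached-~ s q , cf s r }) (λ { n (q , r) → X.reached-inv n q , ce (q , n) r }) a))

    cv-count : V.#cls CV? ≤ᶻ + suc k'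
    cv-count = ZP.≤-trans (count-inj (λ x → V.Rep? x ×-dec CV? x) (λ (_ : Fin (suc k')) → yes tt) (λ { x (_ , t , _) → t }) (λ _ _ → tt)
      (λ { x y (rx , _ , s) (ry , _ , s') refl → trans (sym rx) (trans (V.rep-cong (V.~-trans (V.~-sym s) s')) ry) })) (ZP.≤-reflexive (∑-one (suc k')))

    Im? : ∀ h → Dec (∃ λ t → c t ≡ h)
    Im? h = any? (λ t → c t ≟ h)

    im-count : count Im? ≡ + suc k'
    im-count = trans (sym (trans (∑-reindex Im? c (λ {s} e → c-inj (subst (c s V.~_) e V.~-refl)) (λ t → t , refl) (λ _ q → q) (λ _ → 1ℤ)) (∑-cong (λ y → ZP.*-identityʳ _)))) (∑-one (suc k'))

    cd-count : count CD? ≡ + 2 * + suc k'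
    cd-count = trans (∑-cong (λ h → sym (𝟙-⊎ (Im? h) (Im? (inv h)) disj))) (trans (∑-+ _ _) (trans (cong (λ z → count Im? + z) (∑-perm inv inv inv-inv inv-inv (λ h → 𝟙 (Im? h)))) (trans (cong₂ _+_ im-count im-count) (two (+ suc k')))))
      where
      two : ∀ x → x + x ≡ + 2 * x
      two = solve-∀
      disj : ∀ {h} → (∃ λ t → c t ≡ h) → ¬ (∃ λ t → c t ≡ inv h)
      disj (s , refl) (t , e) with t ≟ s
      ... | yes refl = fpf _ (sym e)
      ... | no ne = proj₂ (distinctEdges t s ne) e

    split-V : count V.Rep? ≡ V.#cls V₁? + V.#cls V₂? + V.#cls CV?
    split-V = trans (∑-cong (λ x → part₃ (A? x) (CV? x) (V.Rep? x))) (trans (∑-+ _ (λ x → 𝟙 (V.Rep? x ×-dec CV? x))) (cong (_+ V.#cls CV?) (∑-+ _ (λ x → 𝟙 (V.Rep? x ×-dec V₂? x)))))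

    split-F : count F.Rep? ≡ F.#cls A? + F.#cls F₂?
    split-F = trans (∑-cong (λ x → 𝟙-split (F.Rep? x) (A? x))) (∑-+ _ (λ x → 𝟙 (F.Rep? x ×-dec F₂? x)))

    split-E : + n ≡ count E₁? + count E₂? + count CD?
    split-E = trans (sym (∑-one n)) (trans (∑-cong (λ x → part₂ (A? x) (CD? x))) (trans (∑-+ _ (λ x → 𝟙 (CD? x))) (cong (_+ count CD?) (∑-+ _ (λ x → 𝟙 (E₂? x))))))

    -- Euler's relation for the side of the cycle away from the outer face
    euler₂ : count E₂? + + 2 ≤ᶻ + 2 * (V.#cls V₂? + F.#cls F₂?)
    euler₂ = lin (V.#cls V₁?) (V.#cls V₂?) (V.#cls CV?) (F.#cls A?) (F.#cls F₂?) (count E₁?) (count E₂?) (+ suc k')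
      (trans (cong₂ (λ u v → + 2 * (u + v)) (sym split-V) (sym split-F)) (trans genus (cong (_+ + 4) (trans split-E (cong (λ z → count E₁? + count E₂? + z) cd-count))))) cv-count euler₁
      where
      lin : ∀ v₁ v₂ v₃ f₁ f₂ e₁ e₂ k → + 2 * (v₁ + v₂ + v₃ + (f₁ + f₂)) ≡ e₁ + e₂ + + 2 * k + + 4 → v₃ ≤ᶻ k → + 2 * (v₁ + f₁) ≤ᶻ e₁ + + 2 → e₂ + + 2 ≤ᶻ + 2 * (v₂ + f₂)
      lin v₁ v₂ v₃ f₁ f₂ e₁ e₂ k eq le₁ le₂ = ZP.≤-trans (ZP.≤-trans (ZP.≤-reflexive (alg₁ e₁ e₂ k)) (ZP.≤-trans (ZP.+-monoʳ-≤ (e₁ + e₂ + + 2 * k + + 4) (ZP.neg-mono-≤ (ZP.+-mono-≤ (ZP.*-monoˡ-≤-nonNeg (+ 2) le₁) le₂))) (ZP.≤-reflexive (cong (λ z → z + - (+ 2 * v₃ + + 2 * (v₁ + f₁))) (sym eq))))) (ZP.≤-reflexive (alg₂ v₁ v₂ v₃ f₁ f₂))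
        where
        alg₁ : ∀ e₁ e₂ k → e₂ + + 2 ≡ e₁ + e₂ + + 2 * k + + 4 + - (+ 2 * k + (e₁ + + 2))
        alg₁ = solve-∀
        alg₂ : ∀ v₁ v₂ v₃ f₁ f₂ → + 2 * (v₁ + v₂ + v₃ + (f₁ + f₂)) + - (+ 2 * v₃ + + 2 * (v₁ + f₁)) ≡ + 2 * (v₂ + f₂)
        alg₂ = solve-∀

    outer-A : ∀ {h} → Outer h → A h
    outer-A o = X.reached-~ o X.reached-root

    V₂-in : ∀ {h} → ¬ A h × ¬ CV h → InV h
    V₂-in (na , nc) (o , oo , s) = na (A-V (V.~-sym s) (λ v → nc (CV-~ (V.~-sym s) v)) (outer-A oo))

    E₂-in : ∀ {h} → ¬ A h × ¬ CD h → InE h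
    E₂-in {h} (na , nc) = na ∘ outer-A , λ o → na (subst A (inv-inv h) (X.reached-inv (¬CD-inv nc) (outer-A o)))

    sum-V : ∑ (λ h → 𝟙 (V₂? h) * a h) ≡ + d * V.#cls V₂?
    sum-V = V.∑-const V₂? (λ { s (na , nc) → (λ q → na (A-V (V.~-sym s) (λ v → nc (CV-~ (V.~-sym s) v)) q)) , λ v → nc (CV-~ (V.~-sym s) v) }) a (+ d) (λ x q → at-vertex x (V₂-in q))

    sum-F : ∑ (λ h → 𝟙 (F₂? h) * (1ℤ - b h)) ≡ + d * F.#cls F₂?
    sum-F = F.∑-const F₂? (λ s na q → na (X.reached-~ (F.~-sym s) q)) (λ h → 1ℤ - b h) (+ d) (λ x na → at-face x (na ∘ outer-A))

    sum-E : + 2 * ∑ (λ h → 𝟙 (E₂? h) * (a h - b h)) ≡ (+ d - + 2) * count E₂?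
    sum-E = trans (two _) (trans (cong (λ z → ∑ (λ h → 𝟙 (E₂? h) * (a h - b h)) + z) (sym (∑-perm inv inv inv-inv inv-inv (λ h → 𝟙 (E₂? h) * (a h - b h))))) (trans (sym (∑-+ _ _)) (trans (∑-cong row) (∑-* (+ d - + 2) _))))
      where
      two : ∀ x → + 2 * x ≡ x + x
      two = solve-∀
      alg : ∀ e a b a' b' → e * (a - b) + e * (a' - b') ≡ e * (a + a' - (b + b'))
      alg = solve-∀
      cross : ∀ {h} → ¬ A h × ¬ CD h → ¬ A (inv h) × ¬ CD (inv h)
      cross {h} (na , nc) = (λ q → na (subst A (inv-inv h) (X.reached-inv (¬CD-inv nc) q))) , ¬CD-inv nc
      row : ∀ h → 𝟙 (E₂? h) * (a h - b h) + 𝟙 (E₂? (inv h)) * (a (inv h) - b (inv h)) ≡ (+ d - + 2) * 𝟙 (E₂? h)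
      row h = trans (cong (λ z → 𝟙 (E₂? h) * (a h - b h) + z * (a (inv h) - b (inv h))) (𝟙-cong (E₂? (inv h)) (E₂? h) (λ q → subst (λ y → ¬ A y × ¬ CD y) (inv-inv h) (cross q)) cross))
        (trans (alg (𝟙 (E₂? h)) (a h) (b h) (a (inv h)) (b (inv h))) (trans (𝟙-*cong (E₂? h) (λ q → at-edge h (E₂-in q))) (ZP.*-comm (𝟙 (E₂? h)) _)))

    -- The vertex and face rules summed over the side away from the outer face, regrouped by edges.
    -- The right side gains `a` at darts of cycle vertices and drops `- b` on darts of the cycle;
    -- both can only increase it.
    compare : + d * V.#cls V₂? + + d * F.#cls F₂? ≤ᶻ ∑ (λ h → 𝟙 (E₂? h) * (a h - b h)) + count F₂?
    compare = ZP.≤-trans (ZP.≤-reflexive (trans (cong₂ _+_ (sym sum-V) (sym sum-F)) (sym (∑-+ _ _)))) (ZP.≤-trans (∑-mono (λ h → aux h (A? h) (CV? h) (CD? h))) (ZP.≤-reflexive (∑-+ _ _)))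
      where
      aux : ∀ h (p : Dec (A h)) (q : Dec (CV h)) (r : Dec (CD h)) → 𝟙 (¬? p ×-dec ¬? q) * a h + 𝟙 (¬? p) * (1ℤ - b h) ≤ᶻ 𝟙 (¬? p ×-dec ¬? r) * (a h - b h) + 𝟙 (¬? p)
      aux h (yes _) q r = ZP.≤-refl
      aux h (no _) (no nq) (yes r) = ⊥-elim (nq (CD-CV r))
      aux h (no _) (no _) (no _) = ZP.≤-reflexive (alg (a h) (b h))
        where
        alg : ∀ a b → 1ℤ * a + 1ℤ * (1ℤ - b) ≡ 1ℤ * (a - b) + 1ℤ
        alg = solve-∀
      aux h (no _) (yes _) (no _) = ZP.≤-trans (ZP.≤-reflexive (alg (b h))) (ZP.≤-trans (ZP.+-monoˡ-≤ (1ℤ - b h) (a≥0 h)) (ZP.≤-reflexive (alg₂ (a h) (b h))))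
        where
        alg : ∀ b → 0ℤ + 1ℤ * (1ℤ - b) ≡ 0ℤ + (1ℤ - b)
        alg = solve-∀
        alg₂ : ∀ a b → a + (1ℤ - b) ≡ 1ℤ * (a - b) + 1ℤ
        alg₂ = solve-∀
      aux h (no _) (yes _) (yes _) = ZP.≤-trans (ZP.≤-reflexive (alg (b h))) (ZP.≤-trans (ZP.+-monoʳ-≤ 1ℤ (ZP.neg-mono-≤ (b≥0 h))) ZP.≤-refl)
        where
        alg : ∀ b → 0ℤ + 1ℤ * (1ℤ - b) ≡ 1ℤ + - b
        alg = solve-∀

    -- Darts of the far side off `E₂?` lie on the cycle, and by `one-side` at most one of the two
    -- darts of each cycle edge is among them.
    border : count F₂? ≤ᶻ count E₂? + + suc k'
    border = ZP.≤-trans (ZP.≤-reflexive (trans (∑-cong (λ h → 𝟙-split (F₂? h) (CD? h))) (trans (∑-+ _ _) (ZP.+-comm (count FC?) _)))) (ZP.+-monoʳ-≤ (count E₂?) few)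
      where
      FC? : ∀ h → Dec (¬ A h × CD h)
      FC? h = F₂? h ×-dec CD? h
      few : count FC? ≤ᶻ + suc k'
      few = ZP.≤-trans (go one-side) (ZP.≤-reflexive (∑-one (suc k')))
        where
        go : (∀ t → A (c t)) ⊎ (∀ t → A (inv (c t))) → count FC? ≤ᶻ ∑ {suc k'} (λ _ → 1ℤ)
        go (inj₁ al) = count-inj FC? (λ (_ : Fin (suc k')) → yes tt) (λ h q → proj₁ (pick h q)) (λ _ _ → tt) (λ h h' q q' e → trans (proj₂ (pick h q)) (trans (cong (inv ∘ c) e) (sym (proj₂ (pick h' q')))))
          where
          pick : ∀ h → ¬ A h × CD h → ∃ λ t → h ≡ inv (c t)
          pick h (na , inj₁ (t , refl)) = ⊥-elim (na (al t))
          pick h (na , inj₂ (t , e)) = t , trans (sym (inv-inv h)) (cong inv (sym e))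
        go (inj₂ al) = count-inj FC? (λ (_ : Fin (suc k')) → yes tt) (λ h q → proj₁ (pick h q)) (λ _ _ → tt) (λ h h' q q' e → trans (proj₂ (pick h q)) (trans (cong c e) (sym (proj₂ (pick h' q')))))
          where
          pick : ∀ h → ¬ A h × CD h → ∃ λ t → h ≡ c t
          pick h (na , inj₁ (t , e)) = t , sym e
          pick h (na , inj₂ (t , e)) = ⊥-elim (na (subst A (trans (cong inv e) (inv-inv h)) (al t)))

    -- With `e` and `f` the dart counts of `E₂?` and `F₂?`, and `k` the length:
    -- `d (e + 2) ≤ (d - 2) e + 2 f` by `euler₂`, `compare` and `sum-E`, and `f ≤ e + k`; hence
    -- `2 d ≤ 2 k`.
    long : + d ≤ᶻ + suc k'
    long = fin (+ d) (+≤+ z≤n) (V.#cls V₂? + F.#cls F₂?) (count E₂?) (count F₂?) (+ suc k') (∑ (λ h → 𝟙 (E₂? h) * (a h - b h))) euler₂ (ZP.≤-trans (ZP.≤-reflexive (ZP.*-distribˡ-+ (+ d) _ _)) compare) sum-E border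
      where
      fin : ∀ D → 0ℤ ≤ᶻ D → ∀ x e f k s → e + + 2 ≤ᶻ + 2 * x → D * x ≤ᶻ s + f → + 2 * s ≡ (D - + 2) * e → f ≤ᶻ e + k → D ≤ᶻ k
      fin D@(+ _) (+≤+ z≤n) x e f k s p q r t = ZP.*-cancelˡ-≤-pos D k (+ 2) (subst₂ _≤ᶻ_ (alg₁ D e) (alg₂ D e k)
          (ZP.+-monoˡ-≤ (- (D * e)) (ZP.≤-trans (ZP.*-monoˡ-≤-nonNeg D p) (ZP.≤-trans (ZP.≤-reflexive (com D x)) (ZP.≤-trans (ZP.*-monoˡ-≤-nonNeg (+ 2) q) (ZP.≤-trans (ZP.≤-reflexive (trans (ZP.*-distribˡ-+ (+ 2) s f) (cong (_+ + 2 * f) r))) (ZP.+-monoʳ-≤ ((D - + 2) * e) (ZP.*-monoˡ-≤-nonNeg (+ 2) t))))))))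
        where
        com : ∀ D x → D * (+ 2 * x) ≡ + 2 * (D * x)
        com = solve-∀
        alg₁ : ∀ D e → D * (e + + 2) + - (D * e) ≡ + 2 * D
        alg₁ = solve-∀
        alg₂ : ∀ D e k → (D - + 2) * e + + 2 * (e + k) + - (D * e) ≡ + 2 * k
        alg₂ = solve-∀

  girth-≥ : ∀ k → HasCycleOfLength P k → d ≤ k
  girth-≥ (suc k') Cy = ZP.drop‿+≤+ (long Cy)

  module OuterWalk = WalkCycle P (λ i → iter fc i root) (λ i → V.~-step) (λ i j e → outer-inv (iter fc j root) (j , refl) (i , e))

  -- The outer contour contains a cycle of length at most its number `d` of darts, and no cycle is
  -- shorter than `d`.
  girth : 1 ≤ d → HasGirth P d
  girth l = subst (HasCycleOfLength P) exact OuterWalk.cycle , girth-≥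
    where
    open OuterWalk
    short : suc m ≤ d
    short = ZP.drop‿+≤+ (ZP.≤-trans (ZP.≤-reflexive (sym (∑-one (suc m)))) (ZP.≤-trans (count-inj (λ (_ : Fin (suc m)) → yes tt) Outer? (λ t _ → at t) (λ t _ → i +ℕ toℕ t , refl)
      (λ s t _ _ e → case s ≟ t of λ { (yes q) → q ; (no ne) → ⊥-elim (at-fresh s t ne (subst (at s V.~_) e V.~-refl)) })) (ZP.≤-reflexive odeg)))
    exact : suc m ≡ d
    exact = NP.≤-antisym short (girth-≥ (suc m) cycle)

-- Mobiles that are trees, and the descent to the outer face along them

record MobTree {m} (T : RMob m) : Set₁ where
  open RMob T
  field
    treeEq : + 2 * count W.Rep? ≡ count (λ x → ¬? (Bud? x)) + + 2
    connT : (Q : Fin m → Set) → (∀ x → Q x → Q (rT x)) → (∀ x → Q x → Q (invT x)) → ∀ {x} → Q x → ∀ y → Q y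

  module At (r : Fin m) where
    module TC = TreeContour r
    module X = TC.X

    all : ∀ x → X.Reached x
    all = connT X.Reached (λ x → X.reached-~ W.~-step) cross X.reached-root
      where
      cross : ∀ x → X.Reached x → X.Reached (invT x)
      cross x q with Bud? x
      ... | yes b = subst X.Reached (sym b) q
      ... | no nb = X.reached-inv nb q

    few : count (λ h → ¬? (Bud? h) ×-dec X.Reached? h) + + 2 ≤ᶻ + 2 * W.#cls X.Reached?
    few = ZP.≤-reflexive (trans (cong (_+ + 2) (count-cong (λ h → ¬? (Bud? h) ×-dec X.Reached? h) (λ h → ¬? (Bud? h)) (λ _ → proj₁) (λ x n → n , all x)))
      (trans (sym treeEq) (cong (λ z → + 2 * z) (count-cong W.Rep? (λ x → W.Rep? x ×-dec X.Reached? x) (λ x r → r , all x) (λ _ → proj₁)))))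

  opaque
    single : ∀ x y → x C.~ y
    single x y = At.TC.contour-single x (At.few x) (At.all x y)

  tree-flow : (z : Fin m → ℤ) → (∀ x → z (invT x) ≡ - z x) → (∀ x → Bud x → z x ≡ 0ℤ) → (∀ x → W.clsum x z ≡ 0ℤ) → ∀ x → z x ≡ 0ℤ
  tree-flow z anti bud bal x = X.forest-flow z anti supp (λ y _ _ → bal y) x
    where
    open At x
    supp : ∀ h → z h ≢ 0ℤ → X.Up h ⊎ X.Up (invT h)
    supp h ne with Bud? h
    ... | yes b = ⊥-elim (ne (bud h b))
    ... | no nb = X.tree-covered few h nb (all h)

module CorrTree {n m d} {M : RMap n} (OD : OuterData d M) {T : RMob m} (K : Corr M T) (Tr : MobTree T) where
  open RMap M
  open Inner M
  open OuterData OD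
  open RMob T
  open Corr K
  open CorrFacts K
  open MobTree Tr

  opaque
    base₀ : Σ (Fin m) λ x → Outer (inv (κ x)) × Bud x
    base₀ with black-over (inv root) (outer-inv root F.~-refl)
    ... | x , c , e = x , o , stop-bud c (inj₂ o)
      where
      o : Outer (inv (κ x))
      o = subst Outer (sym (trans (cong inv e) (inv-inv root))) F.~-refl

  x₀ : Fin m
  x₀ = proj₁ base₀

  o₀ : Outer (inv (κ x₀))
  o₀ = proj₁ (proj₂ base₀)

  b₀ : Bud x₀
  b₀ = proj₂ (proj₂ base₀)

  open Bracket T x₀ b₀ (outer-unmatched o₀) (λ y → single y x₀) public

  black-rot : ∀ {x} → col x ≡ black → col (rT x) ≡ black
  black-rot {x} c = trans (col-rot x) c

  -- Every inner dart has a preferred move: around its face if a white half-edge lies over it,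
  -- around its vertex otherwise. Unless it reaches the outer face, the move brings the black
  -- half-edge over the dart closer to `x₀` on the contour, so these walks support induction. They
  -- are tight for the flow read off from a branching mobile.
  module Ind (Q : Fin n → Set) (out : ∀ h → Outer h → Q h) (up : ∀ h → ¬ Outer h → Over white h → Q (fc h) → Q h)
    (around : ∀ h → ¬ Outer h → ¬ Over white h → Q (rt h) → Q h) where

    go : ∀ j x → col x ≡ black → k x <ℕ j → Q (κ x)
    go (suc j) x c l with Over? white (κ x)
    ... | yes o@(w , cw , e) = up (κ x) (black-in c) o (subst Q (rot-black c) (go j (rT x) (black-rot c) less))
      where
      b : Bud x
      b = stop-bud c (inj₁ o)
      ne : x ≢ x₀
      ne refl = proj₂ (InV-InE (subst InV e (white-in cw))) o₀
      less : k (rT x) <ℕ j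
      less = NP.≤-trans (NP.≤-reflexive (trans (cong (suc ∘ k ∘ rT) (sym b)) (sym (k-step ne)))) (NP.≤-pred l)
    ... | no no' with Outer? (inv (κ x))
    ...   | yes o = around (κ x) (black-in c) no' (out _ (outer-next (κ x) o))
    ...   | no no″ = around (κ x) (black-in c) no' (next (col (invT x)) refl)
      where
      nb : ¬ Bud x
      nb b = case bud-stop b of λ { (inj₁ o) → no' o ; (inj₂ o) → no″ o }
      ne : x ≢ x₀
      ne refl = nb b₀
      less : k (ρ x) <ℕ j
      less = NP.≤-trans (NP.≤-reflexive (sym (k-step ne))) (NP.≤-pred l)
      next : ∀ q → col (invT x) ≡ q → Q (rt (κ x))
      next black ci = subst Q (κ-ρ nb ci) (go j (ρ x) (black-rot ci) less)
      next white ci = subst Q (trans (κρ-bud bγ) (trans (cong fc (match (nb , ci) (F-run (ρ x)))) (trans (cong fc (over-edge nb)) (cong rt (inv-inv (κ x))))))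
          (go j (ρ γ) (trans (col-rot (invT γ)) (trans (cong col bγ) (bud-bl γ bγ))) (NP.<-trans (NP.≤-reflexive (sym (k-step (matched≢β (nb , ci) (F-run (ρ x)))))) (NP.≤-<-trans (k-run (F-run (ρ x))) less)))
        where
        γ : Fin m
        γ = F (ρ x)
        bγ : Bud γ
        bγ = run-bud (F-run (ρ x))

    result : ∀ h → Q h
    result h with Outer? h
    ... | yes o = out h o
    ... | no no' with black-over h no'
    ...   | x , c , refl = go _ x c NP.≤-refl

  outer-chain : ∀ {o x x'} → Outer o → col x ≡ black → κ x ≡ inv o → Run (ρ x) x' → inv (κ x') ≡ fc⁻ o
  outer-chain {o} {x} {x'} oo c e s = trans (cong inv (sym (rt-left (κ x')))) (cong (λ h → inv (rt⁻ h)) (sym (outer-distinct oo out' (V.~-trans at V.~-step))))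
    where
    b : Bud x
    b = stop-bud c (inj₂ (subst Outer (sym (trans (cong inv e) (inv-inv o))) oo))
    at : o V.~ κ x'
    at = V.~-trans V.~-step (rotate-~ (subst (λ h → Rotate h (κ x')) (trans (κρ-bud b) (trans (cong fc e) (cong rt (inv-inv o)))) (proj₁ (run-rotate s) (trans (col-rot (invT x)) (trans (cong col b) c)))))
    out' : Outer (rt (κ x'))
    out' with bud-stop (run-bud s)
    ... | inj₁ (w , cw , ew) = ⊥-elim (white-in cw (o , oo , V.~-sym (subst (o V.~_) (sym ew) at)))
    ... | inj₂ q' = outer-next (κ x') q'

  white-top : ∀ {w} → col w ≡ white → κ (F (rT w)) ≡ κ w
  white-top {w} c = rotate-fun (proj₂ (run-rotate (F-run (rT w))) (trans (col-rot w) c)) (rot-white c)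

-- the sum of increments along the walk that follows up on the set W and around off it
module Potential {n} (O W : Fin n → Set) (f r : Fin n → Fin n) (y x : Fin n → ℤ) where
  data Val : Fin n → ℤ → Set where
    out : ∀ {h} → O h → Val h 0ℤ
    up : ∀ {h v} → ¬ O h → W h → Val (f h) v → Val h (v - y h)
    around : ∀ {h v} → ¬ O h → ¬ W h → Val (r h) v → Val h (v - x h)

  val-fun : ∀ {h v w} → Val h v → Val h w → v ≡ w
  val-fun (out _) (out _) = refl
  val-fun (out o) (up n _ _) = ⊥-elim (n o)
  val-fun (out o) (around n _ _) = ⊥-elim (n o)
  val-fun (up n _ _) (out o) = ⊥-elim (n o)
  val-fun {h} (up _ _ r) (up _ _ s) = cong (_- y h) (val-fun r s)
  val-fun (up _ o _) (around _ n _) = ⊥-elim (n o)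
  val-fun (around n _ _) (out o) = ⊥-elim (n o)
  val-fun (around _ n _) (up _ o _) = ⊥-elim (n o)
  val-fun {h} (around _ _ r) (around _ _ s) = cong (_- x h) (val-fun r s)

edge-alg : ∀ a a₁ b b₁ a' a₁' b' b₁' p p₁ pr pf → ((a₁' - a₁) - (pf - p₁) - ((b₁' - b₁) - (pr - p₁))) + ((a' - a) - (pr - p) - ((b' - b) - (pf - p))) ≡ (a' + a₁' - (b' + b₁')) - (a + a₁ - (b + b₁))
edge-alg = solve-∀

-- Two mobiles of the same map carry the same weights
module Unique {n m m' d} {M : RMap n} (OD : OuterData d M) {T : RMob m} (K : Corr M T) (Tr : MobTree T) (B : Branch d T)
  {T' : RMob m'} (K' : Corr M T') (Tr' : MobTree T') (B' : Branch d T') where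
  open RMap M
  open Inner M
  open OuterData OD
  open RMob T
  open Corr K
  open CorrFacts K
  open MobTree Tr
  module CT = CorrTree OD K Tr
  module CT' = CorrTree OD K' Tr'
  f f' : Flow d M
  f = CorrFacts.toFlow K B
  f' = CorrFacts.toFlow K' B'
  module f = Flow f
  module f' = Flow f'

  x y : Fin n → ℤ
  x h = f'.a h - f.a h
  y h = f'.b h - f.b h

  no-a : ∀ {h} → ¬ Over white h → f.a h ≡ 0ℤ
  no-a {h} = over-none wt h

  no-b : ∀ {h} → ¬ Outer h → Over white h → f.b h ≡ 0ℤ
  no-b {h} no' o with black-over h no'
  ... | t , c , refl = cong -_ (trans (over-at wt t c) (bud-wt t (stop-bud c (inj₁ o))))

  no-a' : ∀ {h} → ¬ Corr.Over K' white h → f'.a h ≡ 0ℤ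
  no-a' {h} = CorrFacts.over-none K' (RMob.wt T') h

  no-b' : ∀ {h} → ¬ Outer h → Corr.Over K' white h → f'.b h ≡ 0ℤ
  no-b' {h} no' o with Corr.black-over K' h no'
  ... | t , c , refl = cong -_ (trans (CorrFacts.over-at K' (RMob.wt T') t c) (RMob.bud-wt T' t (Corr.stop-bud K' c (inj₁ o))))

  open Potential Outer (Over white) fc rt y x

  opaque
    val : ∀ h → ∃ (Val h)
    val = CT.Ind.result (λ h → ∃ (Val h)) (λ h o → 0ℤ , out o) (λ h n o q → _ , up n o (proj₂ q)) (λ h n o q → _ , around n o (proj₂ q))

  p : Fin n → ℤ
  p h = proj₁ (val h)

  p-out : ∀ {h} → Outer h → p h ≡ 0ℤ
  p-out {h} o = val-fun (proj₂ (val h)) (out o)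

  p-up : ∀ {h} → ¬ Outer h → Over white h → p h ≡ p (fc h) - y h
  p-up {h} n o = val-fun (proj₂ (val h)) (up n o (proj₂ (val (fc h))))

  p-around : ∀ {h} → ¬ Outer h → ¬ Over white h → p h ≡ p (rt h) - x h
  p-around {h} n o = val-fun (proj₂ (val h)) (around n o (proj₂ (val (rt h))))

  x-outV : ∀ {h} → OutV h → x h ≡ 0ℤ
  x-outV {h} o = cong₂ _-_ (f'.a-out h o) (f.a-out h o)

  p-outV : ∀ {h} → OutV h → p h ≡ 0ℤ
  p-outV {h} (o , oo , t , e) = go t h (o , oo , t , e) e
    where
    go : ∀ t h → OutV h → iter rt t h ≡ o → p h ≡ 0ℤ
    go zero h v refl = p-out oo
    go (suc t) h v e with Outer? h
    ... | yes q = p-out q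
    ... | no nq = trans (p-around nq (λ { (w , c , refl) → white-in c v })) (trans (cong₂ _-_ (go t (rt h) (OutV-~ V.~-step v) (trans (iter-suc rt t h) e)) (x-outV v)) refl)

  -- The difference of the flows minus the gradient of `p`. By the choice of `p` it vanishes along
  -- the preferred moves of `T`; what is left is `x̂` under white half-edges and `ŷ` under black
  -- non-bud ones, a function on the edges of the tree.
  x̂ ŷ : Fin n → ℤ
  x̂ h = x h - (p (rt h) - p h)
  ŷ h = y h - (p (fc h) - p h)

  private
    solve₁ : ∀ {u v w} → u ≡ v - w → w - (v - u) ≡ 0ℤ
    solve₁ {_} {v} {w} refl = lem v w
      where
      lem : ∀ v w → w - (v - (v - w)) ≡ 0ℤ
      lem = solve-∀
    zero₃ : ∀ {u v w} → u ≡ 0ℤ → v ≡ 0ℤ → w ≡ 0ℤ → u - (v - w) ≡ 0ℤ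
    zero₃ refl refl refl = refl

  x̂-around : ∀ {h} → ¬ Outer h → ¬ Over white h → x̂ h ≡ 0ℤ
  x̂-around {h} n o = solve₁ {p h} {p (rt h)} {x h} (p-around n o)

  ŷ-up : ∀ {h} → ¬ Outer h → Over white h → ŷ h ≡ 0ℤ
  ŷ-up {h} n o = solve₁ {p h} {p (fc h)} {y h} (p-up n o)

  x̂-out : ∀ {h} → OutV h → x̂ h ≡ 0ℤ
  x̂-out v = zero₃ (x-outV v) (p-outV (OutV-~ V.~-step v)) (p-outV v)

  ŷ-edge : ∀ {h} → ¬ InE h → ŷ h ≡ 0ℤ
  ŷ-edge {h} ne = go (Outer? h) (Outer? (inv h))
    where
    y0 : y h ≡ 0ℤ
    y0 = cong₂ _-_ (f'.b-out h ne) (f.b-out h ne)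
    go : Dec (Outer h) → Dec (Outer (inv h)) → ŷ h ≡ 0ℤ
    go (yes o) _ = zero₃ y0 (p-out (F.~-trans o F.~-step)) (p-out o)
    go (no n) (yes o) = zero₃ y0 (p-outV (inv h , o , V.~-back)) (p-outV (rt h , outer-next h o , V.~-step))
    go (no n) (no n') = ⊥-elim (ne (n , n'))

  zc : Fin m → Color → ℤ
  zc t white = x̂ (κ t)
  zc t black = - ŷ (κ t)

  z : Fin m → ℤ
  z t = zc t (col t)

  z-wh : ∀ {t} → col t ≡ white → z t ≡ x̂ (κ t)
  z-wh {t} c = cong (zc t) c
  z-bl : ∀ {t} → col t ≡ black → z t ≡ - ŷ (κ t)
  z-bl {t} c = cong (zc t) c

  z-bud : ∀ t → Bud t → z t ≡ 0ℤ
  z-bud t b = trans (z-bl c) (cong -_ (go (bud-stop b)))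
    where
    c : col t ≡ black
    c = bud-bl t b
    go : Stop (κ t) → ŷ (κ t) ≡ 0ℤ
    go (inj₁ o) = ŷ-up (black-in c) o
    go (inj₂ o) = ŷ-edge (λ i → proj₂ i o)

  z-live : ∀ {t} → ¬ Bud t → z t ≡ x̂ (κ t) - ŷ (κ t)
  z-live {t} nb = go (col t) refl
    where
    go : ∀ c → col t ≡ c → z t ≡ x̂ (κ t) - ŷ (κ t)
    go white c = trans (z-wh c) (sym (trans (cong (λ v → x̂ (κ t) - v) (ŷ-up (proj₁ (InV-InE (white-in c))) (t , c , refl))) (ZP.+-identityʳ _)))
    go black c = trans (z-bl c) (sym (trans (cong (_- ŷ (κ t)) (x̂-around (black-in c) (λ o → nb (stop-bud c (inj₁ o))))) (ZP.+-identityˡ _)))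

  z-anti : ∀ t → z (invT t) ≡ - z t
  z-anti t with Bud? t
  ... | yes b = trans (cong z b) (trans (z-bud t b) (sym (cong -_ (z-bud t b))))
  ... | no nb = opp (trans (cong₂ _+_ (trans (z-live (Graph.Ed-inv skeleton nb)) (cong (λ h → x̂ h - ŷ h) (over-edge nb))) (z-live nb)) (edge (κ t) (nonbud-InE nb)))
    where
    opp : ∀ {u v} → u + v ≡ 0ℤ → u ≡ - v
    opp {u} {v} e = trans (lem u v) (trans (cong (_- v) e) (ZP.+-identityˡ (- v)))
      where
      lem : ∀ u v → u ≡ u + v - v
      lem = solve-∀
    edge : ∀ h → InE h → (x̂ (inv h) - ŷ (inv h)) + (x̂ h - ŷ h) ≡ 0ℤ
    edge h i = trans (cong (λ v → (x (inv h) - (p (fc h) - p (inv h)) - (y (inv h) - (p v - p (inv h)))) + (x̂ h - ŷ h)) (cong rt (inv-inv h)))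
      (trans (edge-alg (f.a h) (f.a (inv h)) (f.b h) (f.b (inv h)) (f'.a h) (f'.a (inv h)) (f'.b h) (f'.b (inv h)) (p h) (p (inv h)) (p (rt h)) (p (fc h)))
        (trans (cong₂ _-_ (f'.at-edge h i) (f.at-edge h i)) (ZP.+-inverseʳ (+ d - + 2))))

  grad-V : ∀ h → V.clsum h (λ g → p (rt g) - p g) ≡ 0ℤ
  grad-V h = trans (∑-cong (λ g → lem (𝟙 (h V.~? g)) (p (rt g)) (p g))) (trans (∑-sub (λ g → 𝟙 (h V.~? g) * p (rt g)) (λ g → 𝟙 (h V.~? g) * p g)) (trans (cong (_- V.clsum h p) (V.clsum-shift h p)) (ZP.+-inverseʳ (V.clsum h p))))
    where
    lem : ∀ u v w → u * (v - w) ≡ u * v - u * w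
    lem = solve-∀

  grad-F : ∀ h → F.clsum h (λ g → p (fc g) - p g) ≡ 0ℤ
  grad-F h = trans (∑-cong (λ g → lem (𝟙 (h F.~? g)) (p (fc g)) (p g))) (trans (∑-sub (λ g → 𝟙 (h F.~? g) * p (fc g)) (λ g → 𝟙 (h F.~? g) * p g)) (trans (cong (_- F.clsum h p) (F.clsum-shift h p)) (ZP.+-inverseʳ (F.clsum h p))))
    where
    lem : ∀ u v w → u * (v - w) ≡ u * v - u * w
    lem = solve-∀

  x̂-sum : ∀ h → InV h → V.clsum h x̂ ≡ 0ℤ
  x̂-sum h i = trans (∑-cong (λ g → lem (𝟙 (h V.~? g)) (f'.a g) (f.a g) (p (rt g) - p g))) (trans (∑-sub (λ g → 𝟙 (h V.~? g) * f'.a g - 𝟙 (h V.~? g) * f.a g) (λ g → 𝟙 (h V.~? g) * (p (rt g) - p g)))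
    (cong₂ _-_ (trans (∑-sub (λ g → 𝟙 (h V.~? g) * f'.a g) (λ g → 𝟙 (h V.~? g) * f.a g)) (trans (cong₂ _-_ (f'.at-vertex h i) (f.at-vertex h i)) (ZP.+-inverseʳ (+ d)))) (grad-V h)))
    where
    lem : ∀ u a' a g → u * ((a' - a) - g) ≡ u * a' - u * a - u * g
    lem = solve-∀

  ŷ-sum : ∀ h → InF h → F.clsum h ŷ ≡ 0ℤ
  ŷ-sum h i = trans (∑-cong (λ g → lem (𝟙 (h F.~? g)) (f'.b g) (f.b g) (p (fc g) - p g))) (trans (∑-sub (λ g → 𝟙 (h F.~? g) * (1ℤ - f.b g) - 𝟙 (h F.~? g) * (1ℤ - f'.b g)) (λ g → 𝟙 (h F.~? g) * (p (fc g) - p g)))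
    (cong₂ _-_ (trans (∑-sub (λ g → 𝟙 (h F.~? g) * (1ℤ - f.b g)) (λ g → 𝟙 (h F.~? g) * (1ℤ - f'.b g))) (trans (cong₂ _-_ (f.at-face h i) (f'.at-face h i)) (ZP.+-inverseʳ (+ d)))) (grad-F h)))
    where
    lem : ∀ u b' b g → u * ((b' - b) - g) ≡ u * (1ℤ - b) - u * (1ℤ - b') - u * g
    lem = solve-∀

  z-bal : ∀ t → W.clsum t z ≡ 0ℤ
  z-bal t = go (col t) refl
    where
    go : ∀ c → col t ≡ c → W.clsum t z ≡ 0ℤ
    go white c = trans (sym (white-clsum z c)) (trans (∑-cong (λ g → 𝟙-*cong (κ t V.~? g) (λ s → pt g (InV-~ s (white-in c))))) (x̂-sum (κ t) (white-in c)))
      where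
      pt : ∀ g → InV g → over white z g ≡ x̂ g
      pt g i with Over? white g
      ... | yes (w , cw , refl) = trans (over-at z w cw) (z-wh cw)
      ... | no no' = trans (over-none z g no') (sym (x̂-around (proj₁ (InV-InE i)) no'))
    go black c = trans (sym (black-clsum z c)) (trans (∑-cong (λ g → 𝟙-*cong (κ t F.~? g) (λ s → pt g (InF-~ s (black-in c))))) (trans (∑-cong (λ g → sym (ZP.neg-distribʳ-* (𝟙 (κ t F.~? g)) (ŷ g)))) (trans (∑-neg (λ g → 𝟙 (κ t F.~? g) * ŷ g)) (cong -_ (ŷ-sum (κ t) (black-in c))))))
      where
      pt : ∀ g → InF g → over black z g ≡ - ŷ g
      pt g i with black-over g i
      ... | w , cw , refl = trans (over-at z w cw) (z-bl cw)

  z-zero : ∀ t → z t ≡ 0ℤ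
  z-zero = tree-flow z z-anti z-bud z-bal

  x̂-zero : ∀ h → x̂ h ≡ 0ℤ
  x̂-zero h with Outer? h
  ... | yes o = x̂-out (h , o , V.~-refl)
  ... | no n with Over? white h
  ...   | no no' = x̂-around n no'
  ...   | yes (t , c , refl) = trans (sym (z-wh c)) (z-zero t)

  ŷ-zero : ∀ h → ŷ h ≡ 0ℤ
  ŷ-zero h with Outer? h
  ... | yes o = ŷ-edge (λ i → proj₁ i o)
  ... | no n with black-over h n
  ...   | t , c , refl = ZP.neg-injective (trans (sym (z-bl c)) (z-zero t))

  private
    grad : ∀ {u v w} → u - (v - w) ≡ 0ℤ → w ≡ v - u
    grad {u} {v} {w} e = trans (lem u v w) (trans (cong (λ q → v - u + q) e) (ZP.+-identityʳ (v - u)))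
      where
      lem : ∀ u v w → w ≡ v - u + (u - (v - w))
      lem = solve-∀
    sub-≤ : ∀ {u v w} → 0ℤ ≤ᶻ v → w ≡ u - v → w ≤ᶻ u
    sub-≤ {u} {v} nn refl = ZP.≤-trans (ZP.+-monoʳ-≤ u (ZP.neg-mono-≤ nn)) (ZP.≤-reflexive (ZP.+-identityʳ u))
    sub-≥ : ∀ {u v w} → v ≤ᶻ 0ℤ → w ≡ u - v → u ≤ᶻ w
    sub-≥ {u} {v} np refl = ZP.≤-trans (ZP.≤-reflexive (sym (ZP.+-identityʳ u))) (ZP.+-monoʳ-≤ u (ZP.neg-mono-≤ np))
    diff≥ : ∀ {u v} → 0ℤ ≤ᶻ u → v ≡ 0ℤ → 0ℤ ≤ᶻ u - v
    diff≥ {u} nn refl = subst (0ℤ ≤ᶻ_) (sym (ZP.+-identityʳ u)) nn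
    diff≤ : ∀ {u v} → u ≡ 0ℤ → 0ℤ ≤ᶻ v → u - v ≤ᶻ 0ℤ
    diff≤ {_} {v} refl nn = ZP.≤-trans (ZP.≤-reflexive (ZP.+-identityˡ (- v))) (ZP.neg-mono-≤ nn)

  -- Along the preferred moves of `T` the weight of `T` is 0, so `p` grows by a weight of `T'`,
  -- which is nonnegative, until it is 0 on the outer face. In `0≤p` the roles are exchanged, the
  -- weights of `T'` being 0 along its own moves.
  p≤0 : ∀ h → p h ≤ᶻ 0ℤ
  p≤0 = CT.Ind.result (λ h → p h ≤ᶻ 0ℤ) (λ h o → ZP.≤-reflexive (p-out o))
    (λ h n o q → ZP.≤-trans (sub-≤ {p (fc h)} {y h} (diff≥ (f'.b≥0 h) (no-b n o)) (p-up n o)) q)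
    (λ h n o q → ZP.≤-trans (sub-≤ {p (rt h)} {x h} (diff≥ (f'.a≥0 h) (no-a o)) (p-around n o)) q)

  0≤p : ∀ h → 0ℤ ≤ᶻ p h
  0≤p = CT'.Ind.result (λ h → 0ℤ ≤ᶻ p h) (λ h o → ZP.≤-reflexive (sym (p-out o)))
    (λ h n o q → ZP.≤-trans q (sub-≥ {p (fc h)} {y h} (diff≤ (no-b' n o) (f.b≥0 h)) (grad {y h} {p (fc h)} (ŷ-zero h))))
    (λ h n o q → ZP.≤-trans q (sub-≥ {p (rt h)} {x h} (diff≤ (no-a' o) (f.a≥0 h)) (grad {x h} {p (rt h)} (x̂-zero h))))

  p-zero : ∀ h → p h ≡ 0ℤ
  p-zero h = ZP.≤-antisym (p≤0 h) (0≤p h)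

  same-a : ∀ h → f'.a h ≡ f.a h
  same-a h = ZP.i-j≡0⇒i≡j (f'.a h) (f.a h) (trans (lem (x h)) (trans (cong₂ (λ u v → x h - (u - v)) (sym (p-zero (rt h))) (sym (p-zero h))) (x̂-zero h)))
    where
    lem : ∀ u → u ≡ u - (0ℤ - 0ℤ)
    lem = solve-∀

  same-b : ∀ h → f'.b h ≡ f.b h
  same-b h = ZP.i-j≡0⇒i≡j (f'.b h) (f.b h) (trans (lem (y h)) (trans (cong₂ (λ u v → y h - (u - v)) (sym (p-zero (fc h))) (sym (p-zero h))) (ŷ-zero h)))
    where
    lem : ∀ u → u ≡ u - (0ℤ - 0ℤ)
    lem = solve-∀

-- Isomorphisms

record RIso {m m'} (T : RMob m) (T' : RMob m') : Set where
  private
    module T = RMob T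
    module T' = RMob T'
  field
    to : Fin m → Fin m'
    fr : Fin m' → Fin m
    fr-to : ∀ x → fr (to x) ≡ x
    to-fr : ∀ x → to (fr x) ≡ x
    rT-c : ∀ x → to (T.rT x) ≡ T'.rT (to x)
    inv-c : ∀ x → to (T.invT x) ≡ T'.invT (to x)
    col-c : ∀ x → T'.col (to x) ≡ T.col x
    wt-c : ∀ x → T'.wt (to x) ≡ T.wt x

  to-inj : ∀ {x y} → to x ≡ to y → x ≡ y
  to-inj {x} {y} e = trans (sym (fr-to x)) (trans (cong fr e) (fr-to y))

  run-c : ∀ {y x} → T.Run y x → T'.Run (to y) (to x)
  run-c (RMob.stop b) = T'.stop (trans (sym (inv-c _)) (cong to b))
  run-c {y} {x} (RMob.skip nb c r) = T'.skip (λ b → nb (to-inj (trans (inv-c y) b))) (trans (cong T'.col (sym (inv-c y))) (trans (col-c _) c)) (subst (λ z → T'.Run z (to x)) (ρ-c y) (run-c r))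
    where
    ρ-c : ∀ y → to (T.ρ y) ≡ T'.ρ (to y)
    ρ-c y = trans (rT-c _) (cong T'.rT (inv-c y))
  run-c {y} {x} (RMob.jump {γ = γ} (nb , c) r s) = T'.jump ((λ b → nb (to-inj (trans (inv-c y) b))) , trans (cong T'.col (sym (inv-c y))) (trans (col-c _) c)) (subst (λ z → T'.Run z (to γ)) (ρ-c y) (run-c r)) (subst (λ z → T'.Run z (to x)) (ρ-c γ) (run-c s))
    where
    ρ-c : ∀ y → to (T.ρ y) ≡ T'.ρ (to y)
    ρ-c y = trans (rT-c _) (cong T'.rT (inv-c y))

RIso-sym : ∀ {m m'} {T : RMob m} {T' : RMob m'} → RIso T T' → RIso T' T
RIso-sym {T = T} {T'} I = record { to = fr ; fr = to ; fr-to = to-fr ; to-fr = fr-to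
  ; rT-c = λ x → to-inj (trans (to-fr _) (sym (trans (rT-c (fr x)) (cong (RMob.rT T') (to-fr x)))))
  ; inv-c = λ x → to-inj (trans (to-fr _) (sym (trans (inv-c (fr x)) (cong (RMob.invT T') (to-fr x)))))
  ; col-c = λ x → trans (sym (col-c (fr x))) (cong (RMob.col T') (to-fr x))
  ; wt-c = λ x → trans (sym (wt-c (fr x))) (cong (RMob.wt T') (to-fr x)) }
  where open RIso I

record MIso {n n'} (M : RMap n) (M' : RMap n') : Set where
  private
    module M = RMap M
    module M' = RMap M'
  field
    to : Fin n → Fin n'
    fr : Fin n' → Fin n
    fr-to : ∀ x → fr (to x) ≡ x
    to-fr : ∀ x → to (fr x) ≡ x
    rt-c : ∀ x → to (M.rt x) ≡ M'.rt (to x)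
    inv-c : ∀ x → to (M.inv x) ≡ M'.inv (to x)
    root-c : M'.Outer (to M.root)

  to-inj : ∀ {x y} → to x ≡ to y → x ≡ y
  to-inj {x} {y} e = trans (sym (fr-to x)) (trans (cong fr e) (fr-to y))

  fc-c : ∀ x → to (M.fc x) ≡ M'.fc (to x)
  fc-c x = trans (rt-c _) (cong M'.rt (inv-c x))

  F-c : ∀ {x y} → x M.F.~ y → to x M'.F.~ to y
  F-c {x} s = M.F.closed-~ {λ z → to x M'.F.~ to z} (λ z r → M'.F.~-trans r (subst (to z M'.F.~_) (sym (fc-c z)) M'.F.~-step)) s M'.F.~-refl

  V-c : ∀ {x y} → x M.V.~ y → to x M'.V.~ to y
  V-c {x} s = M.V.closed-~ {λ z → to x M'.V.~ to z} (λ z r → M'.V.~-trans r (subst (to z M'.V.~_) (sym (rt-c z)) M'.V.~-step)) s M'.V.~-refl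

  out-c : ∀ {h} → M.Outer h → M'.Outer (to h)
  out-c o = M'.F.~-trans root-c (F-c o)

MIso-sym : ∀ {n n'} {M : RMap n} {M' : RMap n'} → MIso M M' → MIso M' M
MIso-sym {M = M} {M'} I = record { to = fr ; fr = to ; fr-to = to-fr ; to-fr = fr-to ; rt-c = rtf ; inv-c = invf
    ; root-c = RMap.F.~-sym M (subst (fr (RMap.root M') ~_) (fr-to (RMap.root M)) (F-f root-c)) }
  where
  open MIso I
  _~_ = RMap.F._~_ M
  rtf : ∀ x → fr (RMap.rt M' x) ≡ RMap.rt M (fr x)
  rtf x = to-inj (trans (to-fr _) (sym (trans (rt-c (fr x)) (cong (RMap.rt M') (to-fr x)))))
  invf : ∀ x → fr (RMap.inv M' x) ≡ RMap.inv M (fr x)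
  invf x = to-inj (trans (to-fr _) (sym (trans (inv-c (fr x)) (cong (RMap.inv M') (to-fr x)))))
  fcf : ∀ x → fr (RMap.fc M' x) ≡ RMap.fc M (fr x)
  fcf x = trans (rtf _) (cong (RMap.rt M) (invf x))
  F-f : ∀ {x y} → RMap.F._~_ M' x y → fr x ~ fr y
  F-f {x} s = RMap.F.closed-~ M' {λ z → fr x ~ fr z} (λ z r → RMap.F.~-trans M r (subst (fr z ~_) (sym (fcf z)) (RMap.F.~-step M))) s (RMap.F.~-refl M)

transport : ∀ {n n' m} {M : RMap n} {M' : RMap n'} {T : RMob m} → MIso M M' → Corr M T → Corr M' T
transport {M = M} {M'} {T} I K = record
  { κ = to ∘ κ
  ; κ-inj = λ c e → κ-inj c (to-inj e)
  ; black-in = λ c o → black-in c (out-r o)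
  ; black-over = λ h no' → let x , c , e = black-over (fr h) (λ o → no' (subst M'.Outer (to-fr h) (out-c o))) in x , c , trans (cong to e) (to-fr h)
  ; white-in = λ { {x} c (o , oo , s) → white-in c (fr o , J.out-c oo , subst (M.V._~ fr o) (fr-to (κ x)) (J.V-c s)) }
  ; white-over = λ h i → let x , c , s = white-over (fr h) (λ { (o , oo , s) → i (to o , out-c oo , subst (M'.V._~ to o) (to-fr h) (V-c s)) }) in x , c , subst (to (κ x) M'.V.~_) (to-fr h) (V-c s)
  ; rot-black = λ {x} c → trans (cong to (rot-black c)) (fc-c (κ x))
  ; rot-white = λ {x} c → subst (λ h → R'.Rotate h (to (κ x))) (rt-c _) (rotate (rot-white c))
  ; bud-stop = λ b → stop (bud-stop b)
  ; stop-bud = λ c s → stop-bud c (unstop s)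
  ; over-edge = λ {x} nb → trans (cong to (over-edge nb)) (inv-c (κ x)) }
  where
  module M = RMap M
  module M' = RMap M'
  open RMob T using (col)
  open MIso I
  module J = MIso (MIso-sym I)
  open Corr K
  out-r : ∀ {h} → M'.Outer (to h) → M.Outer h
  out-r {h} o = subst M.Outer (fr-to h) (J.out-c o)
  Stop' : _ → Set
  Stop' h = (Σ _ λ x → col x ≡ white × to (κ x) ≡ h) ⊎ M'.Outer (M'.inv h)
  module R' = Rotation M'.rt Stop'
  stop : ∀ {h} → Stop h → Stop' (to h)
  stop (inj₁ (x , c , e)) = inj₁ (x , c , cong to e)
  stop {h} (inj₂ o) = inj₂ (subst M'.Outer (inv-c h) (out-c o))
  unstop : ∀ {h} → Stop' (to h) → Stop h
  unstop (inj₁ (x , c , e)) = inj₁ (x , c , to-inj e)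
  unstop {h} (inj₂ o) = inj₂ (out-r (subst M'.Outer (sym (inv-c h)) o))
  rotate : ∀ {h x} → Rotate h x → R'.Rotate (to h) (to x)
  rotate (Rotation.here s) = R'.here (stop s)
  rotate {_} {x} (Rotation.turn {h} ns r) = R'.turn (ns ∘ unstop) (subst (λ z → R'.Rotate z (to x)) (rt-c h) (rotate r))

module Relabel {n m m'} {M : RMap n} {T : RMob m} {T' : RMob m'} (K : Corr M T) (K' : Corr M T')
  (over→ : ∀ {h} → Corr.Over K white h → Corr.Over K' white h) where
  open RMob T
  open Corr K
  module K' = Corr K'
  module T' = RMob T'

  opaque
    image : ∀ t → Σ (Fin m') λ t' → T'.col t' ≡ col t × K'.κ t' ≡ κ t
    image t = go (col t) refl
      where
      go : ∀ c → col t ≡ c → Σ (Fin m') λ t' → T'.col t' ≡ col t × K'.κ t' ≡ κ t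
      go black c = let t' , c' , e = K'.black-over (κ t) (black-in c) in t' , trans c' (sym c) , e
      go white c = let t' , c' , e = over→ (t , c , refl) in t' , trans c' (sym c) , e

  to : Fin m → Fin m'
  to t = proj₁ (image t)
  to-col : ∀ t → T'.col (to t) ≡ col t
  to-col t = proj₁ (proj₂ (image t))
  to-κ : ∀ t → K'.κ (to t) ≡ κ t
  to-κ t = proj₂ (proj₂ (image t))

-- Half-edges are matched by colour and dart. Equal weights give the same darts of positive weight,
-- hence the same white half-edges and the same stops; rotations and pairings are then determined by
-- the map and its stops.
mobile-unique : ∀ {n m m' d} {M : RMap n} (OD : OuterData d M) {T : RMob m} (K : Corr M T) (Tr : MobTree T) (B : Branch d T)
  {T' : RMob m'} (K' : Corr M T') (Tr' : MobTree T') (B' : Branch d T') → RIso T T'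
mobile-unique {M = M} OD {T} K Tr B {T'} K' Tr' B' = record
  { to = to ; fr = fr
  ; fr-to = λ x → K.κ-inj (trans (fr-col (to x)) (to-col x)) (trans (fr-κ (to x)) (to-κ x))
  ; to-fr = λ x → K'.κ-inj (trans (to-col (fr x)) (fr-col x)) (trans (to-κ (fr x)) (fr-κ x))
  ; rT-c = rT-c ; inv-c = inv-c ; col-c = to-col
  ; wt-c = λ x → wt-c x (T.col x) refl }
  where
  module U = Unique OD K Tr B K' Tr' B'
  module K = Corr K
  module K' = Corr K'
  module T = RMob T
  module T' = RMob T'
  module CF = CorrFacts K
  module CF' = CorrFacts K'
  open RMap M
  over→ : ∀ {h} → K.Over white h → K'.Over white h
  over→ {h} (t , c , refl) with CF'.Over? white (K.κ t)
  ... | yes o = o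
  ... | no no' = ⊥-elim (ZP.<⇒≢ (CF.wt-white c) (sym (trans (sym (CF.over-at T.wt t c)) (trans (sym (U.same-a (K.κ t))) (CF'.over-none T'.wt (K.κ t) no')))))
  over← : ∀ {h} → K'.Over white h → K.Over white h
  over← {h} (t , c , refl) with CF.Over? white (K'.κ t)
  ... | yes o = o
  ... | no no' = ⊥-elim (ZP.<⇒≢ (CF'.wt-white c) (sym (trans (sym (CF'.over-at T'.wt t c)) (trans (U.same-a (K'.κ t)) (CF.over-none T.wt (K'.κ t) no')))))
  module L = Relabel K K' over→
  module L' = Relabel K' K over←
  open L using (to; to-col; to-κ)
  open L' using () renaming (to to fr; to-col to fr-col; to-κ to fr-κ)
  stop→ : ∀ {h} → K.Stop h → K'.Stop h
  stop→ (inj₁ o) = inj₁ (over→ o)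
  stop→ (inj₂ o) = inj₂ o
  stop← : ∀ {h} → K'.Stop h → K.Stop h
  stop← (inj₁ o) = inj₁ (over← o)
  stop← (inj₂ o) = inj₂ o
  rotate→ : ∀ {h x} → K.Rotate h x → K'.Rotate h x
  rotate→ (Rotation.here s) = K'.here (stop→ s)
  rotate→ (Rotation.turn ns r) = K'.turn (ns ∘ stop←) (rotate→ r)
  back : ∀ {t} → T.col t ≡ white → K.Rotate (rt (K.κ t)) (K.κ (T.rT⁻ t))
  back {t} c = subst (λ z → K.Rotate (rt (K.κ z)) (K.κ (T.rT⁻ t))) (T.rT-right t) (K.rot-white (trans (sym (T.col-rot _)) (trans (cong T.col (T.rT-right t)) c)))
  back' : ∀ {t} → T'.col t ≡ white → K'.Rotate (rt (K'.κ t)) (K'.κ (T'.rT⁻ t))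
  back' {t} c = subst (λ z → K'.Rotate (rt (K'.κ z)) (K'.κ (T'.rT⁻ t))) (T'.rT-right t) (K'.rot-white (trans (sym (T'.col-rot _)) (trans (cong T'.col (T'.rT-right t)) c)))
  rT-c : ∀ x → to (T.rT x) ≡ T'.rT (to x)
  rT-c x = go (T.col x) refl
    where
    cols : T'.col (to (T.rT x)) ≡ T.col x
    cols = trans (to-col (T.rT x)) (T.col-rot x)
    go : ∀ c → T.col x ≡ c → to (T.rT x) ≡ T'.rT (to x)
    go black c = K'.κ-inj (trans cols (sym (trans (T'.col-rot (to x)) (to-col x)))) (trans (to-κ (T.rT x)) (trans (K.rot-black c) (trans (cong fc (sym (to-κ x))) (sym (K'.rot-black (trans (to-col x) c))))))
    go white c = trans (sym (T'.rT-right (to (T.rT x)))) (cong T'.rT (K'.κ-inj (trans (trans (sym (T'.col-rot _)) (trans (cong T'.col (T'.rT-right _)) cols)) (sym (to-col x)))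
        (trans (K'.rotate-fun (back' (trans cols c)) (subst (λ h → K'.Rotate (rt h) (K.κ x)) (sym (to-κ (T.rT x))) (rotate→ (K.rot-white c)))) (sym (to-κ x)))))
  live : ∀ {x} → ¬ T.Bud x → ¬ T'.Bud (to x)
  live {x} nb b = go (T.col x) refl
    where
    go : ∀ c → T.col x ≡ c → ⊥
    go black c = nb (K.stop-bud c (stop← (subst K'.Stop (to-κ x) (K'.bud-stop b))))
    go white c = CF'.nonbud-white (trans (to-col x) c) b
  inv-c : ∀ x → to (T.invT x) ≡ T'.invT (to x)
  inv-c x with T.Bud? x
  ... | yes b = trans (cong to b) (sym (K'.stop-bud (trans (to-col x) (T.bud-bl x b)) (subst K'.Stop (sym (to-κ x)) (stop→ (K.bud-stop b)))))
  ... | no nb = CF'.nonbud-inj (live (Graph.Ed-inv T.skeleton nb)) (Graph.Ed-inv T'.skeleton (live nb)) (trans (to-κ (T.invT x)) (trans (K.over-edge nb) (trans (cong inv (sym (to-κ x))) (sym (K'.over-edge (live nb))))))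
  wt-c : ∀ x c → T.col x ≡ c → T'.wt (to x) ≡ T.wt x
  wt-c x white c = trans (sym (CF'.over-at T'.wt (to x) (trans (to-col x) c))) (trans (cong (CF'.over white T'.wt) (to-κ x)) (trans (U.same-a (K.κ x)) (CF.over-at T.wt x c)))
  wt-c x black c = trans (sym (CF'.over-at T'.wt (to x) (trans (to-col x) c))) (trans (cong (CF'.over black T'.wt) (to-κ x)) (trans (ZP.neg-injective (U.same-b (K.κ x))) (CF.over-at T.wt x c)))

module MapUnique {n n' m m' d} {M : RMap n} (OD : OuterData d M) {M' : RMap n'} (OD' : OuterData d M') {T : RMob m} (K : Corr M T) (Tr : MobTree T)
  {T' : RMob m'} (K' : Corr M' T') (Tr' : MobTree T') (I : RIso T T') where
  private
    module M' = RMap M'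
    module K' = Corr K'
    module T' = RMob T'
    module CF' = CorrFacts K'
    module CT = CorrTree OD K Tr
    module CT' = CorrTree OD' K' Tr'
    module OD' = OuterData OD'
  open RMap M
  open Inner M
  open OuterData OD
  open RMob T
  open Corr K
  open CorrFacts K
  open RIso I renaming (to to tt'; inv-c to invT-c)

  blackOf : ∀ h → ¬ Outer h → Fin m
  blackOf h i = proj₁ (black-over h i)

  -- An inner dart is named by its black half-edge, an outer dart by the black half-edge over the
  -- opposite inner dart.
  gD : ∀ h → Dec (Outer h) → Fin n'
  gD h (no i) = K'.κ (tt' (blackOf h i))
  gD h (yes o) = M'.inv (K'.κ (tt' (blackOf (inv h) (outer-inv h o))))

  opaque
    g : Fin n → Fin n'
    g h = gD h (Outer? h)

    g-black : ∀ {x} → col x ≡ black → g (κ x) ≡ K'.κ (tt' x)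
    g-black {x} c = go (Outer? (κ x))
      where
      go : ∀ q → gD (κ x) q ≡ K'.κ (tt' x)
      go (yes o) = ⊥-elim (black-in c o)
      go (no i) = let y , cy , e = black-over (κ x) i in cong (K'.κ ∘ tt') (κ-inj (trans cy (sym c)) e)

    g-outer : ∀ {h x} → Outer h → col x ≡ black → κ x ≡ inv h → g h ≡ M'.inv (K'.κ (tt' x))
    g-outer {h} {x} o c e = go (Outer? h)
      where
      go : ∀ q → gD h q ≡ M'.inv (K'.κ (tt' x))
      go (no i) = ⊥-elim (i o)
      go (yes o') = let y , cy , e' = black-over (inv h) (outer-inv h o') in cong (M'.inv ∘ K'.κ ∘ tt') (κ-inj (trans cy (sym c)) (trans e' (sym e)))

  -- A white half-edge shares its dart with the bud that matches its opening, and isomorphisms of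
  -- mobiles preserve the bracketing.
  g-all : ∀ t → g (κ t) ≡ K'.κ (tt' t)
  g-all t = go (col t) refl
    where
    go : ∀ c → col t ≡ c → g (κ t) ≡ K'.κ (tt' t)
    go black c = g-black c
    go white c = trans (cong g (sym (CT.white-top c))) (trans (g-black (bud-bl γ (run-bud (CT.F-run (rT t))))) (trans (cong K'.κ (sym (run'))) (CT'.white-top (trans (col-c t) c))))
      where
      γ : Fin m
      γ = CT.F (rT t)
      run' : CT'.F (T'.rT (tt' t)) ≡ tt' γ
      run' = CT'.F-fun (subst (λ z → T'.Run z (tt' γ)) (rT-c t) (run-c (CT.F-run (rT t))))

  black-inv : ∀ o → Outer o → Σ (Fin m) λ x → col x ≡ black × κ x ≡ inv o
  black-inv o oo = black-over (inv o) (outer-inv o oo)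

  bud-c : ∀ {x} → Bud x → T'.Bud (tt' x)
  bud-c b = trans (sym (invT-c _)) (cong tt' b)

  -- If the image of the bud shared its dart with a white half-edge, so would the bud itself, by
  -- going back; it would then sit at an inner vertex.
  g-out : ∀ {o} → Outer o → M'.Outer (g o)
  g-out {o} oo with black-inv o oo
  ... | x , c , e = subst M'.Outer (sym (g-outer oo c e)) (go (K'.bud-stop (bud-c (stop-bud c (inj₂ (subst Outer (sym (trans (cong inv e) (inv-inv o))) oo))))))
    where
    go : K'.Stop (K'.κ (tt' x)) → M'.Outer (M'.inv (K'.κ (tt' x)))
    go (inj₂ o') = o'
    go (inj₁ (w' , cw , ew)) = ⊥-elim (proj₂ (InV-InE (subst InV same (white-in cw₀))) (subst Outer (sym (trans (cong inv e) (inv-inv o))) oo))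
      where
      w : Fin m
      w = fr w'
      cw₀ : col w ≡ white
      cw₀ = trans (sym (col-c w)) (trans (cong T'.col (to-fr w')) cw)
      γ : Fin m
      γ = CT.F (rT w)
      γx : γ ≡ x
      γx = to-inj (K'.κ-inj (trans (trans (col-c γ) (bud-bl γ (run-bud (CT.F-run (rT w))))) (sym (trans (col-c x) c)))
        (trans (sym (g-black (bud-bl γ (run-bud (CT.F-run (rT w)))))) (trans (cong g (CT.white-top cw₀)) (trans (g-all w) (trans (cong K'.κ (to-fr w')) ew)))))
      same : κ w ≡ κ x
      same = trans (sym (CT.white-top cw₀)) (cong κ γx)

  g-inv : ∀ h → g (inv h) ≡ M'.inv (g h)
  g-inv h = go (Outer? h) (Outer? (inv h))
    where
    go : Dec (Outer h) → Dec (Outer (inv h)) → g (inv h) ≡ M'.inv (g h)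
    go (yes o) _ = let x , c , e = black-inv h o in trans (cong g (sym e)) (trans (g-black c) (sym (trans (cong M'.inv (g-outer o c e)) (M'.inv-inv _))))
    go (no i) (yes o) = let x , c , e = black-over h i in trans (g-outer o c (trans e (sym (inv-inv h)))) (cong M'.inv (trans (sym (g-black c)) (cong g e)))
    go (no i) (no i') = let t , nb , e = active h (i , i') in subst (λ h → g (inv h) ≡ M'.inv (g h)) e
      (trans (cong g (sym (over-edge nb))) (trans (g-all (invT t)) (trans (cong K'.κ (invT-c t)) (trans (K'.over-edge (λ b → nb (to-inj (trans (invT-c t) b)))) (cong M'.inv (sym (g-all t)))))))

  g-fc : ∀ h → g (fc h) ≡ M'.fc (g h)
  g-fc h with Outer? h
  ... | no i = let x , c , e = black-over h i in trans (cong (g ∘ fc) (sym e)) (trans (cong g (sym (rot-black c))) (trans (g-black (trans (col-rot x) c)) (trans (cong K'.κ (rT-c x)) (trans (K'.rot-black (trans (col-c x) c)) (cong M'.fc (trans (sym (g-black c)) (cong g e)))))))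
  -- On the outer face, `fc` is recovered backwards from the next unmatched bud, which the
  -- isomorphism preserves.
  ... | yes o with black-inv (fc h) (F.~-trans o F.~-step)
  ...   | x , c , e = sym (trans (cong M'.fc (trans (g-outer o c' (trans (sym (inv-inv (κ x'))) (cong inv κx'))) chain)) (Perm.right M'.face (g (fc h))))
    where
    o₁ : Outer (fc h)
    o₁ = F.~-trans o F.~-step
    x' : Fin m
    x' = CT.F (ρ x)
    c' : col x' ≡ black
    c' = bud-bl x' (run-bud (CT.F-run (ρ x)))
    κx' : inv (κ x') ≡ h
    κx' = trans (CT.outer-chain o₁ c e (CT.F-run (ρ x))) (Perm.left face h)
    chain : M'.inv (K'.κ (tt' x')) ≡ M'.fc⁻ (g (fc h))
    chain = CT'.outer-chain (g-out o₁) (trans (col-c x) c) (trans (sym (M'.inv-inv _)) (cong M'.inv (sym (g-outer o₁ c e)))) (subst (λ z → T'.Run z (tt' x')) (trans (rT-c _) (cong T'.rT (invT-c x))) (run-c (CT.F-run (ρ x))))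

  g-rt : ∀ h → g (rt h) ≡ M'.rt (g h)
  g-rt h = trans (cong g (cong rt (sym (inv-inv h)))) (trans (g-fc (inv h)) (trans (cong M'.fc (g-inv h)) (cong M'.rt (M'.inv-inv (g h)))))

map-unique : ∀ {n n' m m' d} {M : RMap n} (OD : OuterData d M) {M' : RMap n'} (OD' : OuterData d M') {T : RMob m} (K : Corr M T) (Tr : MobTree T)
  {T' : RMob m'} (K' : Corr M' T') (Tr' : MobTree T') → RIso T T' → MIso M M'
map-unique {M = M} OD {M'} OD' {T} K Tr {T'} K' Tr' I = record { to = A.g ; fr = A'.g ; fr-to = ba ; to-fr = ab ; rt-c = A.g-rt ; inv-c = A.g-inv ; root-c = A.g-out (RMap.F.~-refl M) }
  where
  module A = MapUnique OD OD' K Tr K' Tr' I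
  module A' = MapUnique OD' OD K' Tr' K Tr (RIso-sym I)
  open RIso I
  round : ∀ x → A'.g (A.g (Corr.κ K x)) ≡ Corr.κ K x
  round x = trans (cong A'.g (A.g-all x)) (trans (A'.g-all (to x)) (cong (Corr.κ K) (fr-to x)))
  round' : ∀ x → A.g (A'.g (Corr.κ K' x)) ≡ Corr.κ K' x
  round' x = trans (cong A.g (A'.g-all x)) (trans (A.g-all (fr x)) (cong (Corr.κ K') (to-fr x)))
  ba : ∀ h → A'.g (A.g h) ≡ h
  ba h = case RMap.Outer? M h of λ where
   (no i) → let x , _ , e = Corr.black-over K h i in trans (cong (A'.g ∘ A.g) (sym e)) (trans (round x) e)
   (yes o) → let x , _ , e = A.black-inv h o in
    trans (cong (A'.g ∘ A.g) (sym (trans (cong inv e) (inv-inv h)))) (trans (cong A'.g (A.g-inv (Corr.κ K x))) (trans (A'.g-inv (A.g (Corr.κ K x))) (trans (cong inv (round x)) (trans (cong inv e) (inv-inv h)))))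
    where open RMap M
  ab : ∀ h → A.g (A'.g h) ≡ h
  ab h = case RMap.Outer? M' h of λ where
   (no i) → let x , _ , e = Corr.black-over K' h i in trans (cong (A.g ∘ A'.g) (sym e)) (trans (round' x) e)
   (yes o) → let x , _ , e = A'.black-inv h o in
    trans (cong (A.g ∘ A'.g) (sym (trans (cong inv e) (inv-inv h)))) (trans (cong A.g (A'.g-inv (Corr.κ K' x))) (trans (A.g-inv (A'.g (Corr.κ K' x))) (trans (cong inv (round' x)) (trans (cong inv e) (inv-inv h)))))
    where open RMap M'

-- Passage between the two presentations of maps and mobiles

star-conn : ∀ {n} {s a : Fin n → Fin n} → ((Q : Fin n → Set) → (∀ h → Q h → Q (s h)) → (∀ h → Q h → Q (a h)) → ∀ {x} → Q x → ∀ y → Q y) → ∀ x y → Star (Step s a) x y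
star-conn c x = c (Star _ x) (λ h r → r ◅◅ (byσ h ◅ ε)) (λ h r → r ◅◅ (byα h ◅ ε)) ε

twice-pos : ∀ x → + (2 *ℕ x) ≡ + 2 * + x
twice-pos x = ZP.pos-* 2 x

rawT : ∀ {m} → ZMobile m → RMob m
rawT T = record
  { rotT = record { ap = σ T ; ap⁻ = σ⁻ T ; left = σ-inv₁ T ; right = σ-inv₂ T } ; invT = α T ; invT-inv = α-invol T
  ; col = color T ; col-rot = color-vertex T ; bud-bl = bud-black T ; wt = weight T ; bud-wt = bud-weight T ; wh-pos = white-pos T ; bl-nonpos = black-nonpos T }

module Weights {m} (X : RMob m) where
  open RMob X
  open OrbitBridge rotT

  vw : Fin m → ℤ
  vw x = sumℤ (List.map (λ y → if reachB rT x y then wt y else + 0) (List.allFin m))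

  vw-clsum : ∀ x → vw x ≡ W.clsum x wt
  vw-clsum x = trans (sumℤ-∑ _) (∑-cong (λ y → aux y (reachB rT x y) (reach-sound x y) (reach-complete x y)))
    where
    aux : ∀ y b → (T b → x W.~ y) → (x W.~ y → T b) → (if b then wt y else + 0) ≡ 𝟙 (x W.~? y) * wt y
    aux y true f g = sym (on (x W.~? y) (f tt))
    aux y false f g = sym (off (x W.~? y) g)

  NB? : ∀ x → Dec (¬ Bud x)
  NB? x = ¬? (Bud? x)

  buds : + numBuds invT ≡ count Bud?
  buds = countB-count _ Bud? (λ x t → toWitness t) (λ x b → fromWitness {a? = invT x ≟ x} b)

  nonbuds : + (m ∸ numBuds invT) ≡ count NB?
  nonbuds = trans (cong (λ z → + (z ∸ numBuds invT)) split) (trans (cong +_ (NP.m+n∸n≡m c (numBuds invT))) c-eq)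
    where
    c : ℕ
    c = ∣ count NB? ∣
    c-eq : + c ≡ count NB?
    c-eq = ZP.0≤i⇒+∣i∣≡i (∑-nonneg (λ x → 𝟙-nonneg (NB? x)))
    split : m ≡ c +ℕ numBuds invT
    split = ZP.+-injective (trans (sym (∑-one m)) (trans (∑-cong (λ x → one (Bud? x))) (trans (∑-+ _ (λ x → 𝟙 (Bud? x))) (cong₂ _+_ (sym c-eq) (sym buds)))))
      where
      one : ∀ {P : Set} (q : Dec P) → 1ℤ ≡ 𝟙 (¬? q) + 𝟙 q
      one (yes _) = refl
      one (no _) = refl

  tree→ : 2 *ℕ numOrbits rT ≡ (m ∸ numBuds invT) +ℕ 2 → + 2 * count W.Rep? ≡ count NB? + + 2
  tree→ e = trans (cong (λ z → + 2 * z) (sym numOrbits-cls)) (trans (sym (twice-pos (numOrbits rT))) (trans (cong +_ e) (cong (_+ + 2) nonbuds)))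

  tree← : + 2 * count W.Rep? ≡ count NB? + + 2 → 2 *ℕ numOrbits rT ≡ (m ∸ numBuds invT) +ℕ 2
  tree← e = ZP.+-injective (trans (twice-pos (numOrbits rT)) (trans (cong (λ z → + 2 * z) numOrbits-cls) (trans e (cong (_+ + 2) (sym nonbuds)))))

mobTree : ∀ {m} (T : ZMobile m) → MobTree (rawT T)
mobTree T = record { treeEq = Weights.tree→ (rawT T) (tree T) ; connT = λ Q f g {x} q y → star-closed Q f g (connected T x y) q }

rawBranch : ∀ {m d} (T : ZMobile m) → DBranching d T → Branch d (rawT T)
rawBranch T D = record
  { edge-w = edge-weight
  ; white-w = λ x c → trans (sym (vw-clsum x)) (white-weight x c)
  ; black-w = λ x c → trans (cong₂ _+_ (sym (orbitSize-clsum x)) (sym (vw-clsum x))) (black-weight x c) }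
  where
  open DBranching D
  open Weights (rawT T)
  open OrbitBridge (RMob.rotT (rawT T))

cook : ∀ {m} (T : RMob m) → MobTree T → ZMobile m
cook T Tr = record
  { σ = rT ; σ⁻ = rT⁻ ; σ-inv₁ = rT-left ; σ-inv₂ = rT-right ; α = invT ; α-invol = invT-inv ; color = col ; color-vertex = col-rot ; bud-black = bud-bl
  ; connected = star-conn (MobTree.connT Tr) ; tree = Weights.tree← T (MobTree.treeEq Tr)
  ; weight = wt ; bud-weight = bud-wt ; white-pos = wh-pos ; black-nonpos = bl-nonpos }
  where open RMob T

cookBranch : ∀ {m d} (T : RMob m) (Tr : MobTree T) → Branch d T → DBranching d (cook T Tr)
cookBranch {m} {d} T Tr B = record
  { black-weights = λ x nb c → small (bl-nonpos x nb c) (low x nb)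
  ; edge-weight = edge-w
  ; white-weight = λ x c → trans (vw-clsum x) (white-w x c)
  ; black-weight = λ x c → trans (cong₂ _+_ (orbitSize-clsum x) (vw-clsum x)) (black-w x c) }
  where
  open RMob T
  open Branch B
  open Weights T
  open OrbitBridge rotT
  small : ∀ {w} → w ≤ᶻ 0ℤ → - (+ 2) ≤ᶻ w → (w ≡ + 0) ⊎ (w ≡ + 0 - + 1) ⊎ (w ≡ + 0 - + 2)
  small {+ zero} _ _ = inj₁ refl
  small {+ suc k} (+≤+ ()) _
  small { -[1+ 0 ]} _ _ = inj₂ (inj₁ refl)
  small { -[1+ 1 ]} _ _ = inj₂ (inj₂ refl)
  small { -[1+ suc (suc k) ]} _ (Data.Integer.-≤- (s≤s ()))
  wt-white : ∀ {x} → col x ≡ white → 0ℤ ≤ᶻ wt x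
  wt-white {x} c = ZP.<⇒≤ (wh-pos x (λ b → black≢white (bud-bl x b) c) c)
  top : ∀ x → wt x ≤ᶻ + d
  top x = go (col x) refl
    where
    go : ∀ c → col x ≡ c → wt x ≤ᶻ + d
    go black c with Bud? x
    ... | yes b = ZP.≤-trans (ZP.≤-reflexive (bud-wt x b)) (+≤+ z≤n)
    ... | no nb = ZP.≤-trans (bl-nonpos x nb c) (+≤+ z≤n)
    go white c = ZP.≤-trans (ZP.≤-reflexive (sym (∑-δ x wt))) (ZP.≤-trans (∑-mono le) (ZP.≤-reflexive (white-w x c)))
      where
      le : ∀ y → 𝟙 (x ≟ y) * wt y ≤ᶻ 𝟙 (x W.~? y) * wt y
      le y = aux (x ≟ y) (x W.~? y)
        where
        aux : (p : Dec (x ≡ y)) (q : Dec (x W.~ y)) → 𝟙 p * wt y ≤ᶻ 𝟙 q * wt y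
        aux (yes _) (yes _) = ZP.≤-refl
        aux (yes refl) (no ns) = ⊥-elim (ns W.~-refl)
        aux (no _) (no _) = ZP.≤-refl
        aux (no _) (yes s) = subst (0ℤ ≤ᶻ_) (sym (ZP.*-identityˡ (wt y))) (wt-white (W.closed-~ {λ z → col z ≡ white} (λ z e → trans (col-rot z) e) s c))
  -- The opposite half-edge weighs at most `d`, as white weights are positive and add up to `d`
  -- around a vertex; the two weights of an edge add up to `d - 2`. This is the origin of the bound
  -- -2.
  low : ∀ x → ¬ Bud x → - (+ 2) ≤ᶻ wt x
  low x nb = ZP.≤-trans (ZP.≤-reflexive (alg (+ d))) (ZP.≤-trans (ZP.+-monoʳ-≤ (+ d - + 2) (ZP.neg-mono-≤ (top (invT x)))) (ZP.≤-reflexive (trans (cong (_- wt (invT x)) (sym (edge-w x nb))) (alg₂ (wt x) (wt (invT x))))))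
    where
    alg : ∀ D → - (+ 2) ≡ D - + 2 + - D
    alg = solve-∀
    alg₂ : ∀ u v → u + v - v ≡ u
    alg₂ = solve-∀

module MapBridge {n} (M : RMap n) where
  open RMap M
  module BV = OrbitBridge rot
  module BF = OrbitBridge face

  genus→ : 2 *ℕ (numOrbits rt +ℕ numOrbits fc) ≡ n +ℕ 4 → + 2 * (count V.Rep? + count F.Rep?) ≡ + n + + 4
  genus→ e = trans (cong₂ (λ u v → + 2 * (u + v)) (sym BV.numOrbits-cls) (sym BF.numOrbits-cls)) (trans (sym (twice-pos (numOrbits rt +ℕ numOrbits fc))) (cong +_ e))

  genus← : + 2 * (count V.Rep? + count F.Rep?) ≡ + n + + 4 → 2 *ℕ (numOrbits rt +ℕ numOrbits fc) ≡ n +ℕ 4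
  genus← e = ZP.+-injective (trans (twice-pos (numOrbits rt +ℕ numOrbits fc)) (trans (cong₂ (λ u v → + 2 * (u + v)) BV.numOrbits-cls BF.numOrbits-cls) e))

-- The two constructions on plane maps and mobiles, and the bijection

record Opened {n} (d : ℕ) (M : RMap n) : Set₁ where
  field
    size : ℕ
    mob : RMob size
    K : Corr M mob
    Tr : MobTree mob
    B : Branch d mob

module OpenMap {n d} (1≤d : 1 ≤ d) (P : PlaneMap n) (girth : HasGirth P d) (odeg : outerDegree P ≡ d) where
  M : RMap n
  M = raw P
  open RMap M
  open Inner M

  odeg' : count Outer? ≡ + d
  odeg' = trans (sym (MapBridge.BF.orbitSize-clsum M root)) (cong +_ odeg)

  module OS = OuterSimple P girth odeg'

  od : OuterData d M
  od = record { fpf = PlaneMap.α-fpf P ; conn = raw-conn P ; outer-inv = OS.outer-inv ; outer-distinct = OS.outer-distinct ; odeg = odeg' }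

  genus : + 2 * (count V.Rep? + count F.Rep?) ≡ + n + + 4
  genus = MapBridge.genus→ M (PlaneMap.genus0 P)

  euler : + 2 * (V.#cls InV? + F.#cls InF?) ≡ count InE? + + 2
  euler = Counts.euler→ M od genus

  opaque
    acc : AccFlow d M
    acc = Push.Loop.accessible M od (FlowExists.flow P girth od euler)

  module O = Opening M od 1≤d acc
  open CorrFacts O.corr using (#vertices; #edges)

  treeEq : + 2 * count (RMob.W.Rep? O.T₀) ≡ count (λ x → ¬? (RMob.Bud? O.T₀ x)) + + 2
  treeEq = trans (cong (λ z → + 2 * z) #vertices) (trans euler (cong (_+ + 2) (sym #edges)))

  access : (Q : Fin n → Set) → (∀ h → ¬ Outer h → ¬ Corr.Over O.corr white h → Q h → Q (rt h)) → (∀ h → ¬ Outer h → Q h → Q (fc h)) → ∀ h → Q h → ∃ λ o → Outer o × Q o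
  access Q f g = AccFlow.acc acc Q (λ h i e → f h i (λ o → ZP.<⇒≢ (O.over→pos o) (sym e))) (λ h i _ → g h i)

  opened : Opened d M
  opened = record { mob = O.T₀ ; K = O.corr ; B = O.branch ; Tr = record { treeEq = treeEq ; connT = Connect.mobile-connected od O.corr O.branch 1≤d treeEq access } }

record Closed-up {m} (d : ℕ) (T : RMob m) : Set₁ where
  field
    n : ℕ
    P : PlaneMap n
    girth : HasGirth P d
    odeg : outerDegree P ≡ d
    K : Corr (raw P) T

cookMap : ∀ {n d} (M : RMap n) → OuterData d M → + 2 * (count (RMap.V.Rep? M) + count (RMap.F.Rep? M)) ≡ + n + + 4 → PlaneMap n
cookMap M od genus = record
  { σ = rt ; σ⁻ = rt⁻ ; σ-inv₁ = rt-left ; σ-inv₂ = rt-right ; α = inv ; α-invol = inv-inv ; α-fpf = OuterData.fpf od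
  ; connected = star-conn (OuterData.conn od) ; genus0 = MapBridge.genus← M genus ; root = root }
  where open RMap M

closeUp : ∀ {n m d} (M : RMap n) (od : OuterData d M) {T : RMob m} → Corr M T → Branch d T → 1 ≤ d →
  + 2 * (count (RMap.V.Rep? M) + count (RMap.F.Rep? M)) ≡ + n + + 4 → Closed-up d T
closeUp M od K B 1≤d genus = record { P = cookMap M od genus ; girth = LongCycles.girth (cookMap M od genus) od (CorrFacts.toFlow K B) genus 1≤d
  ; odeg = ZP.+-injective (trans (MapBridge.BF.orbitSize-clsum M (RMap.root M)) (OuterData.odeg od)) ; K = K }

module CloseMobile {m d} (1≤d : 1 ≤ d) (T : RMob m) (Tr : MobTree T) (B : Branch d T) where
  open RMob T
  open MobTree Tr
  open TreeComponent T B 1≤d treeEq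

  r : Fin m
  r = proj₁ component

  module Ex = Excess r (proj₂ component)

  opaque
    β₀ : ∃ λ β → Bud β × Unmatched β
    β₀ = let β , b , _ , u = Ex.bud-base in β , b , u

  β : Fin m
  β = proj₁ β₀

  open Bracket T β (proj₁ (proj₂ β₀)) (proj₂ (proj₂ β₀)) (λ y → single y β)
  module Cl = Closure {d = d} T β (proj₁ (proj₂ β₀)) (proj₂ (proj₂ β₀)) (λ y → single y β) connT

  all : ∀ x → Ex.Xr.Reached x
  all = connT Ex.Xr.Reached (λ x → Ex.Xr.reached-~ W.~-step) (λ x → Ex.inv-R) Ex.Xr.reached-root

  drop-R : ∀ {Q : Fin m → Set} (Q? : ∀ x → Dec (Q x)) → count (λ x → Q? x ×-dec Ex.R? x) ≡ count Q?
  drop-R Q? = count-cong (λ x → Q? x ×-dec Ex.R? x) Q? (λ _ → proj₁) (λ x q → q , all x)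

  -- `Ex.balance` on the whole mobile, where twice the vertices minus the non-bud half-edges is 2.
  excess : count Bud? ≡ count Opens? + + d
  excess = fin (count Bud?) (count Opens?) (+ d) (trans (cong₂ (λ u v → + 2 * (u - v)) (sym (drop-R Bud?)) (trans (sym (drop-R Opens?)) Ex.opens-white)) (trans Ex.balance (cong (λ z → + d * z) (trans (cong₂ (λ u v → + 2 * u - v) (drop-R W.Rep?) (drop-R NB?)) (trans (cong (_- count NB?) treeEq) (alg (count NB?)))))))
    where
    alg : ∀ c → c + + 2 - c ≡ + 2
    alg = solve-∀
    fin : ∀ b o D → + 2 * (b - o) ≡ D * + 2 → b ≡ o + D
    fin b o D e = trans (lem b o) (cong (λ z → o + z) (ZP.*-cancelˡ-≡ (+ 2) (b - o) D (trans e (ZP.*-comm D (+ 2)))))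
      where
      lem : ∀ b o → b ≡ o + (b - o)
      lem = solve-∀

  -- Bracketing pairs all openings with the matched buds, so the excess of buds is what remains
  -- unmatched; it becomes the outer degree.
  free-buds : count U? ≡ + d
  free-buds = cancel (count Opens?) (trans (trans (cong₂ _+_ (count-cong U? BU? (λ { x u → proj₁ u , u }) (λ _ → proj₂)) opens) (sym (trans (∑-cong (λ x → 𝟙-split (Bud? x) (U? x))) (∑-+ _ _)))) (trans excess (ZP.+-comm (count Opens?) (+ d))))
    where
    BU? : ∀ x → Dec (Bud x × U x)
    BU? x = Bud? x ×-dec U? x
    BM? : ∀ x → Dec (Bud x × ¬ U x)
    BM? x = Bud? x ×-dec ¬? (U? x)
    cancel : ∀ {x y} z → x + z ≡ y + z → x ≡ y
    cancel {x} {y} z e = trans (sym (lem x z)) (trans (cong (_- z) e) (lem y z))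
      where
      lem : ∀ x z → x + z - z ≡ x
      lem = solve-∀
    mate : ∀ x → Bud x × ¬ U x → Matched x
    mate x (b , nu) with decideMatched b
    ... | inj₁ u = ⊥-elim (nu (b , u))
    ... | inj₂ q = q
    opens : count Opens? ≡ count BM?
    opens = ZP.≤-antisym
      (count-inj Opens? BM? (λ y _ → F (ρ y)) (λ y o → run-bud (F-run (ρ y)) , λ u → proj₂ u y o (F-run (ρ y))) (λ y y' o o' e → src-inj (inj₁ o) (inj₁ o') (F-run (ρ y)) (subst (Run (ρ y')) (sym e) (F-run (ρ y')))))
      (count-inj BM? Opens? (λ x q → proj₁ (mate x q)) (λ x q → proj₁ (proj₂ (mate x q))) (λ x x' q q' e → run-fun (proj₂ (proj₂ (mate x q))) (subst (λ z → Run (ρ z) x') (sym e) (proj₂ (proj₂ (mate x' q'))))))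

  od : OuterData d Cl.M₀
  od = Cl.outerData free-buds

  open RMap Cl.M₀
  open Inner Cl.M₀
  open CorrFacts Cl.corr using (#vertices; #edges)

  genus : + 2 * (count V.Rep? + count F.Rep?) ≡ + Cl.darts + + 4
  genus = Counts.euler← Cl.M₀ od (trans (cong (λ z → + 2 * z) (sym #vertices)) (trans treeEq (cong (_+ + 2) #edges)))

  closed : Closed-up d T
  closed = closeUp Cl.M₀ od Cl.corr B 1≤d genus

module Degrees {n m} {M : RMap n} {X : RMob m} (K : Corr M X) where
  open RMap M
  open Inner M
  open RMob X
  open Corr K
  open CorrFacts K
  module BF = OrbitBridge face
  module BW = OrbitBridge rotT

  sizes : ∀ {x} → col x ≡ black → orbitSize fc (κ x) ≡ orbitSize rT x
  sizes {x} c = ZP.+-injective (trans (BF.orbitSize-clsum (κ x)) (trans (degree c) (sym (BW.orbitSize-clsum x))))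

  size-F : ∀ {h g} → h F.~ g → orbitSize fc h ≡ orbitSize fc g
  size-F {h} {g} s = ZP.+-injective (trans (BF.orbitSize-clsum h) (trans (count-cong (h F.~?_) (g F.~?_) (λ _ → F.~-trans (F.~-sym s)) (λ _ → F.~-trans s)) (sym (BF.orbitSize-clsum g))))

  size-W : ∀ {x y} → x W.~ y → orbitSize rT x ≡ orbitSize rT y
  size-W {x} {y} s = ZP.+-injective (trans (BW.orbitSize-clsum x) (trans (count-cong (x W.~?_) (y W.~?_) (λ _ → W.~-trans (W.~-sym s)) (λ _ → W.~-trans s)) (sym (BW.orbitSize-clsum y))))

  module _ (i : ℕ) where
    FI? : ∀ h → Dec (F.Rep h × InF h × orbitSize fc h ≡ i)
    FI? h = F.Rep? h ×-dec (InF? h ×-dec (orbitSize fc h NP.≟ i))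

    WI? : ∀ x → Dec (W.Rep x × col x ≡ black × orbitSize rT x ≡ i)
    WI? x = W.Rep? x ×-dec ((col x ≟ᶜ black) ×-dec (orbitSize rT x NP.≟ i))

    counts : count FI? ≡ count WI?
    counts = ZP.≤-antisym
      (count-inj FI? WI? (λ { h (_ , j , _) → W.rep (proj₁ (black-over h j)) })
        (λ { h (_ , j , e) → let x , c , q = black-over h j in W.rep-idem x , col-~ (W.rep-~ x) c , trans (sym (size-W (W.rep-~ x))) (trans (sym (sizes c)) (trans (cong (orbitSize fc) q) e)) })
        (λ { h h' (r , j , _) (r' , j' , _) e → let x , c , q = black-over h j ; x' , c' , q' = black-over h' j' in
          trans (sym r) (trans (F.rep-cong (subst₂ F._~_ q q' (black-~ c (W.rep-sound e)))) r') }))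
      (count-inj WI? FI? (λ x _ → F.rep (κ x))
        (λ { x (_ , c , e) → F.rep-idem (κ x) , InF-~ (F.rep-~ (κ x)) (black-in c) , trans (sym (size-F (F.rep-~ (κ x)))) (trans (sizes c) e) })
        (λ { x y (r , c , _) (r' , c' , _) e → trans (sym r) (trans (W.rep-cong (~-black c c' (F.rep-sound e))) r') }))

    isBlack-sound : ∀ {c} → T (isBlack c) → c ≡ black
    isBlack-sound {black} _ = refl

    isBlack-complete : ∀ {c} → c ≡ black → T (isBlack c)
    isBlack-complete refl = tt

    degrees : countB (λ x → isOrbitMin fc x ∧ not (reachB fc root x) ∧ (orbitSize fc x Data.Nat.≡ᵇ i)) ≡ countB (λ x → isOrbitMin rT x ∧ isBlack (col x) ∧ (orbitSize rT x Data.Nat.≡ᵇ i))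
    degrees = ZP.+-injective (trans (countB-count _ FI?
        (λ h t → let u , v = T∧ {isOrbitMin fc h} t ; v₁ , v₂ = T∧ {not (reachB fc root h)} v in BF.min-sound h u , (λ o → T-not v₁ (BF.reach-complete root h o)) , NP.≡ᵇ⇒≡ _ i v₂)
        (λ { h (r , j , e) → ∧T (BF.min-complete h r) (∧T (not-T (j ∘ BF.reach-sound root h)) (NP.≡⇒≡ᵇ _ i e)) }))
      (trans counts (sym (countB-count _ WI?
        (λ x t → let u , v = T∧ {isOrbitMin rT x} t ; v₁ , v₂ = T∧ {isBlack (col x)} v in BW.min-sound x u , isBlack-sound v₁ , NP.≡ᵇ⇒≡ _ i v₂)
        (λ { x (r , c , e) → ∧T (BW.min-complete x r) (∧T (isBlack-complete c) (NP.≡⇒≡ᵇ _ i e)) })))))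

fromMapIso : ∀ {n n'} {M : PlaneMap n} {M' : PlaneMap n'} → MapIso M M' → MIso (raw M) (raw M')
fromMapIso I = record { to = Inverse.to f ; fr = Inverse.from f ; fr-to = Inverse.strictlyInverseʳ f ; to-fr = Inverse.strictlyInverseˡ f ; rt-c = σ-comm ; inv-c = α-comm ; root-c = root-face }
  where open MapIso I

toMapIso : ∀ {n n'} {M : PlaneMap n} {M' : PlaneMap n'} → MIso (raw M) (raw M') → MapIso M M'
toMapIso I = record { f = mk↔ₛ′ to fr to-fr fr-to ; σ-comm = rt-c ; α-comm = inv-c ; root-face = root-c }
  where open MIso I

fromMobileIso : ∀ {n n'} {T : ZMobile n} {T' : ZMobile n'} → MobileIso T T' → RIso (rawT T) (rawT T')
fromMobileIso I = record { to = Inverse.to f ; fr = Inverse.from f ; fr-to = Inverse.strictlyInverseʳ f ; to-fr = Inverse.strictlyInverseˡ f ; rT-c = σ-comm ; inv-c = α-comm ; col-c = color-pres ; wt-c = weight-pres }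
  where open MobileIso I

toMobileIso : ∀ {n n'} {T : ZMobile n} {T' : ZMobile n'} → RIso (rawT T) (rawT T') → MobileIso T T'
toMobileIso I = record { f = mk↔ₛ′ to fr to-fr fr-to ; σ-comm = rT-c ; α-comm = inv-c ; color-pres = col-c ; weight-pres = wt-c }
  where open RIso I

theorem4p11 : (d : ℕ) → 1 ≤ d →
    Σ (PlaneMapGirthOuter d → BranchingMobile d) λ Φ →
    (∀ M M' → M ≅ᴹ M' → Φ M ≅ᵀ Φ M')
    × (∀ M M' → Φ M ≅ᵀ Φ M' → M ≅ᴹ M')
    × (∀ T → Σ (PlaneMapGirthOuter d) λ M → Φ M ≅ᵀ T)
    × (∀ M i → innerFaces M i ≡ blackVertices (Φ M) i)
theorem4p11 d 1≤d = Φ , respects , reflects , onto , preserves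
  where
  op : ((n , P , g , o) : PlaneMapGirthOuter d) → Opened d (raw P)
  op (n , P , g , o) = OpenMap.opened 1≤d P g o
  od : ((n , P , g , o) : PlaneMapGirthOuter d) → OuterData d (raw P)
  od (n , P , g , o) = OpenMap.od 1≤d P g o
  Φ : PlaneMapGirthOuter d → BranchingMobile d
  Φ M = _ , cook mob Tr , cookBranch mob Tr B
    where open Opened (op M)
  -- Carried along the isomorphism, the second mobile becomes another mobile of the first map.
  respects : ∀ M M' → M ≅ᴹ M' → Φ M ≅ᵀ Φ M'
  respects M M' I = toMobileIso (mobile-unique (od M) O.K O.Tr O.B (transport (MIso-sym (fromMapIso I)) O'.K) O'.Tr O'.B)
    where
    module O = Opened (op M)
    module O' = Opened (op M')
  reflects : ∀ M M' → Φ M ≅ᵀ Φ M' → M ≅ᴹ M'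
  reflects M M' I = toMapIso (map-unique (od M) (od M') O.K O.Tr O'.K O'.Tr (fromMobileIso I))
    where
    module O = Opened (op M)
    module O' = Opened (op M')
  -- Close `T` and open the resulting map: both mobiles correspond to the same map, so uniqueness
  -- identifies them.
  onto : ∀ T → Σ (PlaneMapGirthOuter d) λ M → Φ M ≅ᵀ T
  onto (m , T , D) = M , toMobileIso (mobile-unique (od M) O.K O.Tr O.B C.K (mobTree T) (rawBranch T D))
    where
    module C = Closed-up (CloseMobile.closed 1≤d (rawT T) (mobTree T) (rawBranch T D))
    M : PlaneMapGirthOuter d
    M = C.n , C.P , C.girth , C.odeg
    module O = Opened (op M)
  preserves : ∀ M i → innerFaces M i ≡ blackVertices (Φ M) i
  preserves M i = Degrees.degrees (Opened.K (op M)) i
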